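{- Let $T$ be a set of transpositions in the symmetric group $S_n$ such that $G_T$ is a connected cubic (i.e. $3$-regular) graph. Then $\mathrm{Cay}(S_n,T)$ is integral if and only if $G_T$ is isomorphic to one of the graphs $K_4$ or $K_{3,3}$.
   Context: $S_n$ is the symmetric group on $[n]=\{1,\dots,n\}$. For a group $G$ and an inverse-closed subset $S\subseteq G$ not containing the identity, $\mathrm{Cay}(G,S)$ is the graph with vertex set $G$ in which $g_1,g_2$ are adjacent if and only if $g_1g_2^{ -1}\in S$. For a set $T$ of transpositions in $S_n$, $G_T$ is the graph with vertex set $[n]$ in which $i,j$ are adjacent if and only if $(i,j)\in T$. A finite simple graph is integral if all eigenvalues of its adjacency matrix are integers. -}

module Defs where

open import Algebra.Bundles using (Group; RawRing)
import Algebra.Definitions.RawMonoid as RawMonoidDefs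
import Algebra.Properties.Group as GroupProperties
open import Data.Bool.Base using (if_then_else_)
open import Data.Fin.Base using (Fin; zero; suc; combine; remQuot; punchIn; punchOut)
open import Data.Fin.Properties using (_≟_; +↔⊎; remQuot-combine; combine-remQuot; punchIn-injective)
open import Data.Fin.Permutation as Perm
  using (Permutation′; _⟨$⟩ʳ_; _⟨$⟩ˡ_; _∘ₚ_; transpose; insert; remove)
open import Data.Fin.Permutation.Components using () renaming (transpose to transposeᶠ)
open import Data.Integer.Base using (ℤ; 0ℤ; 1ℤ)
open import Data.Nat.Base as ℕ using (ℕ; zero; suc; _!)
import Data.Nat.Properties as ℕ
open import Data.Product.Base using (∃-syntax; Σ-syntax; ∃₂; _×_; _,_; proj₁; proj₂)
open import Data.Rational.Base as ℚ using (ℚ; 0ℚ; 1ℚ; ½; ∣_∣)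
import Data.Rational.Properties as ℚ
import Data.Rational.Solver as ℚSolver
open import Data.Sum.Base using (_⊎_; inj₁; inj₂)
open import Data.Vec.Base using (count; tabulate)
open import Function.Base using (_∘_)
open import Function.Bundles using (Inverse; _⇔_)
import Function.Construct.Identity as Identity
import Function.Construct.Symmetry as Symmetry
open import Level using (0ℓ)
open import Relation.Binary.Bundles using (Setoid)
open import Relation.Binary.Construct.Closure.ReflexiveTransitive using (Star)
open import Relation.Binary.Core using (Rel)
open import Relation.Binary.Definitions as B using (Irreflexive; Symmetric; _Respects₂_)
open import Relation.Binary.PropositionalEquality
  using (_≡_; _≢_; refl; sym; trans; cong; cong₂; subst; setoid; ≢-sym; module ≡-Reasoning)
open import Relation.Nullary using (¬_; Dec; yes; no; does)
open import Relation.Nullary.Decidable using (¬?; dec-true; dec-false)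
open import Relation.Unary using (Pred; _∈_; _∉_; Decidable)

-- Cauchy sequences of rationals, identified when their difference tends to 0.
record ℝ : Set where
  constructor mkℝ
  field
    seq    : ℕ → ℚ
    cauchy : ∀ ε → 0ℚ ℚ.< ε →
             ∃[ N ] ∀ m n → N ℕ.≤ m → N ℕ.≤ n → ∣ seq m ℚ.- seq n ∣ ℚ.< ε

open ℝ public

infix 4 _≈ᴿ_

_≈ᴿ_ : Rel ℝ 0ℓ
x ≈ᴿ y = ∀ ε → 0ℚ ℚ.< ε → ∃[ N ] ∀ n → N ℕ.≤ n → ∣ seq x n ℚ.- seq y n ∣ ℚ.< ε

private
  open ℚSolver.+-*-Solver using (solve; _:+_; _:*_; :-_; _:-_; _:=_; con)

  0<1 : 0ℚ ℚ.< 1ℚ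
  0<1 = ℚ.positive⁻¹ 1ℚ

  half>0 : ∀ {ε} → 0ℚ ℚ.< ε → 0ℚ ℚ.< ½ ℚ.* ε
  half>0 {ε} 0<ε =
    subst (ℚ._< ½ ℚ.* ε) (ℚ.*-zeroʳ ½) (ℚ.*-monoʳ-<-pos ½ 0<ε)

  half+half : ∀ ε → ½ ℚ.* ε ℚ.+ ½ ℚ.* ε ≡ ε
  half+half ε = trans (sym (ℚ.*-distribʳ-+ ε ½ ½)) (ℚ.*-identityˡ ε)

  quotient : ∀ {b ε} → 0ℚ ℚ.< b → 0ℚ ℚ.< ε → ∃[ δ ] (0ℚ ℚ.< δ × b ℚ.* δ ≡ ε)
  quotient {b} {ε} 0<b 0<ε = δ , 0<δ , bδ≡ε
    where
    instance
      b-pos : ℚ.Positive b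
      b-pos = ℚ.positive 0<b
      b-nz : ℚ.NonZero b
      b-nz = ℚ.pos⇒nonZero b
      b-nn : ℚ.NonNegative b
      b-nn = ℚ.pos⇒nonNeg b
    δ = (ℚ.1/ b) ℚ.* ε
    bδ≡ε : b ℚ.* δ ≡ ε
    bδ≡ε = trans (sym (ℚ.*-assoc b (ℚ.1/ b) ε))
             (trans (cong (ℚ._* ε) (ℚ.*-inverseʳ b)) (ℚ.*-identityˡ ε))
    0<δ : 0ℚ ℚ.< δ
    0<δ = ℚ.*-cancelˡ-<-nonNeg b
            (subst (ℚ._< b ℚ.* δ) (sym (ℚ.*-zeroʳ b)) (subst (0ℚ ℚ.<_) (sym bδ≡ε) 0<ε))

  eventuallyBounded : ∀ x → ∃₂ λ b N → 0ℚ ℚ.< b × (∀ n → N ℕ.≤ n → ∣ seq x n ∣ ℚ.≤ b)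
  eventuallyBounded x with cauchy x 1ℚ 0<1
  ... | N , close = b , N , 0<b , bounded
    where
    b = 1ℚ ℚ.+ ∣ seq x N ∣
    0<b : 0ℚ ℚ.< b
    0<b = ℚ.+-mono-<-≤ 0<1 (ℚ.0≤∣p∣ (seq x N))
    bounded : ∀ n → N ℕ.≤ n → ∣ seq x n ∣ ℚ.≤ b
    bounded n N≤n = begin
      ∣ seq x n ∣                                ≡⟨ cong ∣_∣ (solve 2 (λ p q → p := (p :- q) :+ q) refl (seq x n) (seq x N)) ⟩
      ∣ (seq x n ℚ.- seq x N) ℚ.+ seq x N ∣      ≤⟨ ℚ.∣p+q∣≤∣p∣+∣q∣ (seq x n ℚ.- seq x N) (seq x N) ⟩
      ∣ seq x n ℚ.- seq x N ∣ ℚ.+ ∣ seq x N ∣    ≤⟨ ℚ.+-monoˡ-≤ ∣ seq x N ∣ (ℚ.<⇒≤ (close n N N≤n ℕ.≤-refl)) ⟩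
      b                                          ∎
      where open ℚ.≤-Reasoning

infixl 6 _+ᴿ_ _-ᴿ_
infixl 7 _*ᴿ_
infix  8 -ᴿ_

fromℚ : ℚ → ℝ
fromℚ q = mkℝ (λ _ → q) λ ε 0<ε →
  0 , λ _ _ _ _ → subst (λ r → ∣ r ∣ ℚ.< ε) (sym (ℚ.+-inverseʳ q)) 0<ε

_+ᴿ_ : ℝ → ℝ → ℝ
x +ᴿ y = mkℝ (λ n → seq x n ℚ.+ seq y n) λ ε 0<ε →
  let N₁ , close₁ = cauchy x (½ ℚ.* ε) (half>0 0<ε)
      N₂ , close₂ = cauchy y (½ ℚ.* ε) (half>0 0<ε)
  in N₁ ℕ.⊔ N₂ , λ m n N≤m N≤n →
    let open ℚ.≤-Reasoning
        a = seq x m ; b = seq x n ; c = seq y m ; d = seq y n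
    in begin-strict
      ∣ (a ℚ.+ c) ℚ.- (b ℚ.+ d) ∣        ≡⟨ cong ∣_∣ (solve 4 (λ a b c d → (a :+ c) :- (b :+ d) := (a :- b) :+ (c :- d)) refl a b c d) ⟩
      ∣ (a ℚ.- b) ℚ.+ (c ℚ.- d) ∣        ≤⟨ ℚ.∣p+q∣≤∣p∣+∣q∣ (a ℚ.- b) (c ℚ.- d) ⟩
      ∣ a ℚ.- b ∣ ℚ.+ ∣ c ℚ.- d ∣        <⟨ ℚ.+-mono-<
        (close₁ m n (ℕ.m⊔n≤o⇒m≤o N₁ N₂ N≤m) (ℕ.m⊔n≤o⇒m≤o N₁ N₂ N≤n))
        (close₂ m n (ℕ.m⊔n≤o⇒n≤o N₁ N₂ N≤m) (ℕ.m⊔n≤o⇒n≤o N₁ N₂ N≤n)) ⟩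
      ½ ℚ.* ε ℚ.+ ½ ℚ.* ε                ≡⟨ half+half ε ⟩
      ε                                  ∎

-ᴿ_ : ℝ → ℝ
-ᴿ x = mkℝ (λ n → ℚ.- seq x n) λ ε 0<ε →
  let N , close = cauchy x ε 0<ε
  in N , λ m n N≤m N≤n →
    let open ℚ.≤-Reasoning
        a = seq x m ; b = seq x n
    in begin-strict
      ∣ ℚ.- a ℚ.- ℚ.- b ∣  ≡⟨ cong ∣_∣ (solve 2 (λ a b → :- a :- :- b := b :- a) refl a b) ⟩
      ∣ b ℚ.- a ∣          <⟨ close n m N≤n N≤m ⟩
      ε                    ∎

_-ᴿ_ : ℝ → ℝ → ℝ
x -ᴿ y = x +ᴿ (-ᴿ y)

_*ᴿ_ : ℝ → ℝ → ℝ
x *ᴿ y = mkℝ (λ n → seq x n ℚ.* seq y n) λ ε 0<ε →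
  let B , M₁ , 0<B , ∣x∣≤B = eventuallyBounded x
      C , M₂ , 0<C , ∣y∣≤C = eventuallyBounded y
      δ , 0<δ , Bδ≡½ε = quotient 0<B (half>0 0<ε)
      η , 0<η , Cη≡½ε = quotient 0<C (half>0 0<ε)
      N₁ , close₁ = cauchy x η 0<η
      N₂ , close₂ = cauchy y δ 0<δ
      M = M₁ ℕ.⊔ M₂
      N = N₁ ℕ.⊔ N₂
  in M ℕ.⊔ N , λ m n K≤m K≤n →
    let open ℚ.≤-Reasoning
        a = seq x m ; b = seq x n ; c = seq y m ; d = seq y n
        M≤m = ℕ.m⊔n≤o⇒m≤o M N K≤m
        M≤n = ℕ.m⊔n≤o⇒m≤o M N K≤n
        N≤m = ℕ.m⊔n≤o⇒n≤o M N K≤m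
        N≤n = ℕ.m⊔n≤o⇒n≤o M N K≤n
    in begin-strict
      ∣ a ℚ.* c ℚ.- b ℚ.* d ∣                        ≡⟨ cong ∣_∣ (solve 4 (λ a b c d → a :* c :- b :* d := a :* (c :- d) :+ d :* (a :- b)) refl a b c d) ⟩
      ∣ a ℚ.* (c ℚ.- d) ℚ.+ d ℚ.* (a ℚ.- b) ∣        ≤⟨ ℚ.∣p+q∣≤∣p∣+∣q∣ (a ℚ.* (c ℚ.- d)) (d ℚ.* (a ℚ.- b)) ⟩
      ∣ a ℚ.* (c ℚ.- d) ∣ ℚ.+ ∣ d ℚ.* (a ℚ.- b) ∣    <⟨ ℚ.+-mono-<
        (scaled a (c ℚ.- d) B δ 0<B (∣x∣≤B m (ℕ.m⊔n≤o⇒m≤o M₁ M₂ M≤m))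
          (close₂ m n (ℕ.m⊔n≤o⇒n≤o N₁ N₂ N≤m) (ℕ.m⊔n≤o⇒n≤o N₁ N₂ N≤n)))
        (scaled d (a ℚ.- b) C η 0<C (∣y∣≤C n (ℕ.m⊔n≤o⇒n≤o M₁ M₂ M≤n))
          (close₁ m n (ℕ.m⊔n≤o⇒m≤o N₁ N₂ N≤m) (ℕ.m⊔n≤o⇒m≤o N₁ N₂ N≤n))) ⟩
      B ℚ.* δ ℚ.+ C ℚ.* η                            ≡⟨ cong₂ ℚ._+_ Bδ≡½ε Cη≡½ε ⟩
      ½ ℚ.* ε ℚ.+ ½ ℚ.* ε                            ≡⟨ half+half ε ⟩
      ε                                              ∎
  where
  scaled : ∀ p q b δ → 0ℚ ℚ.< b → ∣ p ∣ ℚ.≤ b → ∣ q ∣ ℚ.< δ → ∣ p ℚ.* q ∣ ℚ.< b ℚ.* δ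
  scaled p q b δ 0<b ∣p∣≤b ∣q∣<δ = begin-strict
    ∣ p ℚ.* q ∣      ≡⟨ ℚ.∣p*q∣≡∣p∣*∣q∣ p q ⟩
    ∣ p ∣ ℚ.* ∣ q ∣  ≤⟨ ℚ.*-monoʳ-≤-nonNeg ∣ q ∣ {{ℚ.nonNegative (ℚ.0≤∣p∣ q)}} ∣p∣≤b ⟩
    b ℚ.* ∣ q ∣      <⟨ ℚ.*-monoʳ-<-pos b {{ℚ.positive 0<b}} ∣q∣<δ ⟩
    b ℚ.* δ          ∎
    where open ℚ.≤-Reasoning

infix 6 _+i_

record ℂ : Set where
  constructor _+i_
  field
    re im : ℝ

open ℂ public

fromℤ : ℤ → ℂ
fromℤ k = fromℚ (k ℚ./ 1) +i fromℚ 0ℚ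

ℂ-rawRing : RawRing 0ℓ 0ℓ
ℂ-rawRing = record
  { Carrier = ℂ
  ; _≈_     = λ z w → re z ≈ᴿ re w × im z ≈ᴿ im w
  ; _+_     = λ z w → (re z +ᴿ re w) +i (im z +ᴿ im w)
  ; _*_     = λ z w → (re z *ᴿ re w -ᴿ im z *ᴿ im w) +i (re z *ᴿ im w +ᴿ im z *ᴿ re w)
  ; -_      = λ z → (-ᴿ re z) +i (-ᴿ im z)
  ; 0#      = fromℤ 0ℤ
  ; 1#      = fromℤ 1ℤ
  }

open RawRing ℂ-rawRing public
  using () renaming (_≈_ to _≈ᶜ_; _+_ to _+ᶜ_; _*_ to _*ᶜ_; -_ to -ᶜ_; 0# to 0ᶜ; 1# to 1ᶜ)

open RawMonoidDefs (RawRing.+-rawMonoid ℂ-rawRing) public using () renaming (sum to sumᶜ)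

Matrix : ℕ → Set
Matrix n = Fin n → Fin n → ℂ

IsEigenvalue : ∀ {n} → Matrix n → ℂ → Set
IsEigenvalue {n} A z = Σ[ v ∈ (Fin n → ℂ) ]
  ¬ (∀ i → v i ≈ᶜ 0ᶜ) × (∀ i → sumᶜ (λ j → A i j *ᶜ v j) ≈ᶜ z *ᶜ v i)

-- The vertices form a setoid, because permutations are compared
-- pointwise rather than by _≡_.
record Graph : Set₁ where
  field
    vertices    : Setoid 0ℓ 0ℓ
    order       : ℕ
    enumeration : Inverse vertices (setoid (Fin order))

  open Setoid vertices public using () renaming (Carrier to Vertex; _≈_ to _≈ᵛ_)

  field
    Adj        : Rel Vertex 0ℓ
    adj-resp   : Adj Respects₂ _≈ᵛ_
    adj?       : B.Decidable Adj
    adj-sym    : Symmetric Adj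
    adj-irrefl : Irreflexive _≈ᵛ_ Adj

  vertexAt : Fin order → Vertex
  vertexAt = Inverse.from enumeration

  degree : Vertex → ℕ
  degree x = count (adj? x) (tabulate vertexAt)

  adjacencyMatrix : Matrix order
  adjacencyMatrix i j = if does (adj? (vertexAt i) (vertexAt j)) then 1ᶜ else 0ᶜ

-- The graph without vertices does not count as connected.
Connected : Graph → Set
Connected G = Vertex × (∀ x y → ∃[ z ] (Star Adj x z × z ≈ᵛ y))
  where open Graph G

Regular : ℕ → Graph → Set
Regular d G = ∀ x → degree x ≡ d
  where open Graph G

Cubic : Graph → Set
Cubic = Regular 3

Integral : Graph → Set
Integral G = ∀ z → IsEigenvalue (Graph.adjacencyMatrix G) z → ∃[ k ] z ≈ᶜ fromℤ k

infix 4 _≅_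

record _≅_ (G H : Graph) : Set where
  private
    module G = Graph G
    module H = Graph H
  field
    bijection : Inverse G.vertices H.vertices
  open Inverse bijection public using (to; from)
  field
    preserves-adj : ∀ x y → G.Adj x y ⇔ H.Adj (to x) (to y)

K : ℕ → Graph
K n = record
  { vertices    = setoid (Fin n)
  ; order       = n
  ; enumeration = Identity.inverse (setoid (Fin n))
  ; Adj         = _≢_
  ; adj-resp    = (λ { refl p → p }) , (λ { refl p → p })
  ; adj?        = λ i j → ¬? (i ≟ j)
  ; adj-sym     = ≢-sym
  ; adj-irrefl  = λ i≡j i≢j → i≢j i≡j
  }

data Across {A B : Set} : Rel (A ⊎ B) 0ℓ where
  left-right : ∀ {a b} → Across (inj₁ a) (inj₂ b)
  right-left : ∀ {a b} → Across (inj₂ b) (inj₁ a)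

K[_,_] : ℕ → ℕ → Graph
K[ m , n ] = record
  { vertices    = setoid (Fin m ⊎ Fin n)
  ; order       = m ℕ.+ n
  ; enumeration = Symmetry.inverse +↔⊎
  ; Adj         = Across
  ; adj-resp    = (λ { refl p → p }) , (λ { refl p → p })
  ; adj?        = across?
  ; adj-sym     = λ { left-right → right-left ; right-left → left-right }
  ; adj-irrefl  = λ { refl () }
  }
  where
  across? : B.Decidable (Across {Fin m} {Fin n})
  across? (inj₁ _) (inj₁ _) = no λ ()
  across? (inj₁ _) (inj₂ _) = yes left-right
  across? (inj₂ _) (inj₁ _) = yes right-left
  across? (inj₂ _) (inj₂ _) = no λ ()

record ConnectionSet (G : Group 0ℓ 0ℓ) : Set₁ where
  open Group G using (Carrier; _≈_; _⁻¹; ε)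
  field
    S         : Pred Carrier 0ℓ
    S-resp    : ∀ {g h} → g ≈ h → g ∈ S → h ∈ S
    S?        : Decidable S
    ⁻¹-closed : ∀ {g} → g ∈ S → g ⁻¹ ∈ S
    ε∉S       : ε ∉ S

module _ (G : Group 0ℓ 0ℓ) {N : ℕ}
         (enum : Inverse (Group.setoid G) (setoid (Fin N)))
         where
  open Group G hiding (refl; sym; trans)
  private
    module G = Group G
    open GroupProperties G using (⁻¹-anti-homo-∙; ⁻¹-involutive)

  Cay : ConnectionSet G → Graph
  Cay C = record
    { vertices    = Group.setoid G
    ; order       = N
    ; enumeration = enum
    ; Adj         = λ g₁ g₂ → g₁ ∙ g₂ ⁻¹ ∈ S
    ; adj-resp    = (λ p → S-resp (∙-congˡ (⁻¹-cong p))) , (λ p → S-resp (∙-congʳ p))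
    ; adj?        = λ g₁ g₂ → S? (g₁ ∙ g₂ ⁻¹)
    ; adj-sym     = λ {g₁} {g₂} p → S-resp
        (G.trans (⁻¹-anti-homo-∙ g₁ (g₂ ⁻¹)) (∙-congʳ (⁻¹-involutive g₂)))
        (⁻¹-closed p)
    ; adj-irrefl  = λ {g₁} {g₂} g₁≈g₂ p →
        ε∉S (S-resp (G.trans (∙-congʳ g₁≈g₂) (inverseʳ g₂)) p)
    }
    where open ConnectionSet C

-- Products are composed from right to left: (π ∙ ρ) i = π (ρ i).
Sym : ℕ → Group 0ℓ 0ℓ
Sym n = record
  { Carrier = Permutation′ n
  ; _≈_     = Perm._≈_
  ; _∙_     = λ π ρ → ρ ∘ₚ π
  ; ε       = Perm.id
  ; _⁻¹     = Perm.flip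
  ; isGroup = record
    { isMonoid = record
      { isSemigroup = record
        { isMagma = record
          { isEquivalence = record
            { refl  = λ _ → refl
            ; sym   = λ p i → sym (p i)
            ; trans = λ p q i → trans (p i) (q i)
            }
          ; ∙-cong = λ {π} {π′} {ρ} {ρ′} p q i →
              trans (cong (π ⟨$⟩ʳ_) (q i)) (p (ρ′ ⟨$⟩ʳ i))
          }
        ; assoc = λ _ _ _ _ → refl
        }
      ; identity = (λ _ _ → refl) , (λ _ _ → refl)
      }
    ; inverse = (λ π _ → Perm.inverseˡ π) , (λ π _ → Perm.inverseʳ π)
    ; ⁻¹-cong = λ {π} {ρ} p i → trans
        (cong (π ⟨$⟩ˡ_) (trans (sym (Perm.inverseʳ ρ)) (sym (p (ρ ⟨$⟩ˡ i)))))
        (Perm.inverseˡ π)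
    }
  }

private
  insert-cong : ∀ {n} j {π ρ : Permutation′ n} → π Perm.≈ ρ → insert zero j π Perm.≈ insert zero j ρ
  insert-cong j p zero    = refl
  insert-cong j p (suc k) = cong (punchIn j) (p k)

  remove-cong : ∀ {n} {π ρ : Permutation′ (suc n)} → π Perm.≈ ρ → remove zero π Perm.≈ remove zero ρ
  remove-cong {π = π} {ρ} p k = punchIn-injective (π ⟨$⟩ʳ zero) _ _ (begin
    punchIn (π ⟨$⟩ʳ zero) (remove zero π ⟨$⟩ʳ k)  ≡⟨ Perm.punchIn-permute π zero k ⟨
    π ⟨$⟩ʳ suc k                                  ≡⟨ p (suc k) ⟩
    ρ ⟨$⟩ʳ suc k                                  ≡⟨ Perm.punchIn-permute ρ zero k ⟩
    punchIn (ρ ⟨$⟩ʳ zero) (remove zero ρ ⟨$⟩ʳ k)  ≡⟨ cong (λ i → punchIn i (remove zero ρ ⟨$⟩ʳ k)) (p zero) ⟨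
    punchIn (π ⟨$⟩ʳ zero) (remove zero ρ ⟨$⟩ʳ k)  ∎)
    where open ≡-Reasoning

-- π is determined by π 0 together with the permutation that remains
-- after removing 0 from the domain and π 0 from the codomain.
rank : ∀ n → Permutation′ n → Fin (n !)
rank zero    π = zero
rank (suc n) π = combine (π ⟨$⟩ʳ zero) (rank n (remove zero π))

unrank : ∀ n → Fin (n !) → Permutation′ n
unrank zero    _ = Perm.id
unrank (suc n) k = let j , l = remQuot {suc n} (n !) k in insert zero j (unrank n l)

private
  rank-cong : ∀ n {π ρ} → π Perm.≈ ρ → rank n π ≡ rank n ρ
  rank-cong zero    p = refl
  rank-cong (suc n) {π} {ρ} p = cong₂ combine (p zero) (rank-cong n (remove-cong {π = π} {ρ} p))

  rank-unrank : ∀ n k → rank n (unrank n k) ≡ k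
  rank-unrank zero    zero = refl
  rank-unrank (suc n) k    = trans
    (cong (combine j) (trans (rank-cong n (Perm.remove-insert zero j (unrank n l))) (rank-unrank n l)))
    (combine-remQuot {suc n} (n !) k)
    where
    j = proj₁ (remQuot {suc n} (n !) k)
    l = proj₂ (remQuot {suc n} (n !) k)

  unrank-rank : ∀ n π → unrank n (rank n π) Perm.≈ π
  unrank-rank (suc n) π i = begin
    unrank (suc n) (combine j l) ⟨$⟩ʳ i      ≡⟨ cong (λ p → insert zero (proj₁ p) (unrank n (proj₂ p)) ⟨$⟩ʳ i) (remQuot-combine {suc n} j l) ⟩
    insert zero j (unrank n l) ⟨$⟩ʳ i        ≡⟨ insert-cong j {unrank n l} {remove zero π} (unrank-rank n (remove zero π)) i ⟩
    insert zero j (remove zero π) ⟨$⟩ʳ i     ≡⟨ Perm.insert-remove zero π i ⟩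
    π ⟨$⟩ʳ i                                 ∎
    where
    open ≡-Reasoning
    j = π ⟨$⟩ʳ zero
    l = rank n (remove zero π)

Sym-enumeration : ∀ n → Inverse (Group.setoid (Sym n)) (setoid (Fin (n !)))
Sym-enumeration n = record
  { to        = rank n
  ; from      = unrank n
  ; to-cong   = rank-cong n
  ; from-cong = λ { refl _ → refl }
  ; inverse   = (λ {k} p → trans (rank-cong n p) (rank-unrank n k))
              , (λ { {π} refl → unrank-rank n π })
  }

IsTransposition : ∀ {n} → Pred (Permutation′ n) 0ℓ
IsTransposition π = ∃₂ λ i j → i ≢ j × π Perm.≈ transpose i j

record TranspositionSet (n : ℕ) : Set₁ where
  field
    T              : Pred (Permutation′ n) 0ℓ
    T-resp         : ∀ {π ρ} → π Perm.≈ ρ → π ∈ T → ρ ∈ T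
    T?             : Decidable T
    transpositions : ∀ {π} → π ∈ T → IsTransposition π

private
  transpose-left : ∀ {n} (i j : Fin n) → transposeᶠ i j i ≡ j
  transpose-left i j rewrite dec-true (i ≟ i) refl = refl

  transpose-right : ∀ {n} (i j : Fin n) → transposeᶠ i j j ≡ i
  transpose-right i j with j ≟ i
  ... | yes j≡i = j≡i
  ... | no _ rewrite dec-true (j ≟ j) refl = refl

  transpose-other : ∀ {n} (i j k : Fin n) → k ≢ i → k ≢ j → transposeᶠ i j k ≡ k
  transpose-other i j k k≢i k≢j
    rewrite dec-false (k ≟ i) k≢i | dec-false (k ≟ j) k≢j = refl

  transpose-comm : ∀ {n} (i j : Fin n) → transpose i j Perm.≈ transpose j i
  transpose-comm i j k = cases (k ≟ i) (k ≟ j)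
    where
    cases : Dec (k ≡ i) → Dec (k ≡ j) → transposeᶠ i j k ≡ transposeᶠ j i k
    cases (yes refl) _          = trans (transpose-left i j) (sym (transpose-right j i))
    cases (no _)     (yes refl) = trans (transpose-right i j) (sym (transpose-left j i))
    cases (no k≢i)   (no k≢j)   =
      trans (transpose-other i j k k≢i k≢j) (sym (transpose-other j i k k≢j k≢i))

  transpose-self : ∀ {n} (i : Fin n) → transpose i i Perm.≈ Perm.id
  transpose-self i k = cases (k ≟ i)
    where
    cases : Dec (k ≡ i) → transposeᶠ i i k ≡ k
    cases (yes refl) = transpose-left i i
    cases (no k≢i)   = transpose-other i i k k≢i k≢i

  id-not-transposition : ∀ {n} → ¬ IsTransposition (Perm.id {n})
  id-not-transposition (i , j , i≢j , p) = i≢j (trans (p i) (transpose-left i j))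

module _ {n} (𝒯 : TranspositionSet n) where
  open TranspositionSet 𝒯

  private
    id∉T : Perm.id ∉ T
    id∉T = id-not-transposition ∘ transpositions

    flip-closed : ∀ {π} → π ∈ T → Perm.flip π ∈ T
    flip-closed {π} π∈T with transpositions π∈T
    ... | i , j , _ , π≈ij = T-resp π≈π⁻¹ π∈T
      where
      π≈π⁻¹ : π Perm.≈ Perm.flip π
      π≈π⁻¹ k = trans (π≈ij k) (trans (transpose-comm i j k)
                  (sym (Group.⁻¹-cong (Sym n) {π} {transpose i j} π≈ij k)))

  connectionSet : ConnectionSet (Sym n)
  connectionSet = record
    { S = T ; S-resp = T-resp ; S? = T? ; ⁻¹-closed = flip-closed ; ε∉S = id∉T }

  CaySym : Graph
  CaySym = Cay (Sym n) (Sym-enumeration n) connectionSet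

  -- transpose i i is the identity, so it is not in T.
  transpositionGraph : Graph
  transpositionGraph = record
    { vertices    = setoid (Fin n)
    ; order       = n
    ; enumeration = Identity.inverse (setoid (Fin n))
    ; Adj         = λ i j → transpose i j ∈ T
    ; adj-resp    = (λ { refl p → p }) , (λ { refl p → p })
    ; adj?        = λ i j → T? (transpose i j)
    ; adj-sym     = λ {i} {j} → T-resp (transpose-comm i j)
    ; adj-irrefl  = λ { {i} refl p → id∉T (T-resp (transpose-self i) p) }
    }

-- Let A be the adjacency matrix of Cay(S_n, T) and τ the number of edges of the cubic graph G = G_T. The Laplacian
-- L = τ - A = Σ (1 - (i j)) acts on functions on points and on pairs of points; these representations embed in the
-- regular one, so there too L has integral spectrum if Cay(S_n, T) is integral. The spectrum of L lies in [0, 6] on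
-- points and in [0, 12] on pairs, and 0 is simple on each orbit because G is connected.
--
-- (⇒) Two consequences. First, L (L - 1) ⋯ (L - 6) vanishes on points, so (L - 1) ⋯ (L - 6) maps a point mass to a
-- constant c, an integer with n c = 720. As functions killed by L - 6 have opposite values at adjacent points, 3 divides
-- c; a computation modulo 2 shows that c is even. On pairs, n (n - 1) divides 12!. As 3 n is even, n ∈ {4, 6, 8, 10, 12}.
-- Second, (L - k) (L - k - 1) is positive semidefinite for all integers k. Evaluating this form on functions supported
-- near a vertex excludes all partial graphs on at most 12 vertices except those that extend only to K₄ or K₃,₃; the test
-- functions are recorded in search trees.
--   Integrality over the rationals comes from the Lanczos process: on the Krylov space of a rational vector, the
-- characteristic polynomials form a Sturm chain, whose largest root is a real eigenvalue with a real eigenvector.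
--
-- (⇐) In the group ring of S_4 or S_6, a product of factors A - r with integers r is computed to be 0, so each
-- eigenvalue is one of the r.

module Submission where

open import Defs
open import Algebra.Bundles using (CommutativeMonoid; CommutativeRing)
import Algebra.Properties.CommutativeMonoid.Sum as CommutativeMonoidSum
import Algebra.Properties.Semiring.Sum as SemiringSum
open import Algebra.Structures using (IsCommutativeRing)
open import Data.Bool.Base using (Bool; true; false; not; _∧_; _∨_; _xor_; if_then_else_)
import Data.Bool.Properties as Bool
open import Data.Empty using (⊥)
open import Data.Fin.Base as Fin using (Fin; zero; suc; toℕ)
open import Data.Fin.Permutation as Perm
  using (Permutation; Permutation′; _⟨$⟩ʳ_; _⟨$⟩ˡ_; _∘ₚ_; transpose)
import Data.Fin.Properties as Fin
open import Data.Integer.Base as ℤ using (ℤ; +_; -[1+_]; 0ℤ; 1ℤ)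
import Data.Integer.DivMod as ℤ
import Data.Integer.Properties as ℤ
import Data.Integer.Solver as ℤSolver
open import Data.List.Base as List using (List; []; _∷_)
open import Data.Maybe.Base using (Maybe; just; nothing)
open import Data.Nat.Base as ℕ using (ℕ; zero; suc; _!)
open import Data.Nat.Divisibility as ℕ using (_∣_; divides)
import Data.Nat.Properties as ℕ
open import Data.Product.Base using (∃-syntax; ∃₂; Σ-syntax; _×_; _,_; proj₁; proj₂)
import Data.Product.Properties as Product
open import Data.Rational.Base as ℚ using (ℚ; 0ℚ; 1ℚ; ½; ∣_∣)
import Data.Rational.Properties as ℚ
import Data.Rational.Solver as ℚSolver
import Data.Rational.Unnormalised.Base as ℚᵘ
import Data.Rational.Unnormalised.Properties as ℚᵘ
open import Data.Sum.Base as Sum using (_⊎_; inj₁; inj₂; [_,_]′)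
open import Data.Unit.Base using (tt)
open import Data.Vec.Base as Vec using (Vec; []; _∷_; lookup; count; tabulate)
import Data.Vec.Properties as Vec
open import Function.Base using (_∘_; id; flip)
open import Function.Bundles using (Inverse; _⇔_; mk⇔; Equivalence)
import Function.Construct.Composition as Composition
import Function.Construct.Symmetry as Symmetry
open import Level using (0ℓ)
open import Relation.Binary.Bundles using (Setoid)
open import Relation.Binary.Construct.Closure.ReflexiveTransitive using (Star; _◅_)
open import Relation.Binary.Definitions using (tri<; tri≈; tri>)
open import Relation.Binary.PropositionalEquality
  using (_≡_; _≢_; _≗_; refl; sym; trans; cong; cong₂; subst; subst₂; ≢-sym; setoid; module ≡-Reasoning)
open import Relation.Nullary using (¬_; Dec; yes; no; does; contradiction)
open import Relation.Nullary.Decidable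
  using (dec-true; dec-false; decidable-stable; toWitness; _×-dec_; _⊎-dec_; _→-dec_)

module ∑ℕ = SemiringSum ℕ.+-*-semiring
module ∑ℤ = SemiringSum ℤ.+-*-semiring

-- Cubic graphs and the quadratic forms of their Laplacians

Adjacency : ℕ → Set
Adjacency n = Fin n → Fin n → Bool

bit : Bool → ℕ
bit true  = 1
bit false = 0

infix 8 _∙ᵇ_
_∙ᵇ_ : Bool → ℤ → ℤ
b ∙ᵇ x = if b then x else 0ℤ

_==_ : ∀ {n} → Fin n → Fin n → Bool
i == j = does (i Fin.≟ j)

allᵇ anyᵇ : ∀ {n} → (Fin n → Bool) → Bool
allᵇ {zero}  p = true
allᵇ {suc n} p = p zero ∧ allᵇ (p ∘ suc)
anyᵇ p = not (allᵇ (not ∘ p))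

∧-split : ∀ {x y} → x ∧ y ≡ true → x ≡ true × y ≡ true
∧-split {true} {true} refl = refl , refl

∨-split : ∀ {x y} → x ∨ y ≡ true → x ≡ true ⊎ y ≡ true
∨-split {true}         refl = inj₁ refl
∨-split {false} {true} refl = inj₂ refl

not-true : ∀ {x} → not x ≡ true → x ≡ false
not-true {false} refl = refl

==-sound : ∀ {n} {i j : Fin n} → (i == j) ≡ true → i ≡ j
==-sound {i = i} {j} p with i Fin.≟ j
... | yes i≡j = i≡j

==-complete : ∀ {n} {i j : Fin n} → (i == j) ≡ false → i ≢ j
==-complete {i = i} p refl with i Fin.≟ i
... | no i≢i = i≢i refl

allᵇ-sound : ∀ {n} (p : Fin n → Bool) → allᵇ p ≡ true → ∀ i → p i ≡ true
allᵇ-sound p h zero    = proj₁ (∧-split h)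
allᵇ-sound p h (suc i) = allᵇ-sound (p ∘ suc) (proj₂ (∧-split {p zero} h)) i

allᵇ-fails : ∀ {n} (p : Fin n → Bool) → allᵇ p ≡ false → ∃[ i ] p i ≡ false
allᵇ-fails {suc n} p h with p zero in eq
... | false = zero , eq
... | true  = let i , pi = allᵇ-fails (p ∘ suc) h in suc i , pi

anyᵇ-sound : ∀ {n} (p : Fin n → Bool) → anyᵇ p ≡ true → ∃[ i ] p i ≡ true
anyᵇ-sound p h with allᵇ-fails (not ∘ p) (not-true h)
... | i , npi with p i in eq
... | true = i , eq

count-mono : ∀ {n} (p q : Fin n → Bool) → (∀ i → p i ≡ true → q i ≡ true) →
             ∑ℕ.sum (bit ∘ p) ℕ.≤ ∑ℕ.sum (bit ∘ q)
count-mono {zero}  p q p⊆q = ℕ.z≤n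
count-mono {suc n} p q p⊆q = ℕ.+-mono-≤ (head (p zero) (q zero) (p⊆q zero)) (count-mono (p ∘ suc) (q ∘ suc) (p⊆q ∘ suc))
  where
  head : ∀ b c → (b ≡ true → c ≡ true) → bit b ℕ.≤ bit c
  head false c     h = ℕ.z≤n
  head true  true  h = ℕ.≤-refl
  head true  false h = contradiction (h refl) λ ()

subset-full : ∀ {n} (p q : Fin n → Bool) → (∀ i → p i ≡ true → q i ≡ true) →
              ∑ℕ.sum (bit ∘ p) ≡ ∑ℕ.sum (bit ∘ q) → ∀ i → p i ≡ q i
subset-full {suc n} p q p⊆q eq i with p zero in p₀ | q zero in q₀
... | true  | false = contradiction (trans (sym q₀) (p⊆q zero p₀)) λ ()
... | false | true  = contradiction
  (subst (ℕ._≤ ∑ℕ.sum (bit ∘ q ∘ suc)) eq (count-mono (p ∘ suc) (q ∘ suc) (p⊆q ∘ suc))) (ℕ.<-irrefl refl)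
subset-full {suc n} p q p⊆q eq zero    | true  | true  = trans p₀ (sym q₀)
subset-full {suc n} p q p⊆q eq (suc i) | true  | true  =
  subset-full (p ∘ suc) (q ∘ suc) (p⊆q ∘ suc) (ℕ.suc-injective eq) i
subset-full {suc n} p q p⊆q eq zero    | false | false = trans p₀ (sym q₀)
subset-full {suc n} p q p⊆q eq (suc i) | false | false =
  subset-full (p ∘ suc) (q ∘ suc) (p⊆q ∘ suc) eq i

missing : ∀ {n} (p q : Fin n → Bool) → (∀ i → p i ≡ true → q i ≡ true) →
          ∑ℕ.sum (bit ∘ p) ≢ ∑ℕ.sum (bit ∘ q) → ∃[ i ] (p i ≡ false × q i ≡ true)
missing {n} p q p⊆q neq with Fin.¬∀⟶∃¬ n (λ i → p i ≡ q i) (λ i → p i Bool.≟ q i)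
  (λ eq → neq (∑ℕ.sum-cong-≗ (cong bit ∘ eq)))
... | i , pi≢qi with p i in pᵢ | q i in qᵢ
... | false | true  = i , pᵢ , qᵢ
... | false | false = contradiction refl pi≢qi
... | true  | true  = contradiction refl pi≢qi
... | true  | false = contradiction (trans (sym qᵢ) (p⊆q i pᵢ)) λ ()

-- The operators Σ (1 - (i j)), over the edges (i j), on functions of points and on functions of pairs that vanish on the diagonal.
L₁ : ∀ {n} → Adjacency n → (Fin n → ℤ) → Fin n → ℤ
L₁ a f x = + 3 ℤ.* f x ℤ.- ∑ℤ.sum (λ j → a j x ∙ᵇ f j)

L₂ : ∀ {n} → Adjacency n → (Fin n → Fin n → ℤ) → Fin n → Fin n → ℤ
L₂ a f x y = + 6 ℤ.* f x y ℤ.- ∑ℤ.sum (λ j → a j x ∙ᵇ f j y) ℤ.- ∑ℤ.sum (λ j → a j y ∙ᵇ f x j)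
             ℤ.- a x y ∙ᵇ (f x y ℤ.+ f y x)

gap : ℕ → ℤ → ℤ → ℤ → ℤ
gap k α fx Lfx = (Lfx ℤ.- + k ℤ.* (fx ℤ.+ α)) ℤ.* (Lfx ℤ.- + suc k ℤ.* (fx ℤ.+ α))

Q₁ : ∀ {n} → Adjacency n → ℕ → ℤ → (Fin n → ℤ) → ℤ
Q₁ a k α f = ∑ℤ.sum λ x → gap k α (f x) (L₁ a f x)

Q₂ : ∀ {n} → Adjacency n → ℕ → ℤ → (Fin n → Fin n → ℤ) → ℤ
Q₂ a k α f = ∑ℤ.sum λ x → ∑ℤ.sum λ y → not (x == y) ∙ᵇ gap k α (f x y) (L₂ a f x y)

record IntegralCubic {n} (a : Adjacency n) : Set where
  field
    symmetric   : ∀ x y → a x y ≡ a y x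
    irreflexive : ∀ x → a x x ≡ false
    cubic       : ∀ x → ∑ℕ.sum (bit ∘ a x) ≡ 3
    connected   : ∀ (p : Fin n → Bool) → (∀ x y → a x y ≡ true → p x ≡ true → p y ≡ true) →
                  ∀ x y → p x ≡ true → p y ≡ true
    Q₁≥0        : ∀ k α f → 0ℤ ℤ.≤ Q₁ a k α f
    Q₂≥0        : ∀ k α f → (∀ x → f x x ≡ 0ℤ) → 0ℤ ℤ.≤ Q₂ a k α f

relabel : ∀ {n} → Permutation′ n → Adjacency n → Adjacency n
relabel π a x y = a (π ⟨$⟩ʳ x) (π ⟨$⟩ʳ y)

module _ {n} (π : Permutation′ n) where

  private
    to from : Fin n → Fin n
    to   = π ⟨$⟩ʳ_
    from = π ⟨$⟩ˡ_

    to∘from : ∀ x → to (from x) ≡ x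
    to∘from x = Perm.inverseʳ π

    from∘to : ∀ x → from (to x) ≡ x
    from∘to x = Perm.inverseˡ π

    to-injective : ∀ {x y} → to x ≡ to y → x ≡ y
    to-injective {x} {y} p = trans (sym (from∘to x)) (trans (cong from p) (from∘to y))

    sum-relabel : ∀ (g : Fin n → ℤ) → ∑ℤ.sum (g ∘ to) ≡ ∑ℤ.sum g
    sum-relabel g = sym (∑ℤ.sum-permute g π)

  ==-to : ∀ x y → (to x == to y) ≡ (x == y)
  ==-to x y with x Fin.≟ y
  ... | yes refl = dec-true (to x Fin.≟ to x) refl
  ... | no x≢y   = dec-false (to x Fin.≟ to y) (x≢y ∘ to-injective)

  relabel-integral : ∀ {a} → IntegralCubic a → IntegralCubic (relabel π a)
  relabel-integral {a} A = record
    { symmetric   = λ x y → A.symmetric _ _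
    ; irreflexive = λ x → A.irreflexive _
    ; cubic       = λ x → trans (sym (∑ℕ.sum-permute (bit ∘ a (to x)) π)) (A.cubic (to x))
    ; connected   = λ p closed x y px →
        subst (λ z → p z ≡ true) (from∘to y)
          (A.connected (p ∘ from)
            (λ u v auv → closed (from u) (from v) (subst₂ (λ u v → a u v ≡ true) (sym (to∘from u)) (sym (to∘from v)) auv))
            (to x) (to y) (subst (λ z → p z ≡ true) (sym (from∘to x)) px))
    ; Q₁≥0 = λ k α f → subst (0ℤ ℤ.≤_) (sym (Q₁-relabel k α f)) (A.Q₁≥0 k α (f ∘ from))
    ; Q₂≥0 = λ k α f f₀ → subst (0ℤ ℤ.≤_) (sym (Q₂-relabel k α f)) (A.Q₂≥0 k α (λ x y → f (from x) (from y)) (f₀ ∘ from))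
    }
    where
    module A = IntegralCubic A
    Q₁-relabel : ∀ k α f → Q₁ (relabel π a) k α f ≡ Q₁ a k α (f ∘ from)
    Q₁-relabel k α f = trans
      (∑ℤ.sum-cong-≗ λ x → cong₂ (gap k α) (cong f (sym (from∘to x)))
        (cong₂ (λ u v → + 3 ℤ.* u ℤ.- v) (cong f (sym (from∘to x)))
          (trans (∑ℤ.sum-cong-≗ λ j → cong (λ u → a (to j) (to x) ∙ᵇ f u) (sym (from∘to j)))
            (sum-relabel λ j → a j (to x) ∙ᵇ f (from j)))))
      (sum-relabel λ x → gap k α (f (from x)) (L₁ a (f ∘ from) x))

    Q₂-relabel : ∀ k α f → Q₂ (relabel π a) k α f ≡ Q₂ a k α (λ x y → f (from x) (from y))
    Q₂-relabel k α f = trans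
      (∑ℤ.sum-cong-≗ λ x → trans
        (∑ℤ.sum-cong-≗ λ y → cong₂ _∙ᵇ_ (cong not (sym (==-to x y)))
          (cong₂ (gap k α) (f≡ x y)
            (cong₂ ℤ._-_ (cong₂ ℤ._-_ (cong₂ ℤ._-_ (cong (+ 6 ℤ.*_) (f≡ x y))
              (trans (∑ℤ.sum-cong-≗ λ j → cong (a (to j) (to x) ∙ᵇ_) (f≡ j y)) (sum-relabel λ j → a j (to x) ∙ᵇ f′ j (to y))))
              (trans (∑ℤ.sum-cong-≗ λ j → cong (a (to j) (to y) ∙ᵇ_) (f≡ x j)) (sum-relabel λ j → a j (to y) ∙ᵇ f′ (to x) j)))
              (cong (a (to x) (to y) ∙ᵇ_) (cong₂ ℤ._+_ (f≡ x y) (f≡ y x))))))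
        (sum-relabel λ y → not (to x == y) ∙ᵇ gap k α (f′ (to x) y) (L₂ a f′ (to x) y)))
      (sum-relabel λ x → ∑ℤ.sum λ y → not (x == y) ∙ᵇ gap k α (f′ x y) (L₂ a f′ x y))
      where
      f′ : Fin n → Fin n → ℤ
      f′ x y = f (from x) (from y)
      f≡ : ∀ x y → f x y ≡ f′ (to x) (to y)
      f≡ x y = cong₂ f (sym (from∘to x)) (sym (from∘to y))

transpose-left : ∀ {n} (i j : Fin n) → transpose i j ⟨$⟩ʳ i ≡ j
transpose-left i j rewrite dec-true (i Fin.≟ i) refl = refl

transpose-right : ∀ {n} (i j : Fin n) → transpose i j ⟨$⟩ʳ j ≡ i
transpose-right i j with j Fin.≟ i
... | yes j≡i = j≡i
... | no _ rewrite dec-true (j Fin.≟ j) refl = refl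

transpose-other : ∀ {n} (i j k : Fin n) → k ≢ i → k ≢ j → transpose i j ⟨$⟩ʳ k ≡ k
transpose-other i j k k≢i k≢j rewrite dec-false (k Fin.≟ i) k≢i | dec-false (k Fin.≟ j) k≢j = refl

transpose-comm : ∀ {n} (i j : Fin n) → transpose i j Perm.≈ transpose j i
transpose-comm i j k = cases (k Fin.≟ i) (k Fin.≟ j)
  where
  cases : Dec (k ≡ i) → Dec (k ≡ j) → transpose i j ⟨$⟩ʳ k ≡ transpose j i ⟨$⟩ʳ k
  cases (yes refl) _          = trans (transpose-left i j) (sym (transpose-right j i))
  cases (no _)     (yes refl) = trans (transpose-right i j) (sym (transpose-left j i))
  cases (no k≢i)   (no k≢j)   = trans (transpose-other i j k k≢i k≢j) (sym (transpose-other j i k k≢j k≢i))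

-- Exhaustive search for integral cubic graphs

Config : ℕ → Set
Config n = Vec (Vec Bool n) n

known : ∀ {n} → Config n → Fin n → Fin n → Bool
known H x y = lookup (lookup H x) y

blank : ∀ n → Config n
blank n = Vec.replicate n (Vec.replicate n false)

mark : ∀ {n} → Fin n → Fin n → Config n → Config n
mark x y H = Vec.updateAt H x (λ row → Vec.updateAt row y (λ _ → true))

connect : ∀ {n} → Config n → Fin n → Fin n → Config n
connect H x y = mark x y (mark y x H)

infix 4 _⊑_
_⊑_ : ∀ {n} → Config n → Adjacency n → Set
H ⊑ a = ∀ x y → known H x y ≡ true → a x y ≡ true

known-mark : ∀ {n} (H : Config n) x y u v → known (mark x y H) u v ≡ true →
             known H u v ≡ true ⊎ (u ≡ x × v ≡ y)
known-mark H x y u v p with u Fin.≟ x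
... | no u≢x = inj₁ (subst (λ row → lookup row v ≡ true) (Vec.lookup∘updateAt′ u x u≢x H) p)
... | yes refl with v Fin.≟ y
...   | yes v≡y = inj₂ (refl , v≡y)
...   | no v≢y  = inj₁ (trans (sym (Vec.lookup∘updateAt′ v y v≢y (lookup H u)))
                          (subst (λ row → lookup row v ≡ true) (Vec.lookup∘updateAt u H) p))

blank⊑ : ∀ {n} (a : Adjacency n) → blank n ⊑ a
blank⊑ {n} a x y p = contradiction (trans (sym p)
  (trans (cong (λ row → lookup row y) (Vec.lookup-replicate x (Vec.replicate n false))) (Vec.lookup-replicate y false))) λ ()

connect⊑ : ∀ {n} {a : Adjacency n} {H x y} → IntegralCubic a → H ⊑ a → a x y ≡ true → connect H x y ⊑ a
connect⊑ {H = H} {x} {y} A H⊑a axy u v p with known-mark (mark y x H) x y u v p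
... | inj₂ (refl , refl) = axy
... | inj₁ q with known-mark H y x u v q
...   | inj₂ (refl , refl) = trans (IntegralCubic.symmetric A _ _) axy
...   | inj₁ r             = H⊑a u v r

saturated : ∀ {n} → Config n → Fin n → Bool
saturated H x = ∑ℕ.sum (bit ∘ known H x) ℕ.≡ᵇ 3

≡ᵇ-sound : ∀ {m n} → (m ℕ.≡ᵇ n) ≡ true → m ≡ n
≡ᵇ-sound {m} {n} p = ℕ.≡ᵇ⇒≡ m n (Equivalence.from Bool.T-≡ p)

saturated-exact : ∀ {n} {a : Adjacency n} {H} → IntegralCubic a → H ⊑ a →
                  ∀ {x} → saturated H x ≡ true → ∀ y → known H x y ≡ a x y
saturated-exact {a = a} {H} A H⊑a {x} sat = subset-full (known H x) (a x) (H⊑a x)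
  (trans (≡ᵇ-sound sat) (sym (IntegralCubic.cubic A x)))

fresh : ∀ {n} → Config n → Fin n → Bool
fresh H w = allᵇ λ x → not (known H w x) ∧ not (known H x w)

-- Tables of small numbers are packed into the base 100 digits of one
-- numeral, least significant first; the digit 50 + d stands for - d.
digit : ℕ → ℕ → ℕ
digit zero    N = N ℕ.% 100
digit (suc i) N = digit i (N ℕ./ 100)

signed : ℕ → ℤ
signed d = if d ℕ.<ᵇ 50 then + d else 50 ℤ.⊖ d

packedEntry : ∀ {n} → ℕ → Fin n → ℤ
packedEntry N x = signed (digit (toℕ x) N)

row : ∀ {n} → List ℕ → Fin n → ℕ
row []       _       = 0
row (r ∷ _)  zero    = r
row (_ ∷ rs) (suc i) = row rs i

-- The rows list the entries strictly below the diagonal.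
symmetricEntry : ∀ {n} → List ℕ → Fin n → Fin n → ℤ
symmetricEntry rs x y =
  if x == y then 0ℤ else if toℕ y ℕ.<ᵇ toℕ x then packedEntry (row rs x) y else packedEntry (row rs y) x

isZero isNegative : ℤ → Bool
isZero x = does (x ℤ.≟ 0ℤ)
isNegative (+ _)    = false
isNegative -[1+ _ ] = true

-- A search tree closes a configuration, a set of known edges, by showing
-- that no integral cubic graph contains it, except for the target graph.
--   split v:  distinguish cases according to another neighbour of v;
--   gap₁, gap₂:  a test function, supported on vertices all of whose
--     neighbours are known, on which (L - k) (L - k - 1) is negative;
--   embed i σ τ:  the i-th of the latest settled configurations embeds, by the permutation σ = τ⁻¹;
--   component:  the saturated vertices form a proper union of components;
--   target:  the graph is the target graph.
mutual
  data Tree : Set where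
    split     : ℕ → Forest → Tree
    gap₁      : ℕ → ℕ → ℕ → Tree
    gap₂      : ℕ → ℕ → List ℕ → Tree
    embed     : ℕ → ℕ → ℕ → Tree
    component : Tree
    target    : Tree

  infixr 5 _↦_∷_
  data Forest : Set where
    []    : Forest
    _↦_∷_ : ℕ → Tree → Forest → Forest

isZero-sound : ∀ {x} → isZero x ≡ true → x ≡ 0ℤ
isZero-sound {x} p with x ℤ.≟ 0ℤ
... | yes x≡0 = x≡0

isNegative-sound : ∀ {x} → isNegative x ≡ true → ¬ (0ℤ ℤ.≤ x)
isNegative-sound { -[1+ _ ]} _ ()

module Search {n} (label : ℕ → Fin n) (targetGraph : Adjacency n) where

  vertex : ℕ → Fin n → Fin n
  vertex N x = label (digit (toℕ x) N)

  Goal : Adjacency n → Set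
  Goal a = Σ[ π ∈ Permutation′ n ] (∀ x y → relabel π a x y ≡ targetGraph x y)

  Settled : Config n → Set
  Settled H = ∀ a → IntegralCubic a → H ⊑ a → Goal a

  Goal-relabel : ∀ π a → Goal (relabel π a) → Goal a
  Goal-relabel π a (ρ , h) = ρ ∘ₚ π , h

  member hasFresh : Config n → Fin n → Forest → Fin n → Bool
  member H v []            w = false
  member H v (u ↦ _ ∷ F)   w = (label u == w) ∨ member H v F w
  hasFresh H v []          w = false
  hasFresh H v (u ↦ _ ∷ F) w = (fresh H (label u) ∧ not (label u == v)) ∨ hasFresh H v F w

  covered : Config n → Fin n → Forest → Fin n → Bool
  covered H v F w = (w == v) ∨ (known H v w ∨ ((saturated H w ∧ not (known H w v)) ∨
                    (member H v F w ∨ (fresh H w ∧ hasFresh H v F w))))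

  supported₁ : Config n → (Fin n → ℤ) → Bool
  supported₁ H f = allᵇ λ x → isZero (f x) ∨ saturated H x

  supported₂ : Config n → (Fin n → Fin n → ℤ) → Bool
  supported₂ H f = allᵇ λ x → allᵇ λ y → isZero (f x y) ∨ (saturated H x ∧ saturated H y)

  nth : List (Config n) → ℕ → Maybe (Config n)
  nth []      _       = nothing
  nth (H ∷ _) zero    = just H
  nth (_ ∷ Γ) (suc i) = nth Γ i

  embeds : Config n → (Fin n → Fin n) → (Fin n → Fin n) → Maybe (Config n) → Bool
  embeds H σ τ nothing   = false
  embeds H σ τ (just H′) =
    (allᵇ λ x → (τ (σ x) == x) ∧ (σ (τ x) == x)) ∧
    (allᵇ λ x → allᵇ λ y → not (known H′ x y) ∨ known H (σ x) (σ y))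

  check       : List (Config n) → Config n → Tree → Bool
  checkForest : List (Config n) → Config n → Fin n → Forest → Bool

  check Γ H (split v F)   = not (saturated H (label v)) ∧
                            (allᵇ (covered H (label v) F) ∧ checkForest Γ H (label v) F)
  check Γ H (gap₁ k α f)  = supported₁ H (packedEntry f) ∧ isNegative (Q₁ (known H) k (signed α) (packedEntry f))
  check Γ H (gap₂ k α f)  = supported₂ H (symmetricEntry f) ∧ isNegative (Q₂ (known H) k (signed α) (symmetricEntry f))
  check Γ H (embed i σ τ) = embeds H (vertex σ) (vertex τ) (nth Γ i)
  check Γ H component     =
    anyᵇ (saturated H) ∧ (anyᵇ (not ∘ saturated H) ∧
    (allᵇ λ x → allᵇ λ y → not (saturated H x) ∨ (not (known H x y) ∨ saturated H y)))
  check Γ H target        =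
    allᵇ λ x → saturated H x ∧ (allᵇ λ y → does (known H x y Bool.≟ targetGraph x y))

  checkForest Γ H v []          = true
  checkForest Γ H v (u ↦ t ∷ F) = check Γ (connect H v (label u)) t ∧ checkForest Γ H v F

  private
    not∨ : ∀ {x y} → not x ∨ y ≡ true → x ≡ true → y ≡ true
    not∨ {true} h refl = h

    zeroOr : ∀ {a : Adjacency n} {H} → IntegralCubic a → H ⊑ a → ∀ {z} j x → z ≡ 0ℤ ⊎ saturated H j ≡ true →
             known H j x ∙ᵇ z ≡ a j x ∙ᵇ z
    zeroOr {a} {H} A H⊑a j x (inj₁ refl) = trans (Bool.if-eta (known H j x)) (sym (Bool.if-eta (a j x)))
    zeroOr {H = H} A H⊑a {z} j x (inj₂ sat) = cong (_∙ᵇ z) (saturated-exact {H = H} A H⊑a sat x)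

    agree₁ : ∀ {a : Adjacency n} {H} → IntegralCubic a → H ⊑ a → ∀ f → supported₁ H f ≡ true →
             ∀ j x → known H j x ∙ᵇ f j ≡ a j x ∙ᵇ f j
    agree₁ {a} {H} A H⊑a f supp j x =
      zeroOr {a} {H} A H⊑a j x (Sum.map₁ isZero-sound (∨-split {isZero (f j)} (allᵇ-sound _ supp j)))

    Q₁-agree : ∀ {a H} → IntegralCubic a → H ⊑ a → ∀ k α f → supported₁ H f ≡ true →
               Q₁ (known H) k α f ≡ Q₁ a k α f
    Q₁-agree {_} {H} A H⊑a k α f supp = ∑ℤ.sum-cong-≗ λ x →
      cong (λ s → gap k α (f x) (+ 3 ℤ.* f x ℤ.- s)) (∑ℤ.sum-cong-≗ λ j → agree₁ {_} {H} A H⊑a f supp j x)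

    supp₂ : ∀ {H} f → supported₂ H f ≡ true → ∀ x y →
            f x y ≡ 0ℤ ⊎ (saturated H x ≡ true × saturated H y ≡ true)
    supp₂ f supp x y with ∨-split {isZero (f x y)} (allᵇ-sound _ (allᵇ-sound _ supp x) y)
    ... | inj₁ f₀  = inj₁ (isZero-sound f₀)
    ... | inj₂ sat = inj₂ (∧-split sat)

    Q₂-agree : ∀ {a H} → IntegralCubic a → H ⊑ a → ∀ k α f → supported₂ H f ≡ true →
               Q₂ (known H) k α f ≡ Q₂ a k α f
    Q₂-agree {a} {H} A H⊑a k α f supp = ∑ℤ.sum-cong-≗ λ x → ∑ℤ.sum-cong-≗ λ y →
      cong (λ s → not (x == y) ∙ᵇ gap k α (f x y) s)
        (cong₂ ℤ._-_ (cong₂ ℤ._-_ (cong (λ s → + 6 ℤ.* f x y ℤ.- s)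
          (∑ℤ.sum-cong-≗ λ j → zeroOr {a} {H} A H⊑a j x (first j y)))
          (∑ℤ.sum-cong-≗ λ j → zeroOr {a} {H} A H⊑a j y (second x j)))
          (trans (if-+ (known H x y) {f x y}) (trans (cong₂ ℤ._+_ (zeroOr {a} {H} A H⊑a x y (first x y)) (zeroOr {a} {H} A H⊑a x y (second y x)))
            (sym (if-+ (a x y) {f x y})))))
      where
      first : ∀ x y → f x y ≡ 0ℤ ⊎ saturated H x ≡ true
      first x y with supp₂ {H} f supp x y
      ... | inj₁ f₀  = inj₁ f₀
      ... | inj₂ sat = inj₂ (proj₁ sat)
      second : ∀ x y → f x y ≡ 0ℤ ⊎ saturated H y ≡ true
      second x y with supp₂ {H} f supp x y
      ... | inj₁ f₀  = inj₁ f₀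
      ... | inj₂ sat = inj₂ (proj₂ sat)
      if-+ : ∀ b {u v} → b ∙ᵇ (u ℤ.+ v) ≡ b ∙ᵇ u ℤ.+ b ∙ᵇ v
      if-+ true  = refl
      if-+ false = refl

    symmetricEntry-diagonal : ∀ (rs : List ℕ) (x : Fin n) → symmetricEntry rs x x ≡ 0ℤ
    symmetricEntry-diagonal rs x rewrite dec-true (x Fin.≟ x) refl = refl

    -- Two vertices about which nothing is known are interchangeable.
    settle-fresh : ∀ {a H v w w₀} → IntegralCubic a → H ⊑ a → a v w ≡ true →
                   fresh H w ≡ true → fresh H w₀ ≡ true → w₀ ≢ v → Settled (connect H v w₀) → Goal a
    settle-fresh {a} {H} {v} {w} {w₀} A H⊑a avw fw fw₀ w₀≢v settled =
      Goal-relabel π a (settled (relabel π a) A′ (connect⊑ {H = H} A′ H⊑πa πavw₀))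
      where
      π : Permutation′ n
      π = transpose w w₀
      A′ : IntegralCubic (relabel π a)
      A′ = relabel-integral π A
      v≢w : v ≢ w
      v≢w refl = contradiction (trans (sym avw) (IntegralCubic.irreflexive A v)) λ ()
      left : ∀ {u} → fresh H u ≡ true → ∀ {x y} → known H x y ≡ true → x ≢ u
      left fu {x} {y} kxy refl =
        contradiction (trans (sym kxy) (not-true (proj₁ (∧-split {not (known H x y)} (allᵇ-sound _ fu y))))) λ ()
      right : ∀ {u} → fresh H u ≡ true → ∀ {x y} → known H x y ≡ true → y ≢ u
      right fu {x} {y} kxy refl =
        contradiction (trans (sym kxy) (not-true (proj₂ (∧-split {not (known H y x)} (allᵇ-sound _ fu x))))) λ ()
      H⊑πa : H ⊑ relabel π a
      H⊑πa x y kxy = trans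
        (cong₂ a (transpose-other w w₀ x (left fw kxy) (left fw₀ kxy)) (transpose-other w w₀ y (right fw kxy) (right fw₀ kxy)))
        (H⊑a x y kxy)
      πavw₀ : relabel π a v w₀ ≡ true
      πavw₀ = trans (cong₂ a (transpose-other w w₀ v v≢w (≢-sym w₀≢v)) (transpose-right w w₀)) avw

  AllSettled : List (Config n) → Set
  AllSettled Γ = ∀ i {H} → nth Γ i ≡ just H → Settled H

  check-sound : ∀ {Γ} → AllSettled Γ → ∀ H t → check Γ H t ≡ true → Settled H
  forest-member : ∀ {Γ} → AllSettled Γ → ∀ H v F w → checkForest Γ H v F ≡ true →
                  member H v F w ≡ true → Settled (connect H v w)
  forest-fresh : ∀ {Γ} → AllSettled Γ → ∀ H v F w → checkForest Γ H v F ≡ true → hasFresh H v F w ≡ true →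
                 ∃[ w₀ ] (fresh H w₀ ≡ true × w₀ ≢ v × Settled (connect H v w₀))

  check-sound Γ✓ H (split v′ F) ok a A H⊑a = cases
    where
    v = label v′
    unsat = proj₁ (∧-split ok)
    rest  = ∧-split (proj₂ (∧-split {not (saturated H v)} ok))
    neighbour : ∃[ w ] (known H v w ≡ false × a v w ≡ true)
    neighbour = missing (known H v) (a v) (H⊑a v) λ eq →
      contradiction (trans (sym (not-true unsat)) (cong (ℕ._≡ᵇ 3) (trans eq (IntegralCubic.cubic A v)))) λ ()
    w = proj₁ neighbour
    kvw = proj₁ (proj₂ neighbour)
    avw = proj₂ (proj₂ neighbour)
    forest = proj₂ rest
    case₅ : fresh H w ∧ hasFresh H v F w ≡ true → Goal a
    case₅ h with ∧-split {fresh H w} h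
    ... | fw , hf with forest-fresh Γ✓ H v F w forest hf
    ...   | w₀ , fw₀ , w₀≢v , settled = settle-fresh {H = H} A H⊑a avw fw fw₀ w₀≢v settled
    case₄ : member H v F w ∨ (fresh H w ∧ hasFresh H v F w) ≡ true → Goal a
    case₄ h with ∨-split h
    ... | inj₁ mem = forest-member Γ✓ H v F w forest mem a A (connect⊑ {H = H} A H⊑a avw)
    ... | inj₂ h′  = case₅ h′
    case₃ : (saturated H w ∧ not (known H w v)) ∨ (member H v F w ∨ (fresh H w ∧ hasFresh H v F w)) ≡ true → Goal a
    case₃ h with ∨-split {saturated H w ∧ not (known H w v)} h
    ... | inj₂ h′ = case₄ h′
    ... | inj₁ h′ with ∧-split {saturated H w} h′
    ...   | sat , nk = contradiction
              (trans (sym avw) (trans (IntegralCubic.symmetric A v w) (trans (sym (saturated-exact {H = H} A H⊑a sat v)) (not-true nk)))) λ ()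
    case₂ : known H v w ∨ ((saturated H w ∧ not (known H w v)) ∨ (member H v F w ∨ (fresh H w ∧ hasFresh H v F w))) ≡ true → Goal a
    case₂ h with ∨-split {known H v w} h
    ... | inj₁ k  = contradiction (trans (sym k) kvw) λ ()
    ... | inj₂ h′ = case₃ h′
    cases : Goal a
    cases with ∨-split {w == v} (allᵇ-sound _ (proj₁ rest) w)
    ... | inj₂ h   = case₂ h
    ... | inj₁ w=v = contradiction (trans (sym avw) (trans (cong (a v) (==-sound w=v)) (IntegralCubic.irreflexive A v))) λ ()
  check-sound Γ✓ H (gap₁ k α f) ok a A H⊑a with ∧-split {supported₁ H (packedEntry f)} ok
  ... | supp , neg = contradiction
    (subst (0ℤ ℤ.≤_) (sym (Q₁-agree {a} {H} A H⊑a k (signed α) (packedEntry f) supp)) (IntegralCubic.Q₁≥0 A k (signed α) (packedEntry f)))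
    (isNegative-sound neg)
  check-sound Γ✓ H (gap₂ k α f) ok a A H⊑a with ∧-split {supported₂ H (symmetricEntry f)} ok
  ... | supp , neg = contradiction
    (subst (0ℤ ℤ.≤_) (sym (Q₂-agree {a} {H} A H⊑a k (signed α) (symmetricEntry f) supp))
      (IntegralCubic.Q₂≥0 A k (signed α) (symmetricEntry f) (symmetricEntry-diagonal f)))
    (isNegative-sound neg)
  check-sound {Γ} Γ✓ H (embed i σ τ) ok a A H⊑a with nth Γ i in eq
  ... | just H′ = Goal-relabel π a (Γ✓ i eq (relabel π a) (relabel-integral π A) H′⊑πa)
    where
    parts = ∧-split {allᵇ λ x → (vertex τ (vertex σ x) == x) ∧ (vertex σ (vertex τ x) == x)} ok
    inverses = λ x → ∧-split {vertex τ (vertex σ x) == x} (allᵇ-sound _ (proj₁ parts) x)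
    π : Permutation′ n
    π = Perm.permutation (vertex σ) (vertex τ) (λ x → ==-sound (proj₂ (inverses x))) (λ x → ==-sound (proj₁ (inverses x)))
    H′⊑πa : H′ ⊑ relabel π a
    H′⊑πa x y k = H⊑a _ _ (not∨ (allᵇ-sound _ (allᵇ-sound _ (proj₂ parts) x) y) k)
  check-sound Γ✓ H component ok a A H⊑a = contradiction (trans (sym (stays x y sx)) (not-true nsy)) λ ()
    where
    p₁ = ∧-split {anyᵇ (saturated H)} ok
    p₂ = ∧-split {anyᵇ (not ∘ saturated H)} (proj₂ p₁)
    x = proj₁ (anyᵇ-sound (saturated H) (proj₁ p₁))
    sx = proj₂ (anyᵇ-sound (saturated H) (proj₁ p₁))
    y = proj₁ (anyᵇ-sound (not ∘ saturated H) (proj₁ p₂))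
    nsy = proj₂ (anyᵇ-sound (not ∘ saturated H) (proj₁ p₂))
    stays : ∀ x y → saturated H x ≡ true → saturated H y ≡ true
    stays = IntegralCubic.connected A (saturated H) λ u v auv su →
      not∨ (not∨ (allᵇ-sound _ (allᵇ-sound _ (proj₂ p₂) u) v) su) (trans (saturated-exact {H = H} A H⊑a su v) auv)
  check-sound Γ✓ H target ok a A H⊑a = Perm.id , λ x y →
    let sat , eqs = ∧-split {saturated H x} (allᵇ-sound _ ok x) in
    trans (sym (saturated-exact {H = H} A H⊑a sat y)) (same (known H x y) _ (allᵇ-sound _ eqs y))
    where
    same : ∀ b c → does (b Bool.≟ c) ≡ true → b ≡ c
    same true  true  _ = refl
    same false false _ = refl

  forest-member Γ✓ H v (u ↦ t ∷ F) w ok mem with ∧-split {check _ (connect H v (label u)) t} ok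
  ... | okₜ , ok′ with ∨-split {label u == w} mem
  ...   | inj₁ u=w  = subst (Settled ∘ connect H v) (==-sound u=w) (check-sound Γ✓ (connect H v (label u)) t okₜ)
  ...   | inj₂ mem′ = forest-member Γ✓ H v F w ok′ mem′

  forest-fresh Γ✓ H v (u ↦ t ∷ F) w ok hf with ∧-split {check _ (connect H v (label u)) t} ok
  ... | okₜ , ok′ with ∨-split {fresh H (label u) ∧ not (label u == v)} hf
  ...   | inj₂ hf′ = forest-fresh Γ✓ H v F w ok′ hf′
  ...   | inj₁ h with ∧-split {fresh H (label u)} h
  ...     | fu , u≠v = label u , fu , ==-complete (not-true u≠v) , check-sound Γ✓ (connect H v (label u)) t okₜ

  config : ℕ → ℕ → Config n
  config zero    N = blank n
  config (suc e) N = connect (config e (N ℕ./ 10000)) (label (digit 1 N)) (label (digit 0 N))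

  checkAll : List (Config n) → List (ℕ × ℕ × Tree) → Tree → Bool
  checkAll Γ []            t = check Γ (blank n) t
  checkAll Γ ((e , N , s) ∷ Λ) t = check Γ (config e N) s ∧ checkAll (config e N ∷ Γ) Λ t

  checkAll-sound : ∀ {Γ} → AllSettled Γ → ∀ Λ t → checkAll Γ Λ t ≡ true → Settled (blank n)
  checkAll-sound Γ✓ []            t ok = check-sound Γ✓ (blank n) t ok
  checkAll-sound {Γ} Γ✓ ((e , N , s) ∷ Λ) t ok with ∧-split {check Γ (config e N) s} ok
  ... | ok₁ , ok₂ = checkAll-sound extended Λ t ok₂
    where
    extended : AllSettled (config e N ∷ Γ)
    extended zero    refl = check-sound Γ✓ (config e N) s ok₁
    extended (suc i) eq   = Γ✓ i eq

  search : ∀ Λ t → checkAll [] Λ t ≡ true → ∀ {a} → IntegralCubic a → Goal a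
  search Λ t ok {a} A = checkAll-sound (λ _ ()) Λ t ok a A (blank⊑ a)

clamp : ∀ {m} → ℕ → Fin (suc m)
clamp {m}     zero    = zero
clamp {zero}  (suc k) = zero
clamp {suc m} (suc k) = suc (clamp k)

complete : Adjacency 4
complete x y = not (x == y)

side : Fin 6 → Bool
side = lookup (true ∷ false ∷ false ∷ false ∷ true ∷ true ∷ [])

bipartite : Adjacency 6
bipartite x y = side x xor side y

-- Not irreflexive, so that a search with this target is a refutation.
impossible : ∀ {n} → Adjacency n
impossible _ _ = true

lemmas4 : List (ℕ × ℕ × Tree)
lemmas4 =
  (4 , 102000300020001 , split 1 (3 ↦ (split 2 (3 ↦ target ∷ [])) ∷ [])) ∷
  []

tree4 : Tree
tree4 = split 0 (1 ↦ split 0 (2 ↦ split 0 (3 ↦ (split 1 (2 ↦ (embed 0 3020100 3020100) ∷ 3 ↦ (embed 0 2030100 2030100) ∷ [])) ∷ []) ∷ []) ∷ [])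

lemmas6 : List (ℕ × ℕ × Tree)
lemmas6 =
  (6 , 20401030102000300020001 , split 3 (4 ↦ (split 4 (5 ↦ (gap₁ 5 51 553530303) ∷ [])) ∷ 5 ↦ (gap₁ 4 1 55550202) ∷ [])) ∷
  (8 , 3050304020501040102000300020001 , split 4 (5 ↦ (gap₂ 8 0 (0 ∷ 51 ∷ 100 ∷ 251 ∷ 51520002 ∷ 100015200 ∷ [])) ∷ [])) ∷
  (7 , 304020501040102000300020001 , split 3 (5 ↦ (embed 0 50403020100 50403020100) ∷ [])) ∷
  (5 , 1040102000300020001 , split 2 (3 ↦ (embed 2 50403010200 50403010200) ∷ 4 ↦ (embed 2 50304000201 50304010002) ∷ 5 ↦ (split 3 (4 ↦ (embed 0 50403020100 50403020100) ∷ 5 ↦ (embed 0 40503010200 40503010200) ∷ [])) ∷ [])) ∷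
  (4 , 102000300020001 , split 1 (3 ↦ (split 2 (3 ↦ component ∷ 4 ↦ (embed 3 50403020100 50403020100) ∷ [])) ∷ 4 ↦ (embed 0 50403020100 50403020100) ∷ [])) ∷
  (7 , 204020301050104000300020001 , split 3 (4 ↦ (gap₁ 5 51 5303030553) ∷ 5 ↦ (embed 3 50401030200 50402010300) ∷ [])) ∷
  (8 , 3040205020401050104000300020001 , split 3 (5 ↦ target ∷ [])) ∷
  (6 , 20401050104000300020001 , split 2 (3 ↦ (embed 1 50403020100 50403020100) ∷ 5 ↦ (split 3 (4 ↦ (embed 0 50403020100 50403020100) ∷ 5 ↦ (embed 0 40503020100 40503020100) ∷ [])) ∷ [])) ∷
  []

tree6 : Tree
tree6 = split 0 (1 ↦ split 0 (2 ↦ split 0 (3 ↦ (split 1 (2 ↦ (embed 3 50403020100 50403020100) ∷ 3 ↦ (embed 3 50402030100 50402030100) ∷ 4 ↦ (split 1 (2 ↦ (embed 4 50403020100 50403020100) ∷ 3 ↦ (embed 4 50402030100 50402030100) ∷ 5 ↦ (split 2 (3 ↦ (split 2 (4 ↦ (embed 2 50403020100 50403020100) ∷ 5 ↦ (embed 2 40503020100 40503020100) ∷ [])) ∷ 4 ↦ (embed 0 50403020100 50403020100) ∷ 5 ↦ (embed 0 40503020100 40503020100) ∷ [])) ∷ [])) ∷ [])) ∷ []) ∷ []) ∷ [])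

lemmas8 : List (ℕ × ℕ × Tree)
lemmas8 =
  (6 , 20401030102000300020001 , split 3 (4 ↦ (split 4 (5 ↦ (gap₁ 0 0 305050606) ∷ [])) ∷ 5 ↦ (split 4 (5 ↦ (split 4 (6 ↦ (gap₁ 2 51 554060000) ∷ [])) ∷ 6 ↦ (split 4 (5 ↦ (gap₁ 2 51 554060000) ∷ 7 ↦ (gap₁ 0 0 205060707) ∷ [])) ∷ [])) ∷ [])) ∷
  (8 , 3050304020501040102000300020001 , split 4 (5 ↦ (gap₂ 8 0 (0 ∷ 51 ∷ 100 ∷ 251 ∷ 51520002 ∷ 100015200 ∷ [])) ∷ 6 ↦ (gap₁ 2 51 408555302) ∷ [])) ∷
  (8 , 3060304020501040102000300020001 , split 4 (5 ↦ (gap₁ 2 51 804550253) ∷ 6 ↦ (split 6 (5 ↦ (gap₁ 1 0 53005252030202) ∷ 7 ↦ (gap₂ 3 0 (0 ∷ 0 ∷ 5101 ∷ 20007 ∷ 525700 ∷ 0 ∷ 5101005202 ∷ [])) ∷ [])) ∷ 7 ↦ (gap₁ 1 52 202030404) ∷ [])) ∷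
  (7 , 304020501040102000300020001 , split 3 (5 ↦ (embed 1 706050403020100 706050403020100) ∷ 6 ↦ (embed 0 706050403020100 706050403020100) ∷ [])) ∷
  (5 , 1040102000300020001 , split 2 (3 ↦ (embed 3 706050403010200 706050403010200) ∷ 4 ↦ (embed 3 706050304000201 706050304010002) ∷ 5 ↦ (split 3 (4 ↦ (embed 0 706050403020100 706050403020100) ∷ 5 ↦ (embed 0 706040503010200 706040503010200) ∷ 6 ↦ (split 3 (4 ↦ (embed 1 706050403020100 706050403020100) ∷ 5 ↦ (embed 1 706040503010200 706040503010200) ∷ 7 ↦ (gap₁ 1 52 2040405) ∷ [])) ∷ [])) ∷ [])) ∷
  (4 , 102000300020001 , split 1 (3 ↦ (split 2 (3 ↦ component ∷ 4 ↦ (embed 4 706050403020100 706050403020100) ∷ [])) ∷ 4 ↦ (embed 0 706050403020100 706050403020100) ∷ [])) ∷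
  (7 , 204020301050104000300020001 , split 3 (4 ↦ (gap₁ 0 0 506060305) ∷ 5 ↦ (embed 4 706050401030200 706050402010300) ∷ 6 ↦ (embed 3 705060401030200 705060402010300) ∷ [])) ∷
  (7 , 206020301050104000300020001 , split 3 (4 ↦ (embed 4 705060401020300 705060401020300) ∷ 5 ↦ (embed 4 704060501020300 705040601020300) ∷ 6 ↦ (split 6 (4 ↦ (gap₁ 2 51 54000000000506) ∷ 5 ↦ (gap₁ 2 51 54000000000506) ∷ 7 ↦ (gap₁ 0 0 5000007070206) ∷ [])) ∷ 7 ↦ (gap₁ 1 52 4040205) ∷ [])) ∷
  (9 , 30603040205020401050104000300020001 , split 5 (6 ↦ (gap₁ 2 0 35153010151) ∷ 7 ↦ (split 6 (7 ↦ (split 6 ( [])) ∷ [])) ∷ [])) ∷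
  (8 , 4060205020401050104000300020001 , split 5 (3 ↦ (embed 0 706030204050001 706020305040001) ∷ 6 ↦ (embed 0 703060200050401 705020106040003) ∷ 7 ↦ (gap₁ 1 52 30300040403) ∷ [])) ∷
  (8 , 4050206020401050104000300020001 , split 5 (3 ↦ (gap₁ 2 51 555300040208) ∷ 6 ↦ (gap₁ 2 51 550200085304) ∷ 7 ↦ (gap₁ 1 52 30400020402) ∷ [])) ∷
  (9 , 40703050206020401050104000300020001 , split 3 (6 ↦ (split 5 (6 ↦ (gap₁ 2 0 51010000520200) ∷ 7 ↦ (gap₂ 7 0 (0 ∷ 0 ∷ 5704 ∷ 754 ∷ 30457 ∷ 53005407 ∷ [])) ∷ [])) ∷ 7 ↦ (gap₁ 2 51 5405025305) ∷ [])) ∷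
  (7 , 206020401050104000300020001 , split 4 (3 ↦ (embed 2 706030205040001 706030205040001) ∷ 5 ↦ (embed 1 706050403020100 706050403020100) ∷ 6 ↦ (embed 1 705060403010200 705060403010200) ∷ 7 ↦ (split 3 (5 ↦ (embed 0 706050403020100 706050403020100) ∷ 6 ↦ (embed 0 705060403010200 705060403010200) ∷ 7 ↦ (split 3 (5 ↦ (gap₁ 2 51 5405025305) ∷ 6 ↦ (gap₁ 2 51 5405530205) ∷ [])) ∷ [])) ∷ [])) ∷
  (6 , 20401050104000300020001 , split 2 (3 ↦ (embed 6 706050403020100 706050403020100) ∷ 5 ↦ (split 4 (3 ↦ (split 3 (5 ↦ component ∷ 6 ↦ (embed 4 706050403020100 706050403020100) ∷ [])) ∷ 5 ↦ (gap₁ 0 0 60600050503) ∷ 6 ↦ (embed 3 706050403020100 706050403020100) ∷ [])) ∷ 6 ↦ (embed 0 706050403020100 706050403020100) ∷ [])) ∷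
  []

tree8 : Tree
tree8 = split 0 (1 ↦ split 0 (2 ↦ split 0 (3 ↦ (split 1 (2 ↦ (embed 8 706050403020100 706050403020100) ∷ 3 ↦ (embed 8 706050402030100 706050402030100) ∷ 4 ↦ (split 1 (2 ↦ (embed 9 706050403020100 706050403020100) ∷ 3 ↦ (embed 9 706050402030100 706050402030100) ∷ 5 ↦ (split 2 (3 ↦ (split 2 (4 ↦ (embed 7 706050403020100 706050403020100) ∷ 5 ↦ (embed 7 706040503020100 706040503020100) ∷ 6 ↦ (embed 6 706050403020100 706050403020100) ∷ [])) ∷ 4 ↦ (embed 0 706050403020100 706050403020100) ∷ 5 ↦ (embed 0 706040503020100 706040503020100) ∷ 6 ↦ (split 2 (3 ↦ (embed 6 706050403020100 706050403020100) ∷ 4 ↦ (embed 1 706050403020100 706050403020100) ∷ 5 ↦ (embed 1 706040503020100 706040503020100) ∷ 7 ↦ (gap₁ 2 51 20203) ∷ [])) ∷ [])) ∷ [])) ∷ [])) ∷ []) ∷ []) ∷ [])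

lemmas10 : List (ℕ × ℕ × Tree)
lemmas10 =
  (6 , 20401030102000300020001 , split 3 (4 ↦ (split 4 (5 ↦ (gap₁ 0 0 305050606) ∷ [])) ∷ 5 ↦ (split 4 (5 ↦ (split 4 (6 ↦ (gap₁ 4 0 353550303) ∷ [])) ∷ 6 ↦ (split 4 (5 ↦ (gap₁ 4 0 353550303) ∷ 7 ↦ (gap₁ 0 0 205060707) ∷ [])) ∷ [])) ∷ [])) ∷
  (8 , 3050304020501040102000300020001 , split 4 (5 ↦ (gap₂ 8 0 (0 ∷ 51 ∷ 100 ∷ 251 ∷ 51520002 ∷ 100015200 ∷ [])) ∷ 6 ↦ (gap₁ 2 0 206545301) ∷ [])) ∷
  (10 , 506040703060304020501040102000300020001 , split 5 (7 ↦ (gap₁ 4 0 25151540202) ∷ 8 ↦ (gap₁ 4 0 20052540103) ∷ [])) ∷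
  (9 , 40703060304020501040102000300020001 , split 5 (6 ↦ (embed 0 9080706050403020100 9080706050403020100) ∷ 7 ↦ (embed 0 9080607050304020001 9080607050304020001) ∷ 8 ↦ (split 5 (6 ↦ (gap₁ 4 0 20052540103) ∷ 7 ↦ (gap₁ 4 0 25200540301) ∷ 9 ↦ (gap₁ 3 51 40303025151) ∷ [])) ∷ [])) ∷
  (8 , 3060304020501040102000300020001 , split 4 (5 ↦ (gap₁ 2 0 602540153) ∷ 6 ↦ (split 6 (5 ↦ (gap₁ 1 0 53005252030202) ∷ 7 ↦ (gap₂ 3 0 (0 ∷ 0 ∷ 5101 ∷ 20007 ∷ 525700 ∷ 0 ∷ 5101005202 ∷ [])) ∷ [])) ∷ 7 ↦ (embed 0 9080706050403020100 9080706050403020100) ∷ [])) ∷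
  (7 , 304020501040102000300020001 , split 3 (5 ↦ (embed 3 9080706050403020100 9080706050403020100) ∷ 6 ↦ (embed 0 9080706050403020100 9080706050403020100) ∷ [])) ∷
  (10 , 408040503070306020501040102000300020001 , split 5 (6 ↦ (gap₁ 4 0 20052535104) ∷ 7 ↦ (gap₁ 4 0 20052535104) ∷ 8 ↦ (split 8 (6 ↦ (gap₁ 1 0 530000525202020204) ∷ 7 ↦ (gap₁ 1 0 530000525202020204) ∷ 9 ↦ (gap₁ 3 51 30000010103515103) ∷ [])) ∷ 9 ↦ (gap₁ 3 51 30304515102) ∷ [])) ∷
  (13 , 708050905060408040603070306020501040102000300020001 , split 7 (9 ↦ (gap₂ 2 51 (0 ∷ 51 ∷ 5651 ∷ 70713 ∷ 2535351 ∷ 5102535351 ∷ 10103020204 ∷ 10100040405 ∷ [])) ∷ [])) ∷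
  (12 , 50905060408040603070306020501040102000300020001 , split 7 (8 ↦ (embed 0 9080706050403020100 9080706050403020100) ∷ 9 ↦ (embed 0 8090706040503010200 8090706040503010200) ∷ [])) ∷
  (10 , 408040603070306020501040102000300020001 , split 6 (5 ↦ (split 5 (7 ↦ (gap₁ 2 0 520002510001) ∷ 8 ↦ (gap₁ 2 0 520200510100) ∷ 9 ↦ (embed 0 9080706050403020100 9080706050403020100) ∷ [])) ∷ 7 ↦ (gap₁ 4 0 2000053005203) ∷ 8 ↦ (gap₁ 4 0 2005300000352) ∷ 9 ↦ (gap₁ 1 52 2000303040505) ∷ [])) ∷
  (9 , 40603070306020501040102000300020001 , split 4 (5 ↦ (gap₁ 4 0 252515304) ∷ 7 ↦ (gap₁ 2 0 5202005101) ∷ 8 ↦ (embed 0 9080706050403020100 9080706050403020100) ∷ [])) ∷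
  (8 , 3070306020501040102000300020001 , split 4 (5 ↦ (split 4 (6 ↦ (gap₁ 4 0 252515304) ∷ 7 ↦ (gap₁ 4 0 252515304) ∷ 8 ↦ (embed 4 9080706050403020100 9080706050403020100) ∷ [])) ∷ 6 ↦ (embed 0 9080706050403020100 9080706050403020100) ∷ 7 ↦ (embed 0 9080607050403020100 9080607050403020100) ∷ 8 ↦ (split 4 (5 ↦ (embed 4 9080706050403020100 9080706050403020100) ∷ 6 ↦ (embed 1 9080706050403020100 9080706050403020100) ∷ 7 ↦ (embed 1 9080607050403020100 9080607050403020100) ∷ 9 ↦ (gap₁ 4 1 5454550202) ∷ [])) ∷ [])) ∷
  (5 , 1040102000300020001 , split 2 (3 ↦ (embed 11 9080706050403010200 9080706050403010200) ∷ 4 ↦ (embed 11 9080706050304000201 9080706050304010002) ∷ 5 ↦ (split 3 (4 ↦ (embed 6 9080706050403020100 9080706050403020100) ∷ 5 ↦ (embed 6 9080706040503010200 9080706040503010200) ∷ 6 ↦ (split 3 (4 ↦ (embed 7 9080706050403020100 9080706050403020100) ∷ 5 ↦ (embed 7 9080706040503010200 9080706040503010200) ∷ 7 ↦ (embed 0 9080706050403020100 9080706050403020100) ∷ [])) ∷ [])) ∷ [])) ∷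
  (4 , 102000300020001 , split 1 (3 ↦ (split 2 (3 ↦ component ∷ 4 ↦ (embed 12 9080706050403020100 9080706050403020100) ∷ [])) ∷ 4 ↦ (embed 0 9080706050403020100 9080706050403020100) ∷ [])) ∷
  (7 , 204020301050104000300020001 , split 3 (4 ↦ (gap₁ 0 0 506060305) ∷ 5 ↦ (embed 12 9080706050401030200 9080706050402010300) ∷ 6 ↦ (embed 9 9080705060401030200 9080705060402010300) ∷ [])) ∷
  (7 , 206020301050104000300020001 , split 3 (4 ↦ (embed 10 9080705060401020300 9080705060401020300) ∷ 5 ↦ (embed 10 9080704060501020300 9080705040601020300) ∷ 6 ↦ (split 6 (4 ↦ (gap₁ 4 0 3000053535305) ∷ 5 ↦ (gap₁ 4 0 3000053535305) ∷ 7 ↦ (gap₁ 0 0 5000007070206) ∷ [])) ∷ 7 ↦ (embed 3 9080504070601030200 9080504070602010300) ∷ [])) ∷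
  (9 , 30603040205020401050104000300020001 , split 5 (6 ↦ (gap₁ 2 0 35153010151) ∷ 7 ↦ (split 6 (7 ↦ (split 6 (8 ↦ (gap₁ 0 0 1050806080808) ∷ [])) ∷ 8 ↦ (split 6 (7 ↦ (gap₁ 0 0 1050806080808) ∷ 9 ↦ (gap₁ 3 51 3030001010100) ∷ [])) ∷ [])) ∷ [])) ∷
  (10 , 507040603060205020401050104000300020001 , split 3 (7 ↦ (gap₁ 5 0 20251535303) ∷ 8 ↦ (gap₁ 5 0 40452555505) ∷ [])) ∷
  (12 , 60805070406030903080205020401050104000300020001 , split 6 (7 ↦ (gap₁ 4 53 4080511010152) ∷ 9 ↦ (gap₂ 3 0 (0 ∷ 52 ∷ 2 ∷ 15100 ∷ 520200 ∷ 0 ∷ 510100 ∷ [])) ∷ [])) ∷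
  (11 , 5070406030903080205020401050104000300020001 , split 6 (7 ↦ (split 6 (8 ↦ (gap₁ 4 53 4080511010152) ∷ 9 ↦ (gap₁ 4 53 4080511010152) ∷ [])) ∷ 8 ↦ (embed 0 9080706050403020100 9080706050403020100) ∷ 9 ↦ (embed 0 8090706050403020100 8090706050403020100) ∷ [])) ∷
  (8 , 4060205020401050104000300020001 , split 5 (3 ↦ (embed 3 9080706030204050001 9080706020305040001) ∷ 6 ↦ (embed 3 9080703060200050401 9080705020106040003) ∷ 7 ↦ (split 3 (6 ↦ (embed 2 9080706050403020100 9080706050403020100) ∷ 7 ↦ (embed 2 9080607040503020100 9080607040503020100) ∷ 8 ↦ (split 3 (6 ↦ (gap₁ 5 0 40452555505) ∷ 7 ↦ (gap₁ 5 0 40452555505) ∷ 9 ↦ (embed 0 9080706050403020100 9080706050403020100) ∷ [])) ∷ [])) ∷ [])) ∷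
  (8 , 4050206020401050104000300020001 , split 5 (3 ↦ (gap₁ 2 0 545300020106) ∷ 6 ↦ (gap₁ 2 0 45100560352) ∷ 7 ↦ (embed 17 9080603070200050401 9080507020106040003) ∷ [])) ∷
  (11 , 5080407030603050206020401050104000300020001 , split 6 (7 ↦ (gap₂ 2 0 (0 ∷ 60 ∷ 5700 ∷ 70010 ∷ 51605758 ∷ 5200000000 ∷ 20007100108 ∷ [])) ∷ 8 ↦ (gap₂ 7 0 (0 ∷ 4 ∷ 355 ∷ 65901 ∷ 1515101 ∷ 5205010559 ∷ 154545208 ∷ [])) ∷ 9 ↦ (gap₁ 3 51 3030301010153) ∷ [])) ∷
  (10 , 407030803050206020401050104000300020001 , split 5 (6 ↦ (gap₁ 2 0 30000530252) ∷ 7 ↦ (embed 0 9080607030205040001 9080607030205040001) ∷ 8 ↦ (gap₁ 2 0 30253520454) ∷ 9 ↦ (gap₁ 3 51 30303035252) ∷ [])) ∷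
  (9 , 40703050206020401050104000300020001 , split 3 (6 ↦ (split 5 (6 ↦ (gap₁ 2 0 51010000520200) ∷ 7 ↦ (gap₂ 7 0 (0 ∷ 0 ∷ 5704 ∷ 754 ∷ 30457 ∷ 53005407 ∷ [])) ∷ 8 ↦ (embed 1 9080706050403020100 9080706050403020100) ∷ [])) ∷ 7 ↦ (gap₁ 2 0 5202005102) ∷ 8 ↦ (embed 0 9080706050403020100 9080706050403020100) ∷ [])) ∷
  (10 , 407030803070206020401050104000300020001 , split 7 (5 ↦ (gap₁ 2 0 5300005200000203) ∷ 6 ↦ (gap₁ 2 0 300000200520053) ∷ 8 ↦ (gap₁ 2 0 5100005201000002) ∷ 9 ↦ (gap₁ 1 52 300000403030304) ∷ [])) ∷
  (7 , 206020401050104000300020001 , split 4 (3 ↦ (embed 5 9080706030205040001 9080706030205040001) ∷ 5 ↦ (embed 4 9080706050403020100 9080706050403020100) ∷ 6 ↦ (embed 4 9080705060403010200 9080705060403010200) ∷ 7 ↦ (split 3 (5 ↦ (embed 1 9080706050403020100 9080706050403020100) ∷ 6 ↦ (embed 1 9080705060403010200 9080705060403010200) ∷ 7 ↦ (split 3 (5 ↦ (gap₁ 2 0 5202005102) ∷ 6 ↦ (gap₁ 2 0 5202510002) ∷ 8 ↦ (embed 0 9080706050403020100 9080706050403020100) ∷ [])) ∷ 8 ↦ (split 3 (5 ↦ (embed 2 9080706050403020100 9080706050403020100) ∷ 6 ↦ (embed 2 9080705060403010200 9080705060403010200) ∷ 7 ↦ (embed 0 9080706050403020100 9080706050403020100)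 ∷ 9 ↦ (gap₁ 1 52 303040406) ∷ [])) ∷ [])) ∷ [])) ∷
  (6 , 20401050104000300020001 , split 2 (3 ↦ (embed 12 9080706050403020100 9080706050403020100) ∷ 5 ↦ (split 4 (3 ↦ (split 3 (5 ↦ component ∷ 6 ↦ (embed 10 9080706050403020100 9080706050403020100) ∷ [])) ∷ 5 ↦ (gap₁ 0 0 60600050503) ∷ 6 ↦ (embed 6 9080706050403020100 9080706050403020100) ∷ [])) ∷ 6 ↦ (embed 0 9080706050403020100 9080706050403020100) ∷ [])) ∷
  (9 , 30603040207020601050104000300020001 , split 4 (5 ↦ (split 5 (6 ↦ (gap₁ 2 0 52510000000102) ∷ 7 ↦ (gap₁ 4 0 65603535203) ∷ 8 ↦ (split 6 (7 ↦ (gap₁ 2 0 52005253020203) ∷ 8 ↦ (gap₁ 2 0 51015253020202) ∷ 9 ↦ (gap₁ 3 51 3030151030151) ∷ [])) ∷ [])) ∷ 6 ↦ (gap₁ 2 0 52005200010103) ∷ 7 ↦ (gap₁ 2 0 5251020002) ∷ 8 ↦ (embed 4 9070805060402010300 9070805060401030200) ∷ [])) ∷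
  (9 , 30803040207020601050104000300020001 , split 4 (5 ↦ (gap₁ 5 52 6318132069) ∷ 6 ↦ (embed 3 9070608050402030100 9060807050402030100) ∷ 7 ↦ (embed 3 9060708050402030100 9060708050402030100) ∷ 8 ↦ (gap₁ 5 2 1370636819) ∷ 9 ↦ (gap₁ 1 52 304030406) ∷ [])) ∷
  (8 , 3040207020601050104000300020001 , split 3 (5 ↦ (split 4 (5 ↦ (gap₁ 5 0 20253515303) ∷ 6 ↦ (gap₂ 3 0 (0 ∷ 3 ∷ 100 ∷ 510053 ∷ 1005100 ∷ [])) ∷ 7 ↦ (gap₂ 3 0 (0 ∷ 3 ∷ 100 ∷ 510053 ∷ 1005100 ∷ [])) ∷ 8 ↦ (split 5 (6 ↦ (gap₁ 5 0 40455525505) ∷ 7 ↦ (gap₁ 5 0 40455525505) ∷ 8 ↦ (gap₂ 3 0 (0 ∷ 0 ∷ 0 ∷ 0 ∷ 54515453 ∷ 4010403 ∷ [])) ∷ 9 ↦ (embed 10 7060908050402030100 7060908050402030100) ∷ [])) ∷ [])) ∷ 6 ↦ (embed 1 9080706050403020100 9080706050403020100) ∷ 7 ↦ (embed 1 9080607050403020100 9080607050403020100) ∷ 8 ↦ (embed 0 9080706050403020100 9080706050403020100) ∷ [])) ∷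
  (13 , 608050704060405030903080207020601050104000300020001 , split 7 (8 ↦ (gap₁ 2 0 5202510100000000) ∷ 9 ↦ (gap₂ 2 51 (0 ∷ 13 ∷ 403 ∷ 500 ∷ 4025107 ∷ 5604025107 ∷ 535301015102 ∷ 51535301015102 ∷ [])) ∷ [])) ∷
  (12 , 50804060405030903080207020601050104000300020001 , split 6 (7 ↦ (gap₁ 4 0 3005300520200) ∷ 8 ↦ (gap₁ 5 0 530003035301510000) ∷ 9 ↦ (gap₁ 1 51 3040552010351) ∷ [])) ∷
  (11 , 4060405030903080207020601050104000300020001 , split 5 (6 ↦ (gap₁ 0 0 4050500020402) ∷ 7 ↦ (split 6 (7 ↦ (gap₁ 1 0 5252020200530300) ∷ 8 ↦ (embed 1 9080706050403020100 9080706050403020100) ∷ 9 ↦ (embed 1 8090706050403020100 8090706050403020100) ∷ [])) ∷ 8 ↦ (embed 0 9080706050403020100 9080706050403020100) ∷ 9 ↦ (embed 0 8090706050403020100 8090706050403020100) ∷ [])) ∷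
  (12 , 60804070406030903080207020601050104000300020001 , split 7 (5 ↦ (gap₁ 2 0 5100000200520200) ∷ 8 ↦ (gap₁ 2 51 40000000403550351) ∷ 9 ↦ (gap₁ 1 51 303000452020151) ∷ [])) ∷
  (11 , 4080406030903080207020601050104000300020001 , split 6 (5 ↦ (embed 0 9080504070603010200 9080504070603010200) ∷ 7 ↦ (split 7 (5 ↦ (embed 3 9080504070603010200 9080504070603010200) ∷ 8 ↦ (gap₁ 5 0 530353000301005100) ∷ 9 ↦ (gap₁ 1 51 405000352030151) ∷ [])) ∷ 8 ↦ (embed 26 9070500030201080604 9020801070005040306) ∷ 9 ↦ (split 8 (5 ↦ (gap₂ 3 0 (0 ∷ 54 ∷ 5151 ∷ 5201 ∷ 52000601 ∷ 0 ∷ 151510200 ∷ 0 ∷ 52005603000002 ∷ [])) ∷ 7 ↦ (split 7 (5 ↦ (gap₂ 9 0 (0 ∷ 2 ∷ 5300 ∷ 30052 ∷ 3070257 ∷ 0 ∷ 5253520003 ∷ 5300020353 ∷ 203000052575307 ∷ [])) ∷ 9 ↦ (gap₁ 3 51 3000300000100000301) ∷ [])) ∷ 9 ↦ (gap₁ 5 0 53030003005300510100) ∷ [])) ∷ [])) ∷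
  (10 , 406030903080207020601050104000300020001 , split 4 (5 ↦ (embed 2 9080706050403020100 9080706050403020100) ∷ 7 ↦ (split 6 (5 ↦ (gap₁ 2 0 52000200530300) ∷ 7 ↦ (gap₁ 0 0 505000400040202) ∷ 8 ↦ (embed 1 9080706050403020100 9080706050403020100) ∷ 9 ↦ (embed 1 8090706050403020100 8090706050403020100) ∷ [])) ∷ 8 ↦ (embed 0 9080706050403020100 9080706050403020100) ∷ 9 ↦ (embed 0 8090706050403020100 8090706050403020100) ∷ [])) ∷
  []

tree10 : Tree
tree10 = split 0 (1 ↦ split 0 (2 ↦ split 0 (3 ↦ (split 1 (2 ↦ (embed 23 9080706050403020100 9080706050403020100) ∷ 3 ↦ (embed 23 9080706050402030100 9080706050402030100) ∷ 4 ↦ (split 1 (2 ↦ (embed 24 9080706050403020100 9080706050403020100) ∷ 3 ↦ (embed 24 9080706050402030100 9080706050402030100) ∷ 5 ↦ (split 2 (3 ↦ (split 2 (4 ↦ (embed 22 9080706050403020100 9080706050403020100) ∷ 5 ↦ (embed 22 9080706040503020100 9080706040503020100) ∷ 6 ↦ (embed 21 9080706050403020100 9080706050403020100) ∷ [])) ∷ 4 ↦ (embed 9 9080706050403020100 9080706050403020100) ∷ 5 ↦ (embed 9 9080706040503020100 9080706040503020100) ∷ 6 ↦ (split 2 (3 ↦ (embed 21 9080706050403020100 9080706050403020100) ∷ 4 ↦ (embed 10 9080706050403020100 9080706050403020100) ∷ 5 ↦ (embed 10 9080706040503020100 9080706040503020100) ∷ 7 ↦ (split 3 (4 ↦ (embed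 6 9080706050403020100 9080706050403020100) ∷ 5 ↦ (embed 6 9080706040503020100 9080706040503020100) ∷ 6 ↦ (embed 6 9080504070603010200 9080504070603010200) ∷ 7 ↦ (embed 6 9080504060703010200 9080405070603010200) ∷ 8 ↦ (split 3 (4 ↦ (embed 7 9080706050403020100 9080706050403020100) ∷ 5 ↦ (embed 7 9080706040503020100 9080706040503020100) ∷ 6 ↦ (embed 7 9080504070603010200 9080504070603010200) ∷ 7 ↦ (embed 7 9080504060703010200 9080405070603010200) ∷ 9 ↦ (split 4 (5 ↦ (split 4 (6 ↦ (embed 3 9080706050403020100 9080706050403020100) ∷ 7 ↦ (embed 3 9080607050403020100 9080607050403020100) ∷ 8 ↦ (embed 3 7060908050402030100 7060908050402030100) ∷ 9 ↦ (embed 3 7060809050402030100 6070908050402030100) ∷ [])) ∷ 6 ↦ (embed 0 9080706050403020100 9080706050403020100) ∷ 7 ↦ (embed 0 9080607050403020100 9080607050403020100) ∷ 8 ↦ (embed 0 7060908050402030100 7060908050402030100) ∷ 9 ↦ (embed 0 7060809050402030100 6070908050402030100) ∷ [])) ∷ [])) ∷ [])) ∷ [])) ∷ [])) ∷ [])) ∷ [])) ∷ []) ∷ []) ∷ [])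

lemmas12 : List (ℕ × ℕ × Tree)
lemmas12 =
  (6 , 20401030102000300020001 , split 3 (4 ↦ (split 4 (5 ↦ (gap₁ 0 0 305050606) ∷ [])) ∷ 5 ↦ (split 4 (5 ↦ (split 4 (6 ↦ (gap₁ 4 0 353550303) ∷ [])) ∷ 6 ↦ (split 4 (5 ↦ (gap₁ 4 0 353550303) ∷ 7 ↦ (gap₁ 0 0 205060707) ∷ [])) ∷ [])) ∷ [])) ∷
  (8 , 3050304020501040102000300020001 , split 4 (5 ↦ (gap₂ 8 0 (0 ∷ 51 ∷ 100 ∷ 251 ∷ 51520002 ∷ 100015200 ∷ [])) ∷ 6 ↦ (gap₁ 2 0 104535201) ∷ [])) ∷
  (10 , 506040703060304020501040102000300020001 , split 5 (7 ↦ (gap₁ 4 0 25151540202) ∷ 8 ↦ (gap₁ 4 0 20052540103) ∷ [])) ∷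
  (9 , 40703060304020501040102000300020001 , split 5 (6 ↦ (embed 0 111009080706050403020100 111009080706050403020100) ∷ 7 ↦ (embed 0 111009080607050304020001 111009080607050304020001) ∷ 8 ↦ (split 5 (6 ↦ (gap₁ 4 0 20052540103) ∷ 7 ↦ (gap₁ 4 0 25200540301) ∷ 9 ↦ (gap₁ 0 0 30606101111) ∷ [])) ∷ [])) ∷
  (8 , 3060304020501040102000300020001 , split 4 (5 ↦ (gap₁ 2 0 401530152) ∷ 6 ↦ (split 6 (5 ↦ (gap₁ 1 0 53005252030202) ∷ 7 ↦ (gap₂ 3 0 (0 ∷ 0 ∷ 5101 ∷ 20007 ∷ 525700 ∷ 0 ∷ 5101005202 ∷ [])) ∷ [])) ∷ 7 ↦ (embed 0 111009080706050403020100 111009080706050403020100) ∷ [])) ∷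
  (7 , 304020501040102000300020001 , split 3 (5 ↦ (embed 3 111009080706050403020100 111009080706050403020100) ∷ 6 ↦ (embed 0 111009080706050403020100 111009080706050403020100) ∷ [])) ∷
  (10 , 408040503070306020501040102000300020001 , split 5 (6 ↦ (gap₁ 4 0 20052535104) ∷ 7 ↦ (gap₁ 4 0 20052535104) ∷ 8 ↦ (split 8 (6 ↦ (gap₁ 1 0 530000525202020204) ∷ 7 ↦ (gap₁ 1 0 530000525202020204) ∷ 9 ↦ (gap₁ 0 0 20000030301040403) ∷ [])) ∷ 9 ↦ (gap₁ 0 0 60603111110) ∷ [])) ∷
  (13 , 708050905060408040603070306020501040102000300020001 , split 7 (9 ↦ (gap₂ 2 0 (0 ∷ 52 ∷ 352 ∷ 575762 ∷ 40603 ∷ 200060403 ∷ 10103020201 ∷ 1515151555556 ∷ [])) ∷ 10 ↦ (gap₁ 1 51 308030106545552) ∷ [])) ∷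
  (12 , 50905060408040603070306020501040102000300020001 , split 7 (8 ↦ (embed 0 111009080706050403020100 111009080706050403020100) ∷ 9 ↦ (embed 0 111008090706040503010200 111008090706040503010200) ∷ 10 ↦ (split 7 (8 ↦ (gap₁ 1 51 308030106545552) ∷ 9 ↦ (gap₁ 1 51 308010306555452) ∷ 11 ↦ (gap₁ 1 51 205020204525251) ∷ [])) ∷ [])) ∷
  (12 , 60905070408040603070306020501040102000300020001 , split 5 (8 ↦ (gap₁ 4 0 2045353570404) ∷ 9 ↦ (gap₁ 4 0 51020252535205) ∷ 10 ↦ (gap₁ 4 51 2060557575614) ∷ [])) ∷
  (10 , 408040603070306020501040102000300020001 , split 6 (5 ↦ (split 5 (7 ↦ (gap₁ 2 0 520002510001) ∷ 8 ↦ (gap₁ 2 0 520200510100) ∷ 9 ↦ (embed 1 111009080706050403020100 111009080706050403020100) ∷ [])) ∷ 7 ↦ (gap₁ 4 0 2000053005203) ∷ 8 ↦ (gap₁ 4 0 2005300000352) ∷ 9 ↦ (split 5 (7 ↦ (embed 0 111009080706050403020100 111009080706050403020100) ∷ 8 ↦ (embed 0 111009070806050304020001 111009070806050304020001) ∷ 9 ↦ (split 5 (7 ↦ (gap₁ 4 0 51020252535205) ∷ 8 ↦ (gap₁ 4 0 51025202530552) ∷ 10 ↦ (gap₁ 4 51 55090505590404) ∷ [])) ∷ 10 ↦ (split 5 (7 ↦ (gap₁ 4 51 2060557575614) ∷ 8 ↦ (gap₁ 4 51 2065705571456) ∷ 9 ↦ (gap₁ 4 51 55090505590404) ∷ 11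 ↦ (gap₁ 0 0 2020303070707) ∷ [])) ∷ [])) ∷ [])) ∷
  (9 , 40603070306020501040102000300020001 , split 4 (5 ↦ (gap₁ 4 0 252515304) ∷ 7 ↦ (gap₁ 2 0 5202005101) ∷ 8 ↦ (embed 0 111009080706050403020100 111009080706050403020100) ∷ [])) ∷
  (12 , 51005060409040803070306020501040102000300020001 , split 6 (7 ↦ (gap₁ 4 0 2005153520003) ∷ 8 ↦ (gap₁ 4 1 5555955540953) ∷ 9 ↦ (gap₁ 4 1 5555955540953) ∷ 10 ↦ (gap₁ 4 0 52030100530002) ∷ 11 ↦ (gap₁ 0 0 2030203070707) ∷ [])) ∷
  (11 , 5060409040803070306020501040102000300020001 , split 5 (7 ↦ (gap₁ 2 0 520002510001) ∷ 8 ↦ (gap₁ 4 0 25252550303) ∷ 9 ↦ (gap₁ 4 0 25252550303) ∷ 10 ↦ (embed 0 111009080706050403020100 111009080706050403020100) ∷ [])) ∷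
  (8 , 3070306020501040102000300020001 , split 4 (5 ↦ (split 4 (6 ↦ (gap₁ 4 0 252515304) ∷ 7 ↦ (gap₁ 4 0 252515304) ∷ 8 ↦ (embed 7 111009080706050403020100 111009080706050403020100) ∷ [])) ∷ 6 ↦ (embed 2 111009080706050403020100 111009080706050403020100) ∷ 7 ↦ (embed 2 111009080607050403020100 111009080607050403020100) ∷ 8 ↦ (split 4 (5 ↦ (embed 7 111009080706050403020100 111009080706050403020100) ∷ 6 ↦ (embed 3 111009080706050403020100 111009080706050403020100) ∷ 7 ↦ (embed 3 111009080607050403020100 111009080607050403020100) ∷ 9 ↦ (split 5 (6 ↦ (embed 0 111009080706050403020100 111009080706050403020100) ∷ 7 ↦ (embed 0 111009080607050403020100 111009080607050403020100) ∷ 8 ↦ (embed 0 111007060908050304020001 111007060908050304020001) ∷ 9 ↦ (embed 0 111007060809050304020001 111006070908050304020001) ∷ 10 ↦ (split 5 (6 ↦ (embed 1 111009080706050403020100 111009080706050403020100) ∷ 7 ↦ (embed 1 111009080607050403020100 111009080607050403020100) ∷ 8 ↦ (embed 1 111007060908050304020001 111007060908050304020001) ∷ 9 ↦ (embed 1 111007060809050304020001 111006070908050304020001) ∷ 11 ↦ (gap₂ 1 53 (0 ∷ 34 ∷ 3434 ∷ 101005 ∷ 3100510 ∷ 303051010 ∷ [])) ∷ [])) ∷ [])) ∷ [])) ∷ [])) ∷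
  (5 , 1040102000300020001 , split 2 (3 ↦ (embed 14 111009080706050403010200 111009080706050403010200) ∷ 4 ↦ (embed 14 111009080706050304000201 111009080706050304010002) ∷ 5 ↦ (split 3 (4 ↦ (embed 9 111009080706050403020100 111009080706050403020100) ∷ 5 ↦ (embed 9 111009080706040503010200 111009080706040503010200) ∷ 6 ↦ (split 3 (4 ↦ (embed 10 111009080706050403020100 111009080706050403020100) ∷ 5 ↦ (embed 10 111009080706040503010200 111009080706040503010200) ∷ 7 ↦ (embed 0 111009080706050403020100 111009080706050403020100) ∷ [])) ∷ [])) ∷ [])) ∷
  (4 , 102000300020001 , split 1 (3 ↦ (split 2 (3 ↦ component ∷ 4 ↦ (embed 15 111009080706050403020100 111009080706050403020100) ∷ [])) ∷ 4 ↦ (embed 0 111009080706050403020100 111009080706050403020100) ∷ [])) ∷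
  (7 , 204020301050104000300020001 , split 3 (4 ↦ (gap₁ 0 0 506060305) ∷ 5 ↦ (embed 15 111009080706050401030200 111009080706050402010300) ∷ 6 ↦ (embed 12 111009080705060401030200 111009080705060402010300) ∷ [])) ∷
  (7 , 206020301050104000300020001 , split 3 (4 ↦ (embed 13 111009080705060401020300 111009080705060401020300) ∷ 5 ↦ (embed 13 111009080704060501020300 111009080705040601020300) ∷ 6 ↦ (split 6 (4 ↦ (gap₁ 4 0 3000053535305) ∷ 5 ↦ (gap₁ 4 0 3000053535305) ∷ 7 ↦ (gap₁ 0 0 5000007070206) ∷ [])) ∷ 7 ↦ (embed 3 111009080504070601030200 111009080504070602010300) ∷ [])) ∷
  (9 , 30603040205020401050104000300020001 , split 5 (6 ↦ (gap₁ 2 0 35153010151) ∷ 7 ↦ (split 6 (7 ↦ (split 6 (8 ↦ (gap₁ 0 0 1050806080808) ∷ [])) ∷ 8 ↦ (split 6 (7 ↦ (gap₁ 0 0 1050806080808) ∷ 9 ↦ (gap₁ 0 0 1030504050505) ∷ [])) ∷ [])) ∷ [])) ∷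
  (10 , 507040603060205020401050104000300020001 , split 3 (7 ↦ (gap₁ 5 0 20251535303) ∷ 8 ↦ (gap₁ 5 0 40452555505) ∷ [])) ∷
  (12 , 60805070406030903080205020401050104000300020001 , split 6 (7 ↦ (gap₁ 5 0 52030451545403) ∷ 9 ↦ (gap₂ 3 0 (0 ∷ 52 ∷ 2 ∷ 15100 ∷ 520200 ∷ 0 ∷ 510100 ∷ [])) ∷ 10 ↦ (gap₂ 3 0 (0 ∷ 53 ∷ 3 ∷ 15100 ∷ 530300 ∷ 0 ∷ 510100 ∷ [])) ∷ [])) ∷
  (11 , 5070406030903080205020401050104000300020001 , split 6 (7 ↦ (split 6 (8 ↦ (gap₁ 5 0 52030451545403) ∷ 9 ↦ (gap₁ 5 0 52030451545403) ∷ 10 ↦ (gap₁ 5 0 52030451545403) ∷ [])) ∷ 8 ↦ (embed 0 111009080706050403020100 111009080706050403020100) ∷ 9 ↦ (embed 0 111008090706050403020100 111008090706050403020100) ∷ 10 ↦ (split 6 (7 ↦ (gap₁ 5 0 52030451545403) ∷ 8 ↦ (gap₂ 3 0 (0 ∷ 53 ∷ 3 ∷ 15100 ∷ 530300 ∷ 0 ∷ 510100 ∷ [])) ∷ 9 ↦ (gap₂ 3 0 (0 ∷ 53 ∷ 3 ∷ 15100 ∷ 530300 ∷ 0 ∷ 510100 ∷ [])) ∷ 11 ↦ (gap₁ 0 0 2050602070706) ∷ [])) ∷ [])) ∷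
  (8 , 4060205020401050104000300020001 , split 5 (3 ↦ (embed 3 111009080706030204050001 111009080706020305040001) ∷ 6 ↦ (embed 3 111009080703060200050401 111009080705020106040003) ∷ 7 ↦ (split 3 (6 ↦ (embed 2 111009080706050403020100 111009080706050403020100) ∷ 7 ↦ (embed 2 111009080607040503020100 111009080607040503020100) ∷ 8 ↦ (split 3 (6 ↦ (gap₁ 5 0 40452555505) ∷ 7 ↦ (gap₁ 5 0 40452555505) ∷ 9 ↦ (embed 0 111009080706050403020100 111009080706050403020100) ∷ [])) ∷ [])) ∷ [])) ∷
  (8 , 4050206020401050104000300020001 , split 5 (3 ↦ (gap₁ 2 0 535200010104) ∷ 6 ↦ (gap₁ 2 0 35100540251) ∷ 7 ↦ (embed 20 111009080603070200050401 111009080507020106040003) ∷ [])) ∷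
  (11 , 5080407030603050206020401050104000300020001 , split 6 (7 ↦ (gap₂ 2 0 (0 ∷ 60 ∷ 5700 ∷ 70010 ∷ 51605758 ∷ 5200000000 ∷ 20007100108 ∷ [])) ∷ 8 ↦ (gap₂ 7 0 (0 ∷ 3 ∷ 354 ∷ 45701 ∷ 1515101 ∷ 5104000457 ∷ 153535206 ∷ [])) ∷ 9 ↦ (gap₁ 5 51 7070757575710) ∷ [])) ∷
  (13 , 610060705090407030803050206020401050104000300020001 , split 7 (8 ↦ (gap₁ 2 0 5101515201025202) ∷ 9 ↦ (gap₁ 3 0 200525100520102) ∷ 10 ↦ (gap₁ 2 0 5101515201025202) ∷ 11 ↦ (split 8 (9 ↦ (split 8 (10 ↦ (gap₂ 3 0 (0 ∷ 23 ∷ 9 ∷ 550370 ∷ 52716651 ∷ 5608000306 ∷ 25204090411 ∷ 51510102535203 ∷ 100515157555362 ∷ [])) ∷ 11 ↦ (gap₁ 2 1 540252040254560555) ∷ [])) ∷ 10 ↦ (split 8 (9 ↦ (gap₂ 3 0 (0 ∷ 23 ∷ 9 ∷ 550370 ∷ 52716651 ∷ 5608000306 ∷ 25204090411 ∷ 51510102535203 ∷ 100515157555362 ∷ [])) ∷ 11 ↦ (gap₁ 1 0 35353025305520103) ∷ [])) ∷ 11 ↦ (split 8 (9 ↦ (gap₁ 2 1 540252040254560555) ∷ 10 ↦ (gap₁ 1 0 35353025305520103) ∷ [])) ∷ [])) ∷ [])) ∷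
  (10 , 407030803050206020401050104000300020001 , split 5 (6 ↦ (gap₁ 2 0 30000530252) ∷ 7 ↦ (embed 1 111009080607030205040001 111009080607030205040001) ∷ 8 ↦ (gap₁ 2 0 30253520454) ∷ 9 ↦ (split 6 (7 ↦ (split 6 (8 ↦ (gap₁ 3 0 2005252510201) ∷ 9 ↦ (gap₁ 2 0 3525302035303) ∷ 10 ↦ (embed 0 111009080706050403020100 111009080706050403020100) ∷ [])) ∷ 8 ↦ (split 6 (7 ↦ (gap₁ 3 0 2005252510201) ∷ 9 ↦ (gap₁ 1 0 53035103530201) ∷ 10 ↦ (gap₁ 5 51 5060754575709) ∷ [])) ∷ 9 ↦ (split 6 (7 ↦ (gap₁ 2 0 3525302035303) ∷ 8 ↦ (gap₁ 1 0 53035103530201) ∷ 10 ↦ (gap₁ 4 51 8550507570400) ∷ [])) ∷ 10 ↦ (split 6 (7 ↦ (embed 0 111009080706050403020100 111009080706050403020100) ∷ 8 ↦ (gap₁ 5 51 5060754575709) ∷ 9 ↦ (gap₁ 4 51 8550507570400) ∷ 11 ↦ (gap₁ 3 51 3040303035253) ∷ [])) ∷ [])) ∷ [])) ∷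
  (9 , 40703050206020401050104000300020001 , split 3 (6 ↦ (split 5 (6 ↦ (gap₁ 2 0 51010000520200) ∷ 7 ↦ (gap₂ 7 0 (0 ∷ 0 ∷ 5704 ∷ 754 ∷ 30457 ∷ 53005407 ∷ [])) ∷ 8 ↦ (embed 2 111009080706050403020100 111009080706050403020100) ∷ [])) ∷ 7 ↦ (gap₁ 2 0 5303005202) ∷ 8 ↦ (embed 0 111009080706050403020100 111009080706050403020100) ∷ [])) ∷
  (12 , 70905080407030803070206020401050104000300020001 , split 5 (6 ↦ (gap₁ 2 0 100010251510152) ∷ 9 ↦ (gap₁ 5 1 5700071757657017) ∷ 10 ↦ (gap₁ 2 0 5100515302005103) ∷ [])) ∷
  (10 , 407030803070206020401050104000300020001 , split 7 (5 ↦ (gap₁ 2 0 5300005200000203) ∷ 6 ↦ (gap₁ 2 0 300000200520053) ∷ 8 ↦ (gap₁ 2 0 5100005201000002) ∷ 9 ↦ (split 5 (6 ↦ (split 5 (8 ↦ (gap₁ 2 0 100010251510152) ∷ 9 ↦ (gap₁ 2 0 5100015201510102) ∷ 10 ↦ (gap₁ 5 0 5200030652555706) ∷ [])) ∷ 8 ↦ (embed 0 111009080706050403020100 111009080706050403020100) ∷ 9 ↦ (embed 0 111008090306050007020104 111008090306050007020104) ∷ 10 ↦ (split 5 (6 ↦ (gap₁ 5 0 5200030652555706) ∷ 8 ↦ (gap₁ 2 0 5100515302005103) ∷ 9 ↦ (gap₁ 2 0 5200015301000103) ∷ 11 ↦ (gap₁ 1 52 200020402030504) ∷ [])) ∷ []))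 ∷ [])) ∷
  (12 , 50805060407030903080206020401050104000300020001 , split 6 (7 ↦ (gap₁ 2 0 3515201035301) ∷ 8 ↦ (gap₁ 2 0 51010000520200) ∷ 9 ↦ (gap₁ 5 51 7071557676720) ∷ 10 ↦ (gap₁ 2 0 51020051530351) ∷ [])) ∷
  (12 , 51005060407030903080206020401050104000300020001 , split 6 (7 ↦ (gap₁ 2 0 5015401035401) ∷ 8 ↦ (gap₁ 2 0 52010001530301) ∷ 9 ↦ (gap₁ 2 0 52010001530301) ∷ 10 ↦ (gap₁ 2 0 51010000520200) ∷ 11 ↦ (gap₁ 1 52 2020302040405) ∷ [])) ∷
  (12 , 50805070407030903080206020401050104000300020001 , split 7 (6 ↦ (gap₁ 1 51 5400530004050207) ∷ 8 ↦ (gap₁ 5 0 200525301020352) ∷ 9 ↦ (gap₁ 1 0 300030253510153) ∷ 10 ↦ (gap₁ 5 51 600545705070957) ∷ [])) ∷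
  (12 , 51005070407030903080206020401050104000300020001 , split 7 (6 ↦ (split 6 (8 ↦ (gap₁ 5 0 5303020451545303) ∷ 9 ↦ (gap₁ 5 0 5303020451545303) ∷ 10 ↦ (gap₂ 2 0 (0 ∷ 51 ∷ 1 ∷ 0 ∷ 116100 ∷ 5951525953 ∷ 901090203 ∷ 11610000085800 ∷ [])) ∷ 11 ↦ (gap₁ 4 51 5304040205020254) ∷ [])) ∷ 8 ↦ (gap₁ 4 1 500575458550007) ∷ 9 ↦ (gap₁ 4 1 500575458550007) ∷ 10 ↦ (gap₁ 5 0 200525301020352) ∷ 11 ↦ (gap₁ 3 51 400035203035303) ∷ [])) ∷
  (13 , 608051005080407030903080206020401050104000300020001 , split 6 (7 ↦ (gap₁ 1 0 540053510351010302) ∷ 9 ↦ (gap₁ 2 1 530057525206540005) ∷ 10 ↦ (gap₂ 3 0 (0 ∷ 5 ∷ 55 ∷ 510100 ∷ 15100 ∷ 51020102 ∷ 1515252 ∷ 0 ∷ 6560000025200 ∷ [])) ∷ 11 ↦ (gap₁ 1 53 40003030404050506) ∷ [])) ∷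
  (12 , 51005080407030903080206020401050104000300020001 , split 8 (6 ↦ (embed 0 111009080706050403020100 111009080706050403020100) ∷ 7 ↦ (embed 0 110910080607030205040001 110910080607030205040001) ∷ 9 ↦ (gap₁ 1 53 10000040603050908) ∷ 10 ↦ (gap₁ 1 53 10000030504060809) ∷ 11 ↦ (gap₁ 1 52 20000030303030505) ∷ [])) ∷
  (11 , 5080407030903080206020401050104000300020001 , split 5 (6 ↦ (embed 5 111009080706050403020100 111009080706050403020100) ∷ 7 ↦ (embed 3 111009080706050403020100 111009080706050403020100) ∷ 9 ↦ (gap₁ 2 0 30153510252) ∷ 10 ↦ (embed 0 111009080706050403020100 111009080706050403020100) ∷ [])) ∷
  (10 , 407030903080206020401050104000300020001 , split 5 (6 ↦ (split 5 (7 ↦ (gap₁ 2 0 25200520201) ∷ 8 ↦ (embed 6 111009080706050403020100 111009080706050403020100) ∷ 9 ↦ (embed 6 111008090706050403020100 111008090706050403020100) ∷ 10 ↦ (embed 5 111009080706050403020100 111009080706050403020100) ∷ [])) ∷ 7 ↦ (split 5 (6 ↦ (gap₁ 2 0 25200520201) ∷ 8 ↦ (embed 4 111009080706050403020100 111009080706050403020100) ∷ 9 ↦ (embed 4 111008090706050403020100 111008090706050403020100) ∷ 10 ↦ (embed 3 111009080706050403020100 111009080706050403020100) ∷ [])) ∷ 8 ↦ (embed 0 111009080706050403020100 111009080706050403020100) ∷ 9 ↦ (embed 0 111008090706050403020100 111008090706050403020100) ∷ 10 ↦ (split 5 (6 ↦ (embed 5 111009080706050403020100 111009080706050403020100) ∷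 7 ↦ (embed 3 111009080706050403020100 111009080706050403020100) ∷ 8 ↦ (embed 1 111009080706050403020100 111009080706050403020100) ∷ 9 ↦ (embed 1 111008090706050403020100 111008090706050403020100) ∷ 11 ↦ (gap₁ 1 51 10201020303) ∷ [])) ∷ [])) ∷
  (7 , 206020401050104000300020001 , split 4 (3 ↦ (embed 15 111009080706030205040001 111009080706030205040001) ∷ 5 ↦ (embed 14 111009080706050403020100 111009080706050403020100) ∷ 6 ↦ (embed 14 111009080705060403010200 111009080705060403010200) ∷ 7 ↦ (split 3 (5 ↦ (embed 10 111009080706050403020100 111009080706050403020100) ∷ 6 ↦ (embed 10 111009080705060403010200 111009080705060403010200) ∷ 7 ↦ (split 3 (5 ↦ (gap₁ 2 0 5303005202) ∷ 6 ↦ (gap₁ 2 0 5303520002) ∷ 8 ↦ (embed 8 111009080706050403020100 111009080706050403020100) ∷ [])) ∷ 8 ↦ (split 3 (5 ↦ (embed 11 111009080706050403020100 111009080706050403020100) ∷ 6 ↦ (embed 11 111009080705060403010200 111009080705060403010200) ∷ 7 ↦ (embed 8 111009080706050403020100 111009080706050403020100) ∷ 9 ↦ (embed 0 111009080706050403020100 111009080706050403020100) ∷ [])) ∷ [])) ∷ [])) ∷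
  (6 , 20401050104000300020001 , split 2 (3 ↦ (embed 22 111009080706050403020100 111009080706050403020100) ∷ 5 ↦ (split 4 (3 ↦ (split 3 (5 ↦ component ∷ 6 ↦ (embed 20 111009080706050403020100 111009080706050403020100) ∷ [])) ∷ 5 ↦ (gap₁ 0 0 60600050503) ∷ 6 ↦ (embed 16 111009080706050403020100 111009080706050403020100) ∷ [])) ∷ 6 ↦ (embed 0 111009080706050403020100 111009080706050403020100) ∷ [])) ∷
  (9 , 30603040207020601050104000300020001 , split 4 (5 ↦ (split 5 (6 ↦ (gap₁ 2 0 52510000000102) ∷ 7 ↦ (gap₁ 4 0 65603545203) ∷ 8 ↦ (split 6 (7 ↦ (gap₁ 2 0 52005253020203) ∷ 8 ↦ (gap₁ 2 0 52015254020303) ∷ 9 ↦ (gap₁ 2 0 52005354020304) ∷ [])) ∷ [])) ∷ 6 ↦ (gap₁ 2 0 52005200010103) ∷ 7 ↦ (gap₁ 2 0 5352030002) ∷ 8 ↦ (embed 13 111009070805060402010300 111009070805060401030200) ∷ [])) ∷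
  (11 , 5060405030803040207020601050104000300020001 , split 6 (7 ↦ (gap₁ 4 0 3530000520200) ∷ 8 ↦ (gap₁ 4 0 52045201005201) ∷ 9 ↦ (gap₁ 4 0 3560200010453) ∷ [])) ∷
  (13 , 609060705090405030803040207020601050104000300020001 , split 7 (8 ↦ (gap₁ 5 0 201000454545506) ∷ 9 ↦ (gap₁ 3 0 2005151005200510002) ∷ 10 ↦ (gap₁ 1 55 909510207150514) ∷ [])) ∷
  (13 , 609060805090405030803040207020601050104000300020001 , split 8 (7 ↦ (gap₁ 2 0 520000005152020102) ∷ 9 ↦ (gap₁ 3 0 52000002510200000152) ∷ 10 ↦ (gap₁ 5 0 10000000353515303) ∷ [])) ∷
  (13 , 610060805090405030803040207020601050104000300020001 , split 8 (7 ↦ (gap₁ 2 0 520000005152020102) ∷ 9 ↦ (gap₁ 3 0 20000525352520402) ∷ 10 ↦ (gap₁ 5 0 520001005304010354) ∷ 11 ↦ (gap₁ 5 0 10000000353515303) ∷ [])) ∷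
  (13 , 610060905090405030803040207020601050104000300020001 , split 9 (7 ↦ (gap₁ 3 0 2000051005200520102) ∷ 8 ↦ (gap₁ 1 0 53000051530003010003) ∷ 10 ↦ (gap₁ 3 0 53000003510400010053) ∷ 11 ↦ (gap₁ 0 0 2000001050503010503) ∷ [])) ∷
  (10 , 405030803040207020601050104000300020001 , split 5 (6 ↦ (embed 4 111009080706050403020100 111009080706050403020100) ∷ 7 ↦ (embed 4 111009080607050403020100 111009080607050403020100) ∷ 8 ↦ (gap₁ 2 0 35154000251) ∷ 9 ↦ (split 6 (7 ↦ (split 6 (8 ↦ (gap₁ 5 0 3000555555607) ∷ 9 ↦ (embed 3 111009080706050403020100 111009080706050403020100) ∷ 10 ↦ (gap₁ 4 52 14146311590106) ∷ [])) ∷ 8 ↦ (split 6 (7 ↦ (gap₁ 5 0 3000555555607) ∷ 9 ↦ (embed 2 111009080706050403020100 111009080706050403020100) ∷ 10 ↦ (embed 1 111009080706050403020100 111009080706050403020100) ∷ [])) ∷ 9 ↦ (split 6 (7 ↦ (embed 3 111009080706050403020100 111009080706050403020100) ∷ 8 ↦ (embed 2 111009080706050403020100 111009080706050403020100) ∷ 10 ↦ (embed 0 111009080706050403020100 111009080706050403020100) ∷ [])) ∷ 10 ↦ (split 6 (7 ↦ (gap₁ 4 52 14146311590106) ∷ 8 ↦ (embed 1 111009080706050403020100 111009080706050403020100) ∷ 9 ↦ (embed 0 111009080706050403020100 111009080706050403020100) ∷ 11 ↦ (gap₁ 3 51 3020403035352) ∷ [])) ∷ [])) ∷ [])) ∷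
  (9 , 30803040207020601050104000300020001 , split 4 (5 ↦ (embed 0 111009080706050403020100 111009080706050403020100) ∷ 6 ↦ (embed 17 111009070608050402030100 111009060807050402030100) ∷ 7 ↦ (embed 17 111009060708050402030100 111009060708050402030100) ∷ 8 ↦ (embed 0 111009050706080401020300 111009050706080401020300) ∷ 9 ↦ (embed 9 111007060908050402030100 111007060908050402030100) ∷ [])) ∷
  (8 , 3040207020601050104000300020001 , split 3 (5 ↦ (split 4 (5 ↦ (gap₁ 5 0 20253515303) ∷ 6 ↦ (gap₂ 3 0 (0 ∷ 3 ∷ 100 ∷ 510053 ∷ 1005100 ∷ [])) ∷ 7 ↦ (gap₂ 3 0 (0 ∷ 3 ∷ 100 ∷ 510053 ∷ 1005100 ∷ [])) ∷ 8 ↦ (split 5 (6 ↦ (gap₁ 5 0 40455525505) ∷ 7 ↦ (gap₁ 5 0 40455525505) ∷ 8 ↦ (gap₂ 3 0 (0 ∷ 0 ∷ 0 ∷ 0 ∷ 54515453 ∷ 4010403 ∷ [])) ∷ 9 ↦ (embed 26 111007060908050402030100 111007060908050402030100) ∷ [])) ∷ [])) ∷ 6 ↦ (embed 7 111009080706050403020100 111009080706050403020100) ∷ 7 ↦ (embed 7 111009080607050403020100 111009080607050403020100) ∷ 8 ↦ (embed 0 111009080706050403020100 111009080706050403020100) ∷ [])) ∷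
  (13 , 608050704060405030903080207020601050104000300020001 , split 7 (8 ↦ (gap₁ 2 0 5202510100000000) ∷ 9 ↦ (gap₂ 2 0 (0 ∷ 12 ∷ 5153 ∷ 510601 ∷ 5520207 ∷ 5305520207 ∷ 545601515300 ∷ 52565401515300 ∷ [])) ∷ 10 ↦ (gap₁ 1 51 301545503085206) ∷ [])) ∷
  (12 , 50804060405030903080207020601050104000300020001 , split 6 (7 ↦ (gap₁ 4 0 3005300520200) ∷ 8 ↦ (gap₁ 5 0 530003035301510000) ∷ 9 ↦ (gap₁ 1 0 4050755520256) ∷ 10 ↦ (gap₁ 4 51 7516205031660) ∷ [])) ∷
  (13 , 608051004060405030903080207020601050104000300020001 , split 8 (7 ↦ (gap₁ 2 1 570052525353060004) ∷ 9 ↦ (gap₂ 9 0 (0 ∷ 54 ∷ 5304 ∷ 521254 ∷ 64535513 ∷ 101020153 ∷ 535411041366 ∷ 0 ∷ 54011154526511 ∷ [])) ∷ 10 ↦ (gap₁ 1 0 520052020151510200) ∷ 11 ↦ (gap₁ 1 52 30004020303030304) ∷ [])) ∷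
  (12 , 51004060405030903080207020601050104000300020001 , split 6 (7 ↦ (gap₁ 4 0 3005300520200) ∷ 8 ↦ (embed 0 111009080706050403020100 111009080706050403020100) ∷ 9 ↦ (embed 0 111008090706050403020100 111008090706050403020100) ∷ 10 ↦ (gap₁ 4 0 2515300000452) ∷ 11 ↦ (gap₁ 4 51 5045704020655) ∷ [])) ∷
  (11 , 4060405030903080207020601050104000300020001 , split 5 (6 ↦ (gap₁ 4 0 3525200510351) ∷ 7 ↦ (split 6 (7 ↦ (gap₁ 1 0 5252020200530300) ∷ 8 ↦ (embed 3 111009080706050403020100 111009080706050403020100) ∷ 9 ↦ (embed 3 111008090706050403020100 111008090706050403020100) ∷ 10 ↦ (gap₁ 1 51 2555403075206) ∷ [])) ∷ 8 ↦ (embed 2 111009080706050403020100 111009080706050403020100) ∷ 9 ↦ (embed 2 111008090706050403020100 111008090706050403020100) ∷ 10 ↦ (embed 0 111009080706050403020100 111009080706050403020100) ∷ [])) ∷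
  (11 , 4100405030903080207020601050104000300020001 , split 5 (6 ↦ (embed 1 111009080706040503020100 111009080706040503020100) ∷ 7 ↦ (embed 1 111009080607040503020100 111009080607040503020100) ∷ 8 ↦ (embed 1 111007060908040502030100 111007060908040502030100) ∷ 9 ↦ (embed 1 111007060809040502030100 111006070908040502030100) ∷ 10 ↦ (gap₂ 4 0 (0 ∷ 0 ∷ 0 ∷ 0 ∷ 51515653 ∷ 1010603 ∷ [])) ∷ 11 ↦ (gap₁ 1 52 30303030506) ∷ [])) ∷
  (13 , 710060804070406030903080207020601050104000300020001 , split 8 (5 ↦ (gap₁ 5 51 550912006104570751) ∷ 9 ↦ (gap₁ 2 0 520052005401045103) ∷ 10 ↦ (gap₁ 2 0 540353005451055203) ∷ 11 ↦ (gap₁ 2 51 30002000702560353) ∷ [])) ∷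
  (12 , 60804070406030903080207020601050104000300020001 , split 7 (5 ↦ (gap₁ 2 0 5200000200530300) ∷ 8 ↦ (gap₁ 2 0 520000005251045102) ∷ 9 ↦ (gap₁ 1 0 303000453010053) ∷ 10 ↦ (embed 0 111009080706050403020100 111009080706050403020100) ∷ [])) ∷
  (12 , 61004070406030903080207020601050104000300020001 , split 7 (5 ↦ (gap₁ 2 0 5100000200520200) ∷ 8 ↦ (embed 1 111009080607050403020100 111009080607050403020100) ∷ 9 ↦ (embed 1 111008090607050403020100 111008090607050403020100) ∷ 10 ↦ (gap₂ 3 0 (0 ∷ 0 ∷ 0 ∷ 0 ∷ 0 ∷ 0 ∷ 351550052 ∷ 5301050002 ∷ [])) ∷ 11 ↦ (gap₁ 1 52 303000303050306) ∷ [])) ∷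
  (13 , 810060904080406030903080207020601050104000300020001 , split 9 (5 ↦ (gap₂ 3 0 (0 ∷ 54 ∷ 3 ∷ 525965 ∷ 51521507 ∷ 0 ∷ 6507030209 ∷ 0 ∷ 51000101510251 ∷ 20054005915005402 ∷ [])) ∷ 7 ↦ (gap₂ 3 0 (0 ∷ 0 ∷ 5154 ∷ 530000 ∷ 51025101 ∷ 0 ∷ 52060002 ∷ 0 ∷ 100000000 ∷ 10056005204000003 ∷ [])) ∷ 10 ↦ (gap₂ 3 0 (0 ∷ 1 ∷ 51 ∷ 0 ∷ 52000051 ∷ 0 ∷ 2000001 ∷ 0 ∷ 3000456000152 ∷ 54005306510002 ∷ [])) ∷ 11 ↦ (gap₁ 4 51 5050052005252050552) ∷ [])) ∷
  (12 , 61004080406030903080207020601050104000300020001 , split 8 (5 ↦ (gap₁ 2 51 70003000203025653) ∷ 7 ↦ (embed 0 111007060908050402030100 111007060908050402030100) ∷ 9 ↦ (split 9 (5 ↦ (gap₁ 1 51 54520003000452030504) ∷ 7 ↦ (gap₁ 1 0 52520001000051020102) ∷ 10 ↦ (gap₁ 1 0 52510002000252010100) ∷ 11 ↦ (gap₁ 1 52 2030003000403030304) ∷ [])) ∷ 10 ↦ (split 10 (5 ↦ (gap₁ 1 0 5200510051000001010203) ∷ 7 ↦ (gap₁ 1 0 5300530051005201030104) ∷ 9 ↦ (gap₁ 1 0 5300510053005203010104) ∷ 11 ↦ (gap₁ 1 53 400050005000603030404) ∷ [])) ∷ 11 ↦ (gap₁ 1 52 30003000403030304) ∷ [])) ∷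
  (11 , 4080406030903080207020601050104000300020001 , split 6 (5 ↦ (embed 3 111009080504070603010200 111009080504070603010200) ∷ 7 ↦ (split 7 (5 ↦ (embed 10 111009080504070603010200 111009080504070603010200) ∷ 8 ↦ (gap₁ 5 0 530353000301005100) ∷ 9 ↦ (gap₁ 1 0 507000455025256) ∷ 10 ↦ (embed 8 111009080504070603010200 111009080504070603010200) ∷ [])) ∷ 8 ↦ (embed 52 111009070500030201080604 111009020801070005040306) ∷ 9 ↦ (split 8 (5 ↦ (gap₂ 3 0 (0 ∷ 54 ∷ 5151 ∷ 5201 ∷ 52000601 ∷ 0 ∷ 151510200 ∷ 0 ∷ 52005603000002 ∷ [])) ∷ 7 ↦ (split 7 (5 ↦ (gap₂ 9 0 (0 ∷ 2 ∷ 5300 ∷ 30052 ∷ 3070257 ∷ 0 ∷ 5253520003 ∷ 5300020353 ∷ 203000052575307 ∷ [])) ∷ 9 ↦ (gap₁ 2 0 53020352000052020000) ∷ 10 ↦ (gap₂ 3 0 (0 ∷ 2 ∷ 5265 ∷ 540004 ∷ 53070205 ∷ 0 ∷ 454070053 ∷ 1005101025151 ∷ 254006507045207 ∷ [])) ∷ [])) ∷ 9 ↦ (gap₁ 5 0 53030003005300510100) ∷ 10 ↦ (embed 1 111009080706050403020100 111009080706050403020100) ∷ [])) ∷ 10 ↦ (embed 0 111009080706050403020100 111009080706050403020100) ∷ [])) ∷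
  (11 , 4100406030903080207020601050104000300020001 , split 6 (5 ↦ (embed 3 111009080504070603010200 111009080504070603010200) ∷ 7 ↦ (gap₁ 4 1 13005855665310) ∷ 8 ↦ (embed 1 111009080504070603010200 111009080504070603010200) ∷ 9 ↦ (embed 1 111008090504070603010200 111008090504070603010200) ∷ 10 ↦ (split 10 (5 ↦ (gap₁ 4 0 5200000006005400530351) ∷ 7 ↦ (gap₁ 4 0 200000004005600530301) ∷ 8 ↦ (gap₁ 1 51 5200000051005103030306) ∷ 9 ↦ (gap₁ 1 51 5200000051005103030306) ∷ 11 ↦ (gap₁ 1 52 200000003000303040406) ∷ [])) ∷ 11 ↦ (gap₁ 1 52 3000303040406) ∷ [])) ∷
  (10 , 406030903080207020601050104000300020001 , split 4 (5 ↦ (embed 8 111009080706050403020100 111009080706050403020100) ∷ 7 ↦ (split 6 (5 ↦ (gap₁ 2 0 52000200530300) ∷ 7 ↦ (gap₁ 4 0 202005300530101) ∷ 8 ↦ (embed 5 111009080706050403020100 111009080706050403020100) ∷ 9 ↦ (embed 5 111008090706050403020100 111008090706050403020100) ∷ 10 ↦ (embed 4 111009080706050403020100 111009080706050403020100) ∷ [])) ∷ 8 ↦ (embed 1 111009080706050403020100 111009080706050403020100) ∷ 9 ↦ (embed 1 111008090706050403020100 111008090706050403020100) ∷ 10 ↦ (embed 0 111009080706050403020100 111009080706050403020100) ∷ [])) ∷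
  []

tree12 : Tree
tree12 = split 0 (1 ↦ split 0 (2 ↦ split 0 (3 ↦ (split 1 (2 ↦ (embed 47 111009080706050403020100 111009080706050403020100) ∷ 3 ↦ (embed 47 111009080706050402030100 111009080706050402030100) ∷ 4 ↦ (split 1 (2 ↦ (embed 48 111009080706050403020100 111009080706050403020100) ∷ 3 ↦ (embed 48 111009080706050402030100 111009080706050402030100) ∷ 5 ↦ (split 2 (3 ↦ (split 2 (4 ↦ (embed 46 111009080706050403020100 111009080706050403020100) ∷ 5 ↦ (embed 46 111009080706040503020100 111009080706040503020100) ∷ 6 ↦ (embed 45 111009080706050403020100 111009080706050403020100) ∷ [])) ∷ 4 ↦ (embed 23 111009080706050403020100 111009080706050403020100) ∷ 5 ↦ (embed 23 111009080706040503020100 111009080706040503020100) ∷ 6 ↦ (split 2 (3 ↦ (embed 45 111009080706050403020100 111009080706050403020100) ∷ 4 ↦ (embed 24 111009080706050403020100 111009080706050403020100) ∷ 5 ↦ (embed 24 111009080706040503020100 111009080706040503020100) ∷ 7 ↦ (split 3 (4 ↦ (embed 14 111009080706050403020100 111009080706050403020100) ∷ 5 ↦ (embed 14 111009080706040503020100 111009080706040503020100) ∷ 6 ↦ (embed 14 111009080504070603010200 111009080504070603010200) ∷ 7 ↦ (embed 14 111009080504060703010200 111009080405070603010200) ∷ 8 ↦ (split 3 (4 ↦ (embed 15 111009080706050403020100 111009080706050403020100) ∷ 5 ↦ (embed 15 111009080706040503020100 111009080706040503020100) ∷ 6 ↦ (embed 15 111009080504070603010200 111009080504070603010200) ∷ 7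 ↦ (embed 15 111009080504060703010200 111009080405070603010200) ∷ 9 ↦ (split 4 (5 ↦ (split 4 (6 ↦ (embed 9 111009080706050403020100 111009080706050403020100) ∷ 7 ↦ (embed 9 111009080607050403020100 111009080607050403020100) ∷ 8 ↦ (embed 9 111007060908050402030100 111007060908050402030100) ∷ 9 ↦ (embed 9 111007060809050402030100 111006070908050402030100) ∷ 10 ↦ (embed 8 111009080706050403020100 111009080706050403020100) ∷ [])) ∷ 6 ↦ (embed 0 111009080706050403020100 111009080706050403020100) ∷ 7 ↦ (embed 0 111009080607050403020100 111009080607050403020100) ∷ 8 ↦ (embed 0 111007060908050402030100 111007060908050402030100) ∷ 9 ↦ (embed 0 111007060809050402030100 111006070908050402030100) ∷ 10 ↦ (split 4 (5 ↦ (embed 8 111009080706050403020100 111009080706050403020100) ∷ 6 ↦ (embed 1 111009080706050403020100 111009080706050403020100) ∷ 7 ↦ (embed 1 111009080607050403020100 111009080607050403020100) ∷ 8 ↦ (embed 1 111007060908050402030100 111007060908050402030100) ∷ 9 ↦ (embed 1 111007060809050402030100 111006070908050402030100) ∷ 11 ↦ (gap₁ 1 52 304040609) ∷ [])) ∷ [])) ∷ [])) ∷ [])) ∷ [])) ∷ [])) ∷ [])) ∷ [])) ∷ []) ∷ []) ∷ [])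

search4 : ∀ {a : Adjacency 4} → IntegralCubic a → Search.Goal clamp complete a
search4 = Search.search clamp complete lemmas4 tree4 refl

search6 : ∀ {a : Adjacency 6} → IntegralCubic a → Search.Goal clamp bipartite a
search6 = Search.search clamp bipartite lemmas6 tree6 refl

search8 : ∀ {a : Adjacency 8} → IntegralCubic a → Search.Goal clamp (impossible {8}) a
search8 = Search.search clamp (impossible {8}) lemmas8 tree8 refl

search10 : ∀ {a : Adjacency 10} → IntegralCubic a → Search.Goal clamp (impossible {10}) a
search10 = Search.search clamp (impossible {10}) lemmas10 tree10 refl

search12 : ∀ {a : Adjacency 12} → IntegralCubic a → Search.Goal clamp (impossible {12}) a
search12 = Search.search clamp (impossible {12}) lemmas12 tree12 refl

-- Rational and complex numbers

module ℤS = ℤSolver.+-*-Solver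
module ℚS = ℚSolver.+-*-Solver
open ℚS using (solve; _:+_; _:*_; :-_; _:-_; _:=_; con)

0≤+ : ∀ {p q} → 0ℚ ℚ.≤ p → 0ℚ ℚ.≤ q → 0ℚ ℚ.≤ p ℚ.+ q
0≤+ {p} {q} 0≤p 0≤q = subst (ℚ._≤ p ℚ.+ q) (ℚ.+-identityˡ 0ℚ) (ℚ.+-mono-≤ 0≤p 0≤q)

0<+ : ∀ {p q} → 0ℚ ℚ.< p → 0ℚ ℚ.≤ q → 0ℚ ℚ.< p ℚ.+ q
0<+ {p} {q} 0<p 0≤q = subst (ℚ._< p ℚ.+ q) (ℚ.+-identityˡ 0ℚ) (ℚ.+-mono-<-≤ 0<p 0≤q)

0≤* : ∀ {p q} → 0ℚ ℚ.≤ p → 0ℚ ℚ.≤ q → 0ℚ ℚ.≤ p ℚ.* q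
0≤* {p} {q} 0≤p 0≤q = subst (ℚ._≤ p ℚ.* q) (ℚ.*-zeroʳ p) (ℚ.*-monoˡ-≤-nonNeg p {{ℚ.nonNegative 0≤p}} 0≤q)

0<* : ∀ {p q} → 0ℚ ℚ.< p → 0ℚ ℚ.< q → 0ℚ ℚ.< p ℚ.* q
0<* {p} {q} 0<p 0<q = subst (ℚ._< p ℚ.* q) (ℚ.*-zeroʳ p) (ℚ.*-monoʳ-<-pos p {{ℚ.positive 0<p}} 0<q)

≤⇒0≤- : ∀ {p q} → p ℚ.≤ q → 0ℚ ℚ.≤ q ℚ.- p
≤⇒0≤- {p} {q} p≤q = subst (ℚ._≤ q ℚ.- p) (ℚ.+-inverseʳ p) (ℚ.+-monoˡ-≤ (ℚ.- p) p≤q)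

<⇒0<- : ∀ {p q} → p ℚ.< q → 0ℚ ℚ.< q ℚ.- p
<⇒0<- {p} {q} p<q = subst (ℚ._< q ℚ.- p) (ℚ.+-inverseʳ p) (ℚ.+-monoˡ-< (ℚ.- p) p<q)

private
  -+-cancel : ∀ p q → q ℚ.- p ℚ.+ p ≡ q
  -+-cancel = solve 2 (λ p q → q :- p :+ p := q) refl

0≤-⇒≤ : ∀ {q p} → 0ℚ ℚ.≤ q ℚ.- p → p ℚ.≤ q
0≤-⇒≤ {q} {p} h = subst₂ ℚ._≤_ (ℚ.+-identityˡ p) (-+-cancel p q) (ℚ.+-monoˡ-≤ p h)

0<-⇒< : ∀ {q p} → 0ℚ ℚ.< q ℚ.- p → p ℚ.< q
0<-⇒< {q} {p} h = subst₂ ℚ._<_ (ℚ.+-identityˡ p) (-+-cancel p q) (ℚ.+-monoˡ-< p h)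

≤-by : ∀ {q p d} → 0ℚ ℚ.≤ d → q ℚ.- p ≡ d → p ℚ.≤ q
≤-by 0≤d eq = 0≤-⇒≤ (subst (0ℚ ℚ.≤_) (sym eq) 0≤d)

<-by : ∀ {q p d} → 0ℚ ℚ.< d → q ℚ.- p ≡ d → p ℚ.< q
<-by 0<d eq = 0<-⇒< (subst (0ℚ ℚ.<_) (sym eq) 0<d)

0≤sq : ∀ p → 0ℚ ℚ.≤ p ℚ.* p
0≤sq p with ℚ.≤-total 0ℚ p
... | inj₁ 0≤p = 0≤* 0≤p 0≤p
... | inj₂ p≤0 = ≤-by (0≤* 0≤-p 0≤-p) (solve 1 (λ p → p :* p :- con 0ℚ := (con 0ℚ :- p) :* (con 0ℚ :- p)) refl p)
  where
  0≤-p : 0ℚ ℚ.≤ 0ℚ ℚ.- p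
  0≤-p = ≤⇒0≤- p≤0

0<sq : ∀ {p} → p ≢ 0ℚ → 0ℚ ℚ.< p ℚ.* p
0<sq {p} p≢0 with ℚ.<-cmp 0ℚ p
... | tri< 0<p _ _ = 0<* 0<p 0<p
... | tri≈ _ 0≡p _ = contradiction (sym 0≡p) p≢0
... | tri> _ _ p<0 = <-by (0<* 0<-p 0<-p) (solve 1 (λ p → p :* p :- con 0ℚ := (con 0ℚ :- p) :* (con 0ℚ :- p)) refl p)
  where
  0<-p : 0ℚ ℚ.< 0ℚ ℚ.- p
  0<-p = <⇒0<- p<0

∣∣-≤ : ∀ {p b} → p ℚ.≤ b → ℚ.- p ℚ.≤ b → ∣ p ∣ ℚ.≤ b
∣∣-≤ {p} {b} p≤b -p≤b with ℚ.∣p∣≡p∨∣p∣≡-p p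
... | inj₁ eq = subst (ℚ._≤ b) (sym eq) p≤b
... | inj₂ eq = subst (ℚ._≤ b) (sym eq) -p≤b

p≤∣p∣ : ∀ p → p ℚ.≤ ∣ p ∣
p≤∣p∣ p with ℚ.≤-total 0ℚ p
... | inj₁ 0≤p = ℚ.≤-reflexive (sym (ℚ.0≤p⇒∣p∣≡p 0≤p))
... | inj₂ p≤0 = ℚ.≤-trans p≤0 (ℚ.0≤∣p∣ p)

∣p-q∣-sym : ∀ p q → ∣ p ℚ.- q ∣ ≡ ∣ q ℚ.- p ∣
∣p-q∣-sym p q = trans (sym (ℚ.∣-p∣≡∣p∣ (p ℚ.- q))) (cong ∣_∣ (solve 2 (λ p q → :- (p :- q) := q :- p) refl p q))

triangle : ∀ p q r → ∣ p ℚ.- r ∣ ℚ.≤ ∣ p ℚ.- q ∣ ℚ.+ ∣ q ℚ.- r ∣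
triangle p q r = subst (λ x → ∣ x ∣ ℚ.≤ ∣ p ℚ.- q ∣ ℚ.+ ∣ q ℚ.- r ∣)
  (solve 3 (λ p q r → (p :- q) :+ (q :- r) := p :- r) refl p q r) (ℚ.∣p+q∣≤∣p∣+∣q∣ (p ℚ.- q) (q ℚ.- r))

0<1 : 0ℚ ℚ.< 1ℚ
0<1 = ℚ.positive⁻¹ 1ℚ

halve : ∀ {p} → 0ℚ ℚ.< p → 0ℚ ℚ.< ½ ℚ.* p
halve = 0<* (ℚ.positive⁻¹ ½)

half+half : ∀ p → ½ ℚ.* p ℚ.+ ½ ℚ.* p ≡ p
half+half = solve 1 (λ p → con ½ :* p :+ con ½ :* p := p) refl

divide : ∀ {b ε} → 0ℚ ℚ.< b → 0ℚ ℚ.< ε → ∃[ δ ] (0ℚ ℚ.< δ × b ℚ.* δ ≡ ε)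
divide {b} {ε} 0<b 0<ε = δ , 0<* (ℚ.positive⁻¹ (ℚ.1/ b) {{ℚ.1/pos⇒pos b}}) 0<ε ,
  trans (sym (ℚ.*-assoc b (ℚ.1/ b) ε)) (trans (cong (ℚ._* ε) (ℚ.*-inverseʳ b)) (ℚ.*-identityˡ ε))
  where
  instance
    b-pos : ℚ.Positive b
    b-pos = ℚ.positive 0<b
    b-nz : ℚ.NonZero b
    b-nz = ℚ.pos⇒nonZero b
  δ : ℚ
  δ = (ℚ.1/ b) ℚ.* ε

ι : ℤ → ℚ
ι k = k ℚ./ 1

private
  toℚᵘ-ι : ∀ k → ℚ.toℚᵘ (ι k) ℚᵘ.≃ ℚᵘ.mkℚᵘ k 0
  toℚᵘ-ι k = ℚ.toℚᵘ-fromℚᵘ (ℚᵘ.mkℚᵘ k 0)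

ι-+ : ∀ a b → ι (a ℤ.+ b) ≡ ι a ℚ.+ ι b
ι-+ a b = ℚ.toℚᵘ-injective (ℚᵘ.≃-trans (toℚᵘ-ι (a ℤ.+ b)) (ℚᵘ.≃-trans
  (ℚᵘ.*≡* (cong (ℤ._* 1ℤ) (sym (cong₂ ℤ._+_ (ℤ.*-identityʳ a) (ℤ.*-identityʳ b)))))
  (ℚᵘ.≃-sym (ℚᵘ.≃-trans (ℚ.toℚᵘ-homo-+ (ι a) (ι b)) (ℚᵘ.+-cong (toℚᵘ-ι a) (toℚᵘ-ι b))))))

ι-* : ∀ a b → ι (a ℤ.* b) ≡ ι a ℚ.* ι b
ι-* a b = ℚ.toℚᵘ-injective (ℚᵘ.≃-trans (toℚᵘ-ι (a ℤ.* b))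
  (ℚᵘ.≃-sym (ℚᵘ.≃-trans (ℚ.toℚᵘ-homo-* (ι a) (ι b)) (ℚᵘ.*-cong (toℚᵘ-ι a) (toℚᵘ-ι b)))))

ι-neg : ∀ a → ι (ℤ.- a) ≡ ℚ.- ι a
ι-neg a = ℚ.toℚᵘ-injective (ℚᵘ.≃-trans (toℚᵘ-ι (ℤ.- a))
  (ℚᵘ.≃-sym (ℚᵘ.≃-trans (ℚ.toℚᵘ-homo‿- (ι a)) (ℚᵘ.-‿cong (toℚᵘ-ι a)))))

ι-minus : ∀ a b → ι (a ℤ.- b) ≡ ι a ℚ.- ι b
ι-minus a b = trans (ι-+ a (ℤ.- b)) (cong (ι a ℚ.+_) (ι-neg b))

ι-cancel-< : ∀ a b → ι a ℚ.< ι b → a ℤ.< b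
ι-cancel-< a b h with ℚᵘ.<-respˡ-≃ (toℚᵘ-ι a) (ℚᵘ.<-respʳ-≃ (toℚᵘ-ι b) (ℚ.toℚᵘ-mono-< h))
... | ℚᵘ.*<* k = subst₂ ℤ._<_ (ℤ.*-identityʳ a) (ℤ.*-identityʳ b) k

ι-mono-≤ : ∀ {a b} → a ℤ.≤ b → ι a ℚ.≤ ι b
ι-mono-≤ {a} {b} a≤b = ℚ.toℚᵘ-cancel-≤ (ℚᵘ.≤-respˡ-≃ (ℚᵘ.≃-sym (toℚᵘ-ι a)) (ℚᵘ.≤-respʳ-≃ (ℚᵘ.≃-sym (toℚᵘ-ι b))
  (ℚᵘ.*≤* (subst₂ ℤ._≤_ (sym (ℤ.*-identityʳ a)) (sym (ℤ.*-identityʳ b)) a≤b))))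

ι-injective : ∀ {a b} → ι a ≡ ι b → a ≡ b
ι-injective {a} {b} eq with ℚᵘ.≃-trans (ℚᵘ.≃-sym (toℚᵘ-ι a)) (ℚᵘ.≃-trans (ℚᵘ.≃-reflexive (cong ℚ.toℚᵘ eq)) (toℚᵘ-ι b))
... | ℚᵘ.*≡* k = trans (sym (ℤ.*-identityʳ a)) (trans k (ℤ.*-identityʳ b))

ι-cancel-≤ : ∀ a b → ι a ℚ.≤ ι b → a ℤ.≤ b
ι-cancel-≤ a b h with a ℤ.≤? b
... | yes a≤b = a≤b
... | no a≰b  = ℤ.≤-reflexive (ι-injective (ℚ.≤-antisym h (ι-mono-≤ (ℤ.<⇒≤ (ℤ.≰⇒> a≰b)))))

ι-close : ∀ a b → ∣ ι a ℚ.- ι b ∣ ℚ.< 1ℚ → a ≡ b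
ι-close a b h = ℤ.≤-antisym (below a b h) (below b a (subst (ℚ._< 1ℚ) (∣p-q∣-sym (ι a) (ι b)) h))
  where
  below : ∀ a b → ∣ ι a ℚ.- ι b ∣ ℚ.< 1ℚ → a ℤ.≤ b
  below a b h with a ℤ.≤? b
  ... | yes a≤b = a≤b
  ... | no a≰b  = contradiction (ℤ.<-≤-trans a<1+b (ℤ.i<j⇒suc[i]≤j (ℤ.≰⇒> a≰b))) (ℤ.<-irrefl refl)
    where
    a<1+b : a ℤ.< ℤ.suc b
    a<1+b = ι-cancel-< a (1ℤ ℤ.+ b) (subst (ι a ℚ.<_) (sym (ι-+ 1ℤ b))
      (<-by (<⇒0<- (ℚ.≤-<-trans (p≤∣p∣ (ι a ℚ.- ι b)) h))
        (solve 2 (λ a b → (con 1ℚ :+ b) :- a := con 1ℚ :- (a :- b)) refl (ι a) (ι b))))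

floor-bounds : ∀ q → ∃[ k ] (ι k ℚ.≤ q × q ℚ.< ι k ℚ.+ 1ℚ)
floor-bounds q@(ℚ.mkℚ a d-1 _) = k , lower , upper
  where
  d = suc d-1
  k = a ℤ./ + d
  m = a ℤ.% + d
  a≡ : a ≡ + m ℤ.+ k ℤ.* + d
  a≡ = ℤ.a≡a%n+[a/n]*n a (+ d)
  lower : ι k ℚ.≤ q
  lower = ℚ.toℚᵘ-cancel-≤ (ℚᵘ.≤-respˡ-≃ (ℚᵘ.≃-sym (toℚᵘ-ι k)) (ℚᵘ.*≤*
    (subst (k ℤ.* + d ℤ.≤_) (sym (ℤ.*-identityʳ a)) (subst (k ℤ.* + d ℤ.≤_) (sym a≡) (ℤ.i≤j+i (k ℤ.* + d) (+ m))))))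
  upper : q ℚ.< ι k ℚ.+ 1ℚ
  upper = subst (q ℚ.<_) (ι-+ k 1ℤ) (ℚ.toℚᵘ-cancel-< (ℚᵘ.<-respʳ-≃ (ℚᵘ.≃-sym (toℚᵘ-ι (k ℤ.+ 1ℤ))) (ℚᵘ.*<*
    (subst₂ ℤ._<_ (sym (trans (ℤ.*-identityʳ a) a≡))
      (ℤSolve k (+ d))
      (ℤ.+-monoˡ-< (k ℤ.* + d) (ℤ.+<+ (ℤ.n%d<d a (+ d))))))))
    where
    ℤSolve : ∀ k d → d ℤ.+ k ℤ.* d ≡ (k ℤ.+ 1ℤ) ℤ.* d
    ℤSolve = ℤS.solve 2 (λ k d → d ℤS.:+ k ℤS.:* d ℤS.:= (k ℤS.:+ ℤS.con 1ℤ) ℤS.:* d) refl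

Null : (ℕ → ℚ) → Set
Null s = ∀ η → 0ℚ ℚ.< η → ∃[ N ] ∀ n → N ℕ.≤ n → ∣ s n ∣ ℚ.< η

null-ext : ∀ {s t} → (∀ n → s n ≡ t n) → Null s → Null t
null-ext s≗t s₀ η 0<η = let N , h = s₀ η 0<η in N , λ n N≤n → subst (λ x → ∣ x ∣ ℚ.< η) (s≗t n) (h n N≤n)

null-0 : Null λ _ → 0ℚ
null-0 η 0<η = 0 , λ _ _ → 0<η

null-+ : ∀ {s t} → Null s → Null t → Null λ n → s n ℚ.+ t n
null-+ {s} {t} s₀ t₀ η 0<η =
  let N , f = s₀ (½ ℚ.* η) (halve 0<η)
      M , g = t₀ (½ ℚ.* η) (halve 0<η)
  in N ℕ.⊔ M , λ n h → subst (∣ s n ℚ.+ t n ∣ ℚ.<_) (half+half η)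
    (ℚ.≤-<-trans (ℚ.∣p+q∣≤∣p∣+∣q∣ (s n) (t n)) (ℚ.+-mono-< (f n (ℕ.m⊔n≤o⇒m≤o N M h)) (g n (ℕ.m⊔n≤o⇒n≤o N M h))))

null-neg : ∀ {s} → Null s → Null λ n → ℚ.- s n
null-neg {s} s₀ η 0<η = let N , f = s₀ η 0<η in N , λ n h → subst (ℚ._< η) (sym (ℚ.∣-p∣≡∣p∣ (s n))) (f n h)

null-≤ : ∀ {s t} → (∃[ N ] ∀ n → N ℕ.≤ n → ∣ s n ∣ ℚ.≤ ∣ t n ∣) → Null t → Null s
null-≤ (N , s≤t) t₀ η 0<η = let M , f = t₀ η 0<η in
  N ℕ.⊔ M , λ n h → ℚ.≤-<-trans (s≤t n (ℕ.m⊔n≤o⇒m≤o N M h)) (f n (ℕ.m⊔n≤o⇒n≤o N M h))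

null-const : ∀ {c} → Null (λ _ → c) → c ≡ 0ℚ
null-const {c} c₀ = decidable-stable (c ℚ.≟ 0ℚ) λ c≢0 →
  let 0<∣c∣ = ℚ.≰⇒> (λ ∣c∣≤0 → c≢0 (ℚ.∣p∣≡0⇒p≡0 c (ℚ.≤-antisym ∣c∣≤0 (ℚ.0≤∣p∣ c))))
      N , f = c₀ ∣ c ∣ 0<∣c∣
  in ℚ.<-irrefl refl (f N ℕ.≤-refl)

bounded : ∀ x → ∃₂ λ b N → 0ℚ ℚ.< b × (∀ n → N ℕ.≤ n → ∣ seq x n ∣ ℚ.≤ b)
bounded x = let N , close = cauchy x 1ℚ 0<1 in
  1ℚ ℚ.+ ∣ seq x N ∣ , N , 0<+ 0<1 (ℚ.0≤∣p∣ (seq x N)) , λ n h →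
    subst (λ q → ∣ q ∣ ℚ.≤ 1ℚ ℚ.+ ∣ seq x N ∣) (solve 2 (λ p q → (p :- q) :+ q := p) refl (seq x n) (seq x N))
      (ℚ.≤-trans (ℚ.∣p+q∣≤∣p∣+∣q∣ (seq x n ℚ.- seq x N) (seq x N))
        (ℚ.+-monoˡ-≤ ∣ seq x N ∣ (ℚ.<⇒≤ (close n N h ℕ.≤-refl))))

null-* : ∀ x {s} → Null s → Null λ n → seq x n ℚ.* s n
null-* x {s} s₀ η 0<η =
  let b , N , 0<b , x≤b = bounded x
      δ , 0<δ , bδ≡η = divide 0<b 0<η
      M , f = s₀ δ 0<δ
  in N ℕ.⊔ M , λ n h → subst₂ ℚ._<_ (sym (ℚ.∣p*q∣≡∣p∣*∣q∣ (seq x n) (s n))) bδ≡η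
    (ℚ.≤-<-trans
      (ℚ.*-monoʳ-≤-nonNeg ∣ s n ∣ {{ℚ.nonNegative (ℚ.0≤∣p∣ (s n))}} (x≤b n (ℕ.m⊔n≤o⇒m≤o N M h)))
      (ℚ.*-monoʳ-<-pos b {{ℚ.positive 0<b}} (f n (ℕ.m⊔n≤o⇒n≤o N M h))))

≈ᴿ-pointwise : ∀ {x y} → (∀ n → seq x n ≡ seq y n) → x ≈ᴿ y
≈ᴿ-pointwise {x} {y} eq = null-ext (λ n → sym (trans (cong (ℚ._- seq y n) (eq n)) (ℚ.+-inverseʳ (seq y n)))) null-0

≈ᴿ-sym : ∀ {x y} → x ≈ᴿ y → y ≈ᴿ x
≈ᴿ-sym {x} {y} h = null-ext (λ n → solve 2 (λ p q → :- (p :- q) := q :- p) refl (seq x n) (seq y n)) (null-neg h)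

≈ᴿ-trans : ∀ {x y z} → x ≈ᴿ y → y ≈ᴿ z → x ≈ᴿ z
≈ᴿ-trans {x} {y} {z} h k = null-ext
  (λ n → solve 3 (λ p q r → (p :- q) :+ (q :- r) := p :- r) refl (seq x n) (seq y n) (seq z n)) (null-+ h k)

+ᴿ-cong : ∀ {x x′ y y′} → x ≈ᴿ x′ → y ≈ᴿ y′ → x +ᴿ y ≈ᴿ x′ +ᴿ y′
+ᴿ-cong {x} {x′} {y} {y′} h k = null-ext
  (λ n → solve 4 (λ a b c d → (a :- b) :+ (c :- d) := (a :+ c) :- (b :+ d)) refl (seq x n) (seq x′ n) (seq y n) (seq y′ n))
  (null-+ h k)

-ᴿ-cong : ∀ {x y} → x ≈ᴿ y → -ᴿ x ≈ᴿ -ᴿ y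
-ᴿ-cong {x} {y} h = null-ext (λ n → solve 2 (λ a b → :- (a :- b) := :- a :- :- b) refl (seq x n) (seq y n)) (null-neg h)

*ᴿ-cong : ∀ {x x′ y y′} → x ≈ᴿ x′ → y ≈ᴿ y′ → x *ᴿ y ≈ᴿ x′ *ᴿ y′
*ᴿ-cong {x} {x′} {y} {y′} h k = null-ext
  (λ n → solve 4 (λ a b c d → a :* (c :- d) :+ d :* (a :- b) := a :* c :- b :* d) refl (seq x n) (seq x′ n) (seq y n) (seq y′ n))
  (null-+ (null-* x k) (null-* y′ h))

≈ᶜ-pointwise : ∀ {z w} → (∀ n → seq (re z) n ≡ seq (re w) n) → (∀ n → seq (im z) n ≡ seq (im w) n) → z ≈ᶜ w
≈ᶜ-pointwise {z} {w} f g = ≈ᴿ-pointwise {re z} {re w} f , ≈ᴿ-pointwise {im z} {im w} g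

ℂ-isCommutativeRing : IsCommutativeRing _≈ᶜ_ _+ᶜ_ _*ᶜ_ -ᶜ_ 0ᶜ 1ᶜ
ℂ-isCommutativeRing = record
  { isRing = record
    { +-isAbelianGroup = record
      { isGroup = record
        { isMonoid = record
          { isSemigroup = record
            { isMagma = record
              { isEquivalence = record
                { refl  = λ {z} → ≈ᶜ-pointwise {z} {z} (λ _ → refl) (λ _ → refl)
                ; sym   = λ {z} {w} (h , k) → ≈ᴿ-sym {re z} {re w} h , ≈ᴿ-sym {im z} {im w} k
                ; trans = λ {z} {w} {u} (h , k) (h′ , k′) →
                    ≈ᴿ-trans {re z} {re w} {re u} h h′ , ≈ᴿ-trans {im z} {im w} {im u} k k′
                }
              ; ∙-cong = λ {z} {z′} {w} {w′} (h , k) (h′ , k′) →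
                  +ᴿ-cong {re z} {re z′} {re w} {re w′} h h′ , +ᴿ-cong {im z} {im z′} {im w} {im w′} k k′
              }
            ; assoc = λ z w u → ≈ᶜ-pointwise {(z +ᶜ w) +ᶜ u} {z +ᶜ (w +ᶜ u)}
                (λ n → ℚ.+-assoc (seq (re z) n) _ _) (λ n → ℚ.+-assoc (seq (im z) n) _ _)
            }
          ; identity =
              (λ z → ≈ᶜ-pointwise {0ᶜ +ᶜ z} {z} (λ n → ℚ.+-identityˡ _) (λ n → ℚ.+-identityˡ _)) ,
              (λ z → ≈ᶜ-pointwise {z +ᶜ 0ᶜ} {z} (λ n → ℚ.+-identityʳ _) (λ n → ℚ.+-identityʳ _))
          }
        ; inverse =
            (λ z → ≈ᶜ-pointwise { -ᶜ z +ᶜ z } {0ᶜ} (λ n → ℚ.+-inverseˡ (seq (re z) n)) (λ n → ℚ.+-inverseˡ (seq (im z) n))) ,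
            (λ z → ≈ᶜ-pointwise {z +ᶜ (-ᶜ z)} {0ᶜ} (λ n → ℚ.+-inverseʳ (seq (re z) n)) (λ n → ℚ.+-inverseʳ (seq (im z) n)))
        ; ⁻¹-cong = λ {z} {w} (h , k) → -ᴿ-cong {re z} {re w} h , -ᴿ-cong {im z} {im w} k
        }
      ; comm = λ z w → ≈ᶜ-pointwise {z +ᶜ w} {w +ᶜ z} (λ n → ℚ.+-comm (seq (re z) n) _) (λ n → ℚ.+-comm (seq (im z) n) _)
      }
    ; *-cong = λ {z} {z′} {w} {w′} (h , k) (h′ , k′) →
        +ᴿ-cong {re z *ᴿ re w} {re z′ *ᴿ re w′} { -ᴿ (im z *ᴿ im w) } { -ᴿ (im z′ *ᴿ im w′) }
          (*ᴿ-cong {re z} {re z′} {re w} {re w′} h h′)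
          (-ᴿ-cong {im z *ᴿ im w} {im z′ *ᴿ im w′} (*ᴿ-cong {im z} {im z′} {im w} {im w′} k k′)) ,
        +ᴿ-cong {re z *ᴿ im w} {re z′ *ᴿ im w′} {im z *ᴿ re w} {im z′ *ᴿ re w′}
          (*ᴿ-cong {re z} {re z′} {im w} {im w′} h k′)
          (*ᴿ-cong {im z} {im z′} {re w} {re w′} k h′)
    ; *-assoc = λ z w u → ≈ᶜ-pointwise {(z *ᶜ w) *ᶜ u} {z *ᶜ (w *ᶜ u)}
        (λ n → solve 6 (λ a b c d e f → (a :* c :- b :* d) :* e :- (a :* d :+ b :* c) :* f
                                     := a :* (c :* e :- d :* f) :- b :* (c :* f :+ d :* e)) refl
          (seq (re z) n) (seq (im z) n) (seq (re w) n) (seq (im w) n) (seq (re u) n) (seq (im u) n))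
        (λ n → solve 6 (λ a b c d e f → (a :* c :- b :* d) :* f :+ (a :* d :+ b :* c) :* e
                                     := a :* (c :* f :+ d :* e) :+ b :* (c :* e :- d :* f)) refl
          (seq (re z) n) (seq (im z) n) (seq (re w) n) (seq (im w) n) (seq (re u) n) (seq (im u) n))
    ; *-identity =
        (λ z → ≈ᶜ-pointwise {1ᶜ *ᶜ z} {z}
          (λ n → solve 2 (λ a b → con 1ℚ :* a :- con 0ℚ :* b := a) refl (seq (re z) n) (seq (im z) n))
          (λ n → solve 2 (λ a b → con 1ℚ :* b :+ con 0ℚ :* a := b) refl (seq (re z) n) (seq (im z) n))) ,
        (λ z → ≈ᶜ-pointwise {z *ᶜ 1ᶜ} {z}
          (λ n → solve 2 (λ a b → a :* con 1ℚ :- b :* con 0ℚ := a) refl (seq (re z) n) (seq (im z) n))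
          (λ n → solve 2 (λ a b → a :* con 0ℚ :+ b :* con 1ℚ := b) refl (seq (re z) n) (seq (im z) n)))
    ; distrib =
        (λ z w u → ≈ᶜ-pointwise {z *ᶜ (w +ᶜ u)} {(z *ᶜ w) +ᶜ (z *ᶜ u)}
          (λ n → solve 6 (λ a b c d e f → a :* (c :+ e) :- b :* (d :+ f) := (a :* c :- b :* d) :+ (a :* e :- b :* f)) refl
            (seq (re z) n) (seq (im z) n) (seq (re w) n) (seq (im w) n) (seq (re u) n) (seq (im u) n))
          (λ n → solve 6 (λ a b c d e f → a :* (d :+ f) :+ b :* (c :+ e) := (a :* d :+ b :* c) :+ (a :* f :+ b :* e)) refl
            (seq (re z) n) (seq (im z) n) (seq (re w) n) (seq (im w) n) (seq (re u) n) (seq (im u) n))) ,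
        (λ z w u → ≈ᶜ-pointwise {(w +ᶜ u) *ᶜ z} {(w *ᶜ z) +ᶜ (u *ᶜ z)}
          (λ n → solve 6 (λ a b c d e f → (c :+ e) :* a :- (d :+ f) :* b := (c :* a :- d :* b) :+ (e :* a :- f :* b)) refl
            (seq (re z) n) (seq (im z) n) (seq (re w) n) (seq (im w) n) (seq (re u) n) (seq (im u) n))
          (λ n → solve 6 (λ a b c d e f → (c :+ e) :* b :+ (d :+ f) :* a := (c :* b :+ d :* a) :+ (e :* b :+ f :* a)) refl
            (seq (re z) n) (seq (im z) n) (seq (re w) n) (seq (im w) n) (seq (re u) n) (seq (im u) n)))
    }
  ; *-comm = λ z w → ≈ᶜ-pointwise {z *ᶜ w} {w *ᶜ z}
      (λ n → solve 4 (λ a b c d → a :* c :- b :* d := c :* a :- d :* b) refl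
        (seq (re z) n) (seq (im z) n) (seq (re w) n) (seq (im w) n))
      (λ n → solve 4 (λ a b c d → a :* d :+ b :* c := c :* b :+ d :* a) refl
        (seq (re z) n) (seq (im z) n) (seq (re w) n) (seq (im w) n))
  }

ℂ-ring : CommutativeRing 0ℓ 0ℓ
ℂ-ring = record { isCommutativeRing = ℂ-isCommutativeRing }

fromℤ-+ : ∀ a b → fromℤ (a ℤ.+ b) ≈ᶜ fromℤ a +ᶜ fromℤ b
fromℤ-+ a b = ≈ᶜ-pointwise {fromℤ (a ℤ.+ b)} {fromℤ a +ᶜ fromℤ b} (λ _ → ι-+ a b) (λ _ → refl)

fromℤ-* : ∀ a b → fromℤ (a ℤ.* b) ≈ᶜ fromℤ a *ᶜ fromℤ b
fromℤ-* a b = ≈ᶜ-pointwise {fromℤ (a ℤ.* b)} {fromℤ a *ᶜ fromℤ b}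
  (λ _ → trans (ι-* a b) (solve 2 (λ a b → a :* b := a :* b :- con 0ℚ :* con 0ℚ) refl (ι a) (ι b)))
  (λ _ → solve 2 (λ a b → con 0ℚ := a :* con 0ℚ :+ con 0ℚ :* b) refl (ι a) (ι b))

Apart : ℝ → Set
Apart x = ∃₂ λ δ N → 0ℚ ℚ.< δ × (∀ n → N ℕ.≤ n → δ ℚ.≤ ∣ seq x n ∣)

0ᴿ : ℝ
0ᴿ = fromℚ 0ℚ

private
  minus-0 : ∀ p → p ℚ.- 0ℚ ≡ p
  minus-0 = solve 1 (λ p → p :- con 0ℚ := p) refl

null⇒≈0 : ∀ {x} → Null (seq x) → x ≈ᴿ 0ᴿ
null⇒≈0 {x} = null-ext (λ n → sym (minus-0 (seq x n)))

≈0⇒null : ∀ {x} → x ≈ᴿ 0ᴿ → Null (seq x)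
≈0⇒null {x} = null-ext (λ n → minus-0 (seq x n))

¬apart⇒null : ∀ x → ¬ Apart x → Null (seq x)
¬apart⇒null x ¬apart η 0<η with cauchy x (½ ℚ.* (½ ℚ.* η)) (halve (halve 0<η))
... | N , close with ∣ seq x N ∣ ℚ.<? ½ ℚ.* η
...   | yes small = N , λ n N≤n → subst (∣ seq x n ∣ ℚ.<_) (half+half η) (ℚ.≤-<-trans (∣x∣≤ n)
          (ℚ.+-mono-< (ℚ.<-trans (close n N N≤n ℕ.≤-refl) quarter<half) small))
  where
  ∣x∣≤ : ∀ n → ∣ seq x n ∣ ℚ.≤ ∣ seq x n ℚ.- seq x N ∣ ℚ.+ ∣ seq x N ∣
  ∣x∣≤ n = subst (λ q → ∣ q ∣ ℚ.≤ ∣ seq x n ℚ.- seq x N ∣ ℚ.+ ∣ seq x N ∣)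
    (solve 2 (λ p q → (p :- q) :+ q := p) refl (seq x n) (seq x N)) (ℚ.∣p+q∣≤∣p∣+∣q∣ (seq x n ℚ.- seq x N) (seq x N))
  quarter<half : ½ ℚ.* (½ ℚ.* η) ℚ.< ½ ℚ.* η
  quarter<half = <-by (halve (halve 0<η)) (solve 1 (λ e → con ½ :* e :- con ½ :* (con ½ :* e) := con ½ :* (con ½ :* e)) refl η)
...   | no large  = contradiction (½ ℚ.* (½ ℚ.* η) , N , halve (halve 0<η) , away) ¬apart
  where
  away : ∀ n → N ℕ.≤ n → ½ ℚ.* (½ ℚ.* η) ℚ.≤ ∣ seq x n ∣
  away n N≤n = ≤-by (≤⇒0≤- (ℚ.≤-trans (ℚ.≮⇒≥ large) (ℚ.≤-trans
      (subst (λ q → ∣ q ∣ ℚ.≤ ∣ seq x n ∣ ℚ.+ ∣ seq x N ℚ.- seq x n ∣)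
        (solve 2 (λ p q → p :+ (q :- p) := q) refl (seq x n) (seq x N)) (ℚ.∣p+q∣≤∣p∣+∣q∣ (seq x n) (seq x N ℚ.- seq x n)))
      (ℚ.+-monoʳ-≤ ∣ seq x n ∣ (ℚ.<⇒≤ (close N n ℕ.≤-refl N≤n))))))
    (solve 2 (λ e y → y :- con ½ :* (con ½ :* e) := (y :+ con ½ :* (con ½ :* e)) :- con ½ :* e) refl η ∣ seq x n ∣)

apart-cancel : ∀ {x s} → Apart x → Null (λ n → seq x n ℚ.* s n) → Null s
apart-cancel {x} {s} (δ , N , 0<δ , δ≤) xs₀ η 0<η =
  let M , f = xs₀ (δ ℚ.* η) (0<* 0<δ 0<η) in
  N ℕ.⊔ M , λ n h → ℚ.*-cancelˡ-<-nonNeg δ {{ℚ.pos⇒nonNeg δ {{ℚ.positive 0<δ}}}} (ℚ.≤-<-trans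
    (subst (δ ℚ.* ∣ s n ∣ ℚ.≤_) (sym (ℚ.∣p*q∣≡∣p∣*∣q∣ (seq x n) (s n)))
      (ℚ.*-monoʳ-≤-nonNeg ∣ s n ∣ {{ℚ.nonNegative (ℚ.0≤∣p∣ (s n))}} (δ≤ n (ℕ.m⊔n≤o⇒m≤o N M h))))
    (f n (ℕ.m⊔n≤o⇒n≤o N M h)))

null-sq : ∀ {s} → Null (λ n → s n ℚ.* s n) → Null s
null-sq {s} s₀ η 0<η = let N , f = s₀ (η ℚ.* η) (0<* 0<η 0<η) in
  N , λ n h → ℚ.≰⇒> λ η≤s → ℚ.<-irrefl refl (ℚ.≤-<-trans
    (ℚ.≤-trans (ℚ.*-monoʳ-≤-nonNeg η {{ℚ.nonNegative (ℚ.<⇒≤ 0<η)}} η≤s)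
      (ℚ.*-monoˡ-≤-nonNeg ∣ s n ∣ {{ℚ.nonNegative (ℚ.0≤∣p∣ (s n))}} η≤s))
    (subst (ℚ._< η ℚ.* η) (ℚ.∣p*q∣≡∣p∣*∣q∣ (s n) (s n)) (f n h)))

norm² : ℂ → ℝ
norm² z = re z *ᴿ re z +ᴿ im z *ᴿ im z

norm²-null : ∀ z → Null (seq (norm² z)) → z ≈ᶜ 0ᶜ
norm²-null z h =
  null⇒≈0 {re z} (null-sq (null-≤ (0 , λ n _ → bound (seq (re z) n) (seq (im z) n)) h)) ,
  null⇒≈0 {im z} (null-sq (null-≤ (0 , λ n _ → subst (λ q → ∣ seq (im z) n ℚ.* seq (im z) n ∣ ℚ.≤ ∣ q ∣)
    (ℚ.+-comm (seq (im z) n ℚ.* seq (im z) n) (seq (re z) n ℚ.* seq (re z) n)) (bound (seq (im z) n) (seq (re z) n))) h))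
  where
  bound : ∀ a b → ∣ a ℚ.* a ∣ ℚ.≤ ∣ a ℚ.* a ℚ.+ b ℚ.* b ∣
  bound a b = subst₂ ℚ._≤_ (sym (ℚ.0≤p⇒∣p∣≡p (0≤sq a))) (sym (ℚ.0≤p⇒∣p∣≡p (0≤+ (0≤sq a) (0≤sq b))))
    (≤-by (0≤sq b) (solve 2 (λ a b → (a :* a :+ b :* b) :- a :* a := b :* b) refl a b))

-- ∣z∣² w = z̄ (z w).
no-zero-divisors : ∀ z w → z *ᶜ w ≈ᶜ 0ᶜ → ¬ (z ≈ᶜ 0ᶜ) → ¬ ¬ (w ≈ᶜ 0ᶜ)
no-zero-divisors z w (h , k) z≉0 w≉0 = z≉0 (norm²-null z (¬apart⇒null (norm² z) λ apart →
  w≉0 (null⇒≈0 {re w} (apart-cancel {norm² z} apart (null-ext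
        (λ n → solve 4 (λ a b c d → a :* (a :* c :- b :* d) :+ b :* (a :* d :+ b :* c) := (a :* a :+ b :* b) :* c) refl
          (seq (re z) n) (seq (im z) n) (seq (re w) n) (seq (im w) n))
        (null-+ (null-* (re z) (≈0⇒null {re (z *ᶜ w)} h)) (null-* (im z) (≈0⇒null {im (z *ᶜ w)} k))))) ,
       null⇒≈0 {im w} (apart-cancel {norm² z} apart (null-ext
        (λ n → solve 4 (λ a b c d → a :* (a :* d :+ b :* c) :+ :- (b :* (a :* c :- b :* d)) := (a :* a :+ b :* b) :* d) refl
          (seq (re z) n) (seq (im z) n) (seq (re w) n) (seq (im w) n))
        (null-+ (null-* (re z) (≈0⇒null {im (z *ᶜ w)} k)) (null-neg (null-* (im z) (≈0⇒null {re (z *ᶜ w)} h)))))))))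

≈ᴿ-stable : ∀ {x y} → ¬ ¬ (x ≈ᴿ y) → x ≈ᴿ y
≈ᴿ-stable {x} {y} h = ¬apart⇒null (x -ᴿ y) λ (δ , N , 0<δ , δ≤) → h λ x≈y →
  let M , f = x≈y δ 0<δ in
  ℚ.<-irrefl refl (ℚ.≤-<-trans (δ≤ (N ℕ.⊔ M) (ℕ.m≤m⊔n N M)) (f (N ℕ.⊔ M) (ℕ.m≤n⊔m N M)))

-- The only candidate for k is the integer nearest to an approximation of re z.
integrality-stable : ∀ z → ¬ ¬ (∃[ k ] z ≈ᶜ fromℤ k) → ∃[ k ] z ≈ᶜ fromℤ k
integrality-stable z h = k , stable
  where
  ¼ : ℚ
  ¼ = ½ ℚ.* ½
  N = proj₁ (cauchy (re z) ¼ (ℚ.positive⁻¹ ¼))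
  q = seq (re z) N
  near : ∀ l → z ≈ᶜ fromℤ l → ∣ ι l ℚ.- q ∣ ℚ.< ½
  near l (z≈l , _) = let M , f = z≈l ¼ (ℚ.positive⁻¹ ¼) ; n = N ℕ.⊔ M in
    subst (ℚ._< ½) (∣p-q∣-sym q (ι l)) (ℚ.≤-<-trans (triangle q (seq (re z) n) (ι l))
      (ℚ.+-mono-< (proj₂ (cauchy (re z) ¼ (ℚ.positive⁻¹ ¼)) N n ℕ.≤-refl (ℕ.m≤m⊔n N M)) (f n (ℕ.m≤n⊔m N M))))
  nearest : ∃[ k ] ∣ q ℚ.- ι k ∣ ℚ.≤ ½
  nearest with floor-bounds q
  ... | j , j≤q , q<j+1 with q ℚ.≤? ι j ℚ.+ ½
  ...   | yes q≤ = j , ∣∣-≤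
          (≤-by (≤⇒0≤- q≤) (solve 2 (λ q j → con ½ :- (q :- j) := j :+ con ½ :- q) refl q (ι j)))
          (≤-by (0≤+ (ℚ.<⇒≤ (ℚ.positive⁻¹ ½)) (≤⇒0≤- j≤q)) (solve 2 (λ q j → con ½ :- :- (q :- j) := con ½ :+ (q :- j)) refl q (ι j)))
  ...   | no q≰  = j ℤ.+ 1ℤ , subst (λ r → ∣ q ℚ.- r ∣ ℚ.≤ ½) (sym (ι-+ j 1ℤ)) (∣∣-≤
          (≤-by (0≤+ (ℚ.<⇒≤ (ℚ.positive⁻¹ ½)) (≤⇒0≤- (ℚ.<⇒≤ q<j+1)))
            (solve 2 (λ q j → con ½ :- (q :- (j :+ con 1ℚ)) := con ½ :+ (j :+ con 1ℚ :- q)) refl q (ι j)))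
          (≤-by (≤⇒0≤- (ℚ.<⇒≤ (ℚ.≰⇒> q≰)))
            (solve 2 (λ q j → con ½ :- :- (q :- (j :+ con 1ℚ)) := q :- (j :+ con ½)) refl q (ι j))))
  k = proj₁ nearest
  unique : ∀ l → z ≈ᶜ fromℤ l → l ≡ k
  unique l z≈l = ι-close l k (ℚ.≤-<-trans (triangle (ι l) q (ι k)) (ℚ.+-mono-<-≤ (near l z≈l) (proj₂ nearest)))
  found : ¬ ¬ (z ≈ᶜ fromℤ k)
  found ¬z≈k = h λ (l , z≈l) → ¬z≈k (subst (λ m → z ≈ᶜ fromℤ m) (unique l z≈l) z≈l)
  stable : z ≈ᶜ fromℤ k
  stable = ≈ᴿ-stable {re z} {re (fromℤ k)} (λ c → found (c ∘ proj₁)) ,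
           ≈ᴿ-stable {im z} {im (fromℤ k)} (λ c → found (c ∘ proj₂))

-- Real roots and the Lanczos process

record TameOn (R : ℚ) (f : ℚ → ℚ) : Set where
  field
    bound lipschitz : ℚ
    0≤bound         : 0ℚ ℚ.≤ bound
    0≤lipschitz     : 0ℚ ℚ.≤ lipschitz
    ∣f∣≤            : ∀ x → ∣ x ∣ ℚ.≤ R → ∣ f x ∣ ℚ.≤ bound
    ∣f-f∣≤          : ∀ x y → ∣ x ∣ ℚ.≤ R → ∣ y ∣ ℚ.≤ R → ∣ f x ℚ.- f y ∣ ℚ.≤ lipschitz ℚ.* ∣ x ℚ.- y ∣

Tame : (ℚ → ℚ) → Set
Tame f = ∀ R → TameOn R f

∣*∣-mono : ∀ {a b c d} → ∣ a ∣ ℚ.≤ b → ∣ c ∣ ℚ.≤ d → 0ℚ ℚ.≤ b → ∣ a ℚ.* c ∣ ℚ.≤ b ℚ.* d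
∣*∣-mono {a} {b} {c} {d} ∣a∣≤b ∣c∣≤d 0≤b = subst (ℚ._≤ b ℚ.* d) (sym (ℚ.∣p*q∣≡∣p∣*∣q∣ a c)) (ℚ.≤-trans
  (ℚ.*-monoʳ-≤-nonNeg ∣ c ∣ {{ℚ.nonNegative (ℚ.0≤∣p∣ c)}} ∣a∣≤b) (ℚ.*-monoˡ-≤-nonNeg b {{ℚ.nonNegative 0≤b}} ∣c∣≤d))

tame-const : ∀ c → Tame λ _ → c
tame-const c R = record
  { bound = ∣ c ∣ ; lipschitz = 0ℚ ; 0≤bound = ℚ.0≤∣p∣ c ; 0≤lipschitz = ℚ.≤-refl
  ; ∣f∣≤ = λ _ _ → ℚ.≤-refl
  ; ∣f-f∣≤ = λ x y _ _ → ℚ.≤-reflexive (trans (cong ∣_∣ (ℚ.+-inverseʳ c)) (sym (ℚ.*-zeroˡ ∣ x ℚ.- y ∣))) }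

tame-id : Tame λ x → x
tame-id R = record
  { bound = ∣ R ∣ ; lipschitz = 1ℚ ; 0≤bound = ℚ.0≤∣p∣ R ; 0≤lipschitz = ℚ.<⇒≤ 0<1
  ; ∣f∣≤ = λ _ h → ℚ.≤-trans h (p≤∣p∣ R)
  ; ∣f-f∣≤ = λ x y _ _ → ℚ.≤-reflexive (sym (ℚ.*-identityˡ _)) }

tame-+ : ∀ {f g} → Tame f → Tame g → Tame λ x → f x ℚ.+ g x
tame-+ {f} {g} F G R = record
  { bound = F.bound ℚ.+ G.bound ; lipschitz = F.lipschitz ℚ.+ G.lipschitz
  ; 0≤bound = 0≤+ F.0≤bound G.0≤bound ; 0≤lipschitz = 0≤+ F.0≤lipschitz G.0≤lipschitz
  ; ∣f∣≤ = λ x h → ℚ.≤-trans (ℚ.∣p+q∣≤∣p∣+∣q∣ (f x) (g x)) (ℚ.+-mono-≤ (F.∣f∣≤ x h) (G.∣f∣≤ x h))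
  ; ∣f-f∣≤ = λ x y hx hy → subst₂ ℚ._≤_
      (cong ∣_∣ (solve 4 (λ a b c d → (a :- c) :+ (b :- d) := (a :+ b) :- (c :+ d)) refl (f x) (g x) (f y) (g y)))
      (sym (ℚ.*-distribʳ-+ ∣ x ℚ.- y ∣ F.lipschitz G.lipschitz))
      (ℚ.≤-trans (ℚ.∣p+q∣≤∣p∣+∣q∣ (f x ℚ.- f y) (g x ℚ.- g y)) (ℚ.+-mono-≤ (F.∣f-f∣≤ x y hx hy) (G.∣f-f∣≤ x y hx hy))) }
  where module F = TameOn (F R) ; module G = TameOn (G R)

tame-* : ∀ {f g} → Tame f → Tame g → Tame λ x → f x ℚ.* g x
tame-* {f} {g} F G R = record
  { bound = F.bound ℚ.* G.bound ; lipschitz = F.bound ℚ.* G.lipschitz ℚ.+ G.bound ℚ.* F.lipschitz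
  ; 0≤bound = 0≤* F.0≤bound G.0≤bound
  ; 0≤lipschitz = 0≤+ (0≤* F.0≤bound G.0≤lipschitz) (0≤* G.0≤bound F.0≤lipschitz)
  ; ∣f∣≤ = λ x h → ∣*∣-mono (F.∣f∣≤ x h) (G.∣f∣≤ x h) F.0≤bound
  ; ∣f-f∣≤ = λ x y hx hy → subst₂ ℚ._≤_
      (cong ∣_∣ (solve 4 (λ a b c d → a :* (b :- d) :+ d :* (a :- c) := a :* b :- c :* d) refl (f x) (g x) (f y) (g y)))
      (solve 5 (λ a b c d e → a :* (b :* e) :+ c :* (d :* e) := (a :* b :+ c :* d) :* e) refl
        F.bound G.lipschitz G.bound F.lipschitz ∣ x ℚ.- y ∣)
      (ℚ.≤-trans (ℚ.∣p+q∣≤∣p∣+∣q∣ (f x ℚ.* (g x ℚ.- g y)) (g y ℚ.* (f x ℚ.- f y)))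
        (ℚ.+-mono-≤ (∣*∣-mono (F.∣f∣≤ x hx) (G.∣f-f∣≤ x y hx hy) F.0≤bound)
                    (∣*∣-mono (G.∣f∣≤ y hy) (F.∣f-f∣≤ x y hx hy) G.0≤bound))) }
  where module F = TameOn (F R) ; module G = TameOn (G R)

tame-ext : ∀ {f g} → (∀ x → f x ≡ g x) → Tame f → Tame g
tame-ext {f} {g} f≗g F R = record
  { bound = F.bound ; lipschitz = F.lipschitz ; 0≤bound = F.0≤bound ; 0≤lipschitz = F.0≤lipschitz
  ; ∣f∣≤ = λ x h → subst (λ q → ∣ q ∣ ℚ.≤ F.bound) (f≗g x) (F.∣f∣≤ x h)
  ; ∣f-f∣≤ = λ x y hx hy → subst (ℚ._≤ F.lipschitz ℚ.* ∣ x ℚ.- y ∣) (cong₂ (λ p q → ∣ p ℚ.- q ∣) (f≗g x) (f≗g y)) (F.∣f-f∣≤ x y hx hy) }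
  where module F = TameOn (F R)

tame-minus : ∀ {f g} → Tame f → Tame g → Tame λ x → f x ℚ.- g x
tame-minus {f} {g} F G = tame-ext (λ x → cong (f x ℚ.+_) (solve 1 (λ q → con (ℚ.- 1ℚ) :* q := :- q) refl (g x)))
  (tame-+ F (tame-* (tame-const (ℚ.- 1ℚ)) G))

tame-null : ∀ {f} → Tame f → ∀ x {y : ℕ → ℚ} → (∃[ B ] ∀ n → ∣ y n ∣ ℚ.≤ B) → Null (λ n → seq x n ℚ.- y n) → Null λ n → f (seq x n) ℚ.- f (y n)
tame-null {f} F x {y} (B , y≤B) x-y =
  let b , N , 0<b , x≤b = bounded x
      R = b ℚ.+ B
      0≤B = ℚ.≤-trans (ℚ.0≤∣p∣ (y 0)) (y≤B 0)
      module F = TameOn (F R)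
  in null-≤ (N , λ n N≤n → ℚ.≤-trans
       (F.∣f-f∣≤ (seq x n) (y n)
         (ℚ.≤-trans (x≤b n N≤n) (≤-by 0≤B (solve 2 (λ b B → b :+ B :- b := B) refl b B)))
         (ℚ.≤-trans (y≤B n) (≤-by (ℚ.<⇒≤ 0<b) (solve 2 (λ b B → b :+ B :- B := b) refl b B))))
       (ℚ.≤-reflexive (trans (cong (ℚ._* ∣ seq x n ℚ.- y n ∣) (sym (ℚ.0≤p⇒∣p∣≡p F.0≤lipschitz)))
         (sym (ℚ.∣p*q∣≡∣p∣*∣q∣ F.lipschitz (seq x n ℚ.- y n))))))
     (null-* (fromℚ F.lipschitz) x-y)

apply : ∀ {f} → Tame f → ℝ → ℝ
apply {f} F x = mkℝ (f ∘ seq x) λ η 0<η →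
  let b , N , 0<b , x≤b = bounded x
      module F = TameOn (F b)
      C = 1ℚ ℚ.+ F.lipschitz
      0<C = 0<+ 0<1 F.0≤lipschitz
      δ , 0<δ , Cδ≡η = divide 0<C 0<η
      M , close = cauchy x δ 0<δ
  in N ℕ.⊔ M , λ m n hm hn → ℚ.≤-<-trans
    (F.∣f-f∣≤ _ _ (x≤b m (ℕ.m⊔n≤o⇒m≤o N M hm)) (x≤b n (ℕ.m⊔n≤o⇒m≤o N M hn)))
    (ℚ.≤-<-trans
      (ℚ.*-monoʳ-≤-nonNeg ∣ seq x m ℚ.- seq x n ∣ {{ℚ.nonNegative (ℚ.0≤∣p∣ (seq x m ℚ.- seq x n))}}
        (≤-by {q = C} {p = F.lipschitz} (ℚ.<⇒≤ 0<1) (solve 1 (λ c → con 1ℚ :+ c :- c := con 1ℚ) refl F.lipschitz)))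
      (subst (C ℚ.* ∣ seq x m ℚ.- seq x n ∣ ℚ.<_) Cδ≡η
        (ℚ.*-monoʳ-<-pos C {{ℚ.positive 0<C}} (close m n (ℕ.m⊔n≤o⇒n≤o N M hm) (ℕ.m⊔n≤o⇒n≤o N M hn)))))

half^ : ℕ → ℚ
half^ zero    = 1ℚ
half^ (suc n) = ½ ℚ.* half^ n

0<half^ : ∀ n → 0ℚ ℚ.< half^ n
0<half^ zero    = 0<1
0<half^ (suc n) = halve (0<half^ n)

half^-≤ : ∀ n → half^ n ℚ.* ι (+ suc n) ℚ.≤ 1ℚ × half^ n ℚ.≤ 1ℚ
half^-≤ zero    = ℚ.≤-refl , ℚ.≤-refl
half^-≤ (suc n) = let p , q = half^-≤ n ; 0≤½ = ℚ.<⇒≤ (ℚ.positive⁻¹ ½) in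
  subst (λ i → ½ ℚ.* half^ n ℚ.* i ℚ.≤ 1ℚ) (sym (ι-+ 1ℤ (+ suc n)))
    (≤-by (0≤+ (0≤* 0≤½ (≤⇒0≤- q)) (0≤* 0≤½ (≤⇒0≤- p)))
      (solve 2 (λ h i → con 1ℚ :- con ½ :* h :* (con 1ℚ :+ i) := con ½ :* (con 1ℚ :- h) :+ con ½ :* (con 1ℚ :- h :* i)) refl
        (half^ n) (ι (+ suc n)))) ,
  ≤-by (0≤+ 0≤½ (0≤* 0≤½ (≤⇒0≤- q))) (solve 1 (λ h → con 1ℚ :- con ½ :* h := con ½ :+ con ½ :* (con 1ℚ :- h)) refl (half^ n))

i≤+∣i∣ : ∀ i → i ℤ.≤ + ℤ.∣ i ∣
i≤+∣i∣ (+ n)    = ℤ.≤-refl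
i≤+∣i∣ -[1+ n ] = ℤ.-≤+

null-half^ : Null half^
null-half^ η 0<η =
  let T , 0<T , ηT≡1 = divide 0<η 0<1
      j , _ , T<j+1 = floor-bounds T
  in ℤ.∣ j ∣ , λ n h →
    let T<n+1 : T ℚ.< ι (+ suc n)
        T<n+1 = ℚ.<-≤-trans T<j+1 (subst (ι j ℚ.+ 1ℚ ℚ.≤_) (trans (ℚ.+-comm (ι (+ n)) 1ℚ) (sym (ι-+ 1ℤ (+ n))))
                  (ℚ.+-monoˡ-≤ 1ℚ (ι-mono-≤ (ℤ.≤-trans (i≤+∣i∣ j) (ℤ.+≤+ h)))))
        0<h = 0<half^ n
    in subst (ℚ._< η) (sym (ℚ.0≤p⇒∣p∣≡p (ℚ.<⇒≤ 0<h)))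
      (<-by (0<+ (0<* (0<* 0<η 0<h) (<⇒0<- T<n+1)) (0≤* (ℚ.<⇒≤ 0<η) (≤⇒0≤- (proj₁ (half^-≤ n)))))
        (trans (cong (λ t → η ℚ.- t) (trans (sym (ℚ.*-identityʳ (half^ n))) (cong (half^ n ℚ.*_) (sym ηT≡1))))
          (solve 4 (λ e h t i → e :- h :* (e :* t) := e :* h :* (i :- t) :+ e :* (con 1ℚ :- h :* i)) refl
            η (half^ n) T (ι (+ suc n)))))

module Bisection {f} (F : Tame f) (l₀ r₀ : ℚ) (l₀≤r₀ : l₀ ℚ.≤ r₀) (fl₀≤0 : f l₀ ℚ.≤ 0ℚ) (0<fr₀ : 0ℚ ℚ.< f r₀) where

  private
    record Bracket (w : ℚ) : Set where
      no-eta-equality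
      field
        l r  : ℚ
        l₀≤l : l₀ ℚ.≤ l
        r≤r₀ : r ℚ.≤ r₀
        gap≡ : r ℚ.- l ≡ w
        fl≤0 : f l ℚ.≤ 0ℚ
        0<fr : 0ℚ ℚ.< f r

    width : ℕ → ℚ
    width n = half^ n ℚ.* (r₀ ℚ.- l₀)

    0≤width : ∀ n → 0ℚ ℚ.≤ width n
    0≤width n = 0≤* (ℚ.<⇒≤ (0<half^ n)) (≤⇒0≤- l₀≤r₀)

    refine : ∀ {n} (B : Bracket (width n)) → Σ[ C ∈ Bracket (width (suc n)) ]
             (Bracket.l B ℚ.≤ Bracket.l C × Bracket.r C ℚ.≤ Bracket.r B)
    refine {n} B with f (½ ℚ.* (Bracket.l B ℚ.+ Bracket.r B)) ℚ.≤? 0ℚ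
    ... | yes fm≤0 = record
          { l = m ; r = r ; l₀≤l = ℚ.≤-trans l₀≤l l≤m ; r≤r₀ = r≤r₀ ; fl≤0 = fm≤0 ; 0<fr = 0<fr
          ; gap≡ = trans (solve 2 (λ l r → r :- con ½ :* (l :+ r) := con ½ :* (r :- l)) refl l r)
                     (trans (cong (½ ℚ.*_) gap≡) (sym (ℚ.*-assoc ½ (half^ n) _))) } , l≤m , ℚ.≤-refl
      where
      open Bracket B
      m = ½ ℚ.* (l ℚ.+ r)
      l≤m : l ℚ.≤ m
      l≤m = ≤-by (subst (λ w → 0ℚ ℚ.≤ ½ ℚ.* w) (sym gap≡) (0≤* (ℚ.<⇒≤ (ℚ.positive⁻¹ ½)) (0≤width n)))
              (solve 2 (λ l r → con ½ :* (l :+ r) :- l := con ½ :* (r :- l)) refl l r)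
    ... | no fm≰0 = record
          { l = l ; r = m ; l₀≤l = l₀≤l ; r≤r₀ = ℚ.≤-trans m≤r r≤r₀ ; fl≤0 = fl≤0 ; 0<fr = ℚ.≰⇒> fm≰0
          ; gap≡ = trans (solve 2 (λ l r → con ½ :* (l :+ r) :- l := con ½ :* (r :- l)) refl l r)
                     (trans (cong (½ ℚ.*_) gap≡) (sym (ℚ.*-assoc ½ (half^ n) _))) } , ℚ.≤-refl , m≤r
      where
      open Bracket B
      m = ½ ℚ.* (l ℚ.+ r)
      m≤r : m ℚ.≤ r
      m≤r = ≤-by (subst (λ w → 0ℚ ℚ.≤ ½ ℚ.* w) (sym gap≡) (0≤* (ℚ.<⇒≤ (ℚ.positive⁻¹ ½)) (0≤width n)))
              (solve 2 (λ l r → r :- con ½ :* (l :+ r) := con ½ :* (r :- l)) refl l r)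

    brackets : ∀ n → Bracket (width n)
    brackets zero    = record { l = l₀ ; r = r₀ ; l₀≤l = ℚ.≤-refl ; r≤r₀ = ℚ.≤-refl
                              ; gap≡ = sym (ℚ.*-identityˡ _) ; fl≤0 = fl₀≤0 ; 0<fr = 0<fr₀ }
    brackets (suc n) = proj₁ (refine {n} (brackets n))

    module B n = Bracket (brackets n)

    l≤r : ∀ n → B.l n ℚ.≤ B.r n
    l≤r n = ≤-by (0≤width n) (B.gap≡ n)

    nested : ∀ {m n} → m ℕ.≤ n → B.l m ℚ.≤ B.l n × B.r n ℚ.≤ B.r m
    nested m≤n = nested′ (ℕ.≤⇒≤′ m≤n)
      where
      nested′ : ∀ {m n} → m ℕ.≤′ n → B.l m ℚ.≤ B.l n × B.r n ℚ.≤ B.r m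
      nested′ ℕ.≤′-refl       = ℚ.≤-refl , ℚ.≤-refl
      nested′ (ℕ.≤′-step {n} h) = let p , q = nested′ h ; p′ , q′ = proj₂ (refine {n} (brackets n)) in
        ℚ.≤-trans p p′ , ℚ.≤-trans q′ q

    within : ∀ {N m n} → N ℕ.≤ m → N ℕ.≤ n → B.r m ℚ.- B.r n ℚ.≤ width N
    within {N} {m} {n} N≤m N≤n = ≤-by
      (0≤+ (≤⇒0≤- (proj₂ (nested N≤m))) (0≤+ (≤⇒0≤- (proj₁ (nested N≤n))) (≤⇒0≤- (l≤r n))))
      (trans (cong (ℚ._- (B.r m ℚ.- B.r n)) (sym (B.gap≡ N)))
        (solve 5 (λ r l m n k → (r :- l) :- (m :- n) := (r :- m) :+ ((k :- l) :+ (n :- k))) refl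
          (B.r N) (B.l N) (B.r m) (B.r n) (B.l n)))

    width-null : Null width
    width-null = null-ext (λ n → ℚ.*-comm (r₀ ℚ.- l₀) (half^ n)) (null-* (fromℚ (r₀ ℚ.- l₀)) null-half^)

  root : ℝ
  root = mkℝ B.r λ η 0<η → let N , small = width-null η 0<η in
    N , λ m n N≤m N≤n → ℚ.≤-<-trans
      (∣∣-≤ (within N≤m N≤n) (subst (ℚ._≤ width N) (solve 2 (λ m n → n :- m := :- (m :- n)) refl (B.r m) (B.r n)) (within N≤n N≤m)))
      (subst (ℚ._< η) (ℚ.0≤p⇒∣p∣≡p (0≤width N)) (small N ℕ.≤-refl))

  l₀≤root : ∀ n → l₀ ℚ.≤ seq root n
  l₀≤root n = ℚ.≤-trans (B.l₀≤l n) (l≤r n)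

  0<f[root] : ∀ n → 0ℚ ℚ.< f (seq root n)
  0<f[root] n = B.0<fr n

  f[root]-null : Null (f ∘ seq root)
  f[root]-null = null-≤ (0 , λ n _ → subst₂ ℚ._≤_ (sym (ℚ.0≤p⇒∣p∣≡p (ℚ.<⇒≤ (B.0<fr n))))
      (sym (ℚ.0≤p⇒∣p∣≡p (0≤* 0≤lipschitz (0≤width n)))) (ℚ.≤-trans
        (≤-by (≤⇒0≤- (B.fl≤0 n)) (solve 2 (λ u v → (u :- v) :- u := con 0ℚ :- v) refl (f (B.r n)) (f (B.l n))))
        (ℚ.≤-trans (p≤∣p∣ (f (B.r n) ℚ.- f (B.l n)))
          (subst (λ w → ∣ f (B.r n) ℚ.- f (B.l n) ∣ ℚ.≤ lipschitz ℚ.* w)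
            (trans (cong ∣_∣ (B.gap≡ n)) (ℚ.0≤p⇒∣p∣≡p (0≤width n)))
            (∣f-f∣≤ (B.r n) (B.l n) (inside (ℚ.≤-trans (B.l₀≤l n) (l≤r n)) (B.r≤r₀ n)) (inside (B.l₀≤l n) (ℚ.≤-trans (l≤r n) (B.r≤r₀ n))))))))
    (null-* (fromℚ lipschitz) width-null)
    where
    R = ∣ l₀ ∣ ℚ.+ ∣ r₀ ∣
    open TameOn (F R)
    inside : ∀ {x} → l₀ ℚ.≤ x → x ℚ.≤ r₀ → ∣ x ∣ ℚ.≤ R
    inside {x} l₀≤x x≤r₀ = ∣∣-≤
      (ℚ.≤-trans x≤r₀ (ℚ.≤-trans (p≤∣p∣ r₀) (≤-by (ℚ.0≤∣p∣ l₀) (solve 2 (λ a b → (a :+ b) :- b := a) refl ∣ l₀ ∣ ∣ r₀ ∣))))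
      (ℚ.≤-trans (ℚ.neg-antimono-≤ l₀≤x) (ℚ.≤-trans (subst (ℚ.- l₀ ℚ.≤_) (ℚ.∣-p∣≡∣p∣ l₀) (p≤∣p∣ (ℚ.- l₀)))
        (≤-by (ℚ.0≤∣p∣ r₀) (solve 2 (λ a b → (a :+ b) :- a := b) refl ∣ l₀ ∣ ∣ r₀ ∣))))

abstract
  root-between : ∀ {f} → Tame f → ∀ l₀ r₀ → l₀ ℚ.≤ r₀ → f l₀ ℚ.≤ 0ℚ → 0ℚ ℚ.< f r₀ →
                 ∃[ x ] ((∀ n → l₀ ℚ.≤ seq x n) × (∀ n → 0ℚ ℚ.< f (seq x n)) × Null (f ∘ seq x))
  root-between F l₀ r₀ l₀≤r₀ fl₀≤0 0<fr₀ = root , l₀≤root , 0<f[root] , f[root]-null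
    where open Bisection F l₀ r₀ l₀≤r₀ fl₀≤0 0<fr₀

-- Polynomials given by a three-term recurrence, as orthogonal polynomials are.
module ThreeTerm (a b : ℕ → ℚ) where

  p : ℕ → ℚ → ℚ
  p zero          x = 1ℚ
  p (suc zero)    x = x ℚ.- a 0
  p (suc (suc k)) x = (x ℚ.- a (suc k)) ℚ.* p (suc k) x ℚ.- b (suc k) ℚ.* p k x

  p-tame : ∀ k → Tame (p k)
  p-tame zero          = tame-const 1ℚ
  p-tame (suc zero)    = tame-minus tame-id (tame-const (a 0))
  p-tame (suc (suc k)) = tame-minus (tame-* (tame-minus tame-id (tame-const (a (suc k)))) (p-tame (suc k)))
                                    (tame-* (tame-const (b (suc k))) (p-tame k))

  data Positive (x : ℚ) : ℕ → Set where
    zero : Positive x zero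
    suc  : ∀ {k} → Positive x k → 0ℚ ℚ.< p (suc k) x → Positive x (suc k)

  0<p : ∀ {k x} → Positive x k → 0ℚ ℚ.< p k x
  0<p zero       = 0<1
  0<p (suc _ 0<) = 0<

  module _ (d : ℕ) (0<b : ∀ k → k ℕ.< d → 0ℚ ℚ.< b k) where

    christoffel-darboux : ∀ {k x y} → k ℕ.< d → Positive x k → Positive y k → x ℚ.≤ y →
                          0ℚ ℚ.≤ p (suc k) y ℚ.* p k x ℚ.- p (suc k) x ℚ.* p k y
    christoffel-darboux {zero} {x} {y} _ _ _ x≤y = subst (0ℚ ℚ.≤_)
      (solve 3 (λ x y a → y :- x := (y :- a) :* con 1ℚ :- (x :- a) :* con 1ℚ) refl x y (a 0)) (≤⇒0≤- x≤y)
    christoffel-darboux {suc k} {x} {y} k<d X@(suc X′ 0<x) Y@(suc Y′ 0<y) x≤y = subst (0ℚ ℚ.≤_)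
      (solve 8 (λ x y a b px py qx qy → (y :- x) :* (px :* py) :+ b :* (py :* qx :- px :* qy)
         := ((y :- a) :* py :- b :* qy) :* px :- ((x :- a) :* px :- b :* qx) :* py) refl
         x y (a (suc k)) (b (suc k)) (p (suc k) x) (p (suc k) y) (p k x) (p k y))
      (0≤+ (0≤* (≤⇒0≤- x≤y) (0≤* (ℚ.<⇒≤ 0<x) (ℚ.<⇒≤ 0<y)))
           (0≤* (ℚ.<⇒≤ (0<b (suc k) k<d)) (christoffel-darboux (ℕ.<-trans (ℕ.n<1+n k) k<d) X′ Y′ x≤y)))

    increasing : ∀ {k x y} → k ℕ.≤ d → Positive x k → x ℚ.≤ y → Positive y k × p k x ℚ.≤ p k y
    increasing _ zero _ = zero , ℚ.≤-refl
    increasing {suc k} {x} {y} k<d (suc X 0<px) x≤y with increasing (ℕ.<⇒≤ k<d) X x≤y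
    ... | Y , qx≤qy = suc Y (ℚ.<-≤-trans 0<px px≤py) , px≤py
      where
      0<qx = 0<p X
      px≤py : p (suc k) x ℚ.≤ p (suc k) y
      px≤py = ℚ.*-cancelʳ-≤-pos (p k x) {{ℚ.positive 0<qx}} (≤-by
        (0≤+ (christoffel-darboux k<d X Y x≤y) (0≤* (ℚ.<⇒≤ 0<px) (≤⇒0≤- qx≤qy)))
        (solve 4 (λ px py qx qy → py :* qx :- px :* qx := (py :* qx :- px :* qy) :+ px :* (qy :- qx)) refl
          (p (suc k) x) (p (suc k) y) (p k x) (p k y)))

    eventually-positive : ∀ k → k ℕ.< d → ∃[ B ] ∀ x → B ℚ.≤ x → Positive x (suc k) × p k x ℚ.≤ p (suc k) x
    eventually-positive zero _ = a 0 ℚ.+ 1ℚ , λ x h →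
      let 1≤ = ≤-by (≤⇒0≤- h) (solve 2 (λ x a → (x :- a) :- con 1ℚ := x :- (a :+ con 1ℚ)) refl x (a 0))
      in suc zero (ℚ.<-≤-trans 0<1 1≤) , 1≤
    eventually-positive (suc k) k<d with eventually-positive k (ℕ.<-trans (ℕ.n<1+n k) k<d)
    ... | B , h = B ℚ.⊔ c , λ x B≤x →
      let X , qx≤px = h x (ℚ.≤-trans (ℚ.p≤p⊔q B c) B≤x)
          c≤x = ℚ.≤-trans (ℚ.p≤q⊔p B c) B≤x
          0<px = 0<p X
          px≤ : p (suc k) x ℚ.≤ p (suc (suc k)) x
          px≤ = ≤-by (0≤+ (0≤* (≤⇒0≤- c≤x) (ℚ.<⇒≤ 0<px)) (0≤+ (0≤* 0≤∣b∣-b (ℚ.<⇒≤ 0<px)) (0≤* (ℚ.<⇒≤ (0<b (suc k) k<d)) (≤⇒0≤- qx≤px))))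
            (solve 6 (λ x a b b′ px qx → ((x :- a) :* px :- b :* qx) :- px
              := (x :- (a :+ b′ :+ con 1ℚ)) :* px :+ ((b′ :- b) :* px :+ b :* (px :- qx))) refl
              x (a (suc k)) (b (suc k)) ∣ b (suc k) ∣ (p (suc k) x) (p k x))
      in suc X (ℚ.<-≤-trans 0<px px≤) , px≤
      where
      c = a (suc k) ℚ.+ ∣ b (suc k) ∣ ℚ.+ 1ℚ
      0≤∣b∣-b = ≤⇒0≤- (p≤∣p∣ (b (suc k)))

    root-right-of : ∀ k → k ℕ.< d → ∀ x₀ → p (suc k) x₀ ℚ.≤ 0ℚ →
      ∃[ x ] ((∀ n → x₀ ℚ.≤ seq x n) × (∀ n → 0ℚ ℚ.< p (suc k) (seq x n)) × Null (p (suc k) ∘ seq x))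
    root-right-of k k<d x₀ px₀≤0 = let B , h = eventually-positive k k<d in
      root-between (p-tame (suc k)) x₀ (x₀ ℚ.⊔ B) (ℚ.p≤p⊔q x₀ B) px₀≤0 (0<p (proj₁ (h (x₀ ℚ.⊔ B) (ℚ.p≤q⊔p x₀ B))))

    sign-change : ∀ k → k ℕ.< d → ∃[ x ] (p (suc k) x ℚ.≤ 0ℚ × Positive x k)
    sign-change zero _ = a 0 , ℚ.≤-reflexive (ℚ.+-inverseʳ (a 0)) , zero
    sign-change (suc k) k<d =
      let x₀ , px₀≤0 , X₀ = sign-change k k<d′
          root , x₀≤root , 0<p[root] , p[root]-null = root-right-of k k<d′ x₀ px₀≤0
          n , small = null-* (apply (tame-minus tame-id (tame-const (a (suc k)))) root) p[root]-null
                        (b (suc k) ℚ.* p k x₀) (0<* (0<b (suc k) k<d) (0<p X₀))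
      in below x₀ X₀ (seq root n) (x₀≤root n) (0<p[root] n) (small n ℕ.≤-refl)
      where
      k<d′ : k ℕ.< d
      k<d′ = ℕ.<-trans (ℕ.n<1+n k) k<d
      below : ∀ x₀ → Positive x₀ k → ∀ x → x₀ ℚ.≤ x → 0ℚ ℚ.< p (suc k) x →
              ∣ (x ℚ.- a (suc k)) ℚ.* p (suc k) x ∣ ℚ.< b (suc k) ℚ.* p k x₀ →
              ∃[ x ] (p (suc (suc k)) x ℚ.≤ 0ℚ × Positive x (suc k))
      below x₀ X₀ x x₀≤x 0<px small = let X , p≥ = increasing (ℕ.<⇒≤ k<d′) X₀ x₀≤x in x , ≤-by
        (0≤+ (≤⇒0≤- (ℚ.≤-trans (p≤∣p∣ ((x ℚ.- a (suc k)) ℚ.* p (suc k) x)) (ℚ.<⇒≤ small)))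
             (0≤* (ℚ.<⇒≤ (0<b (suc k) k<d)) (≤⇒0≤- p≥)))
        (solve 4 (λ s b q q₀ → con 0ℚ :- (s :- b :* q) := (b :* q₀ :- s) :+ b :* (q :- q₀)) refl
          ((x ℚ.- a (suc k)) ℚ.* p (suc k) x) (b (suc k)) (p k x) (p k x₀)) , suc X 0<px

    real-root : ∀ k → k ℕ.< d → ∃[ x ] Null (p (suc k) ∘ seq x)
    real-root k k<d =
      let x₀ , px₀≤0 , _ = sign-change k k<d
          x , _ , _ , px-null = root-right-of k k<d x₀ px₀≤0
      in x , px-null

module ∑ = SemiringSum (CommutativeRing.semiring ℚ.+-*-commutativeRing)

Vector : ℕ → Set
Vector N = Fin N → ℚ

sum-linear : ∀ {N} (f g : Vector N) c → ∑.sum (λ i → f i ℚ.+ c ℚ.* g i) ≡ ∑.sum f ℚ.+ c ℚ.* ∑.sum g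
sum-linear f g c = trans (∑.∑-distrib-+ f (λ i → c ℚ.* g i)) (cong (∑.sum f ℚ.+_) (sym (∑.*-distribˡ-sum c g)))

0≤sum : ∀ {N} (f : Vector N) → (∀ i → 0ℚ ℚ.≤ f i) → 0ℚ ℚ.≤ ∑.sum f
0≤sum {zero}  f 0≤f = ℚ.≤-refl
0≤sum {suc N} f 0≤f = 0≤+ (0≤f zero) (0≤sum (f ∘ suc) (0≤f ∘ suc))

-- inverse 0ℚ is 0ℚ.
inverse : ℚ → ℚ
inverse q with q ℚ.≟ 0ℚ
... | yes _  = 0ℚ
... | no q≢0 = (ℚ.1/ q) {{ℚ.≢-nonZero q≢0}}

inverse-* : ∀ {q} → q ≢ 0ℚ → inverse q ℚ.* q ≡ 1ℚ
inverse-* {q} q≢0 with q ℚ.≟ 0ℚ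
... | yes q≡0 = contradiction q≡0 q≢0
... | no q≢0′ = ℚ.*-inverseˡ q {{ℚ.≢-nonZero q≢0′}}

infix 8 _•_
_•_ : ∀ {N} → Vector N → Vector N → ℚ
u • v = ∑.sum λ i → u i ℚ.* v i

•-comm : ∀ {N} (u v : Vector N) → u • v ≡ v • u
•-comm u v = ∑.sum-cong-≗ λ i → ℚ.*-comm (u i) (v i)

•-linear : ∀ {N} (u v w : Vector N) c → (λ i → u i ℚ.+ c ℚ.* v i) • w ≡ u • w ℚ.+ c ℚ.* (v • w)
•-linear u v w c = trans
  (∑.sum-cong-≗ λ i → solve 4 (λ u v w c → (u :+ c :* v) :* w := u :* w :+ c :* (v :* w)) refl (u i) (v i) (w i) c)
  (sum-linear (λ i → u i ℚ.* w i) (λ i → v i ℚ.* w i) c)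

module Lanczos {N} (M : Fin N → Fin N → ℚ) (M-symmetric : ∀ i j → M i j ≡ M j i) where

  M·_ : Vector N → Vector N
  (M· v) i = M i • v

  M·-linear : ∀ u v c i → (M· (λ j → u j ℚ.+ c ℚ.* v j)) i ≡ (M· u) i ℚ.+ c ℚ.* (M· v) i
  M·-linear u v c i = trans (•-comm (M i) _) (trans (•-linear u v (M i) c)
    (cong₂ (λ s t → s ℚ.+ c ℚ.* t) (•-comm u (M i)) (•-comm v (M i))))

  self-adjoint : ∀ u v → (M· u) • v ≡ u • (M· v)
  self-adjoint u v = trans (∑.sum-cong-≗ λ i → ∑.*-distribʳ-sum (v i) (λ j → M i j ℚ.* u j))
    (trans (∑.∑-comm λ i j → M i j ℚ.* u j ℚ.* v i)
    (∑.sum-cong-≗ λ j → trans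
      (∑.sum-cong-≗ λ i → trans (cong (λ m → m ℚ.* u j ℚ.* v i) (M-symmetric i j))
        (solve 3 (λ m u v → m :* u :* v := u :* (m :* v)) refl (M j i) (u j) (v i)))
      (sym (∑.*-distribˡ-sum (u j) λ i → M j i ℚ.* v i))))

  module Krylov (u₀ : Vector N) where

    α : Vector N → ℚ
    α v = (M· v) • v ℚ.* inverse (v • v)

    u : ℕ → Vector N
    u zero            = u₀
    u (suc zero)    i = (M· u₀) i ℚ.+ ℚ.- α u₀ ℚ.* u₀ i
    u (suc (suc k)) i = (M· u (suc k)) i ℚ.+ ℚ.- α (u (suc k)) ℚ.* u (suc k) i
                        ℚ.+ ℚ.- (u (suc k) • u (suc k) ℚ.* inverse (u k • u k)) ℚ.* u k i

    h a b : ℕ → ℚ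
    h k = u k • u k
    a k = α (u k)
    b zero    = 1ℚ
    b (suc k) = h (suc k) ℚ.* inverse (h k)

    u₁• : ∀ w → u 1 • w ≡ (M· u 0) • w ℚ.+ ℚ.- a 0 ℚ.* (u 0 • w)
    u₁• w = •-linear (M· u 0) (u 0) w (ℚ.- a 0)

    u₂• : ∀ k w → u (suc (suc k)) • w ≡
          (M· u (suc k)) • w ℚ.+ ℚ.- a (suc k) ℚ.* (u (suc k) • w) ℚ.+ ℚ.- b (suc k) ℚ.* (u k • w)
    u₂• k w = trans (•-linear (λ i → (M· u (suc k)) i ℚ.+ ℚ.- a (suc k) ℚ.* u (suc k) i) (u k) w (ℚ.- b (suc k)))
      (cong (ℚ._+ ℚ.- b (suc k) ℚ.* (u k • w)) (•-linear (M· u (suc k)) (u (suc k)) w (ℚ.- a (suc k))))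

    α-h : ∀ v → v • v ≢ 0ℚ → α v ℚ.* (v • v) ≡ (M· v) • v
    α-h v v≢0 = trans (ℚ.*-assoc ((M· v) • v) (inverse (v • v)) (v • v))
      (trans (cong (λ t → (M· v) • v ℚ.* t) (inverse-* v≢0)) (ℚ.*-identityʳ ((M· v) • v)))

    b-h : ∀ k → h k ≢ 0ℚ → b (suc k) ℚ.* h k ≡ h (suc k)
    b-h k hk≢0 = trans (ℚ.*-assoc (h (suc k)) (inverse (h k)) (h k))
      (trans (cong (λ t → h (suc k) ℚ.* t) (inverse-* hk≢0)) (ℚ.*-identityʳ (h (suc k))))

    module _ (d : ℕ) (h≢0 : ∀ k → k ℕ.< d → h k ≢ 0ℚ) where

      Orthogonal : ℕ → Set
      Orthogonal j = ∀ i → i ℕ.< j → u j • u i ≡ 0ℚ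

      shift : ∀ j → Orthogonal j → ∀ i → i ℕ.< j → u j • (M· u i) ≡ u j • u (suc i)
      shift j ⊥ zero i<j = sym (trans (•-comm (u j) (u 1)) (trans (u₁• (u j)) (trans
        (cong₂ (λ s t → s ℚ.+ ℚ.- a 0 ℚ.* t) (•-comm (M· u 0) (u j)) (trans (•-comm (u 0) (u j)) (⊥ 0 i<j)))
        (solve 2 (λ s a → s :+ :- a :* con 0ℚ := s) refl (u j • (M· u 0)) (a 0)))))
      shift j ⊥ (suc i) i<j = sym (trans (•-comm (u j) (u (suc (suc i)))) (trans (u₂• i (u j)) (trans
        (cong₂ ℚ._+_ (cong₂ (λ s t → s ℚ.+ ℚ.- a (suc i) ℚ.* t) (•-comm (M· u (suc i)) (u j)) (trans (•-comm (u (suc i)) (u j)) (⊥ (suc i) i<j)))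
          (cong (ℚ.- b (suc i) ℚ.*_) (trans (•-comm (u i) (u j)) (⊥ i (ℕ.<-trans (ℕ.n<1+n i) i<j)))))
        (solve 3 (λ s a b → s :+ :- a :* con 0ℚ :+ :- b :* con 0ℚ := s) refl (u j • (M· u (suc i))) (a (suc i)) (b (suc i))))))

      orthogonal-step : ∀ k → suc k ℕ.≤ d → Orthogonal k → (∀ j → suc j ≡ k → Orthogonal j) → Orthogonal (suc k)
      orthogonal-step zero 0<d _ _ zero _ = trans (u₁• (u 0)) (trans
        (cong (λ s → s ℚ.+ ℚ.- a 0 ℚ.* (u 0 • u 0)) (sym (α-h (u 0) (h≢0 0 0<d))))
        (solve 2 (λ a h → a :* h :+ :- a :* h := con 0ℚ) refl (a 0) (h 0)))
      orthogonal-step zero 0<d _ _ (suc i) (ℕ.s≤s ())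
      orthogonal-step (suc k) k<d ⊥₁ ⊥₀ i (ℕ.s≤s i≤1+k) with ℕ.m≤n⇒m<n∨m≡n i≤1+k
      ... | inj₂ refl = trans (u₂• k (u (suc k))) (trans
        (cong₂ ℚ._+_ (cong (λ s → s ℚ.+ ℚ.- a (suc k) ℚ.* h (suc k)) (sym (α-h (u (suc k)) (h≢0 (suc k) k<d))))
          (cong (ℚ.- b (suc k) ℚ.*_) (trans (•-comm (u k) (u (suc k))) (⊥₁ k (ℕ.n<1+n k)))))
        (solve 3 (λ a h b → a :* h :+ :- a :* h :+ :- b :* con 0ℚ := con 0ℚ) refl (a (suc k)) (h (suc k)) (b (suc k))))
      ... | inj₁ i<1+k = trans (u₂• k (u i)) (trans
        (cong₂ ℚ._+_ (cong₂ (λ s t → s ℚ.+ ℚ.- a (suc k) ℚ.* t)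
            (trans (self-adjoint (u (suc k)) (u i)) (shift (suc k) ⊥₁ i i<1+k)) (⊥₁ i i<1+k)) refl)
        (rest (ℕ.m≤n⇒m<n∨m≡n (ℕ.≤-pred i<1+k))))
        where
        rest : i ℕ.< k ⊎ i ≡ k → u (suc k) • u (suc i) ℚ.+ ℚ.- a (suc k) ℚ.* 0ℚ ℚ.+ ℚ.- b (suc k) ℚ.* (u k • u i) ≡ 0ℚ
        rest (inj₂ refl) = trans
          (cong (λ s → s ℚ.+ ℚ.- a (suc k) ℚ.* 0ℚ ℚ.+ ℚ.- b (suc k) ℚ.* h k) (sym (b-h k (h≢0 k (ℕ.<-trans (ℕ.n<1+n k) k<d)))))
          (solve 3 (λ a b h → b :* h :+ :- a :* con 0ℚ :+ :- b :* h := con 0ℚ) refl (a (suc k)) (b (suc k)) (h k))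
        rest (inj₁ i<k) = trans
          (cong₂ (λ s t → s ℚ.+ ℚ.- a (suc k) ℚ.* 0ℚ ℚ.+ ℚ.- b (suc k) ℚ.* t) (⊥₁ (suc i) (ℕ.s≤s i<k)) (⊥₀ k refl i i<k))
          (solve 2 (λ a b → con 0ℚ :+ :- a :* con 0ℚ :+ :- b :* con 0ℚ := con 0ℚ) refl (a (suc k)) (b (suc k)))

      orthogonal : ∀ j → j ℕ.≤ d → Orthogonal j
      orthogonal j j≤d = proj₁ (both j j≤d)
        where
        both : ∀ j → j ℕ.≤ d → Orthogonal j × (∀ i → suc i ≡ j → Orthogonal i)
        both zero    _   = (λ _ ()) , λ _ ()
        both (suc j) j<d = let ⊥₁ , ⊥₀ = both j (ℕ.<⇒≤ j<d) in
          orthogonal-step j j<d ⊥₁ ⊥₀ , λ { _ refl → ⊥₁ }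

      -- The residues of the standard basis vectors after projecting away
      -- u 0, …, u (k - 1); each projection lowers the total square norm by 1.
      residue : ℕ → Fin N → Vector N
      residue zero    i j = if does (i Fin.≟ j) then 1ℚ else 0ℚ
      residue (suc k) i j = residue k i j ℚ.+ ℚ.- (inverse (h k) ℚ.* u k i) ℚ.* u k j

      residue-• : ∀ k l → k ℕ.≤ l → l ℕ.< d → ∀ i → residue k i • u l ≡ u l i
      residue-• zero    l _ _ i = δ-• i (u l)
        where
        δ-• : ∀ {N} (i : Fin N) (v : Vector N) → (λ j → if does (i Fin.≟ j) then 1ℚ else 0ℚ) • v ≡ v i
        δ-• {suc m} zero v = trans (cong₂ ℚ._+_ (ℚ.*-identityˡ (v zero))
          (trans (∑.sum-cong-≗ λ j → ℚ.*-zeroˡ (v (suc j))) (∑.sum-replicate-zero m))) (ℚ.+-identityʳ (v zero))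
        δ-• (suc i) v = trans (cong₂ ℚ._+_ (ℚ.*-zeroˡ (v zero)) (δ-• i (v ∘ suc))) (ℚ.+-identityˡ (v (suc i)))
      residue-• (suc k) l k<l l<d i = trans (•-linear (residue k i) (u k) (u l) (ℚ.- (inverse (h k) ℚ.* u k i))) (trans
        (cong₂ (λ s t → s ℚ.+ ℚ.- (inverse (h k) ℚ.* u k i) ℚ.* t) (residue-• k l (ℕ.<⇒≤ k<l) l<d i)
          (trans (•-comm (u k) (u l)) (orthogonal l (ℕ.<⇒≤ l<d) k k<l)))
        (solve 2 (λ s c → s :+ :- c :* con 0ℚ := s) refl (u l i) (inverse (h k) ℚ.* u k i)))

      total : ℕ → ℚ
      total k = ∑.sum λ i → residue k i • residue k i

      total-step : ∀ k → k ℕ.< d → total (suc k) ≡ total k ℚ.- 1ℚ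
      total-step k k<d = trans (∑.sum-cong-≗ expand) (trans
        (sum-linear (λ i → residue k i • residue k i) (λ i → u k i ℚ.* u k i)
          (inverse (h k) ℚ.* inverse (h k) ℚ.* h k ℚ.- ι (+ 2) ℚ.* inverse (h k)))
        (cong (λ c → total k ℚ.+ c) (trans (collect (inverse (h k)) (h k))
          (cong (λ x → x ℚ.* x ℚ.- ι (+ 2) ℚ.* x) (inverse-* (h≢0 k k<d))))))
        where
        collect : ∀ e h → (e ℚ.* e ℚ.* h ℚ.- ι (+ 2) ℚ.* e) ℚ.* h ≡ (e ℚ.* h) ℚ.* (e ℚ.* h) ℚ.- ι (+ 2) ℚ.* (e ℚ.* h)
        collect = solve 2 (λ e h → (e :* e :* h :- con (ι (+ 2)) :* e) :* h := (e :* h) :* (e :* h) :- con (ι (+ 2)) :* (e :* h)) refl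
        expand : ∀ i → residue (suc k) i • residue (suc k) i ≡
                 residue k i • residue k i ℚ.+ (inverse (h k) ℚ.* inverse (h k) ℚ.* h k ℚ.- ι (+ 2) ℚ.* inverse (h k)) ℚ.* (u k i ℚ.* u k i)
        expand i = trans (•-linear (residue k i) (u k) (residue (suc k) i) c) (trans
          (cong₂ (λ s t → s ℚ.+ c ℚ.* t)
            (trans (•-comm (residue k i) (residue (suc k) i)) (trans (•-linear (residue k i) (u k) (residue k i) c)
              (cong (λ s → residue k i • residue k i ℚ.+ c ℚ.* s) (trans (•-comm (u k) (residue k i)) ru))))
            (trans (•-comm (u k) (residue (suc k) i)) (trans (•-linear (residue k i) (u k) (u k) c) (cong (ℚ._+ c ℚ.* h k) ru))))
          (solve 4 (λ r e u h → (r :+ :- (e :* u) :* u) :+ :- (e :* u) :* (u :+ :- (e :* u) :* h)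
             := r :+ (e :* e :* h :- con (ι (+ 2)) :* e) :* (u :* u)) refl (residue k i • residue k i) (inverse (h k)) (u k i) (h k)))
          where
          c = ℚ.- (inverse (h k) ℚ.* u k i)
          ru : residue k i • u k ≡ u k i
          ru = residue-• k k ℕ.≤-refl k<d i

      total≡ : ∀ k → k ℕ.≤ d → total k ≡ ι (+ N) ℚ.- ι (+ k)
      total≡ zero    _   = trans (∑.sum-cong-≗ λ i → unit {N} i) (trans (ones N) (solve 1 (λ n → n := n :- con 0ℚ) refl (ι (+ N))))
        where
        unit : ∀ {N} (i : Fin N) → (λ j → if does (i Fin.≟ j) then 1ℚ else 0ℚ) • (λ j → if does (i Fin.≟ j) then 1ℚ else 0ℚ) ≡ 1ℚ
        unit {suc N} zero = trans (cong (1ℚ ℚ.+_) (∑.sum-replicate-zero N)) refl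
        unit {suc N} (suc i) = trans (ℚ.+-identityˡ ((λ j → if does (i Fin.≟ j) then 1ℚ else 0ℚ) • (λ j → if does (i Fin.≟ j) then 1ℚ else 0ℚ))) (unit {N} i)
        ones : ∀ N → ∑.sum {N} (λ _ → 1ℚ) ≡ ι (+ N)
        ones zero    = refl
        ones (suc N) = trans (cong (1ℚ ℚ.+_) (ones N)) (sym (ι-+ 1ℤ (+ N)))
      total≡ (suc k) k<d = trans (total-step k k<d) (trans (cong (ℚ._- 1ℚ) (total≡ k (ℕ.<⇒≤ k<d)))
        (trans (solve 2 (λ n k → (n :- k) :- con 1ℚ := n :- (con 1ℚ :+ k)) refl (ι (+ N)) (ι (+ k)))
          (cong (λ t → ι (+ N) ℚ.- t) (sym (ι-+ 1ℤ (+ k))))))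

      dimension : d ℕ.≤ N
      dimension = ℤ.drop‿+≤+ (ι-cancel-≤ (+ d) (+ N) (0≤-⇒≤ (subst (0ℚ ℚ.≤_) (total≡ d ℕ.≤-refl)
        (0≤sum (λ i → residue d i • residue d i) λ i → 0≤sum (λ j → residue d i j ℚ.* residue d i j) λ j → 0≤sq (residue d i j)))))

    first-zero : ∀ n → (∀ k → k ℕ.< n → h k ≢ 0ℚ) ⊎ (∃[ d ] (h d ≡ 0ℚ × (∀ k → k ℕ.< d → h k ≢ 0ℚ)))
    first-zero zero = inj₁ λ _ ()
    first-zero (suc n) with first-zero n
    ... | inj₂ found = inj₂ found
    ... | inj₁ h≢0 with h n ℚ.≟ 0ℚ
    ...   | yes hn≡0 = inj₂ (n , hn≡0 , h≢0)
    ...   | no hn≢0  = inj₁ λ k k<1+n → [ h≢0 k , (λ { refl → hn≢0 }) ]′ (ℕ.m≤n⇒m<n∨m≡n (ℕ.≤-pred k<1+n))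

    terminates : ∃[ d ] (h d ≡ 0ℚ × (∀ k → k ℕ.< d → h k ≢ 0ℚ))
    terminates with first-zero (suc N)
    ... | inj₂ found = found
    ... | inj₁ h≢0   = contradiction (dimension (suc N) h≢0) ℕ.1+n≰n

    open ThreeTerm a b

    ritz : ℕ → ℚ → Vector N
    ritz zero    x i = 0ℚ
    ritz (suc k) x i = ritz k x i ℚ.+ p k x ℚ.* (inverse (h k) ℚ.* u k i)

    ritz-tame : ∀ k i → Tame λ x → ritz k x i
    ritz-tame zero    i = tame-const 0ℚ
    ritz-tame (suc k) i = tame-+ (ritz-tame k i) (tame-* (p-tame k) (tame-const (inverse (h k) ℚ.* u k i)))

    M·u : ∀ k i → (M· u (suc k)) i ≡ u (suc (suc k)) i ℚ.+ a (suc k) ℚ.* u (suc k) i ℚ.+ b (suc k) ℚ.* u k i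
    M·u k i = solve 5 (λ m a u b v → m := (m :+ :- a :* u :+ :- b :* v) :+ a :* u :+ b :* v) refl
      ((M· u (suc k)) i) (a (suc k)) (u (suc k) i) (b (suc k)) (u k i)

    M·ritz : ∀ k x i → (∀ j → j ℕ.≤ k → h j ≢ 0ℚ) →
             (M· ritz (suc k) x) i ≡ x ℚ.* ritz (suc k) x i ℚ.+
               inverse (h k) ℚ.* (p k x ℚ.* u (suc k) i ℚ.- p (suc k) x ℚ.* u k i)
    M·ritz k x i h≢0 = trans (trans
      (∑.sum-cong-≗ λ j → cong (M i j ℚ.*_)
        (solve 4 (λ r p e u → r :+ p :* (e :* u) := r :+ p :* e :* u) refl (ritz k x j) (p k x) (inverse (h k)) (u k j)))
      (M·-linear (ritz k x) (u k) (p k x ℚ.* inverse (h k)) i))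
      (step k h≢0)
      where
      step : ∀ k → (∀ j → j ℕ.≤ k → h j ≢ 0ℚ) → (M· ritz k x) i ℚ.+ p k x ℚ.* inverse (h k) ℚ.* (M· u k) i ≡
             x ℚ.* ritz (suc k) x i ℚ.+ inverse (h k) ℚ.* (p k x ℚ.* u (suc k) i ℚ.- p (suc k) x ℚ.* u k i)
      step zero h≢0 = trans
        (cong (ℚ._+ 1ℚ ℚ.* inverse (h 0) ℚ.* (M· u 0) i)
          (trans (∑.sum-cong-≗ λ j → ℚ.*-zeroʳ (M i j)) (∑.sum-replicate-zero N)))
        (solve 5 (λ x e m a u → con 0ℚ :+ con 1ℚ :* e :* m :=
          x :* (con 0ℚ :+ con 1ℚ :* (e :* u)) :+ e :* (con 1ℚ :* (m :+ :- a :* u) :- (x :- a) :* u)) refl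
          x (inverse (h 0)) ((M· u 0) i) (a 0) (u 0 i))
      step (suc k) h≢0 = trans
        (cong₂ (λ s t → s ℚ.+ p (suc k) x ℚ.* inverse (h (suc k)) ℚ.* t)
          (M·ritz k x i λ j j≤k → h≢0 j (ℕ.m≤n⇒m≤1+n j≤k)) (M·u k i))
        (trans
          (solve 13 (λ x r e e′ h′ p p′ u u′ u″ a b one → (x :* r :+ e :* (p :* u′ :- p′ :* u)) :+ p′ :* e′ :* (u″ :+ a :* u′ :+ h′ :* e :* u)
             := (x :* (r :+ p′ :* (e′ :* u′)) :+ e′ :* (p′ :* u″ :- ((x :- a) :* p′ :- h′ :* e :* p) :* u′))
                :+ (con 1ℚ :- e′ :* h′) :* (e :* (p :* u′ :- p′ :* u))) refl
            x (ritz (suc k) x i) (inverse (h k)) (inverse (h (suc k))) (h (suc k)) (p k x) (p (suc k) x)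
            (u k i) (u (suc k) i) (u (suc (suc k)) i) (a (suc k)) 0ℚ 0ℚ)
          (drop (inverse-* (h≢0 (suc k) ℕ.≤-refl))))
        where
        drop : ∀ {o s t} → o ≡ 1ℚ → s ℚ.+ (1ℚ ℚ.- o) ℚ.* t ≡ s
        drop {s = s} {t} refl = solve 2 (λ s t → s :+ (con 1ℚ :- con 1ℚ) :* t := s) refl s t

    ritz-• : ∀ k → (∀ j → j ℕ.< suc k → h j ≢ 0ℚ) → ∀ x → ritz (suc k) x • u 0 ≡ 1ℚ
    ritz-• k h≢0 x = trans (trans (∑.sum-cong-≗ λ i → cong (ℚ._* u 0 i)
        (solve 4 (λ r p e u → r :+ p :* (e :* u) := r :+ p :* e :* u) refl (ritz k x i) (p k x) (inverse (h k)) (u k i)))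
      (•-linear (ritz k x) (u k) (u 0) (p k x ℚ.* inverse (h k)))) (step k h≢0)
      where
      step : ∀ k → (∀ j → j ℕ.< suc k → h j ≢ 0ℚ) → ritz k x • u 0 ℚ.+ p k x ℚ.* inverse (h k) ℚ.* (u k • u 0) ≡ 1ℚ
      step zero h≢0 = trans (cong₂ ℚ._+_ (trans (∑.sum-cong-≗ λ i → ℚ.*-zeroˡ (u 0 i)) (∑.sum-replicate-zero N))
        (trans (cong (ℚ._* h 0) (ℚ.*-identityˡ (inverse (h 0)))) (inverse-* (h≢0 0 (ℕ.s≤s ℕ.z≤n))))) (ℚ.+-identityˡ 1ℚ)
      step (suc k) h≢0 = trans (cong₂ (λ s t → s ℚ.+ p (suc k) x ℚ.* inverse (h (suc k)) ℚ.* t)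
          (ritz-• k (λ j j<1+k → h≢0 j (ℕ.m≤n⇒m≤1+n j<1+k)) x)
          (orthogonal (suc (suc k)) h≢0 (suc k) (ℕ.n≤1+n (suc k)) 0 (ℕ.s≤s ℕ.z≤n)))
        (solve 1 (λ c → con 1ℚ :+ c :* con 0ℚ := con 1ℚ) refl (p (suc k) x ℚ.* inverse (h (suc k))))

  IntegralSpectrum : Set
  IntegralSpectrum = ∀ (x : ℝ) (w : Fin N → ℝ) →
    (∀ i → Null λ n → (M· λ j → seq (w j) n) i ℚ.- seq x n ℚ.* seq (w i) n) →
    ¬ (∀ i → Null (seq (w i))) → ∃[ k ] Null (λ n → seq x n ℚ.- ι k)

  private
    inverse-positive : ∀ {q} → 0ℚ ℚ.< q → 0ℚ ℚ.< inverse q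
    inverse-positive {q} 0<q with q ℚ.≟ 0ℚ
    ... | yes refl = contradiction 0<q (ℚ.<-irrefl refl)
    ... | no q≢0  = ℚ.positive⁻¹ _ {{ℚ.1/pos⇒pos q {{ℚ.positive 0<q}}}}

    null-sum : ∀ {m} (s : Fin m → ℕ → ℚ) → (∀ i → Null (s i)) → Null λ n → ∑.sum λ i → s i n
    null-sum {zero}  s s₀ = null-0
    null-sum {suc m} s s₀ = null-+ (s₀ zero) (null-sum (s ∘ suc) (s₀ ∘ suc))

  square-zero : ∀ {m} (v : Vector m) → v • v ≡ 0ℚ → ∀ i → v i ≡ 0ℚ
  square-zero v v²≡0 i = decidable-stable (v i ℚ.≟ 0ℚ) λ vi≢0 →
    ℚ.<-irrefl (sym v²≡0) (0<v² v i vi≢0)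
    where
    0<v² : ∀ {m} (v : Vector m) i → v i ≢ 0ℚ → 0ℚ ℚ.< v • v
    0<v² v zero    vi≢0 = 0<+ (0<sq vi≢0) (0≤sum (λ i → v (suc i) ℚ.* v (suc i)) λ i → 0≤sq (v (suc i)))
    0<v² v (suc i) vi≢0 = subst (0ℚ ℚ.<_) (ℚ.+-comm ((v ∘ suc) • (v ∘ suc)) (v zero ℚ.* v zero))
      (0<+ (0<v² (v ∘ suc) i vi≢0) (0≤sq (v zero)))

  -- The characteristic polynomial of M on the Krylov space of u₀ has a real
  -- root x; the Ritz vector at x is an eigenvector, so x is an integer.
  rational-eigenvector : IntegralSpectrum → ∀ u₀ → u₀ • u₀ ≢ 0ℚ →
    ∃₂ λ k v → (∀ i → (M· v) i ≡ ι k ℚ.* v i) × v • u₀ ≡ 1ℚ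
  rational-eigenvector integral u₀ u₀≢0 with Krylov.terminates u₀
  ... | zero  , h≡0 , _   = contradiction h≡0 u₀≢0
  ... | suc k , h≡0 , h≢0 = c , v , M·v , ritz-• k h≢0 (ι c)
    where
    open Krylov u₀
    open ThreeTerm a b
    d = suc k
    0<h : ∀ {j} → j ℕ.< d → 0ℚ ℚ.< h j
    0<h {j} j<d = ℚ.≰⇒> λ h≤0 → h≢0 j j<d (ℚ.≤-antisym h≤0 (0≤sum (λ i → u j i ℚ.* u j i) λ i → 0≤sq (u j i)))
    0<b : ∀ j → j ℕ.< d → 0ℚ ℚ.< b j
    0<b zero    _   = 0<1
    0<b (suc j) j<d = 0<* (0<h j<d) (inverse-positive (0<h (ℕ.<-trans (ℕ.n<1+n j) j<d)))
    x = proj₁ (real-root d 0<b k (ℕ.n<1+n k))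
    px = proj₂ (real-root d 0<b k (ℕ.n<1+n k))
    u≡0 : ∀ i → u d i ≡ 0ℚ
    u≡0 = square-zero (u d) h≡0
    w : Fin N → ℝ
    w i = apply (ritz-tame d i) x
    eigen : ∀ y i → (M· ritz d y) i ℚ.- y ℚ.* ritz d y i ≡ ℚ.- (inverse (h k) ℚ.* u k i) ℚ.* p d y
    eigen y i = trans (cong₂ ℚ._-_ (M·ritz k y i λ j j≤k → h≢0 j (ℕ.s≤s j≤k)) refl) (trans
      (cong (λ t → y ℚ.* ritz d y i ℚ.+ inverse (h k) ℚ.* (p k y ℚ.* t ℚ.- p d y ℚ.* u k i) ℚ.- y ℚ.* ritz d y i) (u≡0 i))
      (solve 5 (λ r e p p′ u → r :+ e :* (p :* con 0ℚ :- p′ :* u) :- r := :- (e :* u) :* p′) refl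
        (y ℚ.* ritz d y i) (inverse (h k)) (p k y) (p d y) (u k i)))
    found = integral x w
      (λ i → null-ext (λ n → sym (eigen (seq x n) i)) (null-* (fromℚ (ℚ.- (inverse (h k) ℚ.* u k i))) px))
      (λ w₀ → contradiction (null-const {1ℚ} (null-ext (λ n → ritz-• k h≢0 (seq x n))
        (null-sum (λ i n → ritz d (seq x n) i ℚ.* u 0 i) λ i →
          null-ext (λ n → ℚ.*-comm (u 0 i) (ritz d (seq x n) i)) (null-* (fromℚ (u 0 i)) (w₀ i))))) λ ())
    c = proj₁ found
    v = ritz d (ι c)
    p≡0 : p d (ι c) ≡ 0ℚ
    p≡0 = null-const (null-ext (λ n → solve 2 (λ s t → s :- (s :- t) := t) refl (p d (seq x n)) (p d (ι c)))
      (null-+ px (null-neg (tame-null (p-tame d) x {λ _ → ι c} (∣ ι c ∣ , λ _ → ℚ.≤-refl) (proj₂ found)))))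
    M·v : ∀ i → (M· v) i ≡ ι c ℚ.* v i
    M·v i = trans (solve 2 (λ s t → s := (s :- t) :+ t) refl ((M· v) i) (ι c ℚ.* v i))
      (trans (cong (ℚ._+ ι c ℚ.* v i) (trans (eigen (ι c) i) (trans (cong (ℚ.- (inverse (h k) ℚ.* u k i) ℚ.*_) p≡0)
        (ℚ.*-zeroʳ (ℚ.- (inverse (h k) ℚ.* u k i)))))) (ℚ.+-identityˡ (ι c ℚ.* v i)))

-- Operators with integral spectrum

module Operator {I : Set} (L : (I → ℚ) → I → ℚ)
  (L-ext : ∀ {F G} → F ≗ G → L F ≗ L G)
  (L-linear : ∀ F G c i → L (λ i → F i ℚ.+ c ℚ.* G i) i ≡ L F i ℚ.+ c ℚ.* L G i) where

  Eigenvector : ℤ → (I → ℚ) → Set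
  Eigenvector c F = ∀ i → L F i ≡ ι c ℚ.* F i

  L-scale : ∀ F c i → L (λ i → c ℚ.* F i) i ≡ c ℚ.* L F i
  L-scale F c i = trans (L-ext (λ i → solve 2 (λ c f → c :* f := f :+ (c :- con 1ℚ) :* f) refl c (F i)) i)
    (trans (L-linear F F (c ℚ.- 1ℚ) i) (solve 2 (λ c f → f :+ (c :- con 1ℚ) :* f := c :* f) refl c (L F i)))

  infixl 7 _⊖_
  _⊖_ : (I → ℚ) → ℤ → I → ℚ
  (F ⊖ c) i = L F i ℚ.- ι c ℚ.* F i

  -- (L - lo) (L - (lo + 1)) ⋯ (L - (lo + m - 1))
  prod : ℤ → ℕ → (I → ℚ) → I → ℚ
  prod lo zero    F = F
  prod lo (suc m) F = prod (ℤ.suc lo) m (F ⊖ lo)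

  scalar : ℤ → ℕ → ℤ → ℚ
  scalar lo zero    c = 1ℚ
  scalar lo (suc m) c = (ι c ℚ.- ι lo) ℚ.* scalar (ℤ.suc lo) m c

  ⊖-ext : ∀ {F G} c → F ≗ G → F ⊖ c ≗ G ⊖ c
  ⊖-ext c F≗G i = cong₂ (λ s t → s ℚ.- ι c ℚ.* t) (L-ext F≗G i) (F≗G i)

  ⊖-linear : ∀ F G r c i → ((λ i → F i ℚ.+ r ℚ.* G i) ⊖ c) i ≡ (F ⊖ c) i ℚ.+ r ℚ.* (G ⊖ c) i
  ⊖-linear F G r c i = trans (cong (ℚ._- ι c ℚ.* (F i ℚ.+ r ℚ.* G i)) (L-linear F G r i))
    (solve 6 (λ lf lg f g r c → (lf :+ r :* lg) :- c :* (f :+ r :* g) := (lf :- c :* f) :+ r :* (lg :- c :* g)) refl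
      (L F i) (L G i) (F i) (G i) r (ι c))

  ⊖-comm : ∀ F c d → F ⊖ c ⊖ d ≗ F ⊖ d ⊖ c
  ⊖-comm F c d i = trans (unfold c d) (trans
    (solve 5 (λ llf lf f c d → (llf :+ :- c :* lf) :- d :* (lf :- c :* f) := (llf :+ :- d :* lf) :- c :* (lf :- d :* f)) refl
      (L (L F) i) (L F i) (F i) (ι c) (ι d))
    (sym (unfold d c)))
    where
    unfold : ∀ c d → (F ⊖ c ⊖ d) i ≡ (L (L F) i ℚ.+ ℚ.- ι c ℚ.* L F i) ℚ.- ι d ℚ.* (L F i ℚ.- ι c ℚ.* F i)
    unfold c d = cong (ℚ._- ι d ℚ.* (F ⊖ c) i) (trans
      (L-ext (λ i → solve 3 (λ lf c f → lf :- c :* f := lf :+ :- c :* f) refl (L F i) (ι c) (F i)) i)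
      (L-linear (L F) F (ℚ.- ι c) i))

  prod-ext : ∀ lo m {F G} → F ≗ G → prod lo m F ≗ prod lo m G
  prod-ext lo zero    F≗G = F≗G
  prod-ext lo (suc m) F≗G = prod-ext (ℤ.suc lo) m (⊖-ext lo F≗G)

  prod-linear : ∀ lo m F G r i → prod lo m (λ i → F i ℚ.+ r ℚ.* G i) i ≡ prod lo m F i ℚ.+ r ℚ.* prod lo m G i
  prod-linear lo zero    F G r i = refl
  prod-linear lo (suc m) F G r i = trans (prod-ext (ℤ.suc lo) m (⊖-linear F G r lo) i)
    (prod-linear (ℤ.suc lo) m (F ⊖ lo) (G ⊖ lo) r i)

  prod-scale : ∀ lo m F c i → prod lo m (λ i → c ℚ.* F i) i ≡ c ℚ.* prod lo m F i
  prod-scale lo m F c i = trans (prod-ext lo m (λ i → solve 2 (λ c f → c :* f := f :+ (c :- con 1ℚ) :* f) refl c (F i)) i)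
    (trans (prod-linear lo m F F (c ℚ.- 1ℚ) i) (solve 2 (λ c f → f :+ (c :- con 1ℚ) :* f := c :* f) refl c (prod lo m F i)))

  prod-⊖ : ∀ lo m F c → prod lo m (F ⊖ c) ≗ prod lo m F ⊖ c
  prod-⊖ lo zero    F c i = refl
  prod-⊖ lo (suc m) F c i = trans (prod-ext (ℤ.suc lo) m (⊖-comm F c lo) i) (prod-⊖ (ℤ.suc lo) m (F ⊖ lo) c i)

  prod-eigen : ∀ lo m {c F} → Eigenvector c F → ∀ i → prod lo m F i ≡ scalar lo m c ℚ.* F i
  prod-eigen lo zero    {F = F} e i = sym (ℚ.*-identityˡ (F i))
  prod-eigen lo (suc m) {c} {F} e i = trans
    (prod-ext (ℤ.suc lo) m (λ i → trans (cong (ℚ._- ι lo ℚ.* F i) (e i))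
      (solve 3 (λ c l f → c :* f :- l :* f := (c :- l) :* f) refl (ι c) (ι lo) (F i))) i)
    (trans (prod-scale (ℤ.suc lo) m F (ι c ℚ.- ι lo) i)
      (trans (cong ((ι c ℚ.- ι lo) ℚ.*_) (prod-eigen (ℤ.suc lo) m e i)) (sym (ℚ.*-assoc (ι c ℚ.- ι lo) _ (F i)))))

  scalar-zero : ∀ lo m c → lo ℤ.≤ c → c ℤ.< + m ℤ.+ lo → scalar lo m c ≡ 0ℚ
  scalar-zero lo zero    c lo≤c c< = contradiction (ℤ.≤-<-trans lo≤c (subst (c ℤ.<_) (ℤ.+-identityˡ lo) c<)) (ℤ.<-irrefl refl)
  scalar-zero lo (suc m) c lo≤c c< with lo ℤ.≟ c
  ... | yes refl = trans (cong (ℚ._* scalar (ℤ.suc lo) m lo) (ℚ.+-inverseʳ (ι lo))) (ℚ.*-zeroˡ (scalar (ℤ.suc lo) m lo))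
  ... | no lo≢c  = trans (cong ((ι c ℚ.- ι lo) ℚ.*_) (scalar-zero (ℤ.suc lo) m c (ℤ.i<j⇒suc[i]≤j (ℤ.≤∧≢⇒< lo≤c lo≢c))
                     (subst (c ℤ.<_) (ℤS.solve 2 (λ m lo → (ℤS.con 1ℤ ℤS.:+ m) ℤS.:+ lo ℤS.:= m ℤS.:+ (ℤS.con 1ℤ ℤS.:+ lo)) refl (+ m) lo) c<)))
                     (ℚ.*-zeroʳ (ι c ℚ.- ι lo))

  scalar-nonzero : ∀ lo m c → c ℤ.< lo → scalar lo m c ≢ 0ℚ
  scalar-nonzero lo zero    c c<lo = λ ()
  scalar-nonzero lo (suc m) c c<lo eq = scalar-nonzero (ℤ.suc lo) m c (ℤ.<-trans c<lo (ℤ.suc[i]≤j⇒i<j ℤ.≤-refl)) (begin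
    scalar (ℤ.suc lo) m c                                ≡⟨ ℚ.*-identityˡ _ ⟨
    1ℚ ℚ.* scalar (ℤ.suc lo) m c                         ≡⟨ cong (ℚ._* scalar (ℤ.suc lo) m c) (inverse-* x≢0) ⟨
    inverse x ℚ.* x ℚ.* scalar (ℤ.suc lo) m c            ≡⟨ ℚ.*-assoc (inverse x) x _ ⟩
    inverse x ℚ.* (x ℚ.* scalar (ℤ.suc lo) m c)          ≡⟨ cong (inverse x ℚ.*_) eq ⟩
    inverse x ℚ.* 0ℚ                                     ≡⟨ ℚ.*-zeroʳ (inverse x) ⟩
    0ℚ                                                   ∎)
    where
    open ≡-Reasoning
    x = ι c ℚ.- ι lo
    x≢0 : x ≢ 0ℚ
    x≢0 x≡0 = ℤ.<-irrefl (ι-injective (trans (solve 2 (λ c l → c := (c :- l) :+ l) refl (ι c) (ι lo))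
      (trans (cong (ℚ._+ ι lo) x≡0) (ℚ.+-identityˡ (ι lo))))) c<lo

  module SelfAdjoint (S : (I → ℚ) → ℚ)
    (S-ext : ∀ {F G} → F ≗ G → S F ≡ S G)
    (S-linear : ∀ F G c → S (λ i → F i ℚ.+ c ℚ.* G i) ≡ S F ℚ.+ c ℚ.* S G)
    (0≤S : ∀ F → (∀ i → 0ℚ ℚ.≤ F i) → 0ℚ ℚ.≤ S F)
    (L-self-adjoint : ∀ F G → S (λ i → L F i ℚ.* G i) ≡ S (λ i → F i ℚ.* L G i)) where

    ⟨_,_⟩ : (I → ℚ) → (I → ℚ) → ℚ
    ⟨ F , G ⟩ = S λ i → F i ℚ.* G i

    ⟨⟩-ext : ∀ {F F′ G G′} → F ≗ F′ → G ≗ G′ → ⟨ F , G ⟩ ≡ ⟨ F′ , G′ ⟩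
    ⟨⟩-ext h k = S-ext λ i → cong₂ ℚ._*_ (h i) (k i)

    ⟨⟩-sym : ∀ F G → ⟨ F , G ⟩ ≡ ⟨ G , F ⟩
    ⟨⟩-sym F G = S-ext λ i → ℚ.*-comm (F i) (G i)

    ⟨⟩-linear : ∀ F G H c → ⟨ (λ i → F i ℚ.+ c ℚ.* G i) , H ⟩ ≡ ⟨ F , H ⟩ ℚ.+ c ℚ.* ⟨ G , H ⟩
    ⟨⟩-linear F G H c = trans (S-ext λ i → solve 4 (λ f g h c → (f :+ c :* g) :* h := f :* h :+ c :* (g :* h)) refl (F i) (G i) (H i) c)
      (S-linear (λ i → F i ℚ.* H i) (λ i → G i ℚ.* H i) c)

    ⟨⟩-scale : ∀ F G c → ⟨ (λ i → c ℚ.* F i) , G ⟩ ≡ c ℚ.* ⟨ F , G ⟩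
    ⟨⟩-scale F G c = trans (⟨⟩-ext (λ i → solve 2 (λ c f → c :* f := f :+ (c :- con 1ℚ) :* f) refl c (F i)) λ _ → refl)
      (trans (⟨⟩-linear F F G (c ℚ.- 1ℚ)) (solve 2 (λ c f → f :+ (c :- con 1ℚ) :* f := c :* f) refl c ⟨ F , G ⟩))

    ⟨⟩-zeroʳ : ∀ F {G} → (∀ i → G i ≡ 0ℚ) → ⟨ F , G ⟩ ≡ 0ℚ
    ⟨⟩-zeroʳ F {G} G≡0 = trans (⟨⟩-sym F G) (trans (⟨⟩-ext (λ i → trans (G≡0 i) (sym (ℚ.*-zeroˡ (F i)))) λ _ → refl)
      (trans (⟨⟩-scale F F 0ℚ) (ℚ.*-zeroˡ ⟨ F , F ⟩)))

    ⊖-self-adjoint : ∀ F G c → ⟨ F ⊖ c , G ⟩ ≡ ⟨ F , G ⊖ c ⟩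
    ⊖-self-adjoint F G c = trans (expand F G) (trans (cong₂ (λ s t → s ℚ.+ ℚ.- ι c ℚ.* t) (trans (L-self-adjoint F G) (⟨⟩-sym F (L G))) (⟨⟩-sym F G))
      (trans (sym (expand G F)) (⟨⟩-sym (G ⊖ c) F)))
      where
      expand : ∀ F G → ⟨ F ⊖ c , G ⟩ ≡ ⟨ L F , G ⟩ ℚ.+ ℚ.- ι c ℚ.* ⟨ F , G ⟩
      expand F G = trans (⟨⟩-ext (λ i → solve 3 (λ lf c f → lf :- c :* f := lf :+ :- c :* f) refl (L F i) (ι c) (F i)) λ _ → refl)
        (⟨⟩-linear (L F) F G (ℚ.- ι c))

    prod-self-adjoint : ∀ lo m F G → ⟨ prod lo m F , G ⟩ ≡ ⟨ F , prod lo m G ⟩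
    prod-self-adjoint lo zero    F G = refl
    prod-self-adjoint lo (suc m) F G = trans (prod-self-adjoint (ℤ.suc lo) m (F ⊖ lo) G)
      (trans (⊖-self-adjoint F (prod (ℤ.suc lo) m G) lo) (⟨⟩-ext {F} (λ _ → refl) λ i → sym (prod-⊖ (ℤ.suc lo) m G lo i)))

    Killed : ℤ → ℕ → (I → ℚ) → Set
    Killed lo m F = ∀ i → prod lo m F i ≡ 0ℚ

    record Splitting (lo : ℤ) (m : ℕ) (F : I → ℚ) : Set where
      field
        E R   : I → ℚ
        sum   : ∀ i → F i ≡ R i ℚ.+ 1ℚ ℚ.* E i
        eigen : Eigenvector lo E
        rest  : Killed (ℤ.suc lo) m R
        E⊥R   : ⟨ E , R ⟩ ≡ 0ℚ

    split-off : ∀ lo m F → Killed lo (suc m) F → Splitting lo m F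
    split-off lo m F killed = record { E = E ; R = R ; sum = λ i → solve 2 (λ f e → f := (f :- e) :+ con 1ℚ :* e) refl (F i) (E i) ; eigen = eigen ; rest = rest ; E⊥R = E⊥R }
      where
      s = scalar (ℤ.suc lo) m lo
      s≢0 : s ≢ 0ℚ
      s≢0 = scalar-nonzero (ℤ.suc lo) m lo (ℤ.suc[i]≤j⇒i<j ℤ.≤-refl)
      P = prod (ℤ.suc lo) m F
      E R : I → ℚ
      E i = inverse s ℚ.* P i
      R i = F i ℚ.- E i
      eigenP : Eigenvector lo P
      eigenP i = trans (solve 2 (λ x y → x := (x :- y) :+ y) refl (L P i) (ι lo ℚ.* P i))
        (trans (cong (ℚ._+ ι lo ℚ.* P i) (trans (sym (prod-⊖ (ℤ.suc lo) m F lo i)) (killed i))) (ℚ.+-identityˡ (ι lo ℚ.* P i)))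
      eigen : Eigenvector lo E
      eigen i = trans (L-scale P (inverse s) i) (trans (cong (inverse s ℚ.*_) (eigenP i))
        (solve 3 (λ s l p → s :* (l :* p) := l :* (s :* p)) refl (inverse s) (ι lo) (P i)))
      rest : Killed (ℤ.suc lo) m R
      rest i = trans (prod-ext (ℤ.suc lo) m (λ i → solve 2 (λ f e → f :- e := f :+ con (ℚ.- 1ℚ) :* e) refl (F i) (E i)) i)
        (trans (prod-linear (ℤ.suc lo) m F E (ℚ.- 1ℚ) i)
          (trans (cong (λ x → P i ℚ.+ ℚ.- 1ℚ ℚ.* x) (trans (prod-eigen (ℤ.suc lo) m eigen i)
            (trans (solve 3 (λ s r p → s :* (r :* p) := (r :* s) :* p) refl s (inverse s) (P i))
              (cong (ℚ._* P i) (inverse-* s≢0)))))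
            (solve 1 (λ p → p :+ con (ℚ.- 1ℚ) :* (con 1ℚ :* p) := con 0ℚ) refl (P i))))
      E⊥R : ⟨ E , R ⟩ ≡ 0ℚ
      E⊥R = trans (⟨⟩-scale P R (inverse s)) (trans (cong (inverse s ℚ.*_)
        (trans (prod-self-adjoint (ℤ.suc lo) m F R) (⟨⟩-zeroʳ F rest))) (ℚ.*-zeroʳ (inverse s)))

    gap-nonneg : ∀ k lo m F → Killed lo m F → 0ℚ ℚ.≤ ⟨ F ⊖ k , F ⊖ ℤ.suc k ⟩
    gap-nonneg k lo zero F killed = ℚ.≤-reflexive (sym (⟨⟩-zeroʳ (F ⊖ k)
      λ i → trans (⊖-ext (ℤ.suc k) (λ i → trans (killed i) (sym (ℚ.*-zeroˡ (F i)))) i)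
        (trans (cong (ℚ._- ι (ℤ.suc k) ℚ.* (0ℚ ℚ.* F i)) (L-scale F 0ℚ i))
          (solve 3 (λ x y k → con 0ℚ :* x :- k :* (con 0ℚ :* y) := con 0ℚ) refl (L F i) (F i) (ι (ℤ.suc k))))))
    gap-nonneg k lo (suc m) F killed = subst (0ℚ ℚ.≤_) (sym expand)
      (0≤+ (gap-nonneg k (ℤ.suc lo) m R rest) (0≤* 0≤gap (0≤S (λ i → E i ℚ.* E i) λ i → 0≤sq (E i))))
      where
      open Splitting (split-off lo m F killed)
      x y : ℚ
      x = ι lo ℚ.- ι k
      y = ι lo ℚ.- ι (ℤ.suc k)
      ⊖E : ∀ c i → (E ⊖ c) i ≡ (ι lo ℚ.- ι c) ℚ.* E i
      ⊖E c i = trans (cong (ℚ._- ι c ℚ.* E i) (eigen i)) (solve 3 (λ l c e → l :* e :- c :* e := (l :- c) :* e) refl (ι lo) (ι c) (E i))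
      ⊖F : ∀ c i → (F ⊖ c) i ≡ (R ⊖ c) i ℚ.+ (ι lo ℚ.- ι c) ℚ.* E i
      ⊖F c i = trans (⊖-ext c sum i) (trans (⊖-linear R E 1ℚ c i)
        (cong ((R ⊖ c) i ℚ.+_) (trans (ℚ.*-identityˡ ((E ⊖ c) i)) (⊖E c i))))
      E⊥ : ∀ c → ⟨ E , R ⊖ c ⟩ ≡ 0ℚ
      E⊥ c = trans (sym (⊖-self-adjoint E R c)) (trans (⟨⟩-ext {G = R} (⊖E c) λ _ → refl)
        (trans (⟨⟩-scale E R (ι lo ℚ.- ι c)) (trans (cong ((ι lo ℚ.- ι c) ℚ.*_) E⊥R) (ℚ.*-zeroʳ (ι lo ℚ.- ι c)))))
      expand : ⟨ F ⊖ k , F ⊖ ℤ.suc k ⟩ ≡ ⟨ R ⊖ k , R ⊖ ℤ.suc k ⟩ ℚ.+ x ℚ.* y ℚ.* ⟨ E , E ⟩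
      expand = trans (⟨⟩-ext (⊖F k) (⊖F (ℤ.suc k))) (trans (⟨⟩-linear (R ⊖ k) E _ x) (trans
        (cong₂ (λ s t → s ℚ.+ x ℚ.* t)
          (trans (⟨⟩-sym (R ⊖ k) _) (trans (⟨⟩-linear (R ⊖ ℤ.suc k) E (R ⊖ k) y)
            (cong₂ (λ s t → s ℚ.+ y ℚ.* t) (⟨⟩-sym (R ⊖ ℤ.suc k) (R ⊖ k)) (E⊥ k))))
          (trans (⟨⟩-sym E _) (trans (⟨⟩-linear (R ⊖ ℤ.suc k) E E y)
            (cong (ℚ._+ y ℚ.* ⟨ E , E ⟩) (trans (⟨⟩-sym (R ⊖ ℤ.suc k) E) (E⊥ (ℤ.suc k)))))))
        (solve 4 (λ r x y e → (r :+ y :* con 0ℚ) :+ x :* (con 0ℚ :+ y :* e) := r :+ x :* y :* e) refl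
          ⟨ R ⊖ k , R ⊖ ℤ.suc k ⟩ x y ⟨ E , E ⟩)))
      0≤gap : 0ℚ ℚ.≤ x ℚ.* y
      0≤gap with lo ℤ.≤? k
      ... | yes lo≤k = subst (0ℚ ℚ.≤_) (solve 3 (λ l k k′ → (k :- l) :* (k′ :- l) := (l :- k) :* (l :- k′)) refl (ι lo) (ι k) (ι (ℤ.suc k)))
              (0≤* (≤⇒0≤- (ι-mono-≤ lo≤k)) (≤⇒0≤- (ι-mono-≤ (ℤ.≤-trans lo≤k (ℤ.i≤suc[i] k)))))
      ... | no lo≰k  = 0≤* (≤⇒0≤- (ι-mono-≤ (ℤ.<⇒≤ (ℤ.≰⇒> lo≰k)))) (≤⇒0≤- (ι-mono-≤ (ℤ.i<j⇒suc[i]≤j (ℤ.≰⇒> lo≰k))))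

    -- If the spectrum of L is integral and contained in [0, b], it is contained in {0, …, b}.
    module _ (S-definite : ∀ F → ⟨ F , F ⟩ ≡ 0ℚ → ∀ i → F i ≡ 0ℚ) (b : ℕ)
      (lower : ∀ F → 0ℚ ℚ.≤ ⟨ F , L F ⟩) (upper : ∀ F → ⟨ F , L F ⟩ ℚ.≤ ι (+ b) ℚ.* ⟨ F , F ⟩) where

      eigenvector-vanishes : ∀ c {E} → Eigenvector c E → scalar 0ℤ (suc b) c ≢ 0ℚ → ∀ i → E i ≡ 0ℚ
      eigenvector-vanishes c {E} eigen s≢0 = S-definite E (decidable-stable (⟨ E , E ⟩ ℚ.≟ 0ℚ) λ E²≢0 →
        let 0<E² = ℚ.≰⇒> λ E²≤0 → E²≢0 (ℚ.≤-antisym E²≤0 (0≤S (λ i → E i ℚ.* E i) λ i → 0≤sq (E i)))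
            ELE = trans (⟨⟩-ext {E} (λ _ → refl) eigen) (trans (⟨⟩-sym E _) (⟨⟩-scale E E (ι c)))
            instance pos = ℚ.positive 0<E²
            0≤c = ι-cancel-≤ 0ℤ c (ℚ.*-cancelʳ-≤-pos ⟨ E , E ⟩ (subst₂ ℚ._≤_ (sym (ℚ.*-zeroˡ ⟨ E , E ⟩)) ELE (lower E)))
            c≤b = ι-cancel-≤ c (+ b) (ℚ.*-cancelʳ-≤-pos ⟨ E , E ⟩ (subst (ℚ._≤ ι (+ b) ℚ.* ⟨ E , E ⟩) ELE (upper E)))
        in s≢0 (scalar-zero 0ℤ (suc b) c 0≤c (subst (c ℤ.<_) (sym (ℤ.+-identityʳ (+ suc b))) (ℤ.≤-<-trans c≤b (ℤ.+<+ (ℕ.n<1+n b))))))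

      killed-in-range : ∀ lo m F → Killed lo m F → Killed 0ℤ (suc b) F
      killed-in-range lo zero F killed i = trans (prod-ext 0ℤ (suc b) (λ i → trans (killed i) (sym (ℚ.*-zeroˡ (F i)))) i)
        (trans (prod-scale 0ℤ (suc b) F 0ℚ i) (ℚ.*-zeroˡ (prod 0ℤ (suc b) F i)))
      killed-in-range lo (suc m) F killed i = trans (prod-ext 0ℤ (suc b) sum i) (trans (prod-linear 0ℤ (suc b) R E 1ℚ i)
        (cong₂ (λ s t → s ℚ.+ 1ℚ ℚ.* t) (killed-in-range (ℤ.suc lo) m R rest i) (trans (prod-eigen 0ℤ (suc b) {lo} eigen i) vanishes)))
        where
        open Splitting (split-off lo m F killed)
        vanishes : scalar 0ℤ (suc b) lo ℚ.* E i ≡ 0ℚ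
        vanishes with scalar 0ℤ (suc b) lo ℚ.≟ 0ℚ
        ... | yes s≡0 = trans (cong (ℚ._* E i) s≡0) (ℚ.*-zeroˡ (E i))
        ... | no s≢0  = trans (cong (scalar 0ℤ (suc b) lo ℚ.*_) (eigenvector-vanishes lo eigen s≢0 i)) (ℚ.*-zeroʳ (scalar 0ℤ (suc b) lo))

sum-mono : ∀ {N} {f g : Vector N} → (∀ i → f i ℚ.≤ g i) → ∑.sum f ℚ.≤ ∑.sum g
sum-mono {zero}  f≤g = ℚ.≤-refl
sum-mono {suc N} f≤g = ℚ.+-mono-≤ (f≤g zero) (sum-mono (f≤g ∘ suc))

sum-abs : ∀ {N} (f : Vector N) → ∣ ∑.sum f ∣ ℚ.≤ ∑.sum λ i → ∣ f i ∣
sum-abs {zero}  f = ℚ.≤-refl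
sum-abs {suc N} f = ℚ.≤-trans (ℚ.∣p+q∣≤∣p∣+∣q∣ (f zero) (∑.sum (f ∘ suc))) (ℚ.+-monoʳ-≤ ∣ f zero ∣ (sum-abs (f ∘ suc)))

coordinate-≤ : ∀ {N} (v : Vector N) i → v i ℚ.* v i ℚ.≤ v • v
coordinate-≤ v zero    = ≤-by (0≤sum (λ i → v (suc i) ℚ.* v (suc i)) λ i → 0≤sq (v (suc i)))
  (solve 2 (λ a s → (a :+ s) :- a := s) refl (v zero ℚ.* v zero) ((v ∘ suc) • (v ∘ suc)))
coordinate-≤ v (suc i) = ℚ.≤-trans (coordinate-≤ (v ∘ suc) i) (≤-by (0≤sq (v zero))
  (solve 2 (λ a s → (a :+ s) :- s := a) refl (v zero ℚ.* v zero) ((v ∘ suc) • (v ∘ suc))))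

product-≤ : ∀ {N} (v : Vector N) i j → ∣ v i ℚ.* v j ∣ ℚ.≤ v • v
product-≤ v i j = ∣∣-≤
  (≤-by (0≤* (ℚ.<⇒≤ (ℚ.positive⁻¹ ½)) (0≤+ (0≤sq (v i ℚ.- v j)) (0≤+ (≤⇒0≤- (coordinate-≤ v i)) (≤⇒0≤- (coordinate-≤ v j)))))
    (solve 3 (λ a b s → s :- a :* b := con ½ :* ((a :- b) :* (a :- b) :+ ((s :- a :* a) :+ (s :- b :* b)))) refl (v i) (v j) (v • v)))
  (≤-by (0≤* (ℚ.<⇒≤ (ℚ.positive⁻¹ ½)) (0≤+ (0≤sq (v i ℚ.+ v j)) (0≤+ (≤⇒0≤- (coordinate-≤ v i)) (≤⇒0≤- (coordinate-≤ v j)))))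
    (solve 3 (λ a b s → s :- :- (a :* b) := con ½ :* ((a :+ b) :* (a :+ b) :+ ((s :- a :* a) :+ (s :- b :* b)))) refl (v i) (v j) (v • v)))

module Annihilator {N} (M : Fin N → Fin N → ℚ) (M-symmetric : ∀ i j → M i j ≡ M j i) where

  open Lanczos M M-symmetric

  M·-ext : ∀ {F G} → F ≗ G → (M· F) ≗ (M· G)
  M·-ext F≗G i = ∑.sum-cong-≗ λ j → cong (M i j ℚ.*_) (F≗G j)

  open Operator M·_ M·-ext M·-linear public
  open SelfAdjoint ∑.sum (λ F≗G → ∑.sum-cong-≗ F≗G) sum-linear 0≤sum self-adjoint public

  norm : ℚ
  norm = ∑.sum λ i → ∑.sum λ j → ∣ M i j ∣

  eigenvalue-≤ : ∀ k v → Eigenvector k v → v • v ≢ 0ℚ → ∣ ι k ∣ ℚ.≤ norm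
  eigenvalue-≤ k v eigen v²≢0 = ℚ.*-cancelʳ-≤-pos (v • v) {{ℚ.positive 0<v²}} (subst₂ ℚ._≤_
    (trans (cong ∣_∣ kv²) (trans (ℚ.∣p*q∣≡∣p∣*∣q∣ (ι k) (v • v)) (cong (∣ ι k ∣ ℚ.*_) (ℚ.0≤p⇒∣p∣≡p 0≤v²))))
    (sym (trans (∑.*-distribʳ-sum (v • v) (λ i → ∑.sum λ j → ∣ M i j ∣)) (∑.sum-cong-≗ λ i → ∑.*-distribʳ-sum (v • v) λ j → ∣ M i j ∣)))
    (ℚ.≤-trans (sum-abs λ i → v i ℚ.* (M· v) i) (sum-mono λ i →
      ℚ.≤-trans (ℚ.≤-reflexive (cong ∣_∣ (∑.*-distribˡ-sum (v i) λ j → M i j ℚ.* v j)))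
      (ℚ.≤-trans (sum-abs λ j → v i ℚ.* (M i j ℚ.* v j)) (sum-mono λ j → entry-≤ i j)))))
    where
    0≤v² : 0ℚ ℚ.≤ v • v
    0≤v² = 0≤sum (λ i → v i ℚ.* v i) λ i → 0≤sq (v i)
    0<v² : 0ℚ ℚ.< v • v
    0<v² = ℚ.≰⇒> λ v²≤0 → v²≢0 (ℚ.≤-antisym v²≤0 0≤v²)
    kv² : v • (M· v) ≡ ι k ℚ.* (v • v)
    kv² = trans (∑.sum-cong-≗ λ i → trans (cong (v i ℚ.*_) (eigen i)) (solve 2 (λ k v → v :* (k :* v) := k :* (v :* v)) refl (ι k) (v i)))
      (sym (∑.*-distribˡ-sum (ι k) λ i → v i ℚ.* v i))
    entry-≤ : ∀ i j → ∣ v i ℚ.* (M i j ℚ.* v j) ∣ ℚ.≤ ∣ M i j ∣ ℚ.* (v • v)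
    entry-≤ i j = subst (ℚ._≤ ∣ M i j ∣ ℚ.* (v • v))
      (trans (sym (ℚ.∣p*q∣≡∣p∣*∣q∣ (M i j) (v i ℚ.* v j))) (cong ∣_∣ (solve 3 (λ m a b → m :* (a :* b) := a :* (m :* b)) refl (M i j) (v i) (v j))))
      (ℚ.*-monoˡ-≤-nonNeg ∣ M i j ∣ {{ℚ.nonNegative (ℚ.0≤∣p∣ (M i j))}} (product-≤ v i j))

  annihilator : IntegralSpectrum → ∃₂ λ lo m → ∀ f → Killed lo m f
  annihilator integral = lo , m , λ f → square-zero (prod lo m f) (decidable-stable (prod lo m f • prod lo m f ℚ.≟ 0ℚ) λ u²≢0 →
    let k , v , eigen , vu≡1 = rational-eigenvector integral (prod lo m f) u²≢0
        v²≢0 : v • v ≢ 0ℚ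
        v²≢0 v²≡0 = contradiction (trans (sym vu≡1) (trans (•-comm v (prod lo m f)) (⟨⟩-zeroʳ (prod lo m f) (square-zero v v²≡0)))) λ ()
        ∣k∣≤ = eigenvalue-≤ k v eigen v²≢0
        ∣k∣<J = ℚ.≤-<-trans ∣k∣≤ norm<J
        lo≤k = ℤ.<⇒≤ (ι-cancel-< lo k (subst (ℚ._< ι k) (sym (ι-neg (+ J)))
                 (<-by (<⇒0<- (ℚ.≤-<-trans (subst (ℚ.- ι k ℚ.≤_) (ℚ.∣-p∣≡∣p∣ (ι k)) (p≤∣p∣ (ℚ.- ι k))) ∣k∣<J))
                   (solve 2 (λ k j → k :- :- j := j :- :- k) refl (ι k) (ι (+ J))))))
        k<J = ι-cancel-< k (+ J) (ℚ.≤-<-trans (p≤∣p∣ (ι k)) ∣k∣<J)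
    in contradiction (trans (sym vu≡1) (trans (sym (prod-self-adjoint lo m v f)) (trans
         (⟨⟩-ext {G = f} (prod-eigen lo m {k} eigen) λ _ → refl) (trans (⟨⟩-scale v f (scalar lo m k))
         (trans (cong (ℚ._* ⟨ v , f ⟩) (scalar-zero lo m k lo≤k (subst (k ℤ.<_) J≡ k<J))) (ℚ.*-zeroˡ ⟨ v , f ⟩)))))) λ ())
    where
    j = proj₁ (floor-bounds norm)
    J m : ℕ
    J = suc ℤ.∣ j ∣
    m = J ℕ.+ J
    lo = ℤ.- (+ J)
    J≡ : + J ≡ + m ℤ.+ lo
    J≡ = trans (ℤS.solve 1 (λ j → j ℤS.:= (j ℤS.:+ j) ℤS.:+ ℤS.:- j) refl (+ J)) (cong (ℤ._+ lo) (sym (ℤ.pos-+ J J)))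
    norm<J : norm ℚ.< ι (+ J)
    norm<J = ℚ.<-≤-trans (proj₂ (proj₂ (floor-bounds norm)))
      (subst (ι j ℚ.+ 1ℚ ℚ.≤_) (trans (ℚ.+-comm (ι (+ ℤ.∣ j ∣)) 1ℚ) (sym (ι-+ 1ℤ (+ ℤ.∣ j ∣)))) (ℚ.+-monoˡ-≤ 1ℚ (ι-mono-≤ (i≤+∣i∣ j))))

-- The Cayley graph of a set of transpositions

does-sound : ∀ {P : Set} (d : Dec P) → does d ≡ true → P
does-sound (yes p) _ = p

transpose-involutive : ∀ {n} (i j k : Fin n) → transpose i j ⟨$⟩ʳ (transpose i j ⟨$⟩ʳ k) ≡ k
transpose-involutive i j k = trans (transpose-comm i j (transpose i j ⟨$⟩ʳ k)) (Perm.inverseˡ (transpose i j))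

transpose-unique : ∀ {n} {i j k l : Fin n} → i ≢ j → transpose i j Perm.≈ transpose k l →
                   (i ≡ k × j ≡ l) ⊎ (i ≡ l × j ≡ k)
transpose-unique {i = i} {j} {k} {l} i≢j eq = cases (i Fin.≟ k) (i Fin.≟ l)
  where
  at-i : transpose k l ⟨$⟩ʳ i ≡ j
  at-i = trans (sym (eq i)) (transpose-left i j)
  cases : Dec (i ≡ k) → Dec (i ≡ l) → (i ≡ k × j ≡ l) ⊎ (i ≡ l × j ≡ k)
  cases (yes refl) _          = inj₁ (refl , trans (sym at-i) (transpose-left i l))
  cases (no _)     (yes refl) = inj₂ (refl , trans (sym at-i) (transpose-right k i))
  cases (no i≢k)   (no i≢l)   = contradiction (trans (sym (transpose-other k l i i≢k i≢l)) at-i) i≢j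

module SumLemmas (C : CommutativeMonoid 0ℓ 0ℓ) where

  open CommutativeMonoid C using (Carrier; _≈_; _∙_; ∙-cong; identityˡ; identityʳ) renaming (ε to 0#; refl to ≈-refl; trans to ≈-trans; sym to ≈-sym)
  open CommutativeMonoidSum C public

  sum-zero : ∀ {m} (f : Fin m → Carrier) → (∀ i → f i ≈ 0#) → sum f ≈ 0#
  sum-zero {zero}  f f≈0 = ≈-refl
  sum-zero {suc m} f f≈0 = ≈-trans (∙-cong (f≈0 zero) (sum-zero (f ∘ suc) (f≈0 ∘ suc))) (identityˡ 0#)

  sum-single : ∀ {m} (f : Fin m → Carrier) i → (∀ j → j ≢ i → f j ≈ 0#) → sum f ≈ f i
  sum-single f zero    f≈0 = ≈-trans (∙-cong ≈-refl (sum-zero (f ∘ suc) λ j → f≈0 (suc j) λ ())) (identityʳ (f zero))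
  sum-single f (suc i) f≈0 = ≈-trans (∙-cong (f≈0 zero λ ()) (sum-single (f ∘ suc) i λ j j≢i → f≈0 (suc j) λ { refl → j≢i refl })) (identityˡ (f (suc i)))

module ∑′ = SumLemmas (CommutativeRing.+-commutativeMonoid ℚ.+-*-commutativeRing)

ι-∑ : ∀ {m} (f : Fin m → ℤ) → ι (∑ℤ.sum f) ≡ ∑.sum (ι ∘ f)
ι-∑ {zero}  f = refl
ι-∑ {suc m} f = trans (ι-+ (f zero) (∑ℤ.sum (f ∘ suc))) (cong (ι (f zero) ℚ.+_) (ι-∑ (f ∘ suc)))

module Cayley {n} (𝒯 : TranspositionSet n) (ρ : Fin n → Fin n) (ρ-injective : ∀ {i j} → ρ i ≡ ρ j → i ≡ j) where

  open TranspositionSet 𝒯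
  private
    module Γ = Graph (CaySym 𝒯)

  -- Every edge i j occurs once, in the direction in which ρ increases.
  oriented : Fin n → Fin n → Bool
  oriented i j = does (T? (transpose i j)) ∧ does (ρ i Fin.<? ρ j)

  private
    oriented-true : ∀ {i j} → T (transpose i j) → ρ i Fin.< ρ j → oriented i j ≡ true
    oriented-true {i} {j} t < = cong₂ _∧_ (dec-true (T? (transpose i j)) t) (dec-true (ρ i Fin.<? ρ j) <)

    oriented-sound : ∀ {i j} → oriented i j ≡ true → T (transpose i j) × ρ i Fin.< ρ j
    oriented-sound {i} {j} h = let t , < = ∧-split {does (T? (transpose i j))} h in
      does-sound (T? (transpose i j)) t , does-sound (ρ i Fin.<? ρ j) <

    unrank-rank : ∀ π → unrank n (rank n π) Perm.≈ π
    unrank-rank = Inverse.strictlyInverseʳ (Sym-enumeration n)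

    rank-unrank : ∀ k → rank n (unrank n k) ≡ k
    rank-unrank = Inverse.strictlyInverseˡ (Sym-enumeration n)

  module _ (C : CommutativeMonoid 0ℓ 0ℓ) where

    open CommutativeMonoid C using (Carrier; _≈_; reflexive) renaming (ε to 0#; refl to ≈-refl; trans to ≈-trans; sym to ≈-sym)
    open SumLemmas C

    neighbour-sum : ∀ (φ : Permutation′ n → Carrier) → (∀ {π σ} → π Perm.≈ σ → φ π ≈ φ σ) → ∀ g →
      sum (λ k → if does (Γ.adj? g (unrank n k)) then φ (unrank n k) else 0#) ≈
      sum (λ i → sum λ j → if oriented i j then φ (g ∘ₚ transpose i j) else 0#)
    neighbour-sum φ φ-cong g =
      ≈-trans (sum-cong-≋ spread) (≈-trans (∑-comm λ k i → sum λ j → term k i j)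
        (sum-cong-≋ λ i → ≈-trans (∑-comm λ k j → term k i j) (sum-cong-≋ λ j → gather i j)))
      where
      hit : Fin (n !) → Fin n → Fin n → Bool
      hit k i j = oriented i j ∧ does (rank n (g ∘ₚ transpose i j) Fin.≟ k)
      term : Fin (n !) → Fin n → Fin n → Carrier
      term k i j = if hit k i j then φ (unrank n k) else 0#
      hit-sound : ∀ {k i j} → hit k i j ≡ true → (T (transpose i j) × ρ i Fin.< ρ j) × (∀ x → transpose i j ⟨$⟩ʳ (g ⟨$⟩ʳ x) ≡ unrank n k ⟨$⟩ʳ x)
      hit-sound {k} {i} {j} h with oriented i j in e | rank n (g ∘ₚ transpose i j) Fin.≟ k
      ... | true | yes refl = oriented-sound e , λ x → sym (unrank-rank (g ∘ₚ transpose i j) x)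
      spread : ∀ k → (if does (Γ.adj? g (unrank n k)) then φ (unrank n k) else 0#) ≈ sum λ i → sum λ j → term k i j
      spread k with Γ.adj? g (unrank n k)
      ... | no ¬adj = ≈-sym (sum-zero _ λ i → sum-zero _ λ j → miss i j)
        where
        h = unrank n k
        miss : ∀ i j → term k i j ≈ 0#
        miss i j with hit k i j in e
        ... | false = ≈-refl
        ... | true  = contradiction (T-resp same (proj₁ (proj₁ (hit-sound e)))) ¬adj
          where
          same : transpose i j Perm.≈ (Perm.flip h ∘ₚ g)
          same x = trans (cong (transpose i j ⟨$⟩ʳ_) (sym (trans (proj₂ (hit-sound e) (h ⟨$⟩ˡ x)) (Perm.inverseʳ h))))
            (transpose-involutive i j (g ⟨$⟩ʳ (h ⟨$⟩ˡ x)))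
      ... | yes adj = ≈-sym (≈-trans (sum-single _ a λ i i≢a → sum-zero _ λ j → off i j (i≢a ∘ proj₁))
                              (≈-trans (sum-single _ b λ j j≢b → off a j (j≢b ∘ proj₂)) (reflexive (cong (λ c → if c then φ h else 0#) on))))
        where
        h = unrank n k
        directed : ∃₂ λ a b → ρ a Fin.< ρ b × (Perm.flip h ∘ₚ g) Perm.≈ transpose a b
        directed with transpositions adj
        ... | i , j , i≢j , eq with Fin.<-cmp (ρ i) (ρ j)
        ...   | tri< < _ _ = i , j , < , eq
        ...   | tri≈ _ ≡ _ = contradiction (ρ-injective ≡) i≢j
        ...   | tri> _ _ > = j , i , > , λ x → trans (eq x) (transpose-comm i j x)
        a = proj₁ directed
        b = proj₁ (proj₂ directed)
        a<b = proj₁ (proj₂ (proj₂ directed))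
        gh⁻¹ = proj₂ (proj₂ (proj₂ directed))
        abg : ∀ x → transpose a b ⟨$⟩ʳ (g ⟨$⟩ʳ x) ≡ h ⟨$⟩ʳ x
        abg x = trans (cong (transpose a b ⟨$⟩ʳ_) (trans (cong (g ⟨$⟩ʳ_) (sym (Perm.inverseˡ h))) (gh⁻¹ (h ⟨$⟩ʳ x))))
          (transpose-involutive a b (h ⟨$⟩ʳ x))
        on : hit k a b ≡ true
        on = cong₂ _∧_ (oriented-true (T-resp gh⁻¹ adj) a<b)
          (dec-true (rank n (g ∘ₚ transpose a b) Fin.≟ k)
            (trans (Inverse.to-cong (Sym-enumeration n) {g ∘ₚ transpose a b} {h} abg) (rank-unrank k)))
        off : ∀ i j → ¬ (i ≡ a × j ≡ b) → term k i j ≈ 0#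
        off i j ≢ab with hit k i j in e
        ... | false = ≈-refl
        ... | true  = contradiction (unique (transpose-unique i≢j same)) ≢ab
          where
          i<j = proj₂ (proj₁ (hit-sound e))
          i≢j : i ≢ j
          i≢j refl = Fin.<-irrefl refl i<j
          same : transpose i j Perm.≈ transpose a b
          same x = begin
            transpose i j ⟨$⟩ʳ x                              ≡⟨ cong (transpose i j ⟨$⟩ʳ_) (Perm.inverseʳ g) ⟨
            transpose i j ⟨$⟩ʳ (g ⟨$⟩ʳ (g ⟨$⟩ˡ x))            ≡⟨ proj₂ (hit-sound e) (g ⟨$⟩ˡ x) ⟩
            h ⟨$⟩ʳ (g ⟨$⟩ˡ x)                                 ≡⟨ abg (g ⟨$⟩ˡ x) ⟨
            transpose a b ⟨$⟩ʳ (g ⟨$⟩ʳ (g ⟨$⟩ˡ x))            ≡⟨ cong (transpose a b ⟨$⟩ʳ_) (Perm.inverseʳ g) ⟩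
            transpose a b ⟨$⟩ʳ x                              ∎
            where open ≡-Reasoning
          unique : (i ≡ a × j ≡ b) ⊎ (i ≡ b × j ≡ a) → i ≡ a × j ≡ b
          unique (inj₁ eq)            = eq
          unique (inj₂ (refl , refl)) = contradiction (Fin.<-trans i<j a<b) (Fin.<-irrefl refl)
      gather : ∀ i j → sum (λ k → term k i j) ≈ (if oriented i j then φ (g ∘ₚ transpose i j) else 0#)
      gather i j with oriented i j
      ... | false = sum-zero {n !} (λ _ → 0#) λ _ → ≈-refl
      ... | true  = ≈-trans (sum-single _ r λ k k≢r → reflexive (cong (λ c → if c then φ (unrank n k) else 0#) (dec-false (r Fin.≟ k) (≢-sym k≢r))))
                      (≈-trans (reflexive (cong (λ c → if c then φ (unrank n r) else 0#) (dec-true (r Fin.≟ r) refl)))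
                        (φ-cong (unrank-rank (g ∘ₚ transpose i j))))
        where
        r = rank n (g ∘ₚ transpose i j)

  weighted : (Fin n → Fin n → ℚ) → Fin n → Fin n → ℚ
  weighted D i j = if oriented i j then D i j else 0ℚ

  ∑ₑ : (Fin n → Fin n → ℚ) → ℚ
  ∑ₑ D = ∑.sum λ i → ∑.sum λ j → weighted D i j

  ∑ₑ-ext : ∀ {D D′} → (∀ i j → oriented i j ≡ true → D i j ≡ D′ i j) → ∑ₑ D ≡ ∑ₑ D′
  ∑ₑ-ext {D} {D′} eq = ∑.sum-cong-≗ λ i → ∑.sum-cong-≗ λ j → entry i j
    where
    entry : ∀ i j → (if oriented i j then D i j else 0ℚ) ≡ (if oriented i j then D′ i j else 0ℚ)
    entry i j with oriented i j in e
    ... | true  = eq i j e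
    ... | false = refl

  ∑ₑ-linear : ∀ D D′ c → ∑ₑ (λ i j → D i j ℚ.+ c ℚ.* D′ i j) ≡ ∑ₑ D ℚ.+ c ℚ.* ∑ₑ D′
  ∑ₑ-linear D D′ c = trans
    (∑.sum-cong-≗ λ i → trans (∑.sum-cong-≗ λ j → entry i j) (sum-linear (weighted D i) (weighted D′ i) c))
    (sum-linear (λ i → ∑.sum (weighted D i)) (λ i → ∑.sum (weighted D′ i)) c)
    where
    entry : ∀ i j → (if oriented i j then D i j ℚ.+ c ℚ.* D′ i j else 0ℚ) ≡
                    (if oriented i j then D i j else 0ℚ) ℚ.+ c ℚ.* (if oriented i j then D′ i j else 0ℚ)
    entry i j with oriented i j
    ... | true  = refl
    ... | false = solve 1 (λ c → con 0ℚ := con 0ℚ :+ c :* con 0ℚ) refl c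

  weight : Fin n → Fin n → ℤ
  weight i j = if oriented i j then 1ℤ else 0ℤ

  τ : ℤ
  τ = ∑ℤ.sum λ i → ∑ℤ.sum λ j → weight i j

  ι-τ : ι τ ≡ ∑ₑ λ _ _ → 1ℚ
  ι-τ = trans (ι-∑ λ i → ∑ℤ.sum (weight i)) (∑.sum-cong-≗ λ i → trans (ι-∑ (weight i)) (∑.sum-cong-≗ λ j → entry (oriented i j)))
    where
    entry : ∀ b → ι (if b then 1ℤ else 0ℤ) ≡ (if b then 1ℚ else 0ℚ)
    entry true  = refl
    entry false = refl

  private
    N : ℕ
    N = n !

    adjacent : Fin N → Fin N → Bool
    adjacent k l = does (Γ.adj? (unrank n k) (unrank n l))

    adjacent-sym : ∀ k l → adjacent k l ≡ adjacent l k
    adjacent-sym k l with Γ.adj? (unrank n k) (unrank n l)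
    ... | yes kl = sym (dec-true (Γ.adj? (unrank n l) (unrank n k)) (Γ.adj-sym {unrank n k} {unrank n l} kl))
    ... | no ¬kl = sym (dec-false (Γ.adj? (unrank n l) (unrank n k)) (¬kl ∘ Γ.adj-sym {unrank n l} {unrank n k}))

    laplacian : Fin N → Fin N → ℚ
    laplacian k l = (if does (k Fin.≟ l) then ι τ else 0ℚ) ℚ.- (if adjacent k l then 1ℚ else 0ℚ)

    laplacian-sym : ∀ k l → laplacian k l ≡ laplacian l k
    laplacian-sym k l = cong₂ (λ b c → (if b then ι τ else 0ℚ) ℚ.- (if c then 1ℚ else 0ℚ)) (≟-sym k l) (adjacent-sym k l)
      where
      ≟-sym : ∀ (k l : Fin N) → does (k Fin.≟ l) ≡ does (l Fin.≟ k)
      ≟-sym k l with k Fin.≟ l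
      ... | yes refl = sym (dec-true (k Fin.≟ k) refl)
      ... | no k≢l   = sym (dec-false (l Fin.≟ k) (≢-sym k≢l))

    open Lanczos laplacian laplacian-sym using (M·_; IntegralSpectrum)

    neighbours : Vector N → Fin N → ℚ
    neighbours v k = ∑.sum λ l → if adjacent k l then v l else 0ℚ

    laplacian· : ∀ v k → (M· v) k ≡ ι τ ℚ.* v k ℚ.- neighbours v k
    laplacian· v k = trans (∑.sum-cong-≗ entry) (trans (sum-linear diagonal (λ l → if adjacent k l then v l else 0ℚ) (ℚ.- 1ℚ))
      (trans (cong (ℚ._+ ℚ.- 1ℚ ℚ.* neighbours v k)
        (trans (∑′.sum-single diagonal k λ l l≢k → cong (λ b → if b then ι τ ℚ.* v l else 0ℚ) (dec-false (k Fin.≟ l) (≢-sym l≢k)))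
          (cong (λ b → if b then ι τ ℚ.* v k else 0ℚ) (dec-true (k Fin.≟ k) refl))))
        (solve 2 (λ s t → s :+ con (ℚ.- 1ℚ) :* t := s :- t) refl (ι τ ℚ.* v k) (neighbours v k))))
      where
      diagonal : Vector N
      diagonal l = if does (k Fin.≟ l) then ι τ ℚ.* v l else 0ℚ
      entry : ∀ l → laplacian k l ℚ.* v l ≡ diagonal l ℚ.+ ℚ.- 1ℚ ℚ.* (if adjacent k l then v l else 0ℚ)
      entry l with does (k Fin.≟ l) | adjacent k l
      ... | true  | true  = solve 2 (λ t v → (t :- con 1ℚ) :* v := t :* v :+ con (ℚ.- 1ℚ) :* v) refl (ι τ) (v l)
      ... | true  | false = solve 2 (λ t v → (t :- con 0ℚ) :* v := t :* v :+ con (ℚ.- 1ℚ) :* con 0ℚ) refl (ι τ) (v l)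
      ... | false | true  = solve 1 (λ v → (con 0ℚ :- con 1ℚ) :* v := con 0ℚ :+ con (ℚ.- 1ℚ) :* v) refl (v l)
      ... | false | false = solve 1 (λ v → (con 0ℚ :- con 0ℚ) :* v := con 0ℚ :+ con (ℚ.- 1ℚ) :* con 0ℚ) refl (v l)

    seq-re-sum : ∀ {m} (f : Fin m → ℂ) k → seq (re (sumᶜ f)) k ≡ ∑.sum λ i → seq (re (f i)) k
    seq-re-sum {zero}  f k = refl
    seq-re-sum {suc m} f k = cong (seq (re (f zero)) k ℚ.+_) (seq-re-sum (f ∘ suc) k)

    seq-im-sum : ∀ {m} (f : Fin m → ℂ) k → seq (im (sumᶜ f)) k ≡ ∑.sum λ i → seq (im (f i)) k
    seq-im-sum {zero}  f k = refl
    seq-im-sum {suc m} f k = cong (seq (im (f zero)) k ℚ.+_) (seq-im-sum (f ∘ suc) k)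

    re-entry : ∀ b w m → seq (re ((if b then 1ᶜ else 0ᶜ) *ᶜ (w +i 0ᴿ))) m ≡ (if b then seq w m else 0ℚ)
    re-entry true  w m = solve 1 (λ w → con 1ℚ :* w :- con 0ℚ :* con 0ℚ := w) refl (seq w m)
    re-entry false w m = solve 1 (λ w → con 0ℚ :* w :- con 0ℚ :* con 0ℚ := con 0ℚ) refl (seq w m)

    im-entry : ∀ b w m → seq (im ((if b then 1ᶜ else 0ᶜ) *ᶜ (w +i 0ᴿ))) m ≡ 0ℚ
    im-entry true  w m = solve 1 (λ w → con 1ℚ :* con 0ℚ :+ con 0ℚ :* w := con 0ℚ) refl (seq w m)
    im-entry false w m = solve 1 (λ w → con 0ℚ :* con 0ℚ :+ con 0ℚ :* w := con 0ℚ) refl (seq w m)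

    integral-spectrum : Integral (CaySym 𝒯) → IntegralSpectrum
    integral-spectrum integral x w eigen w≢0 = τ ℤ.- c , null-ext {λ m → ℚ.- ((ι τ ℚ.- seq x m) ℚ.- ι c)} {λ m → seq x m ℚ.- ι (τ ℤ.- c)}
        (λ m → trans (solve 3 (λ t x c → :- ((t :- x) :- c) := x :- (t :- c)) refl (ι τ) (seq x m) (ι c)) (cong (λ t → seq x m ℚ.- t) (sym (ι-minus τ c))))
        (null-neg (proj₁ (proj₂ found)))
      where
      z : ℂ
      z = (fromℚ (ι τ) -ᴿ x) +i 0ᴿ
      v : Fin N → ℂ
      v l = w l +i 0ᴿ
      eq : ∀ k → sumᶜ (λ l → Graph.adjacencyMatrix (CaySym 𝒯) k l *ᶜ v l) ≈ᶜ z *ᶜ v k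
      eq k = null-ext (λ m → trans
               (trans (cong (λ s → ℚ.- (s ℚ.- seq x m ℚ.* seq (w k) m)) (laplacian· (λ l → seq (w l) m) k))
                 (solve 4 (λ t x w s → :- ((t :* w :- s) :- x :* w) := s :- ((t :- x) :* w :- con 0ℚ :* con 0ℚ)) refl
                   (ι τ) (seq x m) (seq (w k) m) (neighbours (λ l → seq (w l) m) k)))
               (cong (ℚ._- seq (re (z *ᶜ v k)) m) (sym (trans (seq-re-sum (λ l → Graph.adjacencyMatrix (CaySym 𝒯) k l *ᶜ v l) m) (∑.sum-cong-≗ λ l → re-entry (adjacent k l) (w l) m)))))
             (null-neg (eigen k)) ,
             ≈ᴿ-pointwise {im (sumᶜ λ l → Graph.adjacencyMatrix (CaySym 𝒯) k l *ᶜ v l)} {im (z *ᶜ v k)} λ m → trans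
               (trans (seq-im-sum (λ l → Graph.adjacencyMatrix (CaySym 𝒯) k l *ᶜ v l) m) (∑′.sum-zero (λ l → seq (im (Graph.adjacencyMatrix (CaySym 𝒯) k l *ᶜ v l)) m) λ l → im-entry (adjacent k l) (w l) m))
               (solve 2 (λ z w → con 0ℚ := z :* con 0ℚ :+ con 0ℚ :* w) refl (seq (re z) m) (seq (w k) m))
      nonzero : ¬ (∀ l → v l ≈ᶜ 0ᶜ)
      nonzero v≈0 = w≢0 λ l → ≈0⇒null {w l} (proj₁ (v≈0 l))
      z-eigenvalue : IsEigenvalue (Graph.adjacencyMatrix (CaySym 𝒯)) z
      z-eigenvalue = v , nonzero , eq
      found : ∃[ c ] z ≈ᶜ fromℤ c
      found = integral z z-eigenvalue
      c = proj₁ found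

  module Action {X : Set} (act : Permutation′ n → X → X)
    (act-cong : ∀ {π σ} → π Perm.≈ σ → act π ≗ act σ)
    (act-∘ : ∀ π σ x → act (π ∘ₚ σ) x ≡ act σ (act π x))
    (act-id : ∀ x → act Perm.id x ≡ x) where

    L : (X → ℚ) → X → ℚ
    L F x = ∑ₑ λ i j → F x ℚ.- F (act (transpose i j) x)

    L-ext : ∀ {F G} → F ≗ G → L F ≗ L G
    L-ext F≗G x = ∑ₑ-ext λ i j _ → cong₂ ℚ._-_ (F≗G x) (F≗G (act (transpose i j) x))

    L-linear : ∀ F G c x → L (λ x → F x ℚ.+ c ℚ.* G x) x ≡ L F x ℚ.+ c ℚ.* L G x
    L-linear F G c x = trans
      (∑ₑ-ext λ i j _ → solve 5 (λ f g f′ g′ c → (f :+ c :* g) :- (f′ :+ c :* g′) := (f :- f′) :+ c :* (g :- g′)) refl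
        (F x) (G x) (F (act (transpose i j) x)) (G (act (transpose i j) x)) c)
      (∑ₑ-linear (λ i j → F x ℚ.- F (act (transpose i j) x)) (λ i j → G x ℚ.- G (act (transpose i j) x)) c)

    open Operator L L-ext L-linear public

    private
      module A = Annihilator laplacian laplacian-sym

    module _ (x₀ : X) where

      lift : (X → ℚ) → Vector N
      lift F k = F (act (unrank n k) x₀)

      lift-L : ∀ F → (M· lift F) ≗ lift (L F)
      lift-L F k = trans (laplacian· (lift F) k) (trans
        (cong (λ t → ι τ ℚ.* f ℚ.- t) (trans
          (neighbour-sum (CommutativeRing.+-commutativeMonoid ℚ.+-*-commutativeRing) (λ π → F (act π x₀)) (λ π≈σ → cong F (act-cong π≈σ x₀)) (unrank n k))
          (∑ₑ-ext λ i j _ → cong F (act-∘ (unrank n k) (transpose i j) x₀))))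
        (sym (trans (∑ₑ-ext λ i j _ → solve 2 (λ f g → f :- g := con (ℚ.- 1ℚ) :* g :+ f :* con 1ℚ) refl f (moved i j))
          (trans (∑ₑ-linear (λ i j → ℚ.- 1ℚ ℚ.* moved i j) (λ _ _ → 1ℚ) f)
          (trans (cong₂ (λ s t → s ℚ.+ f ℚ.* t) (scale (ℚ.- 1ℚ) moved) (sym ι-τ))
            (solve 3 (λ t f s → con (ℚ.- 1ℚ) :* s :+ f :* t := t :* f :- s) refl (ι τ) f (∑ₑ moved)))))))
        where
        f : ℚ
        f = lift F k
        moved : Fin n → Fin n → ℚ
        moved i j = F (act (transpose i j) (act (unrank n k) x₀))
        scale : ∀ c D → ∑ₑ (λ i j → c ℚ.* D i j) ≡ c ℚ.* ∑ₑ D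
        scale c D = trans (∑ₑ-ext λ i j _ → solve 2 (λ c d → c :* d := d :+ (c :- con 1ℚ) :* d) refl c (D i j))
          (trans (∑ₑ-linear D D (c ℚ.- 1ℚ)) (solve 2 (λ c d → d :+ (c :- con 1ℚ) :* d := c :* d) refl c (∑ₑ D)))

      lift-prod : ∀ lo m F → A.prod lo m (lift F) ≗ lift (prod lo m F)
      lift-prod lo zero    F k = refl
      lift-prod lo (suc m) F k = trans (A.prod-ext (ℤ.suc lo) m (λ k → cong (ℚ._- ι lo ℚ.* lift F k) (lift-L F k)) k) (lift-prod (ℤ.suc lo) m (F ⊖ lo) k)

    annihilated : Integral (CaySym 𝒯) → ∃₂ λ lo m → ∀ F x → prod lo m F x ≡ 0ℚ
    annihilated integral = let lo , m , killed = A.annihilator (integral-spectrum integral) in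
      lo , m , λ F x → trans (cong (prod lo m F) (sym (trans (act-cong (unrank-rank Perm.id) x) (act-id x))))
        (trans (sym (lift-prod x lo m F (rank n Perm.id))) (killed (lift x F) (rank n Perm.id)))

zero-summand : ∀ {m} (f : Vector m) → (∀ i → 0ℚ ℚ.≤ f i) → ∑.sum f ≡ 0ℚ → ∀ i → f i ≡ 0ℚ
zero-summand f 0≤f Σ≡0 i = ℚ.≤-antisym (subst (f i ℚ.≤_) Σ≡0 (summand-≤ f 0≤f i)) (0≤f i)
  where
  summand-≤ : ∀ {m} (f : Vector m) → (∀ i → 0ℚ ℚ.≤ f i) → ∀ i → f i ℚ.≤ ∑.sum f
  summand-≤ f 0≤f zero    = ≤-by (0≤sum (f ∘ suc) (0≤f ∘ suc)) (solve 2 (λ a s → (a :+ s) :- a := s) refl (f zero) (∑.sum (f ∘ suc)))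
  summand-≤ f 0≤f (suc i) = ℚ.≤-trans (summand-≤ (f ∘ suc) (0≤f ∘ suc) i)
    (≤-by (0≤f zero) (solve 2 (λ a s → (a :+ s) :- s := a) refl (f zero) (∑.sum (f ∘ suc))))

square-root : ∀ q → q ℚ.* q ≡ 0ℚ → q ≡ 0ℚ
square-root q q²≡0 = decidable-stable (q ℚ.≟ 0ℚ) λ q≢0 → ℚ.<-irrefl (sym q²≡0) (0<sq q≢0)

transpose-conjugate : ∀ {n} {i j k : Fin n} → i ≢ j → k ≢ j → i ≢ k →
                      transpose i j Perm.≈ ((transpose i k ∘ₚ transpose k j) ∘ₚ transpose i k)
transpose-conjugate {i = i} {j} {k} i≢j k≢j i≢k x = cases (x Fin.≟ i) (x Fin.≟ j) (x Fin.≟ k)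
  where
  s t : Fin _ → Fin _
  s = transpose i k ⟨$⟩ʳ_
  t = transpose k j ⟨$⟩ʳ_
  cases : Dec (x ≡ i) → Dec (x ≡ j) → Dec (x ≡ k) → transpose i j ⟨$⟩ʳ x ≡ s (t (s x))
  cases (yes refl) _ _ = trans (transpose-left i j) (sym (trans (cong (s ∘ t) (transpose-left i k))
    (trans (cong s (transpose-left k j)) (transpose-other i k j (≢-sym i≢j) (≢-sym k≢j)))))
  cases (no _) (yes refl) _ = trans (transpose-right i j) (sym (trans (cong (s ∘ t) (transpose-other i k j (≢-sym i≢j) (≢-sym k≢j)))
    (trans (cong s (transpose-right k j)) (transpose-right i k))))
  cases (no x≢i) (no x≢j) (yes refl) = trans (transpose-other i j k x≢i x≢j) (sym (trans (cong (s ∘ t) (transpose-right i k))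
    (trans (cong s (transpose-other k j i i≢k i≢j)) (transpose-left i k))))
  cases (no x≢i) (no x≢j) (no x≢k) = trans (transpose-other i j x x≢i x≢j) (sym (trans (cong (s ∘ t) (transpose-other i k x x≢i x≢k))
    (trans (cong s (transpose-other k j x x≢k x≢j)) (transpose-other i k x x≢i x≢k))))

IsInteger : ℚ → Set
IsInteger q = ∃[ k ] q ≡ ι k

integer-minus : ∀ {p q} → IsInteger p → IsInteger q → IsInteger (p ℚ.- q)
integer-minus (k , refl) (l , refl) = k ℤ.- l , sym (ι-minus k l)

integer-* : ∀ {p q} → IsInteger p → IsInteger q → IsInteger (p ℚ.* q)
integer-* (k , refl) (l , refl) = k ℤ.* l , sym (ι-* k l)

integer-sum : ∀ {m} (f : Vector m) → (∀ i → IsInteger (f i)) → IsInteger (∑.sum f)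
integer-sum {zero}  f int = 0ℤ , refl
integer-sum {suc m} f int with int zero | integer-sum (f ∘ suc) (int ∘ suc)
... | k , eq | l , eq′ = k ℤ.+ l , trans (cong₂ ℚ._+_ eq eq′) (sym (ι-+ k l))

module Spectral {n} (𝒯 : TranspositionSet n) (ρ : Fin n → Fin n) (ρ-injective : ∀ {i j} → ρ i ≡ ρ j → i ≡ j)
  {X : Set} (_≟_ : ∀ (x y : X) → Dec (x ≡ y)) (act : Permutation′ n → X → X)
  (act-cong : ∀ {π σ} → π Perm.≈ σ → act π ≗ act σ)
  (act-∘ : ∀ π σ x → act (π ∘ₚ σ) x ≡ act σ (act π x))
  (act-id : ∀ x → act Perm.id x ≡ x)
  (S : (X → ℚ) → ℚ)
  (S-ext : ∀ {F G} → F ≗ G → S F ≡ S G)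
  (S-linear : ∀ F G c → S (λ x → F x ℚ.+ c ℚ.* G x) ≡ S F ℚ.+ c ℚ.* S G)
  (0≤S : ∀ F → (∀ x → 0ℚ ℚ.≤ F x) → 0ℚ ℚ.≤ S F)
  (S-definite : ∀ F → (∀ x → 0ℚ ℚ.≤ F x) → S F ≡ 0ℚ → ∀ x → F x ≡ 0ℚ)
  (S-invariant : ∀ F i j → S (F ∘ act (transpose i j)) ≡ S F) where

  open Cayley 𝒯 ρ ρ-injective public
  open Action act act-cong act-∘ act-id public
  open TranspositionSet 𝒯

  move : Fin n → Fin n → X → X
  move i j = act (transpose i j)

  move-involutive : ∀ i j x → move i j (move i j x) ≡ x
  move-involutive i j x = trans (sym (act-∘ (transpose i j) (transpose i j) x))
    (trans (act-cong (transpose-involutive i j) x) (act-id x))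

  S-minus : ∀ F G → S (λ x → F x ℚ.- G x) ≡ S F ℚ.- S G
  S-minus F G = trans (S-ext λ x → solve 2 (λ f g → f :- g := f :+ con (ℚ.- 1ℚ) :* g) refl (F x) (G x))
    (trans (S-linear F G (ℚ.- 1ℚ)) (solve 2 (λ f g → f :+ con (ℚ.- 1ℚ) :* g := f :- g) refl (S F) (S G)))

  S-scale : ∀ F c → S (λ x → c ℚ.* F x) ≡ c ℚ.* S F
  S-scale F c = trans (S-ext λ x → solve 2 (λ c f → c :* f := f :+ (c :- con 1ℚ) :* f) refl c (F x))
    (trans (S-linear F F (c ℚ.- 1ℚ)) (solve 2 (λ c f → f :+ (c :- con 1ℚ) :* f := c :* f) refl c (S F)))

  S-zero : S (λ _ → 0ℚ) ≡ 0ℚ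
  S-zero = trans (S-ext λ x → sym (ℚ.*-zeroˡ 0ℚ)) (trans (S-scale (λ _ → 0ℚ) 0ℚ) (ℚ.*-zeroˡ (S λ _ → 0ℚ)))

  S-mono : ∀ {F G} → (∀ x → F x ℚ.≤ G x) → S F ℚ.≤ S G
  S-mono {F} {G} F≤G = 0≤-⇒≤ (subst (0ℚ ℚ.≤_) (S-minus G F) (0≤S (λ x → G x ℚ.- F x) λ x → ≤⇒0≤- (F≤G x)))

  S-sum : ∀ {m} (f : Fin m → X → ℚ) → S (λ x → ∑.sum λ i → f i x) ≡ ∑.sum λ i → S (f i)
  S-sum {zero}  f = S-zero
  S-sum {suc m} f = trans (S-ext λ x → cong (f zero x ℚ.+_) (sym (ℚ.*-identityˡ _)))
    (trans (S-linear (f zero) (λ x → ∑.sum λ i → f (suc i) x) 1ℚ)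
      (cong (S (f zero) ℚ.+_) (trans (ℚ.*-identityˡ _) (S-sum (f ∘ suc)))))

  S-∑ₑ : ∀ (D : Fin n → Fin n → X → ℚ) → S (λ x → ∑ₑ λ i j → D i j x) ≡ ∑ₑ λ i j → S (D i j)
  S-∑ₑ D = trans (S-sum λ i x → ∑.sum (weighted (λ i j → D i j x) i)) (∑.sum-cong-≗ λ i →
    trans (S-sum λ j x → weighted (λ i j → D i j x) i j) (∑.sum-cong-≗ λ j → branch (oriented i j) (D i j)))
    where
    branch : ∀ b F → S (λ x → if b then F x else 0ℚ) ≡ (if b then S F else 0ℚ)
    branch true  F = refl
    branch false F = S-zero

  ∑ₑ-mono : ∀ {D D′} → (∀ i j → oriented i j ≡ true → D i j ℚ.≤ D′ i j) → ∑ₑ D ℚ.≤ ∑ₑ D′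
  ∑ₑ-mono {D} {D′} D≤D′ = sum-mono λ i → sum-mono λ j → entry i j
    where
    entry : ∀ i j → weighted D i j ℚ.≤ weighted D′ i j
    entry i j with oriented i j in e
    ... | true  = D≤D′ i j e
    ... | false = ℚ.≤-refl

  ∑ₑ-scale : ∀ c D → ∑ₑ (λ i j → c ℚ.* D i j) ≡ c ℚ.* ∑ₑ D
  ∑ₑ-scale c D = trans (∑ₑ-ext λ i j _ → solve 2 (λ c d → c :* d := d :+ (c :- con 1ℚ) :* d) refl c (D i j))
    (trans (∑ₑ-linear D D (c ℚ.- 1ℚ)) (solve 2 (λ c d → d :+ (c :- con 1ℚ) :* d := c :* d) refl c (∑ₑ D)))

  self-adjoint : ∀ F G → S (λ x → L F x ℚ.* G x) ≡ S (λ x → F x ℚ.* L G x)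
  self-adjoint F G = trans (expand F G) (trans (∑ₑ-ext λ i j _ → trans (S-ext λ x →
        solve 3 (λ f f′ g → (f :- f′) :* g := f :* g :- f′ :* g) refl (F x) (F (move i j x)) (G x))
      (trans (S-minus (λ x → F x ℚ.* G x) (λ x → F (move i j x) ℚ.* G x))
      (trans (cong (λ t → S (λ x → F x ℚ.* G x) ℚ.- t) (trans (sym (S-invariant (λ x → F (move i j x) ℚ.* G x) i j))
          (S-ext λ x → cong (ℚ._* G (move i j x)) (cong F (move-involutive i j x)))))
      (trans (sym (S-minus (λ x → F x ℚ.* G x) (λ x → F x ℚ.* G (move i j x))))
        (S-ext λ x → solve 3 (λ f g g′ → f :* g :- f :* g′ := (g :- g′) :* f) refl (F x) (G x) (G (move i j x)))))))
    (trans (sym (expand G F)) (S-ext λ x → ℚ.*-comm (L G x) (F x))))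
    where
    expand : ∀ F G → S (λ x → L F x ℚ.* G x) ≡ ∑ₑ λ i j → S (λ x → (F x ℚ.- F (move i j x)) ℚ.* G x)
    expand F G = trans (S-ext λ x → trans (ℚ.*-comm (L F x) (G x)) (trans (sym (∑ₑ-scale (G x) _))
      (∑ₑ-ext λ i j _ → ℚ.*-comm (G x) (F x ℚ.- F (move i j x))))) (S-∑ₑ λ i j x → (F x ℚ.- F (move i j x)) ℚ.* G x)

  open SelfAdjoint S S-ext S-linear 0≤S self-adjoint public

  L-sum : ∀ F → S (L F) ≡ 0ℚ
  L-sum F = trans (S-∑ₑ λ i j x → F x ℚ.- F (move i j x)) (trans
    (∑ₑ-ext λ i j _ → trans (S-minus F (F ∘ move i j)) (trans (cong (λ t → S F ℚ.- t) (S-invariant F i j))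
      (trans (ℚ.+-inverseʳ (S F)) (sym (ℚ.*-zeroˡ 0ℚ))))) (trans (∑ₑ-scale 0ℚ λ _ _ → 0ℚ) (ℚ.*-zeroˡ (∑ₑ λ _ _ → 0ℚ))))

  ⊖-sum : ∀ F c → S (F ⊖ c) ≡ (ι 0ℤ ℚ.- ι c) ℚ.* S F
  ⊖-sum F c = trans (S-minus (L F) (λ x → ι c ℚ.* F x)) (trans (cong₂ ℚ._-_ (L-sum F) (S-scale F (ι c)))
    (solve 2 (λ c s → con 0ℚ :- c :* s := (con 0ℚ :- c) :* s) refl (ι c) (S F)))

  prod-sum : ∀ lo m F → S (prod lo m F) ≡ scalar lo m 0ℤ ℚ.* S F
  prod-sum lo zero    F = sym (ℚ.*-identityˡ (S F))
  prod-sum lo (suc m) F = trans (prod-sum (ℤ.suc lo) m (F ⊖ lo)) (trans (cong (scalar (ℤ.suc lo) m 0ℤ ℚ.*_) (⊖-sum F lo))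
    (solve 3 (λ s l f → s :* (l :* f) := l :* s :* f) refl (scalar (ℤ.suc lo) m 0ℤ) (ι 0ℤ ℚ.- ι lo) (S F)))

  difference² : (X → ℚ) → Fin n → Fin n → X → ℚ
  difference² F i j x = (F x ℚ.- F (move i j x)) ℚ.* (F x ℚ.- F (move i j x))

  dirichlet : ∀ F → ⟨ F , L F ⟩ ≡ ½ ℚ.* ∑ₑ λ i j → S (difference² F i j)
  dirichlet F = trans (S-ext λ x → sym (∑ₑ-scale (F x) _)) (trans (S-∑ₑ λ i j x → F x ℚ.* (F x ℚ.- F (move i j x)))
    (trans (∑ₑ-ext λ i j _ → half i j) (∑ₑ-scale ½ _)))
    where
    half : ∀ i j → S (λ x → F x ℚ.* (F x ℚ.- F (move i j x))) ≡ ½ ℚ.* S (difference² F i j)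
    half i j = sym (trans (sym (S-scale (difference² F i j) ½)) (trans
      (S-ext λ x → solve 2 (λ f g → con ½ :* ((f :- g) :* (f :- g)) := f :* (f :- g) :+ con (ℚ.- ½) :* (f :* f :- g :* g)) refl (F x) (F (move i j x)))
      (trans (S-linear (λ x → F x ℚ.* (F x ℚ.- F (move i j x))) (λ x → F x ℚ.* F x ℚ.- F (move i j x) ℚ.* F (move i j x)) (ℚ.- ½))
      (trans (cong (λ t → S (λ x → F x ℚ.* (F x ℚ.- F (move i j x))) ℚ.+ ℚ.- ½ ℚ.* t)
        (trans (S-minus (λ x → F x ℚ.* F x) (λ x → F (move i j x) ℚ.* F (move i j x)))
          (trans (cong (λ t → S (λ x → F x ℚ.* F x) ℚ.- t) (S-invariant (λ x → F x ℚ.* F x) i j)) (ℚ.+-inverseʳ (S λ x → F x ℚ.* F x)))))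
        (solve 1 (λ s → s :+ con (ℚ.- ½) :* con 0ℚ := s) refl (S λ x → F x ℚ.* (F x ℚ.- F (move i j x))))))))

  0≤∑ₑ : ∀ D → (∀ i j → 0ℚ ℚ.≤ D i j) → 0ℚ ℚ.≤ ∑ₑ D
  0≤∑ₑ D 0≤D = subst (ℚ._≤ ∑ₑ D) (trans (∑ₑ-ext λ _ _ _ → sym (ℚ.*-zeroˡ 0ℚ)) (trans (∑ₑ-scale 0ℚ λ _ _ → 0ℚ) (ℚ.*-zeroˡ (∑ₑ λ _ _ → 0ℚ))))
    (∑ₑ-mono λ i j _ → 0≤D i j)

  0≤difference² : ∀ F i j → 0ℚ ℚ.≤ S (difference² F i j)
  0≤difference² F i j = 0≤S (difference² F i j) λ x → 0≤sq (F x ℚ.- F (move i j x))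

  L-lower : ∀ F → 0ℚ ℚ.≤ ⟨ F , L F ⟩
  L-lower F = subst (0ℚ ℚ.≤_) (sym (dirichlet F))
    (0≤* (ℚ.<⇒≤ (ℚ.positive⁻¹ ½)) (0≤∑ₑ _ (0≤difference² F)))

  kernel-invariant : ∀ h → (∀ x → L h x ≡ 0ℚ) → ∀ i j → oriented i j ≡ true → ∀ x → h (move i j x) ≡ h x
  kernel-invariant h Lh≡0 i j e x = sym (trans (solve 2 (λ f g → f := (f :- g) :+ g) refl (h x) (h (move i j x)))
    (trans (cong (ℚ._+ h (move i j x)) (square-root (h x ℚ.- h (move i j x)) (S-definite (difference² h i j) (λ x → 0≤sq (h x ℚ.- h (move i j x))) S≡0 x)))
      (ℚ.+-identityˡ (h (move i j x)))))
    where
    D : Fin n → Fin n → ℚ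
    D i j = S (difference² h i j)
    total : ∑ₑ D ≡ 0ℚ
    total = trans (solve 1 (λ s → s := con (ι (+ 2)) :* (con ½ :* s)) refl (∑ₑ D))
      (trans (cong (ι (+ 2) ℚ.*_) (trans (sym (dirichlet h)) (⟨⟩-zeroʳ h Lh≡0))) (ℚ.*-zeroʳ (ι (+ 2))))
    0≤weighted : ∀ i j → 0ℚ ℚ.≤ weighted D i j
    0≤weighted i j with oriented i j
    ... | true  = 0≤difference² h i j
    ... | false = ℚ.≤-refl
    S≡0 : D i j ≡ 0ℚ
    S≡0 = trans (cong (λ b → if b then D i j else 0ℚ) (sym e))
      (zero-summand (weighted D i) (0≤weighted i)
        (zero-summand (λ i → ∑.sum (weighted D i)) (λ i → 0≤sum (weighted D i) (0≤weighted i)) total i) j)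

  moves : Fin n → Fin n → X → ℚ
  moves i j x = if does (move i j x ≟ x) then 0ℚ else 1ℚ

  module _ (b : ℕ) (degree-≤ : ∀ x → ∑ₑ (λ i j → moves i j x) ℚ.≤ ι (+ b)) where

    L-upper : ∀ F → ⟨ F , L F ⟩ ℚ.≤ ι (+ (2 ℕ.* b)) ℚ.* ⟨ F , F ⟩
    L-upper F = ℚ.≤-trans (ℚ.≤-reflexive (trans (S-ext λ x → sym (∑ₑ-scale (F x) _)) (S-∑ₑ λ i j x → F x ℚ.* (F x ℚ.- F (move i j x)))))
      (ℚ.≤-trans (∑ₑ-mono λ i j _ → edge i j) (ℚ.≤-trans
        (ℚ.≤-reflexive (trans (∑ₑ-scale (ι (+ 2)) _) (cong (ι (+ 2) ℚ.*_) (trans (sym (S-∑ₑ λ i j x → moves i j x ℚ.* (F x ℚ.* F x)))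
          (S-ext λ x → trans (∑ₑ-ext λ i j _ → ℚ.*-comm (moves i j x) (F x ℚ.* F x)) (∑ₑ-scale (F x ℚ.* F x) λ i j → moves i j x))))))
        (ℚ.≤-trans (ℚ.*-monoˡ-≤-nonNeg (ι (+ 2)) (S-mono λ x → ℚ.*-monoˡ-≤-nonNeg (F x ℚ.* F x) {{ℚ.nonNegative (0≤sq (F x))}} (degree-≤ x)))
          (ℚ.≤-reflexive (trans (cong (ι (+ 2) ℚ.*_) (trans (S-ext λ x → ℚ.*-comm (F x ℚ.* F x) (ι (+ b))) (S-scale (λ x → F x ℚ.* F x) (ι (+ b)))))
            (trans (sym (ℚ.*-assoc (ι (+ 2)) (ι (+ b)) ⟨ F , F ⟩)) (cong (ℚ._* ⟨ F , F ⟩) (trans (sym (ι-* (+ 2) (+ b))) (cong ι (sym (ℤ.pos-* 2 b)))))))))))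
      where
      edge : ∀ i j → S (λ x → F x ℚ.* (F x ℚ.- F (move i j x))) ℚ.≤ ι (+ 2) ℚ.* S (λ x → moves i j x ℚ.* (F x ℚ.* F x))
      edge i j = ℚ.≤-trans (S-mono bound) (ℚ.≤-reflexive (trans (S-linear (λ x → ι (+ 3) ℚ.* ½ ℚ.* G x) (λ x → G (move i j x)) ½)
        (trans (cong₂ (λ s t → s ℚ.+ ½ ℚ.* t) (S-scale G (ι (+ 3) ℚ.* ½)) (S-invariant G i j))
          (solve 1 (λ g → con (ι (+ 3)) :* con ½ :* g :+ con ½ :* g := con (ι (+ 2)) :* g) refl (S G)))))
        where
        G : X → ℚ
        G x = moves i j x ℚ.* (F x ℚ.* F x)
        moves-move : ∀ x → moves i j (move i j x) ≡ moves i j x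
        moves-move x = cong (if_then 0ℚ else 1ℚ) (same (move i j (move i j x) ≟ move i j x) (move i j x ≟ x))
          where
          same : (d : Dec (move i j (move i j x) ≡ move i j x)) (e : Dec (move i j x ≡ x)) → does d ≡ does e
          same (yes _) (yes _) = refl
          same (no _)  (no _)  = refl
          same (yes p) (no ¬q) = contradiction (sym (trans (sym (move-involutive i j x)) p)) ¬q
          same (no ¬p) (yes q) = contradiction (cong (move i j) q) ¬p
        bound : ∀ x → F x ℚ.* (F x ℚ.- F (move i j x)) ℚ.≤ ι (+ 3) ℚ.* ½ ℚ.* G x ℚ.+ ½ ℚ.* G (move i j x)
        bound x = subst (λ g → F x ℚ.* (F x ℚ.- F (move i j x)) ℚ.≤ ι (+ 3) ℚ.* ½ ℚ.* G x ℚ.+ ½ ℚ.* (g ℚ.* (F (move i j x) ℚ.* F (move i j x))))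
          (sym (moves-move x)) (cases (move i j x ≟ x))
          where
          cases : (d : Dec (move i j x ≡ x)) → let w = if does d then 0ℚ else 1ℚ in
            F x ℚ.* (F x ℚ.- F (move i j x)) ℚ.≤ ι (+ 3) ℚ.* ½ ℚ.* (w ℚ.* (F x ℚ.* F x)) ℚ.+ ½ ℚ.* (w ℚ.* (F (move i j x) ℚ.* F (move i j x)))
          cases (yes fixed) = subst (λ y → F x ℚ.* (F x ℚ.- F y) ℚ.≤ ι (+ 3) ℚ.* ½ ℚ.* (0ℚ ℚ.* (F x ℚ.* F x)) ℚ.+ ½ ℚ.* (0ℚ ℚ.* (F y ℚ.* F y))) (sym fixed)
            (ℚ.≤-reflexive (solve 1 (λ f → f :* (f :- f) := con (ι (+ 3)) :* con ½ :* (con 0ℚ :* (f :* f)) :+ con ½ :* (con 0ℚ :* (f :* f))) refl (F x)))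
          cases (no _) = ≤-by (0≤* (ℚ.<⇒≤ (ℚ.positive⁻¹ ½)) (0≤sq (F x ℚ.+ F (move i j x))))
            (solve 2 (λ f g → (con (ι (+ 3)) :* con ½ :* (con 1ℚ :* (f :* f)) :+ con ½ :* (con 1ℚ :* (g :* g))) :- f :* (f :- g) := con ½ :* ((f :+ g) :* (f :+ g))) refl
              (F x) (F (move i j x)))

    product-invariant : Integral (CaySym 𝒯) → ∀ F i j → oriented i j ≡ true → ∀ x →
                        prod 1ℤ (2 ℕ.* b) F (move i j x) ≡ prod 1ℤ (2 ℕ.* b) F x
    product-invariant integral F = kernel-invariant h λ x →
      trans (solve 2 (λ l h → l := l :- con 0ℚ :* h) refl (L h x) (h x))
        (trans (sym (prod-⊖ 1ℤ (2 ℕ.* b) F 0ℤ x)) (killed x))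
      where
      h : X → ℚ
      h = prod 1ℤ (2 ℕ.* b) F
      killed : Killed 0ℤ (suc (2 ℕ.* b)) F
      killed = let lo , m , k = annihilated integral in
        killed-in-range (λ F F²≡0 x → square-root (F x) (S-definite (λ x → F x ℚ.* F x) (λ x → 0≤sq (F x)) F²≡0 x)) (2 ℕ.* b) L-lower L-upper lo m F (k F)

    -- Abstract, since unfolding the product is intractable.
    abstract
      product : (X → ℚ) → X → ℚ
      product = prod 1ℤ (2 ℕ.* b)

      product-move : Integral (CaySym 𝒯) → ∀ F i j → oriented i j ≡ true → ∀ x → product F (move i j x) ≡ product F x
      product-move = product-invariant

      product-sum : ∀ F → S (product F) ≡ scalar 1ℤ (2 ℕ.* b) 0ℤ ℚ.* S F
      product-sum = prod-sum 1ℤ (2 ℕ.* b)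

      product-preserves : ∀ (P : (X → ℚ) → Set) → (∀ {F} c → P F → P (F ⊖ c)) → ∀ {F} → P F → P (product F)
      product-preserves P step = preserves 1ℤ (2 ℕ.* b)
        where
        preserves : ∀ lo m {F} → P F → P (prod lo m F)
        preserves lo zero    pF = pF
        preserves lo (suc m) pF = preserves (ℤ.suc lo) m (step lo pF)

  invariant-everywhere : (∀ i j → Star (λ i j → T (transpose i j)) i j) →
    ∀ (h : X → ℚ) → (∀ i j → T (transpose i j) → ∀ x → h (move i j x) ≡ h x) → ∀ i j → i ≢ j → ∀ x → h (move i j x) ≡ h x
  invariant-everywhere paths h inv i j i≢j = [ (λ i≡j → contradiction i≡j i≢j) , (λ h≡ → h≡) ]′ (along {i} {j} (paths i j))
    where
    along : ∀ {i j} → Star (λ i j → T (transpose i j)) i j → i ≡ j ⊎ (∀ x → h (move i j x) ≡ h x)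
    along Star.ε = inj₁ refl
    along {i} {j} (_◅_ {j = k} ik path) with i Fin.≟ j | k Fin.≟ j | i Fin.≟ k | along path
    ... | yes i≡j | _ | _ | _ = inj₁ i≡j
    ... | no _ | yes refl | _ | _ = inj₂ (inv i k ik)
    ... | no _ | no k≢j | yes refl | inj₁ k≡j = contradiction k≡j k≢j
    ... | no _ | no k≢j | yes refl | inj₂ h≡ = inj₂ h≡
    ... | no i≢j | no k≢j | no i≢k | inj₁ k≡j = contradiction k≡j k≢j
    ... | no i≢j | no k≢j | no i≢k | inj₂ h≡ = inj₂ λ x → trans
      (cong h (trans (act-cong (transpose-conjugate i≢j k≢j i≢k) x)
        (trans (act-∘ (transpose i k ∘ₚ transpose k j) (transpose i k) x) (cong (move i k) (act-∘ (transpose i k) (transpose k j) x)))))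
      (trans (inv i k ik (move k j (move i k x))) (trans (h≡ (move i k x)) (inv i k ik x)))

  integer-L : ∀ {F} → (∀ x → IsInteger (F x)) → ∀ x → IsInteger (L F x)
  integer-L {F} int x = integer-sum _ λ i → integer-sum _ λ j → branch (oriented i j) (integer-minus (int x) (int (move i j x)))
    where
    branch : ∀ b {q} → IsInteger q → IsInteger (if b then q else 0ℚ)
    branch true  int = int
    branch false _   = 0ℤ , refl

  integer-⊖ : ∀ {F} → (∀ x → IsInteger (F x)) → ∀ c x → IsInteger ((F ⊖ c) x)
  integer-⊖ int c x = integer-minus (integer-L int x) (integer-* (c , refl) (int x))

  integer-prod : ∀ lo m {F} → (∀ x → IsInteger (F x)) → ∀ x → IsInteger (prod lo m F x)
  integer-prod lo zero    int = int
  integer-prod lo (suc m) int = integer-prod (ℤ.suc lo) m (integer-⊖ int lo)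

does-cong : {P Q : Set} (p : Dec P) (q : Dec Q) → (P → Q) → (Q → P) → does p ≡ does q
does-cong (yes _) (yes _) _ _ = refl
does-cong (no _)  (no _)  _ _ = refl
does-cong (yes p) (no ¬q) f _ = contradiction (f p) ¬q
does-cong (no ¬p) (yes q) _ g = contradiction (g q) ¬p

count-tabulate : ∀ {m} {A : Set} {P : A → Set} (P? : ∀ x → Dec (P x)) (f : Fin m → A) →
                 count P? (tabulate f) ≡ ∑ℕ.sum λ i → bit (does (P? (f i)))
count-tabulate {zero}  P? f = refl
count-tabulate {suc m} P? f with does (P? (f zero))
... | true  = cong suc (count-tabulate P? (f ∘ suc))
... | false = count-tabulate P? (f ∘ suc)


δ : ∀ {n} → Fin n → Fin n → ℚ
δ i x = if does (i Fin.≟ x) then 1ℚ else 0ℚ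

δ-refl : ∀ {n} (x : Fin n) → δ x x ≡ 1ℚ
δ-refl x = cong (if_then 1ℚ else 0ℚ) (dec-true (x Fin.≟ x) refl)

δ-off : ∀ {n} {i x : Fin n} → i ≢ x → δ i x ≡ 0ℚ
δ-off {i = i} {x} i≢x = cong (if_then 1ℚ else 0ℚ) (dec-false (i Fin.≟ x) i≢x)

0≤δ : ∀ {n} (i x : Fin n) → 0ℚ ℚ.≤ δ i x
0≤δ i x with i Fin.≟ x
... | yes _ = ℚ.<⇒≤ 0<1
... | no _  = ℚ.≤-refl

Even : ℚ → Set
Even q = ∃[ k ] q ≡ ι (+ 2) ℚ.* ι k

even-minus : ∀ {p q} → Even p → Even q → Even (p ℚ.- q)
even-minus (k , refl) (l , refl) = k ℤ.- l , trans
  (solve 2 (λ k l → con (ι (+ 2)) :* k :- con (ι (+ 2)) :* l := con (ι (+ 2)) :* (k :- l)) refl (ι k) (ι l))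
  (cong (ι (+ 2) ℚ.*_) (sym (ι-minus k l)))

even-* : ∀ {p q} → IsInteger p → Even q → Even (p ℚ.* q)
even-* (k , refl) (l , refl) = k ℤ.* l , trans
  (solve 2 (λ k l → k :* (con (ι (+ 2)) :* l) := con (ι (+ 2)) :* (k :* l)) refl (ι k) (ι l))
  (cong (ι (+ 2) ℚ.*_) (sym (ι-* k l)))

even-double : ∀ {q} → IsInteger q → Even (ι (+ 2) ℚ.* q)
even-double (k , refl) = k , refl

even-sum : ∀ {m} (f : Vector m) → (∀ i → Even (f i)) → Even (∑.sum f)
even-sum {zero}  f even = 0ℤ , refl
even-sum {suc m} f even with even zero | even-sum (f ∘ suc) (even ∘ suc)
... | k , eq | l , eq′ = k ℤ.+ l , trans (cong₂ ℚ._+_ eq eq′) (trans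
  (solve 2 (λ k l → con (ι (+ 2)) :* k :+ con (ι (+ 2)) :* l := con (ι (+ 2)) :* (k :+ l)) refl (ι k) (ι l))
  (cong (ι (+ 2) ℚ.*_) (sym (ι-+ k l))))

square-parity : ∀ {q} → IsInteger q → Even (q ℚ.* q ℚ.- q)
square-parity (k , refl) = cases (k ℤ.%ℕ 2) (k ℤ./ℕ 2) (ℤ.n%ℕd<d k 2) (ℤ.a≡a%ℕn+[a/ℕn]*n k 2)
  where
  cast : ∀ k l → k ℤ.* k ℤ.- k ≡ + 2 ℤ.* l → Even (ι k ℚ.* ι k ℚ.- ι k)
  cast k l eq = l , trans (sym (trans (ι-minus (k ℤ.* k) k) (cong (ℚ._- ι k) (ι-* k k)))) (trans (cong ι eq) (ι-* (+ 2) l))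
  cases : ∀ r q → r ℕ.< 2 → k ≡ + r ℤ.+ q ℤ.* + 2 → Even (ι k ℚ.* ι k ℚ.- ι k)
  cases 0 q _ refl = cast k (q ℤ.* (q ℤ.* + 2 ℤ.- 1ℤ)) (ℤS.solve 1 (λ q →
    (ℤS.con 0ℤ ℤS.:+ q ℤS.:* ℤS.con (+ 2)) ℤS.:* (ℤS.con 0ℤ ℤS.:+ q ℤS.:* ℤS.con (+ 2)) ℤS.:- (ℤS.con 0ℤ ℤS.:+ q ℤS.:* ℤS.con (+ 2))
    ℤS.:= ℤS.con (+ 2) ℤS.:* (q ℤS.:* (q ℤS.:* ℤS.con (+ 2) ℤS.:- ℤS.con 1ℤ))) refl q)
  cases 1 q _ refl = cast k (q ℤ.* (q ℤ.* + 2 ℤ.+ 1ℤ)) (ℤS.solve 1 (λ q →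
    (ℤS.con 1ℤ ℤS.:+ q ℤS.:* ℤS.con (+ 2)) ℤS.:* (ℤS.con 1ℤ ℤS.:+ q ℤS.:* ℤS.con (+ 2)) ℤS.:- (ℤS.con 1ℤ ℤS.:+ q ℤS.:* ℤS.con (+ 2))
    ℤS.:= ℤS.con (+ 2) ℤS.:* (q ℤS.:* (q ℤS.:* ℤS.con (+ 2) ℤS.:+ ℤS.con 1ℤ))) refl q)
  cases (suc (suc r)) q (ℕ.s≤s (ℕ.s≤s ())) _

sum-δ : ∀ {n} (i : Fin n) (f : Vector n) → ∑.sum (λ x → δ i x ℚ.* f x) ≡ f i
sum-δ i f = trans (∑′.sum-single (λ x → δ i x ℚ.* f x) i λ x x≢i → trans (cong (ℚ._* f x) (δ-off (≢-sym x≢i))) (ℚ.*-zeroˡ (f x)))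
  (trans (cong (ℚ._* f i) (δ-refl i)) (ℚ.*-identityˡ (f i)))

sum-const : ∀ n q → ∑.sum {n} (λ _ → q) ≡ ι (+ n) ℚ.* q
sum-const zero    q = sym (ℚ.*-zeroˡ q)
sum-const (suc n) q = trans (cong (q ℚ.+_) (sum-const n q)) (trans
  (solve 2 (λ q n → q :+ n :* q := (con 1ℚ :+ n) :* q) refl q (ι (+ n))) (cong (ℚ._* q) (sym (ι-+ 1ℤ (+ n)))))

module Concrete {n} (𝒯 : TranspositionSet n) (isCubic : Cubic (transpositionGraph 𝒯))
                (isConnected : Connected (transpositionGraph 𝒯)) (integral : Integral (CaySym 𝒯)) where

  open TranspositionSet 𝒯
  open Cayley 𝒯 id id using (oriented; weighted; ∑ₑ; ∑ₑ-ext; ∑ₑ-linear)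

  a : Adjacency n
  a i j = does (T? (transpose i j))

  a-symmetric : ∀ i j → a i j ≡ a j i
  a-symmetric i j = does-cong (T? (transpose i j)) (T? (transpose j i))
    (T-resp {transpose i j} {transpose j i} (transpose-comm i j)) (T-resp {transpose j i} {transpose i j} (transpose-comm j i))

  a-irreflexive : ∀ i → a i i ≡ false
  a-irreflexive i = dec-false (T? (transpose i i)) λ t → Graph.adj-irrefl (transpositionGraph 𝒯) {i} refl t

  a-cubic : ∀ x → ∑ℕ.sum (bit ∘ a x) ≡ 3
  a-cubic x = trans (sym (count-tabulate (λ j → T? (transpose x j)) id)) (isCubic x)

  paths : ∀ i j → Star (λ i j → T (transpose i j)) i j
  paths i j = let z , path , z≡j = proj₂ isConnected i j in subst (Star (λ i j → T (transpose i j)) i) z≡j path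

  a-connected : ∀ (p : Fin n → Bool) → (∀ x y → a x y ≡ true → p x ≡ true → p y ≡ true) →
                ∀ x y → p x ≡ true → p y ≡ true
  a-connected p closed x y = along (paths x y)
    where
    along : ∀ {x y} → Star (λ i j → T (transpose i j)) x y → p x ≡ true → p y ≡ true
    along Star.ε       px = px
    along (_◅_ {i} {j} t path) px = along path (closed i j (dec-true (T? (transpose i j)) t) px)

  a-distinct : ∀ i j → a i j ≡ true → i ≢ j
  a-distinct i _ e refl = contradiction (trans (sym e) (a-irreflexive i)) λ ()

  oriented-distinct : ∀ {i j} → oriented i j ≡ true → i ≢ j
  oriented-distinct {i} {j} e = a-distinct i j (proj₁ (∧-split {a i j} e))

  orientations : ∀ x j q → (if oriented x j then q else 0ℚ) ℚ.+ (if oriented j x then q else 0ℚ) ≡ (if a j x then q else 0ℚ)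
  orientations x j q = trans
    (cong (λ b → (if b ∧ does (x Fin.<? j) then q else 0ℚ) ℚ.+ (if oriented j x then q else 0ℚ)) (a-symmetric x j))
    (cases (Fin.<-cmp x j))
    where
    cases : _ → (if a j x ∧ does (x Fin.<? j) then q else 0ℚ) ℚ.+ (if a j x ∧ does (j Fin.<? x) then q else 0ℚ) ≡ (if a j x then q else 0ℚ)
    cases (tri< x<j _ j≮x) = trans (cong₂ (λ b c → (if a j x ∧ b then q else 0ℚ) ℚ.+ (if a j x ∧ c then q else 0ℚ))
      (dec-true (x Fin.<? j) x<j) (dec-false (j Fin.<? x) j≮x)) (left (a j x))
      where
      left : ∀ b → (if b ∧ true then q else 0ℚ) ℚ.+ (if b ∧ false then q else 0ℚ) ≡ (if b then q else 0ℚ)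
      left true  = ℚ.+-identityʳ q
      left false = refl
    cases (tri> x≮j _ j<x) = trans (cong₂ (λ b c → (if a j x ∧ b then q else 0ℚ) ℚ.+ (if a j x ∧ c then q else 0ℚ))
      (dec-false (x Fin.<? j) x≮j) (dec-true (j Fin.<? x) j<x)) (right (a j x))
      where
      right : ∀ b → (if b ∧ false then q else 0ℚ) ℚ.+ (if b ∧ true then q else 0ℚ) ≡ (if b then q else 0ℚ)
      right true  = ℚ.+-identityˡ q
      right false = refl
    cases (tri≈ _ refl _) = subst (λ b → (if b ∧ does (x Fin.<? x) then q else 0ℚ) ℚ.+ (if b ∧ does (x Fin.<? x) then q else 0ℚ) ≡ (if b then q else 0ℚ))
      (sym (a-irreflexive x)) refl

  nbrs : Fin n → (Fin n → ℚ) → ℚ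
  nbrs x H = ∑.sum λ j → if a j x then H j else 0ℚ

  private
    if-linear : ∀ b s c t → (if b then s ℚ.+ c ℚ.* t else 0ℚ) ≡ (if b then s else 0ℚ) ℚ.+ c ℚ.* (if b then t else 0ℚ)
    if-linear true  s c t = refl
    if-linear false s c t = solve 1 (λ c → con 0ℚ := con 0ℚ :+ c :* con 0ℚ) refl c

    if-zero : ∀ b {q} → q ≡ 0ℚ → (if b then q else 0ℚ) ≡ 0ℚ
    if-zero true  q≡0 = q≡0
    if-zero false _   = refl

  nbrs-ext : ∀ x {H K} → (∀ j → H j ≡ K j) → nbrs x H ≡ nbrs x K
  nbrs-ext x H≗K = ∑.sum-cong-≗ λ j → cong (if a j x then_else 0ℚ) (H≗K j)

  nbrs-linear : ∀ x H K c → nbrs x (λ j → H j ℚ.+ c ℚ.* K j) ≡ nbrs x H ℚ.+ c ℚ.* nbrs x K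
  nbrs-linear x H K c = trans (∑.sum-cong-≗ λ j → if-linear (a j x) (H j) c (K j))
    (sum-linear (λ j → if a j x then H j else 0ℚ) (λ j → if a j x then K j else 0ℚ) c)

  nbrs-1 : ∀ x → nbrs x (λ _ → 1ℚ) ≡ ι (+ 3)
  nbrs-1 x = trans (∑.sum-cong-≗ λ j → trans (cong (if_then 1ℚ else 0ℚ) (a-symmetric j x)) (sym (bit-ι (a x j))))
    (trans (sym (cast (bit ∘ a x))) (cong (ι ∘ +_) (a-cubic x)))
    where
    bit-ι : ∀ b → ι (+ bit b) ≡ (if b then 1ℚ else 0ℚ)
    bit-ι true  = refl
    bit-ι false = refl
    cast : ∀ {m} (f : Fin m → ℕ) → ι (+ ∑ℕ.sum f) ≡ ∑.sum λ i → ι (+ f i)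
    cast {zero}  f = refl
    cast {suc m} f = trans (trans (cong ι (ℤ.pos-+ (f zero) _)) (ι-+ (+ f zero) (+ ∑ℕ.sum (f ∘ suc)))) (cong (ι (+ f zero) ℚ.+_) (cast (f ∘ suc)))

  nbrs-const : ∀ x q → nbrs x (λ _ → q) ≡ ι (+ 3) ℚ.* q
  nbrs-const x q = trans (nbrs-ext x λ j → solve 1 (λ q → q := con 1ℚ :+ (q :- con 1ℚ) :* con 1ℚ) refl q)
    (trans (nbrs-linear x (λ _ → 1ℚ) (λ _ → 1ℚ) (q ℚ.- 1ℚ)) (trans (cong (λ t → t ℚ.+ (q ℚ.- 1ℚ) ℚ.* t) (nbrs-1 x))
      (solve 2 (λ t q → t :+ (q :- con 1ℚ) :* t := t :* q) refl (ι (+ 3)) q)))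

  nbrs-difference : ∀ x q H → nbrs x (λ j → q ℚ.- H j) ≡ ι (+ 3) ℚ.* q ℚ.- nbrs x H
  nbrs-difference x q H = trans (nbrs-ext x λ j → solve 2 (λ q h → q :- h := q :+ con (ℚ.- 1ℚ) :* h) refl q (H j))
    (trans (nbrs-linear x (λ _ → q) H (ℚ.- 1ℚ)) (trans (cong (ℚ._+ ℚ.- 1ℚ ℚ.* nbrs x H) (nbrs-const x q))
      (solve 2 (λ q h → q :+ con (ℚ.- 1ℚ) :* h := q :- h) refl (ι (+ 3) ℚ.* q) (nbrs x H))))

  nbrs-δ : ∀ x y q → nbrs x (λ j → δ j y ℚ.* q) ≡ (if a y x then q else 0ℚ)
  nbrs-δ x y q = trans (∑′.sum-single (λ j → if a j x then δ j y ℚ.* q else 0ℚ) y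
      λ j j≢y → if-zero (a j x) (trans (cong (ℚ._* q) (δ-off j≢y)) (ℚ.*-zeroˡ q)))
    (cong (if a y x then_else 0ℚ) (trans (cong (ℚ._* q) (δ-refl y)) (ℚ.*-identityˡ q)))

  edge-sum : ∀ x H → ∑ₑ (λ i j → δ i x ℚ.* H j ℚ.+ 1ℚ ℚ.* (δ j x ℚ.* H i)) ≡ nbrs x H
  edge-sum x H = trans (∑ₑ-linear (λ i j → δ i x ℚ.* H j) (λ i j → δ j x ℚ.* H i) 1ℚ) (trans
    (cong₂ (λ s t → s ℚ.+ 1ℚ ℚ.* t) from-x to-x) (trans
      (sym (sum-linear (λ j → if oriented x j then H j else 0ℚ) (λ j → if oriented j x then H j else 0ℚ) 1ℚ))
      (∑.sum-cong-≗ λ j → trans (cong ((if oriented x j then H j else 0ℚ) ℚ.+_) (ℚ.*-identityˡ _)) (orientations x j (H j)))))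
    where
    from-x : ∑ₑ (λ i j → δ i x ℚ.* H j) ≡ ∑.sum λ j → if oriented x j then H j else 0ℚ
    from-x = trans (∑′.sum-single (λ i → ∑.sum (weighted (λ i j → δ i x ℚ.* H j) i)) x λ i i≢x →
        ∑′.sum-zero (weighted (λ i j → δ i x ℚ.* H j) i) λ j → if-zero (oriented i j) (trans (cong (ℚ._* H j) (δ-off i≢x)) (ℚ.*-zeroˡ (H j))))
      (∑.sum-cong-≗ λ j → cong (if oriented x j then_else 0ℚ) (trans (cong (ℚ._* H j) (δ-refl x)) (ℚ.*-identityˡ (H j))))
    to-x : ∑ₑ (λ i j → δ j x ℚ.* H i) ≡ ∑.sum λ i → if oriented i x then H i else 0ℚ
    to-x = ∑.sum-cong-≗ λ i → trans (∑′.sum-single (weighted (λ i j → δ j x ℚ.* H i) i) x λ j j≢x →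
        if-zero (oriented i j) (trans (cong (ℚ._* H i) (δ-off j≢x)) (ℚ.*-zeroˡ (H i))))
      (cong (if oriented i x then_else 0ℚ) (trans (cong (ℚ._* H i) (δ-refl x)) (ℚ.*-identityˡ (H i))))

  symmetric-sum : ∀ (P : Fin n → Fin n → ℚ) → (∀ x y → P x y ≡ P y x) → ∑.sum (λ x → nbrs x (P x)) ≡ ι (+ 2) ℚ.* ∑ₑ P
  symmetric-sum P P-sym = trans (∑.sum-cong-≗ λ x → trans
      (∑.sum-cong-≗ λ j → sym (orientations x j (P x j)))
      (∑.∑-distrib-+ (λ j → if oriented x j then P x j else 0ℚ) (λ j → if oriented j x then P x j else 0ℚ)))
    (trans (∑.∑-distrib-+ (λ x → ∑.sum λ j → if oriented x j then P x j else 0ℚ) (λ x → ∑.sum λ j → if oriented j x then P x j else 0ℚ))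
    (trans (cong (∑ₑ P ℚ.+_) (trans (∑.∑-comm λ x j → if oriented j x then P x j else 0ℚ)
        (∑.sum-cong-≗ λ j → ∑.sum-cong-≗ λ x → cong (if oriented j x then_else 0ℚ) (P-sym x j))))
      (solve 1 (λ s → s :+ s := con (ι (+ 2)) :* s) refl (∑ₑ P))))

  moved-point : ∀ {i j} → i ≢ j → ∀ x (F : Fin n → ℚ) →
    F x ℚ.- F (transpose i j ⟨$⟩ʳ x) ≡ δ i x ℚ.* (F x ℚ.- F j) ℚ.+ 1ℚ ℚ.* (δ j x ℚ.* (F x ℚ.- F i))
  moved-point {i} {j} i≢j x F = cases (i Fin.≟ x) (j Fin.≟ x)
    where
    cases : Dec (i ≡ x) → Dec (j ≡ x) → F x ℚ.- F (transpose i j ⟨$⟩ʳ x) ≡ δ i x ℚ.* (F x ℚ.- F j) ℚ.+ 1ℚ ℚ.* (δ j x ℚ.* (F x ℚ.- F i))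
    cases (yes refl) _ = trans (cong (λ y → F x ℚ.- F y) (transpose-left x j)) (sym (trans
      (cong₂ (λ s t → s ℚ.* (F x ℚ.- F j) ℚ.+ 1ℚ ℚ.* (t ℚ.* (F x ℚ.- F x))) (δ-refl x) (δ-off (≢-sym i≢j)))
      (solve 2 (λ f g → con 1ℚ :* (f :- g) :+ con 1ℚ :* (con 0ℚ :* (f :- f)) := f :- g) refl (F x) (F j))))
    cases (no i≢x) (yes refl) = trans (cong (λ y → F x ℚ.- F y) (transpose-right i x)) (sym (trans
      (cong₂ (λ s t → s ℚ.* (F x ℚ.- F x) ℚ.+ 1ℚ ℚ.* (t ℚ.* (F x ℚ.- F i))) (δ-off i≢x) (δ-refl x))
      (solve 2 (λ f g → con 0ℚ :* (f :- f) :+ con 1ℚ :* (con 1ℚ :* (f :- g)) := f :- g) refl (F x) (F i))))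
    cases (no i≢x) (no j≢x) = trans (cong (λ y → F x ℚ.- F y) (transpose-other i j x (≢-sym i≢x) (≢-sym j≢x))) (sym (trans
      (cong₂ (λ s t → s ℚ.* (F x ℚ.- F j) ℚ.+ 1ℚ ℚ.* (t ℚ.* (F x ℚ.- F i))) (δ-off i≢x) (δ-off j≢x))
      (solve 3 (λ f g h → con 0ℚ :* (f :- g) :+ con 1ℚ :* (con 0ℚ :* (f :- h)) := f :- f) refl (F x) (F j) (F i))))

  module Points = Spectral 𝒯 id id Fin._≟_ _⟨$⟩ʳ_ (λ π≈σ → π≈σ) (λ _ _ _ → refl) (λ _ → refl)
    ∑.sum (λ F≗G → ∑.sum-cong-≗ F≗G) sum-linear 0≤sum zero-summand (λ F i j → sym (∑.sum-permute F (transpose i j)))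

  pair-sum : (Fin n × Fin n → ℚ) → ℚ
  pair-sum F = ∑.sum λ x → ∑.sum λ y → F (x , y)

  module Pairs = Spectral 𝒯 id id (Product.≡-dec Fin._≟_ Fin._≟_) (λ π (x , y) → π ⟨$⟩ʳ x , π ⟨$⟩ʳ y)
    (λ π≈σ (x , y) → cong₂ _,_ (π≈σ x) (π≈σ y)) (λ _ _ _ → refl) (λ _ → refl)
    pair-sum (λ F≗G → ∑.sum-cong-≗ λ x → ∑.sum-cong-≗ λ y → F≗G (x , y))
    (λ F G c → trans (∑.sum-cong-≗ λ x → sum-linear (λ y → F (x , y)) (λ y → G (x , y)) c)
                     (sum-linear (λ x → ∑.sum λ y → F (x , y)) (λ x → ∑.sum λ y → G (x , y)) c))
    (λ F 0≤F → 0≤sum (λ x → ∑.sum λ y → F (x , y)) λ x → 0≤sum (λ y → F (x , y)) λ y → 0≤F (x , y))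
    (λ F 0≤F S≡0 (x , y) → zero-summand (λ y → F (x , y)) (λ y → 0≤F (x , y))
      (zero-summand (λ x → ∑.sum λ y → F (x , y)) (λ x → 0≤sum (λ y → F (x , y)) λ y → 0≤F (x , y)) S≡0 x) y)
    (λ F i j → trans (∑.sum-cong-≗ λ x → sym (∑.sum-permute (λ y → F (transpose i j ⟨$⟩ʳ x , y)) (transpose i j)))
      (sym (∑.sum-permute (λ x → ∑.sum λ y → F (x , y)) (transpose i j))))

  L-point : ∀ F x → Points.L F x ≡ ι (+ 3) ℚ.* F x ℚ.- nbrs x F
  L-point F x = trans (∑ₑ-ext λ i j e → moved-point (oriented-distinct e) x F)
    (trans (edge-sum x λ j → F x ℚ.- F j) (nbrs-difference x (F x) F))

  L-pair : ∀ F {x y} → x ≢ y → Pairs.L F (x , y) ≡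
    (ι (+ 3) ℚ.* F (x , y) ℚ.- nbrs x (λ j → F (j , y))) ℚ.+ (ι (+ 3) ℚ.* F (x , y) ℚ.- nbrs y (λ j → F (x , j))) ℚ.+
    (if a y x then F (x , x) ℚ.+ F (y , y) ℚ.- F (x , y) ℚ.- F (y , x) else 0ℚ)
  L-pair F {x} {y} x≢y = trans (∑ₑ-ext λ i j e → moved (oriented-distinct e))
    (trans (∑ₑ-linear (λ i j → first i j ℚ.+ 1ℚ ℚ.* second i j) swapped 1ℚ)
    (trans (cong (ℚ._+ 1ℚ ℚ.* ∑ₑ swapped) (∑ₑ-linear first second 1ℚ))
    (trans (cong₂ (λ s t → s ℚ.+ 1ℚ ℚ.* t)
      (cong₂ (λ s t → s ℚ.+ 1ℚ ℚ.* t)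
        (trans (edge-sum x λ j → F (x , y) ℚ.- F (j , y)) (nbrs-difference x (F (x , y)) λ j → F (j , y)))
        (trans (edge-sum y λ j → F (x , y) ℚ.- F (x , j)) (nbrs-difference y (F (x , y)) λ j → F (x , j))))
      (trans (edge-sum x λ j → δ j y ℚ.* correction) (nbrs-δ x y correction)))
      (solve 3 (λ s t u → s :+ con 1ℚ :* t :+ con 1ℚ :* u := s :+ t :+ u) refl
        (ι (+ 3) ℚ.* F (x , y) ℚ.- nbrs x (λ j → F (j , y))) (ι (+ 3) ℚ.* F (x , y) ℚ.- nbrs y (λ j → F (x , j)))
        (if a y x then correction else 0ℚ)))))
    where
    correction : ℚ
    correction = F (x , x) ℚ.+ F (y , y) ℚ.- F (x , y) ℚ.- F (y , x)
    first second swapped : Fin n → Fin n → ℚ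
    first i j = δ i x ℚ.* (F (x , y) ℚ.- F (j , y)) ℚ.+ 1ℚ ℚ.* (δ j x ℚ.* (F (x , y) ℚ.- F (i , y)))
    second i j = δ i y ℚ.* (F (x , y) ℚ.- F (x , j)) ℚ.+ 1ℚ ℚ.* (δ j y ℚ.* (F (x , y) ℚ.- F (x , i)))
    swapped i j = δ i x ℚ.* (δ j y ℚ.* correction) ℚ.+ 1ℚ ℚ.* (δ j x ℚ.* (δ i y ℚ.* correction))
    moved : ∀ {i j} → i ≢ j → F (x , y) ℚ.- F (transpose i j ⟨$⟩ʳ x , transpose i j ⟨$⟩ʳ y) ≡ (first i j ℚ.+ 1ℚ ℚ.* second i j) ℚ.+ 1ℚ ℚ.* swapped i j
    moved {i} {j} i≢j = cases (i Fin.≟ x) (j Fin.≟ x) (i Fin.≟ y) (j Fin.≟ y)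
      where
      combination : ∀ ix jx iy jy → ℚ
      combination ix jx iy jy =
        ((ix ℚ.* (F (x , y) ℚ.- F (j , y)) ℚ.+ 1ℚ ℚ.* (jx ℚ.* (F (x , y) ℚ.- F (i , y)))) ℚ.+
         1ℚ ℚ.* (iy ℚ.* (F (x , y) ℚ.- F (x , j)) ℚ.+ 1ℚ ℚ.* (jy ℚ.* (F (x , y) ℚ.- F (x , i))))) ℚ.+
         1ℚ ℚ.* (ix ℚ.* (jy ℚ.* correction) ℚ.+ 1ℚ ℚ.* (jx ℚ.* (iy ℚ.* correction)))
      evaluate : ∀ {p q ix jx iy jy} → transpose i j ⟨$⟩ʳ x ≡ p → transpose i j ⟨$⟩ʳ y ≡ q →
        δ i x ≡ ix → δ j x ≡ jx → δ i y ≡ iy → δ j y ≡ jy → F (x , y) ℚ.- F (p , q) ≡ combination ix jx iy jy →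
        F (x , y) ℚ.- F (transpose i j ⟨$⟩ʳ x , transpose i j ⟨$⟩ʳ y) ≡ combination (δ i x) (δ j x) (δ i y) (δ j y)
      evaluate refl refl refl refl refl refl h = h
      cases : Dec (i ≡ x) → Dec (j ≡ x) → Dec (i ≡ y) → Dec (j ≡ y) →
              F (x , y) ℚ.- F (transpose i j ⟨$⟩ʳ x , transpose i j ⟨$⟩ʳ y) ≡ combination (δ i x) (δ j x) (δ i y) (δ j y)
      cases (yes refl) (yes refl) _ _ = contradiction refl i≢j
      cases (yes refl) _ (yes refl) _ = contradiction refl x≢y
      cases _ (yes refl) _ (yes refl) = contradiction refl x≢y
      cases _ _ (yes refl) (yes refl) = contradiction refl i≢j
      cases (yes refl) (no j≢x) (no i≢y) (yes refl) = evaluate (transpose-left x y) (transpose-right x y)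
        (δ-refl x) (δ-off j≢x) (δ-off i≢y) (δ-refl y)
        (solve 4 (λ f g d e → f :- g := ((con 1ℚ :* (f :- e) :+ con 1ℚ :* (con 0ℚ :* (f :- f))) :+
           con 1ℚ :* (con 0ℚ :* (f :- f) :+ con 1ℚ :* (con 1ℚ :* (f :- d)))) :+
           con 1ℚ :* (con 1ℚ :* (con 1ℚ :* (d :+ e :- f :- g)) :+ con 1ℚ :* (con 0ℚ :* (con 0ℚ :* (d :+ e :- f :- g))))) refl
          (F (x , y)) (F (y , x)) (F (x , x)) (F (y , y)))
      cases (no i≢x) (yes refl) (yes refl) (no j≢y) = evaluate (transpose-right y x) (transpose-left y x)
        (δ-off i≢x) (δ-refl x) (δ-refl y) (δ-off j≢y)
        (solve 4 (λ f g d e → f :- g := ((con 0ℚ :* (f :- f) :+ con 1ℚ :* (con 1ℚ :* (f :- e))) :+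
           con 1ℚ :* (con 1ℚ :* (f :- d) :+ con 1ℚ :* (con 0ℚ :* (f :- f)))) :+
           con 1ℚ :* (con 0ℚ :* (con 0ℚ :* (d :+ e :- f :- g)) :+ con 1ℚ :* (con 1ℚ :* (con 1ℚ :* (d :+ e :- f :- g))))) refl
          (F (x , y)) (F (y , x)) (F (x , x)) (F (y , y)))
      cases (yes refl) (no j≢x) (no i≢y) (no j≢y) = evaluate (transpose-left x j) (transpose-other x j y (≢-sym i≢y) (≢-sym j≢y))
        (δ-refl x) (δ-off j≢x) (δ-off i≢y) (δ-off j≢y)
        (solve 5 (λ f g h k c → f :- g := ((con 1ℚ :* (f :- g) :+ con 1ℚ :* (con 0ℚ :* (f :- f))) :+
           con 1ℚ :* (con 0ℚ :* (f :- h) :+ con 1ℚ :* (con 0ℚ :* (f :- k)))) :+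
           con 1ℚ :* (con 1ℚ :* (con 0ℚ :* c) :+ con 1ℚ :* (con 0ℚ :* (con 0ℚ :* c)))) refl
          (F (x , y)) (F (j , y)) (F (x , j)) (F (x , x)) correction)
      cases (no i≢x) (yes refl) (no i≢y) (no j≢y) = evaluate (transpose-right i x) (transpose-other i x y (≢-sym i≢y) (≢-sym j≢y))
        (δ-off i≢x) (δ-refl x) (δ-off i≢y) (δ-off j≢y)
        (solve 5 (λ f g h k c → f :- g := ((con 0ℚ :* (f :- f) :+ con 1ℚ :* (con 1ℚ :* (f :- g))) :+
           con 1ℚ :* (con 0ℚ :* (f :- k) :+ con 1ℚ :* (con 0ℚ :* (f :- h)))) :+
           con 1ℚ :* (con 0ℚ :* (con 0ℚ :* c) :+ con 1ℚ :* (con 1ℚ :* (con 0ℚ :* c)))) refl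
          (F (x , y)) (F (i , y)) (F (x , i)) (F (x , x)) correction)
      cases (no i≢x) (no j≢x) (yes refl) (no j≢y) = evaluate (transpose-other y j x (≢-sym i≢x) (≢-sym j≢x)) (transpose-left y j)
        (δ-off i≢x) (δ-off j≢x) (δ-refl y) (δ-off j≢y)
        (solve 5 (λ f g h k c → f :- g := ((con 0ℚ :* (f :- h) :+ con 1ℚ :* (con 0ℚ :* (f :- k))) :+
           con 1ℚ :* (con 1ℚ :* (f :- g) :+ con 1ℚ :* (con 0ℚ :* (f :- f)))) :+
           con 1ℚ :* (con 0ℚ :* (con 0ℚ :* c) :+ con 1ℚ :* (con 0ℚ :* (con 1ℚ :* c)))) refl
          (F (x , y)) (F (x , j)) (F (j , y)) (F (y , y)) correction)
      cases (no i≢x) (no j≢x) (no i≢y) (yes refl) = evaluate (transpose-other i y x (≢-sym i≢x) (≢-sym j≢x)) (transpose-right i y)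
        (δ-off i≢x) (δ-off j≢x) (δ-off i≢y) (δ-refl y)
        (solve 5 (λ f g h k c → f :- g := ((con 0ℚ :* (f :- k) :+ con 1ℚ :* (con 0ℚ :* (f :- h))) :+
           con 1ℚ :* (con 0ℚ :* (f :- f) :+ con 1ℚ :* (con 1ℚ :* (f :- g)))) :+
           con 1ℚ :* (con 0ℚ :* (con 1ℚ :* c) :+ con 1ℚ :* (con 0ℚ :* (con 0ℚ :* c)))) refl
          (F (x , y)) (F (x , i)) (F (i , y)) (F (y , y)) correction)
      cases (no i≢x) (no j≢x) (no i≢y) (no j≢y) = evaluate
        (transpose-other i j x (≢-sym i≢x) (≢-sym j≢x)) (transpose-other i j y (≢-sym i≢y) (≢-sym j≢y))
        (δ-off i≢x) (δ-off j≢x) (δ-off i≢y) (δ-off j≢y)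
        (solve 6 (λ f g h k l c → f :- f := ((con 0ℚ :* (f :- g) :+ con 1ℚ :* (con 0ℚ :* (f :- h))) :+
           con 1ℚ :* (con 0ℚ :* (f :- k) :+ con 1ℚ :* (con 0ℚ :* (f :- l)))) :+
           con 1ℚ :* (con 0ℚ :* (con 0ℚ :* c) :+ con 1ℚ :* (con 0ℚ :* (con 0ℚ :* c)))) refl
          (F (x , y)) (F (j , y)) (F (i , y)) (F (x , j)) (F (x , i)) correction)

  L-diagonal : ∀ F → (∀ x → F (x , x) ≡ 0ℚ) → ∀ x → Pairs.L F (x , x) ≡ 0ℚ
  L-diagonal F F₀ x = trans (∑ₑ-ext λ i j _ → trans (cong₂ ℚ._-_ (F₀ x) (F₀ (transpose i j ⟨$⟩ʳ x))) (sym (ℚ.*-zeroˡ 0ℚ)))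
    (trans (Pairs.∑ₑ-scale 0ℚ λ _ _ → 0ℚ) (ℚ.*-zeroˡ (∑ₑ λ _ _ → 0ℚ)))

  private
    point-cover : ∀ {i j} x → Points.moves i j x ℚ.≤ δ i x ℚ.* 1ℚ ℚ.+ 1ℚ ℚ.* (δ j x ℚ.* 1ℚ)
    point-cover {i} {j} x = cases (i Fin.≟ x) (j Fin.≟ x)
      where
      ≤1 : ∀ b → (if b then 0ℚ else 1ℚ) ℚ.≤ 1ℚ
      ≤1 true  = ℚ.<⇒≤ 0<1
      ≤1 false = ℚ.≤-refl
      cases : Dec (i ≡ x) → Dec (j ≡ x) → Points.moves i j x ℚ.≤ δ i x ℚ.* 1ℚ ℚ.+ 1ℚ ℚ.* (δ j x ℚ.* 1ℚ)
      cases (yes refl) _ = ℚ.≤-trans (≤1 (does (transpose i j ⟨$⟩ʳ i Fin.≟ i))) (≤-by (0≤δ j i)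
        (trans (cong (λ s → s ℚ.* 1ℚ ℚ.+ 1ℚ ℚ.* (δ j i ℚ.* 1ℚ) ℚ.- 1ℚ) (δ-refl i))
          (solve 1 (λ d → con 1ℚ :* con 1ℚ :+ con 1ℚ :* (d :* con 1ℚ) :- con 1ℚ := d) refl (δ j i))))
      cases (no _) (yes refl) = ℚ.≤-trans (≤1 (does (transpose i j ⟨$⟩ʳ j Fin.≟ j))) (≤-by (0≤δ i j)
        (trans (cong (λ s → δ i j ℚ.* 1ℚ ℚ.+ 1ℚ ℚ.* (s ℚ.* 1ℚ) ℚ.- 1ℚ) (δ-refl j))
          (solve 1 (λ d → d :* con 1ℚ :+ con 1ℚ :* (con 1ℚ :* con 1ℚ) :- con 1ℚ := d) refl (δ i j))))
      cases (no i≢x) (no j≢x) = ℚ.≤-trans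
        (ℚ.≤-reflexive (cong (if_then 0ℚ else 1ℚ) (dec-true (transpose i j ⟨$⟩ʳ x Fin.≟ x) (transpose-other i j x (≢-sym i≢x) (≢-sym j≢x)))))
        (≤-by (0≤+ (0≤δ i x) (0≤δ j x)) (solve 2 (λ c d → (c :* con 1ℚ :+ con 1ℚ :* (d :* con 1ℚ)) :- con 0ℚ := c :+ d) refl (δ i x) (δ j x)))

    pair-cover : ∀ i j x y → Pairs.moves i j (x , y) ℚ.≤ Points.moves i j x ℚ.+ 1ℚ ℚ.* Points.moves i j y
    pair-cover i j x y = cases (transpose i j ⟨$⟩ʳ x Fin.≟ x) (transpose i j ⟨$⟩ʳ y Fin.≟ y) (Product.≡-dec Fin._≟_ Fin._≟_ (transpose i j ⟨$⟩ʳ x , transpose i j ⟨$⟩ʳ y) (x , y))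
      where
      cases : (d : Dec (transpose i j ⟨$⟩ʳ x ≡ x)) (e : Dec (transpose i j ⟨$⟩ʳ y ≡ y)) (f : Dec ((transpose i j ⟨$⟩ʳ x , transpose i j ⟨$⟩ʳ y) ≡ (x , y))) →
        (if does f then 0ℚ else 1ℚ) ℚ.≤ (if does d then 0ℚ else 1ℚ) ℚ.+ 1ℚ ℚ.* (if does e then 0ℚ else 1ℚ)
      cases (yes p) (yes q) (no ¬f) = contradiction (cong₂ _,_ p q) ¬f
      cases (yes p) (yes q) (yes _) = ℚ.≤-refl
      cases (yes p) (no _)  (yes _) = ℚ.<⇒≤ 0<1
      cases (yes p) (no _)  (no _)  = ℚ.≤-refl
      cases (no _)  (yes _) (yes _) = ℚ.<⇒≤ 0<1
      cases (no _)  (yes _) (no _)  = ℚ.≤-refl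
      cases (no _)  (no _)  (yes _) = ℚ.<⇒≤ (0<+ 0<1 (ℚ.<⇒≤ 0<1))
      cases (no _)  (no _)  (no _)  = ≤-by (ℚ.<⇒≤ 0<1) refl

  point-degree : ∀ x → ∑ₑ (λ i j → Points.moves i j x) ℚ.≤ ι (+ 3)
  point-degree x = ℚ.≤-trans (Points.∑ₑ-mono λ i j _ → point-cover x) (ℚ.≤-reflexive (trans (edge-sum x λ _ → 1ℚ) (nbrs-1 x)))

  pair-degree : ∀ p → ∑ₑ (λ i j → Pairs.moves i j p) ℚ.≤ ι (+ 6)
  pair-degree (x , y) = ℚ.≤-trans (Pairs.∑ₑ-mono λ i j _ → pair-cover i j x y)
    (ℚ.≤-trans (ℚ.≤-reflexive (∑ₑ-linear (λ i j → Points.moves i j x) (λ i j → Points.moves i j y) 1ℚ))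
      (ℚ.≤-trans (ℚ.+-mono-≤ (point-degree x) (ℚ.*-monoˡ-≤-nonNeg 1ℚ (point-degree y))) (ℚ.≤-reflexive refl)))

  private
    ι-∙ᵇ : ∀ b z → ι (b ∙ᵇ z) ≡ (if b then ι z else 0ℚ)
    ι-∙ᵇ true  z = refl
    ι-∙ᵇ false z = refl

    ι-nbrs : ∀ x (f : Fin n → ℤ) → ι (∑ℤ.sum λ j → a j x ∙ᵇ f j) ≡ nbrs x (ι ∘ f)
    ι-nbrs x f = trans (ι-∑ λ j → a j x ∙ᵇ f j) (∑.sum-cong-≗ λ j → ι-∙ᵇ (a j x) (f j))

    ι-L₁ : ∀ f x → ι (L₁ a f x) ≡ Points.L (ι ∘ f) x
    ι-L₁ f x = trans (ι-minus (+ 3 ℤ.* f x) (∑ℤ.sum λ j → a j x ∙ᵇ f j))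
      (trans (cong₂ ℚ._-_ (ι-* (+ 3) (f x)) (ι-nbrs x f)) (sym (L-point (ι ∘ f) x)))

    ι-L₂ : ∀ f → (∀ x → f x x ≡ 0ℤ) → ∀ {x y} → x ≢ y → ι (L₂ a f x y) ≡ Pairs.L (λ (x , y) → ι (f x y)) (x , y)
    ι-L₂ f f₀ {x} {y} x≢y = trans
      (trans (ι-minus (u ℤ.- v ℤ.- w) (a x y ∙ᵇ (f x y ℤ.+ f y x))) (cong₂ ℚ._-_
        (trans (ι-minus (u ℤ.- v) w) (cong₂ ℚ._-_
          (trans (ι-minus u v) (cong₂ ℚ._-_ (ι-* (+ 6) (f x y)) (ι-nbrs x λ j → f j y))) (ι-nbrs y λ j → f x j)))
        (trans (ι-∙ᵇ (a x y) (f x y ℤ.+ f y x)) (cong₂ (λ b q → if b then q else 0ℚ) (a-symmetric x y) (ι-+ (f x y) (f y x))))))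
      (trans (regroup (a y x)) (sym (L-pair (λ (x , y) → ι (f x y)) x≢y)))
      where
      u v w : ℤ
      u = + 6 ℤ.* f x y
      v = ∑ℤ.sum λ j → a j x ∙ᵇ f j y
      w = ∑ℤ.sum λ j → a j y ∙ᵇ f x j
      p q : ℚ
      p = nbrs x λ j → ι (f j y)
      q = nbrs y λ j → ι (f x j)
      regroup : ∀ b → ι (+ 6) ℚ.* ι (f x y) ℚ.- p ℚ.- q ℚ.- (if b then ι (f x y) ℚ.+ ι (f y x) else 0ℚ) ≡
        (ι (+ 3) ℚ.* ι (f x y) ℚ.- p) ℚ.+ (ι (+ 3) ℚ.* ι (f x y) ℚ.- q) ℚ.+
        (if b then ι (f x x) ℚ.+ ι (f y y) ℚ.- ι (f x y) ℚ.- ι (f y x) else 0ℚ)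
      regroup true = trans
        (solve 4 (λ f g p q → con (ι (+ 6)) :* f :- p :- q :- (f :+ g) :=
           (con (ι (+ 3)) :* f :- p) :+ (con (ι (+ 3)) :* f :- q) :+ (con 0ℚ :+ con 0ℚ :- f :- g)) refl (ι (f x y)) (ι (f y x)) p q)
        (cong₂ (λ s t → (ι (+ 3) ℚ.* ι (f x y) ℚ.- p) ℚ.+ (ι (+ 3) ℚ.* ι (f x y) ℚ.- q) ℚ.+ (ι s ℚ.+ ι t ℚ.- ι (f x y) ℚ.- ι (f y x)))
          (sym (f₀ x)) (sym (f₀ y)))
      regroup false = solve 3 (λ f p q → con (ι (+ 6)) :* f :- p :- q :- con 0ℚ :=
           (con (ι (+ 3)) :* f :- p) :+ (con (ι (+ 3)) :* f :- q) :+ con 0ℚ) refl (ι (f x y)) p q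

    ι-gap : ∀ k α u v → ι (gap k α u v) ≡
      (ι v ℚ.- ι (+ k) ℚ.* (ι u ℚ.+ ι α ℚ.* 1ℚ)) ℚ.* (ι v ℚ.- ι (+ suc k) ℚ.* (ι u ℚ.+ ι α ℚ.* 1ℚ))
    ι-gap k α u v = trans (ι-* (v ℤ.- + k ℤ.* (u ℤ.+ α)) (v ℤ.- + suc k ℤ.* (u ℤ.+ α))) (cong₂ ℚ._*_ (factor (+ k)) (factor (+ suc k)))
      where
      factor : ∀ c → ι (v ℤ.- c ℤ.* (u ℤ.+ α)) ≡ ι v ℚ.- ι c ℚ.* (ι u ℚ.+ ι α ℚ.* 1ℚ)
      factor c = trans (ι-minus v (c ℤ.* (u ℤ.+ α))) (cong (λ t → ι v ℚ.- t) (trans (ι-* c (u ℤ.+ α))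
        (cong (ι c ℚ.*_) (trans (ι-+ u α) (cong (ι u ℚ.+_) (sym (ℚ.*-identityʳ (ι α))))))))

  a-Q₁ : ∀ k α f → 0ℤ ℤ.≤ Q₁ a k α f
  a-Q₁ k α f = ι-cancel-≤ 0ℤ (Q₁ a k α f) (subst (0ℚ ℚ.≤_)
    (sym (trans (ι-∑ λ x → gap k α (f x) (L₁ a f x)) (∑.sum-cong-≗ λ x → trans (ι-gap k α (f x) (L₁ a f x))
      (cong (λ l → (l ℚ.- ι (+ k) ℚ.* F x) ℚ.* (l ℚ.- ι (+ suc k) ℚ.* F x)) (trans (ι-L₁ f x) (sym (LF x)))))))
    (let lo , m , killed = Points.annihilated integral in Points.gap-nonneg (+ k) lo m F (killed F)))
    where
    F : Fin n → ℚ
    F x = ι (f x) ℚ.+ ι α ℚ.* 1ℚ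
    LF : ∀ x → Points.L F x ≡ Points.L (ι ∘ f) x
    LF x = trans (Points.L-linear (ι ∘ f) (λ _ → 1ℚ) (ι α) x) (trans
      (cong (λ t → Points.L (ι ∘ f) x ℚ.+ ι α ℚ.* t) (trans (L-point (λ _ → 1ℚ) x) (cong (λ t → ι (+ 3) ℚ.* 1ℚ ℚ.- t) (nbrs-1 x))))
      (solve 2 (λ l c → l :+ c :* con 0ℚ := l) refl (Points.L (ι ∘ f) x) (ι α)))

  a-Q₂ : ∀ k α f → (∀ x → f x x ≡ 0ℤ) → 0ℤ ℤ.≤ Q₂ a k α f
  a-Q₂ k α f f₀ = ι-cancel-≤ 0ℤ (Q₂ a k α f) (subst (0ℚ ℚ.≤_)
    (sym (trans (ι-∑ λ x → ∑ℤ.sum λ y → not (x == y) ∙ᵇ gap k α (f x y) (L₂ a f x y)) (∑.sum-cong-≗ λ x →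
      trans (ι-∑ λ y → not (x == y) ∙ᵇ gap k α (f x y) (L₂ a f x y)) (∑.sum-cong-≗ λ y → entry x y (x Fin.≟ y)))))
    (let lo , m , killed = Pairs.annihilated integral in Pairs.gap-nonneg (+ k) lo m F (killed F)))
    where
    G O F : Fin n × Fin n → ℚ
    G (x , y) = ι (f x y)
    O (x , y) = if x == y then 0ℚ else 1ℚ
    F p = G p ℚ.+ ι α ℚ.* O p
    LO : ∀ p → Pairs.L O p ≡ 0ℚ
    LO (x , y) = trans (∑ₑ-ext λ i j _ → trans (cong (λ t → O (x , y) ℚ.- t) (cong (if_then 0ℚ else 1ℚ) (==-to (transpose i j) x y)))
        (trans (ℚ.+-inverseʳ (O (x , y))) (sym (ℚ.*-zeroˡ 0ℚ))))
      (trans (Pairs.∑ₑ-scale 0ℚ λ _ _ → 0ℚ) (ℚ.*-zeroˡ (∑ₑ λ _ _ → 0ℚ)))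
    LF : ∀ p → Pairs.L F p ≡ Pairs.L G p
    LF p = trans (Pairs.L-linear G O (ι α) p) (trans (cong (λ t → Pairs.L G p ℚ.+ ι α ℚ.* t) (LO p))
      (solve 2 (λ l c → l :+ c :* con 0ℚ := l) refl (Pairs.L G p) (ι α)))
    entry : ∀ x y → Dec (x ≡ y) → ι (not (x == y) ∙ᵇ gap k α (f x y) (L₂ a f x y)) ≡
      (Pairs.L F (x , y) ℚ.- ι (+ k) ℚ.* F (x , y)) ℚ.* (Pairs.L F (x , y) ℚ.- ι (+ suc k) ℚ.* F (x , y))
    entry x y (yes refl) = trans (cong (λ b → ι (not b ∙ᵇ gap k α (f x x) (L₂ a f x x))) (dec-true (x Fin.≟ x) refl)) (sym (trans
      (cong₂ (λ l g → (l ℚ.- ι (+ k) ℚ.* g) ℚ.* (l ℚ.- ι (+ suc k) ℚ.* g))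
        (trans (LF (x , x)) (L-diagonal G (λ x → cong ι (f₀ x)) x))
        (trans (cong₂ (λ u b → ι u ℚ.+ ι α ℚ.* (if b then 0ℚ else 1ℚ)) (f₀ x) (dec-true (x Fin.≟ x) refl)) (trans (ℚ.+-identityˡ (ι α ℚ.* 0ℚ)) (ℚ.*-zeroʳ (ι α)))))
      (solve 2 (λ k k′ → (con 0ℚ :- k :* con 0ℚ) :* (con 0ℚ :- k′ :* con 0ℚ) := con 0ℚ) refl (ι (+ k)) (ι (+ suc k)))))
    entry x y (no x≢y) = trans (cong (λ b → ι (not b ∙ᵇ gap k α (f x y) (L₂ a f x y))) (dec-false (x Fin.≟ y) x≢y)) (trans
      (ι-gap k α (f x y) (L₂ a f x y))
      (cong₂ (λ l o → (l ℚ.- ι (+ k) ℚ.* (G (x , y) ℚ.+ ι α ℚ.* o)) ℚ.* (l ℚ.- ι (+ suc k) ℚ.* (G (x , y) ℚ.+ ι α ℚ.* o)))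
        (trans (ι-L₂ f f₀ x≢y) (sym (LF (x , y)))) (sym (cong (if_then 0ℚ else 1ℚ) (dec-false (x Fin.≟ y) x≢y)))))

  integralCubic : IntegralCubic a
  integralCubic = record
    { symmetric = a-symmetric ; irreflexive = a-irreflexive ; cubic = a-cubic ; connected = a-connected
    ; Q₁≥0 = a-Q₁ ; Q₂≥0 = a-Q₂ }

-- The order of the graph

∣-of-product : ∀ n c k m → k ℤ.* c ≡ m → ℤ.∣ k ∣ ≡ n → n ∣ ℤ.∣ m ∣
∣-of-product n c k m eq refl = divides ℤ.∣ c ∣ (trans (cong ℤ.∣_∣ (trans (sym eq) (ℤ.*-comm k c))) (ℤ.abs-* c k))

δ-integer : ∀ {n} (i x : Fin n) → IsInteger (δ i x)
δ-integer i x with i Fin.≟ x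
... | yes _ = 1ℤ , refl
... | no _  = 0ℤ , refl

0≤if : ∀ b {q} → 0ℚ ℚ.≤ q → 0ℚ ℚ.≤ (if b then q else 0ℚ)
0≤if true  0≤q = 0≤q
0≤if false _   = ℚ.≤-refl

sixth : ℚ
sixth = + 1 ℚ./ 6

from-opposite : ∀ c u v → (u ℚ.+ (c ℚ.* sixth) ℚ.* 1ℚ) ℚ.+ (v ℚ.+ (c ℚ.* sixth) ℚ.* 1ℚ) ≡ 0ℚ → c ≡ (u ℚ.+ v) ℚ.* ι (ℤ.- + 3)
from-opposite c u v eq = trans
  (solve 3 (λ c u v → c := con (ι (+ 3)) :* ((u :+ (c :* con sixth) :* con 1ℚ) :+ (v :+ (c :* con sixth) :* con 1ℚ)) :+ (u :+ v) :* con (ι (ℤ.- + 3))) refl c u v)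
  (trans (cong (λ t → ι (+ 3) ℚ.* t ℚ.+ (u ℚ.+ v) ℚ.* ι (ℤ.- + 3)) eq) (ℚ.+-identityˡ ((u ℚ.+ v) ℚ.* ι (ℤ.- + 3))))

2∣-of-double : ∀ n t s → ι t ≡ s → ι (+ 2) ℚ.* s ≡ ι (+ n) ℚ.* ι (+ 3) → 2 ∣ 3 ℕ.* n
2∣-of-double n t s refl eq = subst (2 ∣_) (ℤ.abs-* (+ 3) (+ n)) (∣-of-product 2 t (+ 2) (+ 3 ℤ.* + n)
  (ι-injective (trans (ι-* (+ 2) t) (trans eq (trans (ℚ.*-comm (ι (+ n)) (ι (+ 3))) (sym (ι-* (+ 3) (+ n))))))) refl)

divides-240 : ∀ n {c u v} → ι (+ n) ℚ.* c ≡ ι (+ 720) → c ≡ (u ℚ.+ v) ℚ.* ι (ℤ.- + 3) → IsInteger u → IsInteger v → n ∣ 240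
divides-240 n {c} nc≡720 c≡ (k , refl) (l , refl) =
  ∣-of-product n (k ℤ.+ l) (+ n) (ℤ.- + 240) (ℤ.*-cancelʳ-≡ (+ n ℤ.* (k ℤ.+ l)) (ℤ.- + 240) (ℤ.- + 3) (ι-injective (trans
    (ι-* (+ n ℤ.* (k ℤ.+ l)) (ℤ.- + 3)) (trans (cong (ℚ._* ι (ℤ.- + 3)) (trans (ι-* (+ n) (k ℤ.+ l)) (cong (ι (+ n) ℚ.*_) (ι-+ k l))))
    (trans (ℚ.*-assoc (ι (+ n)) (ι k ℚ.+ ι l) (ι (ℤ.- + 3))) (trans (cong (ι (+ n) ℚ.*_) (sym c≡)) nc≡720)))))) refl

divides-360 : ∀ n {c} → ι (+ n) ℚ.* c ≡ ι (+ 720) → Even c → n ∣ 360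
divides-360 n nc≡720 (k , refl) = ∣-of-product n k (+ n) (+ 360) (ℤ.*-cancelʳ-≡ (+ n ℤ.* k) (+ 360) (+ 2) (ι-injective (trans
  (ι-* (+ n ℤ.* k) (+ 2)) (trans (cong (ℚ._* ι (+ 2)) (ι-* (+ n) k)) (trans
    (solve 3 (λ n k t → n :* k :* t := n :* (t :* k)) refl (ι (+ n)) (ι k) (ι (+ 2))) nc≡720))))) refl

divides-12! : ∀ n {c} → ι (+ n) ℚ.* (ι (+ n) ℚ.* c ℚ.+ ℚ.- c ℚ.* 1ℚ) ≡ ι (+ (12 !)) → IsInteger c → ℤ.∣ + n ℤ.* + n ℤ.- + n ∣ ∣ 12 !
divides-12! n eq (k , refl) = ∣-of-product _ k (+ n ℤ.* + n ℤ.- + n) (+ (12 !)) (ι-injective (trans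
  (ι-* (+ n ℤ.* + n ℤ.- + n) k) (trans (cong (ℚ._* ι k) (trans (ι-minus (+ n ℤ.* + n) (+ n)) (cong (ℚ._- ι (+ n)) (ι-* (+ n) (+ n)))))
  (trans (solve 2 (λ n c → (n :* n :- n) :* c := n :* (n :* c :+ :- c :* con 1ℚ)) refl (ι (+ n)) (ι k)) eq)))) refl

module Orders {n} (𝒯 : TranspositionSet n) (isCubic : Cubic (transpositionGraph 𝒯))
              (isConnected : Connected (transpositionGraph 𝒯)) (integral : Integral (CaySym 𝒯)) where

  open TranspositionSet 𝒯
  open Concrete 𝒯 isCubic isConnected integral
  open Cayley 𝒯 id id using (oriented; ∑ₑ; τ; ι-τ)

  edge-invariant : ∀ {X : Set} (act : Permutation′ n → X → X) → (∀ {π σ} → π Perm.≈ σ → act π ≗ act σ) → (h : X → ℚ) →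
    (∀ i j → oriented i j ≡ true → ∀ x → h (act (transpose i j) x) ≡ h x) →
    ∀ i j → T (transpose i j) → ∀ x → h (act (transpose i j) x) ≡ h x
  edge-invariant act act-cong h inv i j t x = cases (Fin.<-cmp i j)
    where
    cases : _ → h (act (transpose i j) x) ≡ h x
    cases (tri< i<j _ _) = inv i j (cong₂ _∧_ (dec-true (T? (transpose i j)) t) (dec-true (i Fin.<? j) i<j)) x
    cases (tri≈ _ i≡j _) = contradiction i≡j (a-distinct i j (dec-true (T? (transpose i j)) t))
    cases (tri> _ _ j<i) = trans (cong h (act-cong {transpose i j} {transpose j i} (transpose-comm i j) x))
      (inv j i (cong₂ _∧_ (trans (a-symmetric j i) (dec-true (T? (transpose i j)) t)) (dec-true (j Fin.<? i) j<i)) x)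

  x₀ : Fin n
  x₀ = proj₁ isConnected

  neighbour : ∃[ j ] a x₀ j ≡ true
  neighbour = let j , _ , e = missing (λ _ → false) (a x₀) (λ _ ()) (λ eq → contradiction (trans (sym (trans eq (a-cubic x₀))) (zeros n)) λ ()) in j , e
    where
    zeros : ∀ m → ∑ℕ.sum {m} (λ _ → 0) ≡ 0
    zeros zero    = refl
    zeros (suc m) = zeros m

  y₀ : Fin n
  y₀ = proj₁ neighbour

  x₀≢y₀ : x₀ ≢ y₀
  x₀≢y₀ = a-distinct x₀ y₀ (proj₂ neighbour)

  point-const : ∀ (h : Fin n → ℚ) → (∀ i j → oriented i j ≡ true → ∀ x → h (transpose i j ⟨$⟩ʳ x) ≡ h x) → ∀ x → h x ≡ h x₀
  point-const h inv x = cases (x₀ Fin.≟ x)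
    where
    cases : Dec (x₀ ≡ x) → h x ≡ h x₀
    cases (yes refl) = refl
    cases (no x₀≢x)  = trans (cong h (sym (transpose-left x₀ x)))
      (Points.invariant-everywhere paths h (edge-invariant _⟨$⟩ʳ_ (λ π≈σ → π≈σ) h inv) x₀ x x₀≢x x₀)

  nbrs-total : ∀ H → ∑.sum (λ x → nbrs x H) ≡ ι (+ 3) ℚ.* ∑.sum H
  nbrs-total H = trans (∑.∑-comm λ x j → if a j x then H j else 0ℚ) (trans
    (∑.sum-cong-≗ λ j → trans (∑.sum-cong-≗ λ x → cong (if_then H j else 0ℚ) (a-symmetric j x)) (nbrs-const j (H j)))
    (sym (∑.*-distribˡ-sum (ι (+ 3)) H)))

  -- Shifted by c / 6, w is an eigenvector of the adjacency matrix for the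
  -- eigenvalue -3, so its values at adjacent vertices are opposite.
  module Shifted (w : Fin n → ℚ) (c : ℚ) (w-c : ∀ x → (w Points.⊖ + 6) x ≡ c) where

    y : Fin n → ℚ
    y x = w x ℚ.+ (c ℚ.* sixth) ℚ.* 1ℚ

    y-eigen : ∀ x → Points.L y x ≡ ι (+ 6) ℚ.* y x
    y-eigen x = trans (Points.L-linear w (λ _ → 1ℚ) (c ℚ.* sixth) x) (trans
      (cong₂ (λ s t → s ℚ.+ (c ℚ.* sixth) ℚ.* t)
        (trans (solve 2 (λ l f → l := (l :- f) :+ f) refl (Points.L w x) (ι (+ 6) ℚ.* w x)) (cong (ℚ._+ ι (+ 6) ℚ.* w x) (w-c x)))
        (trans (L-point (λ _ → 1ℚ) x) (cong (λ t → ι (+ 3) ℚ.* 1ℚ ℚ.- t) (nbrs-1 x))))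
      (solve 2 (λ c w → (c :+ con (ι (+ 6)) :* w) :+ (c :* con sixth) :* con 0ℚ := con (ι (+ 6)) :* (w :+ (c :* con sixth) :* con 1ℚ)) refl c (w x)))

    nbrs-y : ∀ x → nbrs x y ≡ ℚ.- (ι (+ 3) ℚ.* y x)
    nbrs-y x = trans (solve 2 (λ y s → s := con (ι (+ 3)) :* y :- (con (ι (+ 3)) :* y :- s)) refl (y x) (nbrs x y))
      (trans (cong (λ t → ι (+ 3) ℚ.* y x ℚ.- t) (trans (sym (L-point y x)) (y-eigen x)))
        (solve 1 (λ y → con (ι (+ 3)) :* y :- con (ι (+ 6)) :* y := :- (con (ι (+ 3)) :* y)) refl (y x)))

    opposite : ∀ x j → a j x ≡ true → y x ℚ.+ y j ≡ 0ℚ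
    opposite x j e = square-root (y x ℚ.+ y j) (trans (cong (if_then (y x ℚ.+ y j) ℚ.* (y x ℚ.+ y j) else 0ℚ) (sym e))
      (zero-summand (E x) (0≤E x) (zero-summand (λ x → ∑.sum (E x)) (λ x → 0≤sum (E x) (0≤E x)) total x) j))
      where
      E : Fin n → Fin n → ℚ
      E x j = if a j x then (y x ℚ.+ y j) ℚ.* (y x ℚ.+ y j) else 0ℚ
      0≤E : ∀ x j → 0ℚ ℚ.≤ E x j
      0≤E x j = 0≤if (a j x) (0≤sq (y x ℚ.+ y j))
      row-sum : ∀ x → ∑.sum (E x) ≡ nbrs x (λ j → y j ℚ.* y j) ℚ.+ ℚ.- ι (+ 3) ℚ.* (y x ℚ.* y x)
      row-sum x = trans (nbrs-ext x λ j → solve 2 (λ x j → (x :+ j) :* (x :+ j) := (j :* j :+ (con (ι (+ 2)) :* x) :* j) :+ (x :* x) :* con 1ℚ) refl (y x) (y j))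
        (trans (nbrs-linear x (λ j → y j ℚ.* y j ℚ.+ (ι (+ 2) ℚ.* y x) ℚ.* y j) (λ _ → 1ℚ) (y x ℚ.* y x))
        (trans (cong₂ (λ s t → s ℚ.+ (y x ℚ.* y x) ℚ.* t)
          (trans (nbrs-linear x (λ j → y j ℚ.* y j) y (ι (+ 2) ℚ.* y x)) (cong (λ t → nbrs x (λ j → y j ℚ.* y j) ℚ.+ (ι (+ 2) ℚ.* y x) ℚ.* t) (nbrs-y x))) (nbrs-1 x))
          (solve 2 (λ s y → (s :+ (con (ι (+ 2)) :* y) :* :- (con (ι (+ 3)) :* y)) :+ (y :* y) :* con (ι (+ 3)) := s :+ con (ℚ.- ι (+ 3)) :* (y :* y)) refl
            (nbrs x (λ j → y j ℚ.* y j)) (y x))))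
      total : ∑.sum (λ x → ∑.sum (E x)) ≡ 0ℚ
      total = trans (∑.sum-cong-≗ row-sum) (trans (sum-linear (λ x → nbrs x (λ j → y j ℚ.* y j)) (λ x → y x ℚ.* y x) (ℚ.- ι (+ 3)))
        (trans (cong (ℚ._+ ℚ.- ι (+ 3) ℚ.* ∑.sum (λ x → y x ℚ.* y x)) (nbrs-total λ j → y j ℚ.* y j))
          (solve 1 (λ s → con (ι (+ 3)) :* s :+ con (ℚ.- ι (+ 3)) :* s := con 0ℚ) refl (∑.sum λ x → y x ℚ.* y x))))

    value : ∀ x j → a j x ≡ true → c ≡ (w x ℚ.+ w j) ℚ.* ι (ℤ.- + 3)
    value x j e = from-opposite c (w x) (w j) (opposite x j e)

  private
    open Points using (_⊖_; ⊖-linear; integer-⊖; ⟨_,_⟩)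

    infix 4 _≈₂_
    _≈₂_ : (Fin n → ℚ) → (Fin n → ℚ) → Set
    F ≈₂ G = ∀ x → Even (F x ℚ.- G x)

    ⊖-≈₂ : ∀ {F G} c d → F ≈₂ G → (∀ x → IsInteger (G x)) → Even (ι d ℚ.- ι c) → F ⊖ c ≈₂ G ⊖ d
    ⊖-≈₂ {F} {G} c d f int dc x = subst Even (solve 3 (λ u v w → (u :- w) :- (v :- w) := u :- v) refl ((F ⊖ c) x) ((G ⊖ d) x) ((G ⊖ c) x))
      (even-minus (subst Even (sym same) (even-double (integer-⊖ (λ x → proj₁ (f x) , refl) c x)))
        (subst Even (solve 4 (λ l g c d → :- g :* (d :- c) := (l :- d :* g) :- (l :- c :* g)) refl (Points.L G x) (G x) (ι c) (ι d))
          (even-* (negate (int x)) dc)))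
      where
      H : Fin n → ℚ
      H x = ι (proj₁ (f x))
      negate : ∀ {q} → IsInteger q → IsInteger (ℚ.- q)
      negate (k , refl) = ℤ.- k , sym (ι-neg k)
      F≡ : ∀ x → F x ≡ G x ℚ.+ ι (+ 2) ℚ.* H x
      F≡ x = trans (solve 2 (λ f g → f := g :+ (f :- g)) refl (F x) (G x)) (cong (G x ℚ.+_) (proj₂ (f x)))
      same : (F ⊖ c) x ℚ.- (G ⊖ c) x ≡ ι (+ 2) ℚ.* (H ⊖ c) x
      same = trans (cong (ℚ._- (G ⊖ c) x) (trans (Points.⊖-ext c F≡ x) (⊖-linear G H (ι (+ 2)) c x)))
        (solve 2 (λ g k → (g :+ k) :- g := k) refl ((G ⊖ c) x) (ι (+ 2) ℚ.* (H ⊖ c) x))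

    D m H₀ : Fin n → ℚ
    D = δ x₀
    m = D ⊖ 1ℤ ⊖ 0ℤ
    H₀ = m ⊖ 1ℤ ⊖ 0ℤ ⊖ 1ℤ ⊖ 0ℤ

    int₁ : ∀ x → IsInteger ((D ⊖ 1ℤ) x)
    int₁ = integer-⊖ (δ-integer x₀) 1ℤ

    m-integer : ∀ x → IsInteger (m x)
    m-integer = integer-⊖ int₁ 0ℤ

    -- Modulo 2, the product (L - 1) ⋯ (L - 6) agrees with (L - 1) L (L - 1) L (L - 1) L.
    h≈₂H₀ : D ⊖ + 1 ⊖ + 2 ⊖ + 3 ⊖ + 4 ⊖ + 5 ⊖ + 6 ≈₂ H₀
    h≈₂H₀ = ⊖-≈₂ {D ⊖ + 1 ⊖ + 2 ⊖ + 3 ⊖ + 4 ⊖ + 5} {m ⊖ 1ℤ ⊖ 0ℤ ⊖ 1ℤ} (+ 6) 0ℤ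
      (⊖-≈₂ {D ⊖ + 1 ⊖ + 2 ⊖ + 3 ⊖ + 4} {m ⊖ 1ℤ ⊖ 0ℤ} (+ 5) 1ℤ
        (⊖-≈₂ {D ⊖ + 1 ⊖ + 2 ⊖ + 3} {m ⊖ 1ℤ} (+ 4) 0ℤ
          (⊖-≈₂ {D ⊖ + 1 ⊖ + 2} {m} (+ 3) 1ℤ
            (⊖-≈₂ {D ⊖ + 1} {D ⊖ 1ℤ} (+ 2) 0ℤ (λ x → 0ℤ , ℚ.+-inverseʳ ((D ⊖ 1ℤ) x)) int₁ (ℤ.- + 1 , refl))
            m-integer (ℤ.- + 1 , refl))
          (integer-⊖ m-integer 1ℤ) (ℤ.- + 2 , refl))
        (integer-⊖ (integer-⊖ m-integer 1ℤ) 0ℤ) (ℤ.- + 2 , refl))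
      (integer-⊖ (integer-⊖ (integer-⊖ m-integer 1ℤ) 0ℤ) 1ℤ) (ℤ.- + 3 , refl)

    Σm≡0 : ∑.sum m ≡ 0ℚ
    Σm≡0 = trans (Points.⊖-sum (D ⊖ 1ℤ) 0ℤ) (ℚ.*-zeroˡ (∑.sum (D ⊖ 1ℤ)))

    even-norm : ∀ F → (∀ x → IsInteger (F x)) → ∑.sum F ≡ 0ℚ → Even ⟨ F , F ⟩
    even-norm F int Σ≡0 = subst Even (trans (Points.S-minus (λ x → F x ℚ.* F x) F) (trans (cong (λ t → ⟨ F , F ⟩ ℚ.- t) Σ≡0)
      (solve 1 (λ s → s :- con 0ℚ := s) refl ⟨ F , F ⟩))) (even-sum (λ x → F x ℚ.* F x ℚ.- F x) λ x → square-parity (int x))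

    even-energy : Even ⟨ m , Points.L m ⟩
    even-energy = subst Even (sym (trans (∑.sum-cong-≗ λ x → trans (cong (m x ℚ.*_) (L-point m x))
          (solve 2 (λ f s → f :* (con (ι (+ 3)) :* f :- s) := con (ι (+ 3)) :* (f :* f) :- f :* s) refl (m x) (nbrs x m)))
        (trans (Points.S-minus (λ x → ι (+ 3) ℚ.* (m x ℚ.* m x)) (λ x → m x ℚ.* nbrs x m)) (cong₂ ℚ._-_ (Points.S-scale (λ x → m x ℚ.* m x) (ι (+ 3)))
          (trans (∑.sum-cong-≗ pull) (symmetric-sum (λ x j → m x ℚ.* m j) λ x j → ℚ.*-comm (m x) (m j)))))))
      (even-minus (even-* (+ 3 , refl) (even-norm m m-integer Σm≡0))
        (even-double (integer-sum _ λ i → integer-sum _ λ j → branch (oriented i j) (integer-* (m-integer i) (m-integer j)))))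
      where
      branch : ∀ b {q} → IsInteger q → IsInteger (if b then q else 0ℚ)
      branch true  int = int
      branch false _   = 0ℤ , refl
      pull : ∀ x → m x ℚ.* nbrs x m ≡ nbrs x λ j → m x ℚ.* m j
      pull x = trans (∑.*-distribˡ-sum (m x) λ j → if a j x then m j else 0ℚ) (∑.sum-cong-≗ λ j → into (a j x) j)
        where
        into : ∀ b j → m x ℚ.* (if b then m j else 0ℚ) ≡ (if b then m x ℚ.* m j else 0ℚ)
        into true  j = refl
        into false j = ℚ.*-zeroʳ (m x)

    ⊖0 : ∀ F x → (F ⊖ 0ℤ) x ≡ Points.L F x
    ⊖0 F x = solve 2 (λ l f → l :- con 0ℚ :* f := l) refl (Points.L F x) (F x)

    H₀-value : H₀ x₀ ≡ ⟨ Points.L m , Points.L m ⟩ ℚ.- ⟨ m , Points.L m ⟩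
    H₀-value = trans (sym (sum-δ x₀ H₀)) (trans (sym (Points.⊖-self-adjoint D (G ⊖ 1ℤ) 0ℤ))
      (trans (sym (Points.⊖-self-adjoint (D ⊖ 0ℤ) G 1ℤ))
      (trans (Points.⟨⟩-ext {G = G} (Points.⊖-comm D 0ℤ 1ℤ) (λ _ → refl))
      (trans (Points.⟨⟩-ext {m} (λ _ → refl) (λ x → trans (Points.⊖-comm m 1ℤ 0ℤ x) (trans (Points.⊖-ext 1ℤ (⊖0 m) x) (cong (λ t → Points.L (Points.L m) x ℚ.- t) (ℚ.*-identityˡ (Points.L m x))))))
      (trans (trans (∑.sum-cong-≗ λ x → solve 3 (λ m u v → m :* (u :- v) := m :* u :- m :* v) refl (m x) (Points.L (Points.L m) x) (Points.L m x))
        (Points.S-minus (λ x → m x ℚ.* Points.L (Points.L m) x) (λ x → m x ℚ.* Points.L m x)))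
        (cong (ℚ._- ⟨ m , Points.L m ⟩) (sym (Points.self-adjoint m (Points.L m)))))))))
      where
      G : Fin n → ℚ
      G = m ⊖ 1ℤ ⊖ 0ℤ

    even-at-x₀ : ∀ {c} → Even (c ℚ.- H₀ x₀) → Even c
    even-at-x₀ {c} e = subst Even (solve 2 (λ c h → (c :- h) :- (con 0ℚ :- h) := c) refl c (H₀ x₀))
      (even-minus e (even-minus (0ℤ , refl)
        (subst Even (sym H₀-value) (even-minus (even-norm (Points.L m) (Points.integer-L m-integer) (Points.L-sum m)) even-energy))))

  h-sum : ∀ (h : Fin n → ℚ) → (∀ x → h x ≡ h x₀) → ∑.sum h ≡ ι (+ 720) ℚ.* ∑.sum (δ x₀) → ι (+ n) ℚ.* h x₀ ≡ ι (+ 720)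
  h-sum h h-const Σh = trans (sym (sum-const n (h x₀))) (trans (∑.sum-cong-≗ λ x → sym (h-const x)) (trans Σh (cong (ι (+ 720) ℚ.*_)
    (trans (∑.sum-cong-≗ λ x → sym (ℚ.*-identityʳ (δ x₀ x))) (sum-δ x₀ λ _ → 1ℚ)))))

  720-product : ι (+ n) ℚ.* Points.prod 1ℤ 6 (δ x₀) x₀ ≡ ι (+ 720)
  720-product = h-sum (Points.prod 1ℤ 6 (δ x₀)) (point-const (Points.prod 1ℤ 6 (δ x₀)) (Points.product-invariant 3 point-degree integral (δ x₀)))
    (Points.prod-sum 1ℤ 6 (δ x₀))

  n∣240 : n ∣ 240
  n∣240 = divides-240 n 720-product
    (Shifted.value (Points.prod 1ℤ 5 (δ x₀)) (Points.prod 1ℤ 6 (δ x₀) x₀)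
      (point-const (Points.prod 1ℤ 6 (δ x₀)) (Points.product-invariant 3 point-degree integral (δ x₀)))
      x₀ y₀ (trans (a-symmetric y₀ x₀) (proj₂ neighbour)))
    (Points.integer-prod 1ℤ 5 (δ-integer x₀) x₀) (Points.integer-prod 1ℤ 5 (δ-integer x₀) y₀)

  n∣360 : n ∣ 360
  n∣360 = divides-360 n 720-product (even-at-x₀ (h≈₂H₀ x₀))

  degree-sum : ∑.sum (λ x → nbrs x (λ _ → 1ℚ)) ≡ ι (+ n) ℚ.* ι (+ 3)
  degree-sum = trans (∑.sum-cong-≗ {n} {λ x → nbrs x (λ _ → 1ℚ)} {λ _ → ι (+ 3)} nbrs-1) (sum-const n (ι (+ 3)))

  2∣3n : 2 ∣ 3 ℕ.* n
  2∣3n = 2∣-of-double n τ (∑ₑ λ _ _ → 1ℚ) ι-τ (trans (sym (symmetric-sum (λ _ _ → 1ℚ) λ _ _ → refl)) degree-sum)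

  diagonal-⊖ : ∀ {F} c → (∀ x → F (x , x) ≡ 0ℚ) → ∀ x → (F Pairs.⊖ c) (x , x) ≡ 0ℚ
  diagonal-⊖ {F} c F₀ x = trans (cong₂ (λ l f → l ℚ.- ι c ℚ.* f) (L-diagonal F F₀ x) (F₀ x))
    (solve 1 (λ l → con 0ℚ :- l :* con 0ℚ := con 0ℚ) refl (ι c))

  δ-total : ∀ (x : Fin n) → ∑.sum (δ x) ≡ 1ℚ
  δ-total x = trans (∑.sum-cong-≗ λ y → sym (ℚ.*-identityʳ (δ x y))) (sum-δ x λ _ → 1ℚ)

  module PairConst (h : Fin n × Fin n → ℚ) (h-diagonal : ∀ x → h (x , x) ≡ 0ℚ)
    (inv : ∀ i j → oriented i j ≡ true → ∀ p → h (Pairs.move i j p) ≡ h p) where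

    c : ℚ
    c = h (x₀ , y₀)

    invariant : ∀ i j → i ≢ j → ∀ p → h (Pairs.move i j p) ≡ h p
    invariant = Pairs.invariant-everywhere paths h
      (edge-invariant (λ π (x , y) → π ⟨$⟩ʳ x , π ⟨$⟩ʳ y) (λ π≈σ (x , y) → cong₂ _,_ (π≈σ x) (π≈σ y)) h inv)

    -- Move x₀ to x by one transposition and then y₀ to y by another one fixing x.
    constant : ∀ {x y} → x ≢ y → h (x , y) ≡ c
    constant {x} {y} x≢y = trans (sym (second (y′ Fin.≟ y))) (sym (first (x₀ Fin.≟ x)))
      where
      y′ : Fin n
      y′ = transpose x₀ x ⟨$⟩ʳ y₀
      x≢y′ : x ≢ y′
      x≢y′ x≡y′ = x₀≢y₀ (trans (sym (transpose-right x₀ x)) (trans (cong (transpose x₀ x ⟨$⟩ʳ_) x≡y′) (transpose-involutive x₀ x y₀)))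
      first : Dec (x₀ ≡ x) → c ≡ h (x , y′)
      first (yes refl) = cong (λ z → h (x₀ , z)) (sym (transpose-other x₀ x₀ y₀ (≢-sym x₀≢y₀) (≢-sym x₀≢y₀)))
      first (no x₀≢x) = sym (trans (cong (λ z → h (z , y′)) (sym (transpose-left x₀ x))) (invariant x₀ x x₀≢x (x₀ , y₀)))
      second : Dec (y′ ≡ y) → h (x , y′) ≡ h (x , y)
      second (yes y′≡y) = cong (λ z → h (x , z)) y′≡y
      second (no y′≢y)  = trans (sym (invariant y′ y y′≢y (x , y′)))
        (cong₂ (λ u v → h (u , v)) (transpose-other y′ y x x≢y′ x≢y) (transpose-left y′ y))

    value : ∀ x y → h (x , y) ≡ c ℚ.+ ℚ.- c ℚ.* δ x y
    value x y = cases (x Fin.≟ y)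
      where
      cases : Dec (x ≡ y) → h (x , y) ≡ c ℚ.+ ℚ.- c ℚ.* δ x y
      cases (yes refl) = trans (h-diagonal x) (sym (trans (cong (λ t → c ℚ.+ ℚ.- c ℚ.* t) (δ-refl x))
        (solve 1 (λ c → c :+ :- c :* con 1ℚ := con 0ℚ) refl c)))
      cases (no x≢y) = trans (constant x≢y) (sym (trans (cong (λ t → c ℚ.+ ℚ.- c ℚ.* t) (δ-off x≢y))
        (solve 1 (λ c → c :+ :- c :* con 0ℚ := c) refl c)))

    total : pair-sum h ≡ ι (+ n) ℚ.* (ι (+ n) ℚ.* c ℚ.+ ℚ.- c ℚ.* 1ℚ)
    total = trans (∑.sum-cong-≗ λ x → trans (∑.sum-cong-≗ (value x)) (trans (sum-linear (λ _ → c) (δ x) (ℚ.- c))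
      (cong₂ (λ s t → s ℚ.+ ℚ.- c ℚ.* t) (sum-const n c) (δ-total x)))) (sum-const n (ι (+ n) ℚ.* c ℚ.+ ℚ.- c ℚ.* 1ℚ))

  δ₂ : Fin n × Fin n → ℚ
  δ₂ (x , y) = δ x₀ x ℚ.* δ y₀ y

  δ₂-diagonal : ∀ x → δ₂ (x , x) ≡ 0ℚ
  δ₂-diagonal x = cases (x₀ Fin.≟ x)
    where
    cases : Dec (x₀ ≡ x) → δ₂ (x , x) ≡ 0ℚ
    cases (no x₀≢x)  = trans (cong (ℚ._* δ y₀ x) (δ-off x₀≢x)) (ℚ.*-zeroˡ (δ y₀ x))
    cases (yes refl) = trans (cong (δ x₀ x₀ ℚ.*_) (δ-off (≢-sym x₀≢y₀))) (ℚ.*-zeroʳ (δ x₀ x₀))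

  δ₂-sum : pair-sum δ₂ ≡ 1ℚ
  δ₂-sum = trans (∑.sum-cong-≗ λ x → trans (sym (∑.*-distribˡ-sum (δ x₀ x) (δ y₀))) (trans (cong (δ x₀ x ℚ.*_) (δ-total y₀)) (ℚ.*-identityʳ (δ x₀ x)))) (δ-total x₀)

  pair-divides : ∀ (h : Fin n × Fin n → ℚ) → (∀ x → h (x , x) ≡ 0ℚ) →
    (∀ i j → oriented i j ≡ true → ∀ p → h (Pairs.move i j p) ≡ h p) →
    ∀ {s} → s ≡ ι (+ (12 !)) → pair-sum h ≡ s ℚ.* pair-sum δ₂ → (∀ p → IsInteger (h p)) → ℤ.∣ + n ℤ.* + n ℤ.- + n ∣ ∣ 12 !
  pair-divides h h-diagonal inv {s} s≡ Σh int = divides-12! n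
    (trans (sym (PairConst.total h h-diagonal inv)) (trans Σh (trans (cong (s ℚ.*_) δ₂-sum) (trans (ℚ.*-identityʳ s) s≡))))
    (int (x₀ , y₀))

  n²-n∣12! : ℤ.∣ + n ℤ.* + n ℤ.- + n ∣ ∣ 12 !
  n²-n∣12! = pair-divides (Pairs.product 6 pair-degree δ₂)
    (Pairs.product-preserves 6 pair-degree (λ F → ∀ x → F (x , x) ≡ 0ℚ) (λ {F} → diagonal-⊖ {F}) δ₂-diagonal)
    (Pairs.product-move 6 pair-degree integral δ₂) refl (Pairs.product-sum 6 pair-degree δ₂)
    (Pairs.product-preserves 6 pair-degree (λ F → ∀ p → IsInteger (F p)) (λ {F} c int → Pairs.integer-⊖ {F} int c)
      (λ (x , y) → integer-* (δ-integer x₀ x) (δ-integer y₀ y)))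

PossibleOrder : ℕ → Set
PossibleOrder n = n ≡ 2 ⊎ n ≡ 4 ⊎ n ≡ 6 ⊎ n ≡ 8 ⊎ n ≡ 10 ⊎ n ≡ 12

possible-order : ∀ {n} → n ∣ 120 → 2 ∣ 3 ℕ.* n → ℤ.∣ + n ℤ.* + n ℤ.- + n ∣ ∣ 12 ! → PossibleOrder n
possible-order {n} n∣120 2∣3n n²-n∣12! = subst PossibleOrder (Fin.toℕ-fromℕ< n<121)
  (table (Fin.fromℕ< n<121) (subst Constraints (sym (Fin.toℕ-fromℕ< n<121)) (n∣120 , 2∣3n , n²-n∣12!)))
  where
  Constraints : ℕ → Set
  Constraints n = (n ∣ 120) × (2 ∣ 3 ℕ.* n) × (ℤ.∣ + n ℤ.* + n ℤ.- + n ∣ ∣ 12 !)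
  n<121 : n ℕ.< 121
  n<121 = ℕ.s≤s (ℕ.∣⇒≤ n∣120)
  constraints? : ∀ n → Dec (Constraints n)
  constraints? n = (n ℕ.∣? 120) ×-dec (2 ℕ.∣? 3 ℕ.* n) ×-dec (ℤ.∣ + n ℤ.* + n ℤ.- + n ∣ ℕ.∣? 12 !)
  possible? : ∀ n → Dec (PossibleOrder n)
  possible? n = (n ℕ.≟ 2) ⊎-dec (n ℕ.≟ 4) ⊎-dec (n ℕ.≟ 6) ⊎-dec (n ℕ.≟ 8) ⊎-dec (n ℕ.≟ 10) ⊎-dec (n ℕ.≟ 12)
  table : ∀ (i : Fin 121) → Constraints (toℕ i) → PossibleOrder (toℕ i)
  table = toWitness {a? = Fin.all? λ i → constraints? (toℕ i) →-dec possible? (toℕ i)} tt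

no-order-2 : {a : Adjacency 2} → ¬ IntegralCubic a
no-order-2 {a} C = at-most-2 (a zero zero) (a zero (suc zero)) (IntegralCubic.cubic C zero)
  where
  at-most-2 : ∀ b c → bit b ℕ.+ (bit c ℕ.+ 0) ≢ 3
  at-most-2 true  true  ()
  at-most-2 true  false ()
  at-most-2 false true  ()
  at-most-2 false false ()

refuted : ∀ {m} {a : Adjacency (suc m)} → IntegralCubic a → ¬ Search.Goal clamp (impossible {suc m}) a
refuted {m} {a} C (π , eq) = contradiction (trans (sym (eq zero zero)) (IntegralCubic.irreflexive C (π ⟨$⟩ʳ zero))) λ ()

does-≡ : ∀ {P : Set} (d : Dec P) b → (P → b ≡ true) → (b ≡ true → P) → does d ≡ b
does-≡ (yes p) b     f g = sym (f p)
does-≡ (no ¬p) true  f g = contradiction (g refl) ¬p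
does-≡ (no ¬p) false f g = refl

adjacency : ∀ {n} → TranspositionSet n → Adjacency n
adjacency 𝒯 i j = does (TranspositionSet.T? 𝒯 (transpose i j))

module Labelled {m} (H : Graph) (edge : Adjacency m) (label : Inverse (setoid (Fin m)) (Graph.vertices H))
  (edge⇔ : ∀ x y → edge x y ≡ true ⇔ Graph.Adj H (Inverse.to label x) (Inverse.to label y)) where

  private
    module H = Graph H
    module L = Inverse label
    open Setoid H.vertices using () renaming (sym to ≈-sym)

  Labelling : TranspositionSet m → Set
  Labelling 𝒯 = Σ[ π ∈ Permutation′ m ] (∀ x y → adjacency 𝒯 (π ⟨$⟩ʳ x) (π ⟨$⟩ʳ y) ≡ edge x y)

  isomorphic : ∀ 𝒯 → Labelling 𝒯 → transpositionGraph 𝒯 ≅ H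
  isomorphic 𝒯 (π , eq) = record
    { bijection     = Composition.inverse (Perm.flip π) label
    ; preserves-adj = λ x y → mk⇔
        (λ t → Equivalence.to (edge⇔ (π ⟨$⟩ˡ x) (π ⟨$⟩ˡ y)) (trans (sym (at x y)) (dec-true (T? (transpose x y)) t)))
        (λ h → does-sound (T? (transpose x y)) (trans (at x y) (Equivalence.from (edge⇔ (π ⟨$⟩ˡ x) (π ⟨$⟩ˡ y)) h)))
    }
    where
    open TranspositionSet 𝒯
    at : ∀ x y → adjacency 𝒯 x y ≡ edge (π ⟨$⟩ˡ x) (π ⟨$⟩ˡ y)
    at x y = trans (cong₂ (adjacency 𝒯) (sym (Perm.inverseʳ π)) (sym (Perm.inverseʳ π))) (eq (π ⟨$⟩ˡ x) (π ⟨$⟩ˡ y))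

  module _ {n} (𝒯 : TranspositionSet n) (iso : transpositionGraph 𝒯 ≅ H) where

    labels : Permutation n m
    labels = Composition.inverse (_≅_.bijection iso) (Symmetry.inverse label)

    edge-adjacent : ∀ i j → edge (labels ⟨$⟩ʳ i) (labels ⟨$⟩ʳ j) ≡ adjacency 𝒯 i j
    edge-adjacent i j = sym (does-≡ (TranspositionSet.T? 𝒯 (transpose i j)) (edge (labels ⟨$⟩ʳ i) (labels ⟨$⟩ʳ j))
      (λ t → Equivalence.from (edge⇔ (labels ⟨$⟩ʳ i) (labels ⟨$⟩ʳ j)) (respects (≈-sym (label-inverse i)) (≈-sym (label-inverse j))
        (Equivalence.to (_≅_.preserves-adj iso i j) t)))
      (λ e → Equivalence.from (_≅_.preserves-adj iso i j) (respects (label-inverse i) (label-inverse j)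
        (Equivalence.to (edge⇔ (labels ⟨$⟩ʳ i) (labels ⟨$⟩ʳ j)) e))))
      where
      label-inverse : ∀ i → L.to (L.from (_≅_.to iso i)) H.≈ᵛ _≅_.to iso i
      label-inverse i = L.strictlyInverseˡ (_≅_.to iso i)
      respects : ∀ {x x′ y y′} → x H.≈ᵛ x′ → y H.≈ᵛ y′ → H.Adj x y → H.Adj x′ y′
      respects {x} {x′} {y} {y′} x≈ y≈ h = proj₂ H.adj-resp {y′} {x} {x′} x≈ (proj₁ H.adj-resp {x} {y} {y′} y≈ h)

module Labelled-K₄ = Labelled (K 4) complete (Perm.id {4}) (λ x y → mk⇔
  (λ e x≡y → contradiction (trans (sym e) (cong not (dec-true (x Fin.≟ y) x≡y))) λ ())
  (λ x≢y → cong not (dec-false (x Fin.≟ y) x≢y)))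

parts : Inverse (setoid (Fin 6)) (setoid (Fin 3 ⊎ Fin 3))
parts = record
  { to        = lookup labels
  ; from      = [ lookup lefts , lookup rights ]′
  ; to-cong   = cong (lookup labels)
  ; from-cong = cong [ lookup lefts , lookup rights ]′
  ; inverse   = (λ { {x} refl → label-vertex x }) , (λ { {x} refl → vertex-label x })
  }
  where
  labels : Vec (Fin 3 ⊎ Fin 3) 6
  labels = inj₁ zero ∷ inj₂ zero ∷ inj₂ (suc zero) ∷ inj₂ (suc (suc zero)) ∷ inj₁ (suc zero) ∷ inj₁ (suc (suc zero)) ∷ []
  lefts rights : Vec (Fin 6) 3
  lefts  = clamp 0 ∷ clamp 4 ∷ clamp 5 ∷ []
  rights = clamp 1 ∷ clamp 2 ∷ clamp 3 ∷ []
  vertex-label : ∀ x → [ lookup lefts , lookup rights ]′ (lookup labels x) ≡ x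
  vertex-label = toWitness {a? = Fin.all? λ x → [ lookup lefts , lookup rights ]′ (lookup labels x) Fin.≟ x} tt
  label-vertex : ∀ p → lookup labels ([ lookup lefts , lookup rights ]′ p) ≡ p
  label-vertex (inj₁ zero)             = refl
  label-vertex (inj₁ (suc zero))       = refl
  label-vertex (inj₁ (suc (suc zero))) = refl
  label-vertex (inj₂ zero)             = refl
  label-vertex (inj₂ (suc zero))       = refl
  label-vertex (inj₂ (suc (suc zero))) = refl

isLeft : Fin 3 ⊎ Fin 3 → Bool
isLeft = [ (λ _ → true) , (λ _ → false) ]′

side-isLeft : ∀ x → side x ≡ isLeft (Inverse.to parts x)
side-isLeft = toWitness {a? = Fin.all? λ x → side x Bool.≟ isLeft (Inverse.to parts x)} tt

across : ∀ p q → (isLeft p xor isLeft q) ≡ true ⇔ Across p q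
across (inj₁ _) (inj₁ _) = mk⇔ (λ ()) (λ ())
across (inj₁ _) (inj₂ _) = mk⇔ (λ _ → left-right) (λ _ → refl)
across (inj₂ _) (inj₁ _) = mk⇔ (λ _ → right-left) (λ _ → refl)
across (inj₂ _) (inj₂ _) = mk⇔ (λ ()) (λ ())

bipartite-across : ∀ x y → bipartite x y ≡ true ⇔ Across (Inverse.to parts x) (Inverse.to parts y)
bipartite-across x y = subst (λ b → b ≡ true ⇔ Across (Inverse.to parts x) (Inverse.to parts y))
  (sym (cong₂ _xor_ (side-isLeft x) (side-isLeft y))) (across (Inverse.to parts x) (Inverse.to parts y))

module Labelled-K₃₃ = Labelled K[ 3 , 3 ] bipartite parts bipartite-across

K₄-or-K₃₃ : ∀ {n} (𝒯 : TranspositionSet n) → IntegralCubic (adjacency 𝒯) → PossibleOrder n →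
            (transpositionGraph 𝒯 ≅ K 4) ⊎ (transpositionGraph 𝒯 ≅ K[ 3 , 3 ])
K₄-or-K₃₃ 𝒯 C (inj₁ refl)                                     = contradiction C no-order-2
K₄-or-K₃₃ 𝒯 C (inj₂ (inj₁ refl))                              = inj₁ (Labelled-K₄.isomorphic 𝒯 (search4 C))
K₄-or-K₃₃ 𝒯 C (inj₂ (inj₂ (inj₁ refl)))                       = inj₂ (Labelled-K₃₃.isomorphic 𝒯 (search6 C))
K₄-or-K₃₃ 𝒯 C (inj₂ (inj₂ (inj₂ (inj₁ refl))))                = contradiction (search8 C) (refuted C)
K₄-or-K₃₃ 𝒯 C (inj₂ (inj₂ (inj₂ (inj₂ (inj₁ refl)))))         = contradiction (search10 C) (refuted C)
K₄-or-K₃₃ 𝒯 C (inj₂ (inj₂ (inj₂ (inj₂ (inj₂ refl)))))         = contradiction (search12 C) (refuted C)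

-- Products in the group ring

-- A trie of depth d is a ℤ-valued function on words of length d with letters in Fin m; absent subtries are zero.
Trie : ℕ → ℕ → Set
Trie m zero    = ℤ
Trie m (suc d) = Maybe (Vec (Trie m d) m)

module _ {m : ℕ} where

  empty : ∀ d → Trie m d
  empty zero    = 0ℤ
  empty (suc d) = nothing

  single : ∀ {d} → Vec (Fin m) d → Trie m d
  single []            = 1ℤ
  single {suc d} (x ∷ w) = just (tabulate λ y → if does (y Fin.≟ x) then single w else empty d)

  add : ∀ {d} → Trie m d → Trie m d → Trie m d
  add {zero}  s         t         = s ℤ.+ t
  add {suc d} nothing   t         = t
  add {suc d} (just ss) nothing   = just ss
  add {suc d} (just ss) (just ts) = just (Vec.zipWith add ss ts)

  scale : ∀ {d} → ℤ → Trie m d → Trie m d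
  scale {zero}  c t         = c ℤ.* t
  scale {suc d} c nothing   = nothing
  scale {suc d} c (just ts) = just (Vec.map (scale c) ts)

  swap : ∀ {d} → Fin m → Fin m → Trie m d → Trie m d
  swap {zero}  x y t         = t
  swap {suc d} x y nothing   = nothing
  swap {suc d} x y (just ts) = just (tabulate λ z → swap x y (lookup ts (transpose x y ⟨$⟩ʳ z)))

  addAll : ∀ {d k} → (Fin k → Trie m d) → Trie m d
  addAll {d} {zero}  f = empty d
  addAll {d} {suc k} f = add (f zero) (addAll (f ∘ suc))

  vanishes : ∀ {d} → Trie m d → Bool
  vanishes {zero}  t         = does (t ℤ.≟ 0ℤ)
  vanishes {suc d} nothing   = true
  vanishes {suc d} (just ts) = Vec.foldr _ (λ t b → vanishes t ∧ b) true ts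

  -- Multiplication by (sum of the transpositions selected by b) − r in the group ring.
  step : ∀ {d} → (Fin m → Fin m → Bool) → ℤ → Trie m d → Trie m d
  step {d} b r t = add (scale (ℤ.- r) t) (addAll λ x → addAll λ y → if b x y then swap x y t else empty d)

record IntegerRing : Set₁ where
  field
    ring   : CommutativeRing 0ℓ 0ℓ
    ⟦_⟧    : ℤ → CommutativeRing.Carrier ring
  open CommutativeRing ring using (_≈_; _+_; _*_; 0#; 1#)
  field
    ⟦⟧-+ : ∀ a b → ⟦ a ℤ.+ b ⟧ ≈ ⟦ a ⟧ + ⟦ b ⟧
    ⟦⟧-* : ∀ a b → ⟦ a ℤ.* b ⟧ ≈ ⟦ a ⟧ * ⟦ b ⟧
    ⟦⟧-0 : ⟦ 0ℤ ⟧ ≈ 0#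
    ⟦⟧-1 : ⟦ 1ℤ ⟧ ≈ 1#

module Evaluation (R : IntegerRing) where

  open IntegerRing R
  open CommutativeRing ring renaming (refl to ≈-refl; sym to ≈-sym; trans to ≈-trans; zero to *-zero)
  open SumLemmas +-commutativeMonoid public using (sum-zero; sum-single)
  open SemiringSum semiring public

  polynomial : Carrier → List ℤ → Carrier
  polynomial z = List.foldr (λ r p → (⟦ ℤ.- r ⟧ + z) * p) 1#

  polynomial-regular : (∀ a b → a * b ≈ 0# → ¬ (a ≈ 0#) → ¬ ¬ (b ≈ 0#)) → ∀ {z} → (∀ r → ¬ (z ≈ ⟦ r ⟧)) →
                       ∀ rs {w} → polynomial z rs * w ≈ 0# → ¬ ¬ (w ≈ 0#)
  polynomial-regular cancel {z} not-root []       {w} eq w≉0 = w≉0 (≈-trans (≈-sym (*-identityˡ w)) eq)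
  polynomial-regular cancel {z} not-root (r ∷ rs) {w} eq w≉0 =
    cancel (⟦ ℤ.- r ⟧ + z) (polynomial z rs * w) (≈-trans (≈-sym (*-assoc (⟦ ℤ.- r ⟧ + z) (polynomial z rs) w)) eq)
      (λ -r+z≈0 → not-root r (≈-trans (≈-sym (+-identityˡ z)) (≈-trans (+-congʳ (≈-sym r-r))
        (≈-trans (+-assoc ⟦ r ⟧ ⟦ ℤ.- r ⟧ z) (≈-trans (+-congˡ -r+z≈0) (+-identityʳ ⟦ r ⟧))))))
      λ rest → polynomial-regular cancel not-root rs rest w≉0
    where
    r-r : ⟦ r ⟧ + ⟦ ℤ.- r ⟧ ≈ 0#
    r-r = ≈-trans (≈-sym (⟦⟧-+ r (ℤ.- r))) (≈-trans (reflexive (cong ⟦_⟧ (ℤ.+-inverseʳ r))) ⟦⟧-0)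

  module _ {m : ℕ} where

    eval : ∀ {d} → Trie m d → (Vec (Fin m) d → Carrier) → Carrier
    eval {zero}  c         V = ⟦ c ⟧ * V []
    eval {suc d} nothing   V = 0#
    eval {suc d} (just ts) V = sum λ x → eval (lookup ts x) (λ w → V (x ∷ w))

    eval-cong : ∀ {d} (t : Trie m d) {V W} → (∀ w → V w ≈ W w) → eval t V ≈ eval t W
    eval-cong {zero}  c         eq = *-congˡ (eq [])
    eval-cong {suc d} nothing   eq = ≈-refl
    eval-cong {suc d} (just ts) eq = sum-cong-≋ λ x → eval-cong (lookup ts x) λ w → eq (x ∷ w)

    eval-empty : ∀ d V → eval (empty d) V ≈ 0#
    eval-empty zero    V = ≈-trans (*-congʳ ⟦⟧-0) (zeroˡ (V []))
    eval-empty (suc d) V = ≈-refl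

    eval-single : ∀ {d} (w : Vec (Fin m) d) V → eval (single w) V ≈ V w
    eval-single []      V = ≈-trans (*-congʳ ⟦⟧-1) (*-identityˡ (V []))
    eval-single {suc d} (x ∷ w) V = ≈-trans
      (sum-cong-≋ λ y → reflexive (cong (λ t → eval t (λ w → V (y ∷ w))) (Vec.lookup∘tabulate child y)))
      (≈-trans (sum-single (λ y → eval (child y) (λ w → V (y ∷ w))) x λ y y≢x →
          ≈-trans (reflexive (cong (λ b → eval (if b then single w else empty d) (λ w → V (y ∷ w))) (dec-false (y Fin.≟ x) y≢x)))
            (eval-empty d λ w → V (y ∷ w)))
        (≈-trans (reflexive (cong (λ b → eval (if b then single w else empty d) (λ w → V (x ∷ w))) (dec-true (x Fin.≟ x) refl)))
          (eval-single w λ w → V (x ∷ w))))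
      where
      child : Fin m → Trie m d
      child y = if does (y Fin.≟ x) then single w else empty d

    eval-add : ∀ {d} (s t : Trie m d) V → eval (add s t) V ≈ eval s V + eval t V
    eval-add {zero}  s t V = ≈-trans (*-congʳ (⟦⟧-+ s t)) (distribʳ (V []) ⟦ s ⟧ ⟦ t ⟧)
    eval-add {suc d} nothing   t         V = ≈-sym (+-identityˡ (eval t V))
    eval-add {suc d} (just ss) nothing   V = ≈-sym (+-identityʳ (eval (just ss) V))
    eval-add {suc d} (just ss) (just ts) V = ≈-trans
      (sum-cong-≋ λ x → ≈-trans
        (reflexive (cong (λ t → eval t (λ w → V (x ∷ w))) (Vec.lookup-zipWith add x ss ts)))
        (eval-add (lookup ss x) (lookup ts x) λ w → V (x ∷ w)))
      (∑-distrib-+ (λ x → eval (lookup ss x) (λ w → V (x ∷ w))) (λ x → eval (lookup ts x) (λ w → V (x ∷ w))))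

    eval-addAll : ∀ {d k} (f : Fin k → Trie m d) V → eval (addAll f) V ≈ sum λ i → eval (f i) V
    eval-addAll {d} {zero}  f V = eval-empty d V
    eval-addAll {d} {suc k} f V = ≈-trans (eval-add (f zero) (addAll (f ∘ suc)) V) (+-congˡ (eval-addAll (f ∘ suc) V))

    eval-scale : ∀ {d} c (t : Trie m d) V → eval (scale c t) V ≈ ⟦ c ⟧ * eval t V
    eval-scale {zero}  c t         V = ≈-trans (*-congʳ (⟦⟧-* c t)) (*-assoc ⟦ c ⟧ ⟦ t ⟧ (V []))
    eval-scale {suc d} c nothing   V = ≈-sym (zeroʳ ⟦ c ⟧)
    eval-scale {suc d} c (just ts) V = ≈-trans
      (sum-cong-≋ λ x → ≈-trans
        (reflexive (cong (λ t → eval t (λ w → V (x ∷ w))) (Vec.lookup-map x (scale c) ts)))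
        (eval-scale c (lookup ts x) λ w → V (x ∷ w)))
      (≈-sym (*-distribˡ-sum ⟦ c ⟧ λ x → eval (lookup ts x) (λ w → V (x ∷ w))))

    eval-swap : ∀ {d} x y (t : Trie m d) V → eval (swap x y t) V ≈ eval t (λ w → V (Vec.map (transpose x y ⟨$⟩ʳ_) w))
    eval-swap {zero}  x y t       V = ≈-refl
    eval-swap {suc d} x y nothing V = ≈-refl
    eval-swap {suc d} x y (just ts) V = ≈-trans
      (sum-cong-≋ λ z → ≈-trans
        (reflexive (cong (λ t → eval t (λ w → V (z ∷ w))) (Vec.lookup∘tabulate (λ z → swap x y (lookup ts (transpose x y ⟨$⟩ʳ z))) z)))
        (≈-trans (eval-swap x y (lookup ts (transpose x y ⟨$⟩ʳ z)) λ w → V (z ∷ w))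
          (reflexive (cong (λ u → eval (lookup ts (transpose x y ⟨$⟩ʳ z)) (λ w → V (u ∷ Vec.map (transpose x y ⟨$⟩ʳ_) w)))
            (sym (transpose-involutive x y z))))))
      (≈-sym (sum-permute (λ z → eval (lookup ts z) (λ w → V (Vec.map (transpose x y ⟨$⟩ʳ_) (z ∷ w)))) (transpose x y)))

    eval-zero : ∀ {d} (t : Trie m d) {V} → (∀ w → V w ≈ 0#) → eval t V ≈ 0#
    eval-zero {zero}  c         V≈0 = ≈-trans (*-congˡ (V≈0 [])) (zeroʳ ⟦ c ⟧)
    eval-zero {suc d} nothing   V≈0 = ≈-refl
    eval-zero {suc d} (just ts) V≈0 = sum-zero _ λ x → eval-zero (lookup ts x) λ w → V≈0 (x ∷ w)

    eval-+ : ∀ {d} (t : Trie m d) V W → eval t (λ w → V w + W w) ≈ eval t V + eval t W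
    eval-+ {zero}  c         V W = distribˡ ⟦ c ⟧ (V []) (W [])
    eval-+ {suc d} nothing   V W = ≈-sym (+-identityˡ 0#)
    eval-+ {suc d} (just ts) V W = ≈-trans
      (sum-cong-≋ λ x → eval-+ (lookup ts x) (λ w → V (x ∷ w)) (λ w → W (x ∷ w)))
      (∑-distrib-+ (λ x → eval (lookup ts x) (λ w → V (x ∷ w))) (λ x → eval (lookup ts x) (λ w → W (x ∷ w))))

    eval-* : ∀ {d} (t : Trie m d) z V → eval t (λ w → z * V w) ≈ z * eval t V
    eval-* {zero}  c z V = ≈-trans (≈-sym (*-assoc ⟦ c ⟧ z (V []))) (≈-trans (*-congʳ (*-comm ⟦ c ⟧ z)) (*-assoc z ⟦ c ⟧ (V [])))
    eval-* {suc d} nothing   z V = ≈-sym (zeroʳ z)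
    eval-* {suc d} (just ts) z V = ≈-trans
      (sum-cong-≋ λ x → eval-* (lookup ts x) z λ w → V (x ∷ w))
      (≈-sym (*-distribˡ-sum z λ x → eval (lookup ts x) (λ w → V (x ∷ w))))

    eval-sum : ∀ {d k} (t : Trie m d) (F : Fin k → Vec (Fin m) d → Carrier) → eval t (λ w → sum λ i → F i w) ≈ sum λ i → eval t (F i)
    eval-sum {d} {zero}  t F = eval-zero t λ _ → ≈-refl
    eval-sum {d} {suc k} t F = ≈-trans (eval-+ t (F zero) λ w → sum λ i → F (suc i) w) (+-congˡ (eval-sum t (F ∘ suc)))

    eval-vanishes : ∀ {d} (t : Trie m d) V → vanishes t ≡ true → eval t V ≈ 0#
    eval-vanishes {zero}  t V h = ≈-trans (*-congʳ (≈-trans (reflexive (cong ⟦_⟧ (does-sound (t ℤ.≟ 0ℤ) h))) ⟦⟧-0)) (zeroˡ (V []))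
    eval-vanishes {suc d} nothing V h = ≈-refl
    eval-vanishes {suc d} (just ts) V h = sum-zero _ λ x → eval-vanishes (lookup ts x) (λ w → V (x ∷ w)) (all-zero ts h x)
      where
      all-zero : ∀ {k} (ts : Vec (Trie m d) k) → Vec.foldr _ (λ t b → vanishes t ∧ b) true ts ≡ true → ∀ x → vanishes (lookup ts x) ≡ true
      all-zero (t ∷ ts) h zero    = proj₁ (∧-split {vanishes t} h)
      all-zero (t ∷ ts) h (suc x) = all-zero ts (proj₂ (∧-split {vanishes t} h)) x

    module _ (b : Fin m → Fin m → Bool) {d} (V : Vec (Fin m) d → Carrier) (z : Carrier)
             (eigen : ∀ w → (sum λ x → sum λ y → if b x y then V (Vec.map (transpose x y ⟨$⟩ʳ_) w) else 0#) ≈ z * V w) where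

      eval-step : ∀ r t → eval (step b r t) V ≈ (⟦ ℤ.- r ⟧ + z) * eval t V
      eval-step r t = ≈-trans (eval-add (scale (ℤ.- r) t) (addAll λ x → addAll λ y → term x y) V) (≈-trans
        (+-cong (eval-scale (ℤ.- r) t V) (≈-trans (eval-addAll (λ x → addAll λ y → term x y) V) (≈-trans
          (sum-cong-≋ λ x → ≈-trans (eval-addAll (term x) V) (≈-trans (sum-cong-≋ λ y → entry x y (b x y)) (≈-sym (eval-sum t λ y w → image x y w))))
          (≈-trans (≈-sym (eval-sum t λ x w → sum λ y → image x y w)) (≈-trans (eval-cong t eigen) (eval-* t z V))))))
        (≈-sym (distribʳ (eval t V) ⟦ ℤ.- r ⟧ z)))
        where
        term : Fin m → Fin m → Trie m d
        term x y = if b x y then swap x y t else empty d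
        image : Fin m → Fin m → Vec (Fin m) d → Carrier
        image x y w = if b x y then V (Vec.map (transpose x y ⟨$⟩ʳ_) w) else 0#
        entry : ∀ x y c → eval (if c then swap x y t else empty d) V ≈ eval t (λ w → if c then V (Vec.map (transpose x y ⟨$⟩ʳ_) w) else 0#)
        entry x y true  = eval-swap x y t V
        entry x y false = ≈-trans (eval-empty d V) (≈-sym (eval-zero t λ _ → ≈-refl))

      eval-steps : ∀ rs t → eval (List.foldr (step b) t rs) V ≈ polynomial z rs * eval t V
      eval-steps []       t = ≈-sym (*-identityˡ (eval t V))
      eval-steps (r ∷ rs) t = ≈-trans (eval-step r (List.foldr (step b) t rs)) (≈-trans (*-congˡ (eval-steps rs t))
        (≈-sym (*-assoc (⟦ ℤ.- r ⟧ + z) (polynomial z rs) (eval t V))))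

      annihilates : ∀ rs w → vanishes (List.foldr (step b) (single w) rs) ≡ true → polynomial z rs * V w ≈ 0#
      annihilates rs w h = ≈-trans (≈-sym (≈-trans (eval-steps rs (single w)) (*-congˡ (eval-single w V))))
        (eval-vanishes (List.foldr (step b) (single w) rs) V h)

transpose-relabel : ∀ {m n} (π : Permutation n m) x y i →
  transpose x y ⟨$⟩ʳ (π ⟨$⟩ʳ i) ≡ π ⟨$⟩ʳ (transpose (π ⟨$⟩ˡ x) (π ⟨$⟩ˡ y) ⟨$⟩ʳ i)
transpose-relabel π x y i = cases (i Fin.≟ x′) (i Fin.≟ y′)
  where
  x′ = π ⟨$⟩ˡ x
  y′ = π ⟨$⟩ˡ y
  shift : ∀ {z} → i ≢ π ⟨$⟩ˡ z → π ⟨$⟩ʳ i ≢ z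
  shift i≢ eq = i≢ (trans (sym (Perm.inverseˡ π)) (cong (π ⟨$⟩ˡ_) eq))
  cases : Dec (i ≡ x′) → Dec (i ≡ y′) → transpose x y ⟨$⟩ʳ (π ⟨$⟩ʳ i) ≡ π ⟨$⟩ʳ (transpose x′ y′ ⟨$⟩ʳ i)
  cases (yes refl) _ = trans (cong (transpose x y ⟨$⟩ʳ_) (Perm.inverseʳ π)) (trans (transpose-left x y)
    (sym (trans (cong (π ⟨$⟩ʳ_) (transpose-left x′ y′)) (Perm.inverseʳ π))))
  cases (no _) (yes refl) = trans (cong (transpose x y ⟨$⟩ʳ_) (Perm.inverseʳ π)) (trans (transpose-right x y)
    (sym (trans (cong (π ⟨$⟩ʳ_) (transpose-right x′ y′)) (Perm.inverseʳ π))))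
  cases (no i≢x) (no i≢y) = trans (transpose-other x y (π ⟨$⟩ʳ i) (shift i≢x) (shift i≢y))
    (cong (π ⟨$⟩ʳ_) (sym (transpose-other x′ y′ i i≢x i≢y)))

increasing : ∀ {n} → Adjacency n → Adjacency n
increasing k x y = k x y ∧ does (x Fin.<? y)

-- The product of A − r over the listed r, A being the sum of the transpositions along the edges, is 0 in the group ring.
record Annihilates {n} (rs : List ℤ) (edge : Adjacency n) : Set where
  constructor computed
  field
    product-vanishes : vanishes (List.foldr (step (increasing edge)) (single (Vec.allFin n)) rs) ≡ true

module CayleyPolynomial (R : IntegerRing) {n} (𝒯 : TranspositionSet n) (edge : Adjacency n) (π : Permutation′ n)
  (edge-adjacent : ∀ i j → edge (π ⟨$⟩ʳ i) (π ⟨$⟩ʳ j) ≡ does (TranspositionSet.T? 𝒯 (transpose i j))) where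

  open IntegerRing R
  open CommutativeRing ring hiding (zero) renaming (refl to ≈-refl; sym to ≈-sym; trans to ≈-trans)
  open Evaluation R

  π-injective : ∀ {i j} → π ⟨$⟩ʳ i ≡ π ⟨$⟩ʳ j → i ≡ j
  π-injective eq = trans (sym (Perm.inverseˡ π)) (trans (cong (π ⟨$⟩ˡ_) eq) (Perm.inverseˡ π))

  open Cayley 𝒯 (π ⟨$⟩ʳ_) π-injective using (oriented; neighbour-sum)
  private
    module Γ = Graph (CaySym 𝒯)

  module _ (v : Fin (n !) → Carrier) (z : Carrier)
    (eigen : ∀ k → (sum λ l → if does (Γ.adj? (unrank n k) (unrank n l)) then v l else 0#) ≈ z * v k) where

    φ : Permutation′ n → Carrier
    φ σ = v (rank n σ)

    rank-cong : ∀ {σ τ} → σ Perm.≈ τ → rank n σ ≡ rank n τ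
    rank-cong {σ} {τ} = Inverse.to-cong (Sym-enumeration n) {σ} {τ}

    φ-cong : ∀ {σ τ} → σ Perm.≈ τ → φ σ ≈ φ τ
    φ-cong {σ} {τ} eq = reflexive (cong v (rank-cong {σ} {τ} eq))

    φ-unrank : ∀ k → φ (unrank n k) ≈ v k
    φ-unrank k = reflexive (cong v (Inverse.strictlyInverseˡ (Sym-enumeration n) k))

    moved : Permutation′ n → Fin n → Fin n → Permutation′ n
    moved σ x y = σ ∘ₚ transpose (π ⟨$⟩ˡ x) (π ⟨$⟩ˡ y)

    φ-eigen : ∀ k → (sum λ x → sum λ y → if increasing edge x y then φ (moved (unrank n k) x y) else 0#) ≈ z * φ (unrank n k)
    φ-eigen k = ≈-trans (sum-permute (λ x → sum λ y → term x y (increasing edge x y)) π)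
      (≈-trans (sum-cong-≋ λ i → ≈-trans (sum-permute (λ y → term (π ⟨$⟩ʳ i) y (increasing edge (π ⟨$⟩ʳ i) y)) π) (sum-cong-≋ λ j → entry i j))
      (≈-trans (≈-sym (neighbour-sum +-commutativeMonoid φ (λ {σ} {τ} → φ-cong {σ} {τ}) (unrank n k)))
      (≈-trans (sum-cong-≋ λ l → neighbour l (does (Γ.adj? (unrank n k) (unrank n l))))
      (≈-trans (eigen k) (*-congˡ (≈-sym (φ-unrank k)))))))
      where
      term : Fin n → Fin n → Bool → Carrier
      term x y b = if b then φ (moved (unrank n k) x y) else 0#
      entry : ∀ i j → term (π ⟨$⟩ʳ i) (π ⟨$⟩ʳ j) (increasing edge (π ⟨$⟩ʳ i) (π ⟨$⟩ʳ j)) ≈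
        (if oriented i j then φ (unrank n k ∘ₚ transpose i j) else 0#)
      entry i j = reflexive (trans
        (cong (λ b → term (π ⟨$⟩ʳ i) (π ⟨$⟩ʳ j) (b ∧ does ((π ⟨$⟩ʳ i) Fin.<? (π ⟨$⟩ʳ j)))) (edge-adjacent i j))
        (cong₂ (λ i′ j′ → if oriented i j then φ (unrank n k ∘ₚ transpose i′ j′) else 0#) (Perm.inverseˡ π) (Perm.inverseˡ π)))
      neighbour : ∀ l b → (if b then φ (unrank n l) else 0#) ≈ (if b then v l else 0#)
      neighbour l true  = φ-unrank l
      neighbour l false = ≈-refl

    -- The eigenvector as a function on words, based at g; words that are not permutations get the value 0.
    module _ (g : Permutation′ n) where

      word : Permutation′ n → Vec (Fin n) n
      word σ = tabulate λ x → π ⟨$⟩ʳ (σ ⟨$⟩ʳ (g ⟨$⟩ˡ (π ⟨$⟩ˡ x)))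

      word-ext : ∀ {σ τ} → σ Perm.≈ τ → word σ ≡ word τ
      word-ext eq = Vec.tabulate-cong λ x → cong (π ⟨$⟩ʳ_) (eq (g ⟨$⟩ˡ (π ⟨$⟩ˡ x)))

      word-injective : ∀ {σ τ} → word σ ≡ word τ → σ Perm.≈ τ
      word-injective {σ} {τ} eq i = π-injective (trans (sym (at σ)) (trans (cong (λ w → lookup w (π ⟨$⟩ʳ (g ⟨$⟩ʳ i))) eq) (at τ)))
        where
        at : ∀ σ → lookup (word σ) (π ⟨$⟩ʳ (g ⟨$⟩ʳ i)) ≡ π ⟨$⟩ʳ (σ ⟨$⟩ʳ i)
        at σ = trans (Vec.lookup∘tabulate (λ x → π ⟨$⟩ʳ (σ ⟨$⟩ʳ (g ⟨$⟩ˡ (π ⟨$⟩ˡ x)))) (π ⟨$⟩ʳ (g ⟨$⟩ʳ i)))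
          (cong (λ j → π ⟨$⟩ʳ (σ ⟨$⟩ʳ j)) (trans (cong (g ⟨$⟩ˡ_) (Perm.inverseˡ π)) (Perm.inverseˡ g)))

      word-moved : ∀ σ x y → Vec.map (transpose x y ⟨$⟩ʳ_) (word σ) ≡ word (moved σ x y)
      word-moved σ x y = trans (sym (Vec.tabulate-∘ (transpose x y ⟨$⟩ʳ_) λ u → π ⟨$⟩ʳ (σ ⟨$⟩ʳ (g ⟨$⟩ˡ (π ⟨$⟩ˡ u)))))
        (Vec.tabulate-cong λ u → transpose-relabel π x y (σ ⟨$⟩ʳ (g ⟨$⟩ˡ (π ⟨$⟩ˡ u))))

      occurs? : ∀ w → Dec (∃[ k ] word (unrank n k) ≡ w)
      occurs? w = Fin.any? λ k → Vec.≡-dec Fin._≟_ (word (unrank n k)) w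

      value : ∀ {w} → Dec (∃[ k ] word (unrank n k) ≡ w) → Carrier
      value (yes (k , _)) = φ (unrank n k)
      value (no _)        = 0#

      V : Vec (Fin n) n → Carrier
      V w = value (occurs? w)

      unrank-rank : ∀ σ → unrank n (rank n σ) Perm.≈ σ
      unrank-rank = Inverse.strictlyInverseʳ (Sym-enumeration n)

      V-word : ∀ σ → V (word σ) ≈ φ σ
      V-word σ = cases (occurs? (word σ))
        where
        cases : (d : Dec (∃[ k ] word (unrank n k) ≡ word σ)) → value d ≈ φ σ
        cases (yes (k , eq)) = φ-cong {unrank n k} {σ} (word-injective {unrank n k} {σ} eq)
        cases (no ¬occurs)   = contradiction (rank n σ , word-ext {unrank n (rank n σ)} {σ} (unrank-rank σ)) ¬occurs

      V-eigen : ∀ w → (sum λ x → sum λ y → if increasing edge x y then V (Vec.map (transpose x y ⟨$⟩ʳ_) w) else 0#) ≈ z * V w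
      V-eigen w = cases (occurs? w)
        where
        cases : (d : Dec (∃[ k ] word (unrank n k) ≡ w)) →
          (sum λ x → sum λ y → if increasing edge x y then V (Vec.map (transpose x y ⟨$⟩ʳ_) w) else 0#) ≈ z * value d
        cases (yes (k , refl)) = ≈-trans (sum-cong-≋ λ x → sum-cong-≋ λ y → entry x y (increasing edge x y)) (φ-eigen k)
          where
          entry : ∀ x y b → (if b then V (Vec.map (transpose x y ⟨$⟩ʳ_) w) else 0#) ≈ (if b then φ (moved (unrank n k) x y) else 0#)
          entry x y true  = ≈-trans (reflexive (cong V (word-moved (unrank n k) x y))) (V-word (moved (unrank n k) x y))
          entry x y false = ≈-refl
        cases (no ¬occurs) = ≈-trans (sum-zero _ λ x → sum-zero _ λ y → entry x y (increasing edge x y)) (≈-sym (zeroʳ z))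
          where
          absent : ∀ x y → (d : Dec (∃[ k ] word (unrank n k) ≡ Vec.map (transpose x y ⟨$⟩ʳ_) w)) → value d ≈ 0#
          absent x y (no _) = ≈-refl
          absent x y (yes (k , eq)) = contradiction (rank n σ , (begin
            word (unrank n (rank n σ))                                            ≡⟨ word-ext {unrank n (rank n σ)} {σ} (unrank-rank σ) ⟩
            word σ                                                                ≡⟨ word-moved (unrank n k) x y ⟨
            Vec.map (transpose x y ⟨$⟩ʳ_) (word (unrank n k))                     ≡⟨ cong (Vec.map (transpose x y ⟨$⟩ʳ_)) eq ⟩
            Vec.map (transpose x y ⟨$⟩ʳ_) (Vec.map (transpose x y ⟨$⟩ʳ_) w)       ≡⟨ Vec.map-∘ (transpose x y ⟨$⟩ʳ_) (transpose x y ⟨$⟩ʳ_) w ⟨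
            Vec.map (λ u → transpose x y ⟨$⟩ʳ (transpose x y ⟨$⟩ʳ u)) w           ≡⟨ Vec.map-cong (transpose-involutive x y) w ⟩
            Vec.map id w                                                          ≡⟨ Vec.map-id w ⟩
            w                                                                     ∎)) ¬occurs
            where
            open ≡-Reasoning
            σ = moved (unrank n k) x y
          entry : ∀ x y b → (if b then V (Vec.map (transpose x y ⟨$⟩ʳ_) w) else 0#) ≈ 0#
          entry x y true  = absent x y (occurs? (Vec.map (transpose x y ⟨$⟩ʳ_) w))
          entry x y false = ≈-refl

      word-g : word g ≡ Vec.allFin n
      word-g = Vec.tabulate-cong λ x → trans (cong (π ⟨$⟩ʳ_) (Perm.inverseʳ g)) (Perm.inverseʳ π)

    annihilates-eigenvector : ∀ rs → Annihilates rs edge →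
      ∀ k → polynomial z rs * v k ≈ 0#
    annihilates-eigenvector rs h k = ≈-trans
      (*-congˡ (≈-trans (≈-sym (φ-unrank k)) (≈-trans (≈-sym (V-word g g)) (reflexive (cong (V g) (word-g g))))))
      (annihilates (increasing edge) (V g) z (V-eigen g) rs (Vec.allFin n) (Annihilates.product-vanishes h))
      where
      g = unrank n k

  eigenvalue-is-root : (∀ a b → a * b ≈ 0# → ¬ (a ≈ 0#) → ¬ ¬ (b ≈ 0#)) → (∀ a → ¬ ¬ (a ≈ 0#) → a ≈ 0#) →
    ∀ rs → Annihilates rs edge →
    ∀ {A : Fin (n !) → Fin (n !) → Carrier} → (∀ k l → A k l ≡ (if does (Γ.adj? (unrank n k) (unrank n l)) then 1# else 0#)) →
    ∀ {z} (v : Fin (n !) → Carrier) → ¬ (∀ k → v k ≈ 0#) → (∀ k → (sum λ l → A k l * v l) ≈ z * v k) →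
    ¬ ¬ (∃[ r ] z ≈ ⟦ r ⟧)
  eigenvalue-is-root cancel stable rs zero-trie A≡ {z} v v≉0 eigen not-integer = v≉0 λ k → stable (v k)
    (polynomial-regular cancel (λ r z≈r → not-integer (r , z≈r)) rs (annihilates-eigenvector v z eigen′ rs zero-trie k))
    where
    entry : ∀ b a → (if b then a else 0#) ≈ (if b then 1# else 0#) * a
    entry true  a = ≈-sym (*-identityˡ a)
    entry false a = ≈-sym (zeroˡ a)
    eigen′ : ∀ k → (sum λ l → if does (Γ.adj? (unrank n k) (unrank n l)) then v l else 0#) ≈ z * v k
    eigen′ k = ≈-trans (sum-cong-≋ λ l → ≈-trans (entry (does (Γ.adj? (unrank n k) (unrank n l))) (v l)) (*-congʳ (reflexive (sym (A≡ k l))))) (eigen k)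

ℂ-integerRing : IntegerRing
ℂ-integerRing = record
  { ring = ℂ-ring
  ; ⟦_⟧  = fromℤ
  ; ⟦⟧-+ = fromℤ-+
  ; ⟦⟧-* = fromℤ-*
  ; ⟦⟧-0 = CommutativeRing.refl ℂ-ring {0ᶜ}
  ; ⟦⟧-1 = CommutativeRing.refl ℂ-ring {1ᶜ}
  }

integral-from-roots : ∀ {n} (𝒯 : TranspositionSet n) (edge : Adjacency n) (π : Permutation′ n) →
  (∀ i j → edge (π ⟨$⟩ʳ i) (π ⟨$⟩ʳ j) ≡ does (TranspositionSet.T? 𝒯 (transpose i j))) →
  ∀ rs → Annihilates rs edge → Integral (CaySym 𝒯)
integral-from-roots 𝒯 edge π edge-adjacent rs zero-trie z (v , v≉0 , eigen) =
  integrality-stable z (CayleyPolynomial.eigenvalue-is-root ℂ-integerRing 𝒯 edge π edge-adjacent no-zero-divisors ≈ᶜ-stable rs zero-trie {Graph.adjacencyMatrix (CaySym 𝒯)} (λ _ _ → refl) {z} v v≉0 eigen)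
  where
  ≈ᶜ-stable : ∀ w → ¬ ¬ (w ≈ᶜ 0ᶜ) → w ≈ᶜ 0ᶜ
  ≈ᶜ-stable w h = ≈ᴿ-stable {re w} {re 0ᶜ} (λ c → h (c ∘ proj₁)) , ≈ᴿ-stable {im w} {im 0ᶜ} (λ c → h (c ∘ proj₂))

integral-if-labelled : ∀ {n m} (𝒯 : TranspositionSet n) (edge : Adjacency m) (π : Permutation n m) →
  (∀ i j → edge (π ⟨$⟩ʳ i) (π ⟨$⟩ʳ j) ≡ adjacency 𝒯 i j) →
  ∀ rs → Annihilates rs edge → Integral (CaySym 𝒯)
integral-if-labelled {n} {m} 𝒯 edge π adj rs zero-trie = cases (Perm.↔⇒≡ π) edge π adj zero-trie
  where
  cases : ∀ {m} → n ≡ m → (edge : Adjacency m) (π : Permutation n m) →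
    (∀ i j → edge (π ⟨$⟩ʳ i) (π ⟨$⟩ʳ j) ≡ adjacency 𝒯 i j) →
    Annihilates rs edge → Integral (CaySym 𝒯)
  cases refl edge π adj = integral-from-roots 𝒯 edge π adj rs

complete-roots bipartite-roots : List ℤ
complete-roots  = + 0 ∷ + 2 ∷ + 6 ∷ -[1+ 1 ] ∷ -[1+ 5 ] ∷ []
bipartite-roots = + 0 ∷ + 1 ∷ + 2 ∷ + 3 ∷ + 5 ∷ + 6 ∷ + 9 ∷ -[1+ 0 ] ∷ -[1+ 1 ] ∷ -[1+ 2 ] ∷ -[1+ 4 ] ∷ -[1+ 5 ] ∷ -[1+ 8 ] ∷ []

complete-annihilated : Annihilates complete-roots complete
complete-annihilated = computed refl

bipartite-annihilated : Annihilates bipartite-roots bipartite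
bipartite-annihilated = computed refl

proposition5 : (n : ℕ) (T : TranspositionSet n) →
    Connected (transpositionGraph T) →
    Cubic (transpositionGraph T) →
    Integral (CaySym T) ⇔ ((transpositionGraph T ≅ K 4) ⊎ (transpositionGraph T ≅ K[ 3 , 3 ]))
proposition5 n T connected cubic = mk⇔
  (λ integral → let open Orders T cubic connected integral in
    K₄-or-K₃₃ T (Concrete.integralCubic T cubic connected integral) (possible-order (ℕ.∣m+n∣m⇒∣n {n} {240} {120} n∣360 n∣240) 2∣3n n²-n∣12!))
  [ (λ iso → integral-if-labelled T complete (Labelled-K₄.labels T iso) (Labelled-K₄.edge-adjacent T iso) complete-roots complete-annihilated)
  , (λ iso → integral-if-labelled T bipartite (Labelled-K₃₃.labels T iso) (Labelled-K₃₃.edge-adjacent T iso) bipartite-roots bipartite-annihilated)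
  ]′
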